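{- Let $k\ge1$, $c,r\ge1$ with $c+r=k+1$ and $R=(c^r)$. Then for every $i\in\{0,1,\dots,k\}$, in the affine nilCoxeter algebra, $$s_R^{(k)}u_i=u_{i+c}\,s_R^{(k)},$$ where $i+c$ is taken modulo $k+1$.
   Context: Indices are modulo $k+1$. $W$ is the affine symmetric group with generators $s_0,\dots,s_k$ (relations $s_i^2=1$, $s_is_j=s_js_i$ if $i-j\not\equiv\pm1$, $s_is_{i+1}s_i=s_{i+1}s_is_{i+1}$). The affine nilCoxeter algebra $\mathbb{A}$ has generators $u_0,\dots,u_k$, relations $u_i^2=0$, $u_iu_j=u_ju_i$ if $i-j\not\equiv\pm1$, $u_iu_{i+1}u_i=u_{i+1}u_iu_{i+1}$; for $w\in W$ with reduced word $s_{i_1}\cdots s_{i_m}$, ${\bf u}(w)=u_{i_1}\cdots u_{i_m}$. The content of the box in row $i$, column $j$ is $(j-i)\bmod(k+1)$. $W$ acts on $(k+1)$-cores: $s_i\nu$ adds all addable boxes of content $i$ if any, removes all removable boxes of content $i$ if any, else is $\nu$. $W_0=\langle s_1,\dots,s_k\rangle$, $W^0$ = minimal length coset representatives of $W/W_0$. A partition $\lambda$ is $k$-bounded if $\lambda_1\le k$; $\mathfrak{c}(\lambda)$ is the $(k+1)$-core corresponding to it under the Lapointe–Morse bijection (inverse: core $\mapsto$ partition whose $i$-th part is the number of cells in row $i$ of hook length $\le k$); $w_\lambda\in W^0$ satisfies $w_\lambda\emptyset=\mathfrak{c}(\lambda)$, and $u_\lambda={\bf u}(w_\lambda)$. For $D\subsetneq\{0,\dots,k\}$,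 $u_D$ is the product of $u_m$, $m\in D$, each once, with $u_{j+1}$ left of $u_j$ whenever $j,j+1\in D$. ${\bf h}_i=\sum_{|D|=i}u_D$. The $k$-Schur functions $s^{(k)}_\lambda$ are the unique elements of the subalgebra generated by ${\bf h}_1,\dots,{\bf h}_k$ with $s^{(k)}_\emptyset=1$ and ${\bf h}_is^{(k)}_\lambda=\sum_\mu s^{(k)}_\mu$, summed over $k$-bounded $\mu$ with $u_\mu=u_Du_\lambda$ for some $|D|=i$. -}

module Defs where

open import Data.Bool using (Bool; true; false; if_then_else_; _∧_; _∨_; T)
open import Data.Nat using (ℕ; zero; suc; _+_; _*_; _∸_; _≤_; _<_; _≤ᵇ_; _<ᵇ_; _≡ᵇ_; _≤?_)
open import Data.Nat.DivMod using (_%_; _mod_)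
open import Data.Fin using (Fin; toℕ)
open import Data.Fin.Subset using (Subset; ∣_∣)
open import Data.Vec using (Vec; []; _∷_; lookup)
open import Data.List using (List; []; _∷_; map; foldr; filter; length; upTo; replicate; any; allFin)
open import Data.List.Relation.Unary.All using (All)
open import Data.List.Relation.Unary.Linked using (Linked)
open import Data.List.Relation.Unary.Unique.Propositional using (Unique)
open import Data.List.Membership.Propositional using (_∈_)
open import Data.Maybe using (Maybe; just; nothing)
open import Data.Product using (Σ; _×_; ∃)
open import Data.Unit using (⊤)
open import Data.Sum using (_⊎_)
open import Function.Bundles using (_⇔_)
open import Relation.Nullary using (¬_)
open import Relation.Binary.PropositionalEquality using (_≡_)

data Expr (G : Set) : Set where
  gen      : G → Expr G
  𝟘 𝟙      : Expr G
  _⊕_ _⊗_  : Expr G → Expr G → Expr G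
  ⊖_       : Expr G → Expr G

infixl 6 _⊕_
infixl 7 _⊗_

eval : {G H : Set} → (G → Expr H) → Expr G → Expr H
eval f (gen g) = f g
eval f 𝟘 = 𝟘
eval f 𝟙 = 𝟙
eval f (x ⊕ y) = eval f x ⊕ eval f y
eval f (x ⊗ y) = eval f x ⊗ eval f y
eval f (⊖ x) = ⊖ eval f x

Σ⊕ : {G : Set} → List (Expr G) → Expr G
Σ⊕ = foldr _⊕_ 𝟘

Π⊗ : {G : Set} → List (Expr G) → Expr G
Π⊗ = foldr _⊗_ 𝟙

_+ₘ_ : {k : ℕ} → Fin (suc k) → ℕ → Fin (suc k)
_+ₘ_ {k} i n = (toℕ i + n) mod (suc k)

Adjacent : (k : ℕ) → Fin (suc k) → Fin (suc k) → Set
Adjacent k i j = (j ≡ i +ₘ 1) ⊎ (i ≡ j +ₘ 1)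

-- The affine nilCoxeter algebra 𝔸 (over ℤ) for parameter k, presented by
-- generators u_0..u_k and relations; equality is the congruence generated
-- by the (unital associative) ring axioms and the defining relations.

𝔸 : ℕ → Set
𝔸 k = Expr (Fin (suc k))

u : {k : ℕ} → Fin (suc k) → 𝔸 k
u = gen

infix 4 _≈_
data _≈_ {k : ℕ} : 𝔸 k → 𝔸 k → Set where
  ≈-refl   : ∀ {x} → x ≈ x
  ≈-sym    : ∀ {x y} → x ≈ y → y ≈ x
  ≈-trans  : ∀ {x y z} → x ≈ y → y ≈ z → x ≈ z
  ⊕-cong   : ∀ {x x' y y'} → x ≈ x' → y ≈ y' → x ⊕ y ≈ x' ⊕ y'
  ⊗-cong   : ∀ {x x' y y'} → x ≈ x' → y ≈ y' → x ⊗ y ≈ x' ⊗ y'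
  ⊖-cong   : ∀ {x x'} → x ≈ x' → ⊖ x ≈ ⊖ x'
  ⊕-assoc  : ∀ x y z → (x ⊕ y) ⊕ z ≈ x ⊕ (y ⊕ z)
  ⊕-comm   : ∀ x y → x ⊕ y ≈ y ⊕ x
  ⊕-idˡ    : ∀ x → 𝟘 ⊕ x ≈ x
  ⊖-invˡ   : ∀ x → (⊖ x) ⊕ x ≈ 𝟘
  ⊗-assoc  : ∀ x y z → (x ⊗ y) ⊗ z ≈ x ⊗ (y ⊗ z)
  ⊗-idˡ    : ∀ x → 𝟙 ⊗ x ≈ x
  ⊗-idʳ    : ∀ x → x ⊗ 𝟙 ≈ x
  distribˡ : ∀ x y z → x ⊗ (y ⊕ z) ≈ (x ⊗ y) ⊕ (x ⊗ z)
  distribʳ : ∀ x y z → (y ⊕ z) ⊗ x ≈ (y ⊗ x) ⊕ (z ⊗ x)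
  nil      : ∀ i → u i ⊗ u i ≈ 𝟘
  comm     : ∀ i j → ¬ Adjacent k i j → u i ⊗ u j ≈ u j ⊗ u i
  -- braid relation (only for k ≥ 2; for k = 1 the affine symmetric group
  -- is the infinite dihedral group, with no braid relation)
  braid    : 2 ≤ k → ∀ i → u i ⊗ u (i +ₘ 1) ⊗ u i ≈ u (i +ₘ 1) ⊗ u i ⊗ u (i +ₘ 1)

uw : {k : ℕ} → List (Fin (suc k)) → 𝔸 k
uw w = Π⊗ (map u w)

IsPartition : List ℕ → Set
IsPartition λ′ = Linked (λ a b → b ≤ a) λ′ × All (λ a → 0 < a) λ′

KBounded : ℕ → List ℕ → Set
KBounded k λ′ = IsPartition λ′ × All (λ a → a ≤ k) λ′

-- content of the box in row r, column j (1-indexed): (j - r) mod (k+1)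
content : (k r j : ℕ) → ℕ
content k r j = (j + k * r) % suc k

private
  -- addable box at the end of row r (1-indexed), given the length of the
  -- previous row (nothing = row 1, no constraint) and of row r
  addableAt : Maybe ℕ → ℕ → Bool
  addableAt nothing x = true
  addableAt (just p) x = x <ᵇ p

  addGo : (k i : ℕ) → Maybe ℕ → ℕ → List ℕ → List ℕ
  addGo k i p r [] = if addableAt p 0 ∧ (content k r 1 ≡ᵇ i) then 1 ∷ [] else []
  addGo k i p r (x ∷ xs) =
    (if addableAt p x ∧ (content k r (suc x) ≡ᵇ i) then suc x else x) ∷ addGo k i (just x) (suc r) xs

  hasAddGo : (k i : ℕ) → Maybe ℕ → ℕ → List ℕ → Bool
  hasAddGo k i p r [] = addableAt p 0 ∧ (content k r 1 ≡ᵇ i)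
  hasAddGo k i p r (x ∷ xs) = (addableAt p x ∧ (content k r (suc x) ≡ᵇ i)) ∨ hasAddGo k i (just x) (suc r) xs

  nextLen : List ℕ → ℕ
  nextLen [] = 0
  nextLen (y ∷ _) = y

  remGo : (k i : ℕ) → ℕ → List ℕ → List ℕ
  remGo k i r [] = []
  remGo k i r (x ∷ xs) =
    (if (nextLen xs <ᵇ x) ∧ (content k r x ≡ᵇ i) then x ∸ 1 else x) ∷ remGo k i (suc r) xs

  hasRemGo : (k i : ℕ) → ℕ → List ℕ → Bool
  hasRemGo k i r [] = false
  hasRemGo k i r (x ∷ xs) = ((nextLen xs <ᵇ x) ∧ (content k r x ≡ᵇ i)) ∨ hasRemGo k i (suc r) xs

  dropZeros : List ℕ → List ℕ
  dropZeros = filter (λ a → 1 ≤? a)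

HasAddable : (k : ℕ) → Fin (suc k) → List ℕ → Bool
HasAddable k i ν = hasAddGo k (toℕ i) nothing 1 ν

-- the action of s_i on a (k+1)-core
act : (k : ℕ) → Fin (suc k) → List ℕ → List ℕ
act k i ν =
  if HasAddable k i ν then addGo k (toℕ i) nothing 1 ν
  else if hasRemGo k (toℕ i) 1 ν then dropZeros (remGo k (toℕ i) 1 ν)
  else ν

actW : (k : ℕ) → List (Fin (suc k)) → List ℕ
actW k [] = []
actW k (i ∷ w) = act k i (actW k w)

-- every letter (applied right to left, starting from ∅) adds boxes;
-- equivalently w is a reduced word of an element of W^0
Builds : (k : ℕ) → List (Fin (suc k)) → Set
Builds k [] = ⊤
Builds k (i ∷ w) = Builds k w × T (HasAddable k i (actW k w))

-- inverse Lapointe–Morse map: i-th part = # cells in row i of hook length ≤ k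
colLen : List ℕ → ℕ → ℕ
colLen ν j = length (filter (λ a → j ≤? a) ν)

hook : List ℕ → ℕ → ℕ → ℕ → ℕ
hook ν r x j = (x ∸ j) + (colLen ν j ∸ r) + 1

private
  boundedGo : ℕ → List ℕ → ℕ → List ℕ → List ℕ
  boundedGo k ν r [] = []
  boundedGo k ν r (x ∷ xs) =
    length (filter (λ j → hook ν r x j ≤? k) (map suc (upTo x))) ∷ boundedGo k ν (suc r) xs

boundedPartition : ℕ → List ℕ → List ℕ
boundedPartition k ν = filter (λ a → 1 ≤? a) (boundedGo k ν 1 ν)

-- w is a reduced word for w_λ (w ∈ W^0 and w ∅ = 𝔠(λ))
ReducedWordOf : (k : ℕ) → List ℕ → List (Fin (suc k)) → Set
ReducedWordOf k λ′ w = Builds k w × boundedPartition k (actW k w) ≡ λ′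

private
  firstOut : {n : ℕ} → Subset n → Maybe (Fin n)
  firstOut [] = nothing
  firstOut (false ∷ d) = just Data.Fin.zero
  firstOut (true ∷ d) = Data.Maybe.map Data.Fin.suc (firstOut d)

-- u_D for D ⊊ {0..k}: with m ∉ D minimal, the elements of D are multiplied
-- in the cyclically decreasing order m-1, m-2, …, m+1 (mod k+1), so that
-- u_{j+1} is to the left of u_j whenever j, j+1 ∈ D.
uD : {k : ℕ} → Subset (suc k) → 𝔸 k
uD {k} D with firstOut D
... | nothing = 𝟘
... | just m = uw (filter (λ j → Data.Bool._≟_ (lookup D j) true)
                     (map (λ t → (toℕ m + suc k ∸ t) mod (suc k)) (map suc (upTo k))))

allSubsets : (n : ℕ) → List (Subset n)
allSubsets zero = [] ∷ []
allSubsets (suc n) = map (false ∷_) (allSubsets n) Data.List.++ map (true ∷_) (allSubsets n)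

𝐡 : (k : ℕ) → ℕ → 𝔸 k
𝐡 k i = Σ⊕ (map uD (filter (λ D → ∣ D ∣ Data.Nat.≟ i) (allSubsets (suc k))))

InHSubalgebra : (k : ℕ) → 𝔸 k → Set
InHSubalgebra k x = Σ (Expr (Fin k)) λ e → eval (λ j → 𝐡 k (suc (toℕ j))) e ≈ x

PieriStep : (k i : ℕ) → List ℕ → List ℕ → Set
PieriStep k i λ′ μ =
  Σ (Subset (suc k)) λ D → ∣ D ∣ ≡ i ×
  Σ (List (Fin (suc k))) λ wλ → Σ (List (Fin (suc k))) λ wμ →
    ReducedWordOf k λ′ wλ × ReducedWordOf k μ wμ × (uD D ⊗ uw wλ ≈ uw wμ)

IsKSchur : (k : ℕ) → (List ℕ → 𝔸 k) → Set
IsKSchur k s =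
  (s [] ≈ 𝟙) ×
  (∀ λ′ → KBounded k λ′ → InHSubalgebra k (s λ′)) ×
  (∀ λ′ → KBounded k λ′ → ∀ i → 1 ≤ i → i ≤ k →
     Σ (List (List ℕ)) λ L → Unique L ×
       (∀ μ → (μ ∈ L) ⇔ (KBounded k μ × PieriStep k i λ′ μ)) ×
       (𝐡 k i ⊗ s λ′ ≈ Σ⊕ (map s L)))

-- The algebra acts on the span of the (k + 1)-cores, u_i adding all boxes of content i or killing the core. This action
-- is faithful, because every reduced word survives on a core with sufficiently many inversions. Triangularity of the
-- Pieri rule gives s_λ ∅ = 𝔠(λ). The Pieri rule for one-row shapes is symmetric, so the h_i commute; they are also
-- invariant under the rotation ρ : u_i ↦ u_{i+c}. The letters that kill ∅ are the u_l with l ≠ 0, and the u_{l+c} with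
-- l ≠ 0 kill 𝔠(R); hence z ∅ = 0 implies ρ(z) 𝔠(R) = 0. For a core x ∅ with k-Schur function s_x this gives
-- s_R x ∅ = s_R s_x ∅ = s_x 𝔠(R) = ρ(s_x) 𝔠(R) = ρ(u(x)) 𝔠(R), so s_R u_i and u_{i+c} s_R agree on every core.
module Submission where

-- The presentation of the algebra offers no normal forms, so an equation is decided by an action
-- and then pulled back: two words that reach the same state without being killed are equal in the
-- algebra by the exchange condition. This is proved once for every start vector without descents
-- and used for two of them: the empty core, where end states are cosets of `W` by `W_0`, and the
-- zero vector, where they are elements of `W`. A single core kills many reduced words, which is why
-- faithfulness needs cores adapted to the word.
--
-- The action is taken on functions of states and not on formal sums, so the coefficients of an
-- element are read off by delta functions.
--
-- The condition on `c` and `r` enters through contents: the two addable boxes of `R` have contents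
-- `c` and `-r`, which agree modulo `n`, just as ∅ has addable boxes of content 0 only. Hence `R`
-- behaves like ∅ rotated by `c`.

open import Defs
open import Data.Nat as ℕ using (ℕ; suc; zero)

-- Defs keeps its recursive functions private. Below, each definition f = _ is solved to such a function by unification
-- with the equation next to it, which makes the function available under a name.
module Unfolding where
  open import Data.Nat
  open import Data.Nat.DivMod using (_mod_)
  open import Data.Fin using (Fin; toℕ; zero; suc)
  open import Data.Fin.Subset using (Subset)
  open import Data.Vec using (lookup; []; _∷_)
  open import Data.List using (List; []; _∷_; map; filter; upTo; length)
  open import Data.Maybe as Maybe using (Maybe; just; nothing)
  import Data.Bool
  open import Data.Bool using (Bool; true; false)
  open import Relation.Binary.PropositionalEquality
  open import Tactic.Cong
  open import Data.Product using (∃; _×_; _,_)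

  wordFrom : {k : ℕ} → Subset (suc k) → Fin (suc k) → List (Fin (suc k))
  wordFrom {k} D m = filter (λ j → lookup D j Data.Bool.≟ true)
                       (map (λ t → (toℕ m + suc k ∸ t) mod (suc k)) (map suc (upTo k)))
  mutual
    uDfrom : (k : ℕ) → Subset (suc k) → Subset k → 𝔸 k
    uDfrom = _

    uD-true : ∀ k (d : Subset k) → uD {k} (true ∷ d) ≡ uDfrom k (true ∷ d) d
    uD-true k d with true ∷ d
    ... | D = refl

  mutual
    firstOut : (n : ℕ) → Subset (suc n) → Maybe (Fin (suc n))
    firstOut⁺ : (n : ℕ) → Subset n → Maybe (Fin (suc n))
    firstOut = _
    firstOut⁺ = _

    firstOut-spec : ∀ k (D : Subset (2 + k)) (d : Subset (suc k)) (d′ : Subset k) →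
      firstOut k d ≡ firstOut⁺ k d′ → uDfrom (suc k) D d ≡ uDfrom (suc k) D (true ∷ d′)
    -- With the outer `Maybe.map` abstracted, the two sides differ in a single subterm, and `cong!`
    -- has to solve `firstOut` and `firstOut⁺` by its two forms.
    firstOut-spec k D d d′ eq with Maybe.map {A = Fin (suc k)} Fin.suc
    ... | C = cong! eq

  firstOut-just : ∀ n (D : Subset (suc n)) m → firstOut n D ≡ just m → lookup D m ≡ false
  firstOut-just n (false ∷ D) .zero refl = refl
  firstOut-just (suc n) (true ∷ D) m eq with firstOut n D in e
  firstOut-just (suc n) (true ∷ D) .(suc i) refl | just i = firstOut-just n D i e
  firstOut-just zero (true ∷ []) m ()

  firstOut-nothing : ∀ n (D : Subset (suc n)) → firstOut n D ≡ nothing → ∀ m → lookup D m ≡ true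
  firstOut-nothing n (true ∷ D) _ zero = refl
  firstOut-nothing (suc n) (true ∷ D) eq (suc m) with firstOut n D in e
  firstOut-nothing (suc n) (true ∷ D) _ (suc m) | nothing = firstOut-nothing n D e m

  uD-wordFrom : ∀ k (D : Subset (suc k)) x → lookup D x ≡ false → ∃ λ m → lookup D m ≡ false × uD D ≡ uw (wordFrom D m)
  uD-wordFrom k D x x∉D with firstOut k D in eq
  ... | nothing with () ← trans (sym (firstOut-nothing k D eq x)) x∉D
  ... | just m = m , firstOut-just k D m eq , refl

  cellsUpTo : ℕ → List ℕ → ℕ → ℕ → ℕ
  cellsUpTo k ν r x = length (filter (λ j → hook ν r x j ≤? k) (map suc (upTo x)))

  mutual
    hasAddableFrom : ℕ → ℕ → Maybe ℕ → ℕ → List ℕ → Bool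
    hasAddableFrom = _

    HasAddable-unfold : ∀ k (i : Fin (suc k)) ν → HasAddable k i ν ≡ hasAddableFrom k (toℕ i) nothing 1 ν
    HasAddable-unfold k i ν with toℕ i | Maybe.nothing {A = ℕ} | 1
    ... | j | p | r = refl

  mutual
    addFrom : ℕ → ℕ → Maybe ℕ → ℕ → List ℕ → List ℕ
    addFrom = _

    act-unfold : ∀ k (i : Fin (suc k)) ν → HasAddable k i ν ≡ true → act k i ν ≡ addFrom k (toℕ i) nothing 1 ν
    act-unfold k i ν eq rewrite eq with toℕ i | Maybe.nothing {A = ℕ} | 1
    ... | j | p | r = refl

  mutual
    boundedFrom : ℕ → List ℕ → ℕ → List ℕ → List ℕ
    boundedFrom = _

    boundedPartition-unfold : ∀ k x xs → boundedPartition k (x ∷ xs) ≡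
      filter (λ a → 1 ≤? a) (cellsUpTo k (x ∷ xs) 1 x ∷ boundedFrom k (x ∷ xs) 2 xs)
    boundedPartition-unfold k x xs with x ∷ xs | 2
    ... | ν | r = refl

-- Residues modulo k + 1

module Shift where
  open import Data.Nat using (ℕ; zero; suc; _+_; _*_; _∸_; _≤_; _<_; s≤s; z≤n)
  open import Data.Nat.Properties
  open import Data.Nat.DivMod
  open import Data.Fin using (Fin; toℕ) renaming (zero to fz; suc to fs)
  open import Data.Fin.Properties using (toℕ-injective; toℕ-fromℕ<; toℕ<n)
  open import Data.Product using (∃; _×_; _,_)
  open import Relation.Nullary using (¬_)
  open import Relation.Binary.PropositionalEquality

  module _ {k : ℕ} where
    toℕ-+ₘ : ∀ (i : Fin (suc k)) t → toℕ (i +ₘ t) ≡ (toℕ i + t) % suc k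
    toℕ-+ₘ i t = toℕ-fromℕ< _

    +ₘ-≡ : ∀ (i j : Fin (suc k)) s t → (toℕ i + s) % suc k ≡ (toℕ j + t) % suc k → i +ₘ s ≡ j +ₘ t
    +ₘ-≡ i j s t eq = toℕ-injective (trans (toℕ-+ₘ i s) (trans eq (sym (toℕ-+ₘ j t))))

    +ₘ-identity : ∀ (i : Fin (suc k)) → i +ₘ 0 ≡ i
    +ₘ-identity i = toℕ-injective (trans (toℕ-+ₘ i 0) (trans (cong (_% suc k) (+-identityʳ (toℕ i))) (m<n⇒m%n≡m (toℕ<n i))))

    +ₘ-+ₘ : ∀ (i : Fin (suc k)) s t → (i +ₘ s) +ₘ t ≡ i +ₘ (s + t)
    +ₘ-+ₘ i s t = +ₘ-≡ (i +ₘ s) i t (s + t) (begin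
      (toℕ (i +ₘ s) + t) % suc k                ≡⟨ cong (λ z → (z + t) % suc k) (toℕ-+ₘ i s) ⟩
      ((toℕ i + s) % suc k + t) % suc k         ≡⟨ %-distribˡ-+ ((toℕ i + s) % suc k) t (suc k) ⟩
      ((toℕ i + s) % suc k % suc k + t % suc k) % suc k ≡⟨ cong (λ z → (z + t % suc k) % suc k) (m%n%n≡m%n (toℕ i + s) (suc k)) ⟩
      ((toℕ i + s) % suc k + t % suc k) % suc k ≡⟨ %-distribˡ-+ (toℕ i + s) t (suc k) ⟨
      (toℕ i + s + t) % suc k                   ≡⟨ cong (_% suc k) (+-assoc (toℕ i) s t) ⟩
      (toℕ i + (s + t)) % suc k                 ∎)
      where open ≡-Reasoning

    +ₘ-period : ∀ (i : Fin (suc k)) t → i +ₘ (t + suc k) ≡ i +ₘ t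
    +ₘ-period i t = +ₘ-≡ i i (t + suc k) t
      (trans (cong (_% suc k) (sym (+-assoc (toℕ i) t (suc k)))) ([m+n]%n≡m%n (toℕ i + t) (suc k)))

    +ₘ-cycle : ∀ (i : Fin (suc k)) → i +ₘ suc k ≡ i
    +ₘ-cycle i = trans (+ₘ-period i 0) (+ₘ-identity i)

    zero+ₘ : ∀ (x : Fin (suc k)) → fz +ₘ toℕ x ≡ x
    zero+ₘ x = toℕ-injective (trans (toℕ-+ₘ fz (toℕ x)) (m<n⇒m%n≡m (toℕ<n x)))

    +ₘ-comm : ∀ (i : Fin (suc k)) s t → (i +ₘ s) +ₘ t ≡ (i +ₘ t) +ₘ s
    +ₘ-comm i s t = trans (+ₘ-+ₘ i s t) (trans (cong (i +ₘ_) (+-comm s t)) (sym (+ₘ-+ₘ i t s)))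

    neg : Fin (suc k) → ℕ
    neg i = suc k ∸ toℕ i

    +ₘ-neg : ∀ (i : Fin (suc k)) → i +ₘ neg i ≡ fz
    +ₘ-neg i = toℕ-injective (trans (toℕ-+ₘ i (neg i))
      (trans (cong (_% suc k) (m+[n∸m]≡n (<⇒≤ (toℕ<n i)))) (n%n≡0 (suc k))))

    fz+ₘ : ∀ {t} → t < suc k → toℕ (fz {k} +ₘ t) ≡ t
    fz+ₘ {t} t<n = trans (toℕ-+ₘ fz t) (m<n⇒m%n≡m t<n)

    +ₘ-rebase : ∀ (i : Fin (suc k)) t → (i +ₘ t) +ₘ neg i ≡ fz +ₘ t
    +ₘ-rebase i t = trans (+ₘ-comm i t (neg i)) (cong (_+ₘ t) (+ₘ-neg i))

    +ₘ-injective : ∀ (i : Fin (suc k)) {s t} → s < suc k → t < suc k → i +ₘ s ≡ i +ₘ t → s ≡ t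
    +ₘ-injective i {s} {t} s<n t<n eq = begin
      s                             ≡⟨ fz+ₘ s<n ⟨
      toℕ (fz +ₘ s)                 ≡⟨ cong toℕ (+ₘ-rebase i s) ⟨
      toℕ ((i +ₘ s) +ₘ neg i)       ≡⟨ cong (λ z → toℕ (z +ₘ neg i)) eq ⟩
      toℕ ((i +ₘ t) +ₘ neg i)       ≡⟨ cong toℕ (+ₘ-rebase i t) ⟩
      toℕ (fz +ₘ t)                 ≡⟨ fz+ₘ t<n ⟩
      t                             ∎
      where open ≡-Reasoning

    -- Shifting on by `t * k` completes `t` full turns, which inverts the shift by `t` without any
    -- subtraction.
    +ₘ-cancelʳ : ∀ (i j : Fin (suc k)) {t} → i +ₘ t ≡ j +ₘ t → i ≡ j
    +ₘ-cancelʳ i j {t} eq = begin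
      i                          ≡⟨ back i ⟨
      (i +ₘ t) +ₘ (t * k)        ≡⟨ cong (_+ₘ (t * k)) eq ⟩
      (j +ₘ t) +ₘ (t * k)        ≡⟨ back j ⟩
      j                          ∎
      where
      open ≡-Reasoning
      mult : ∀ x a → x +ₘ (a * suc k) ≡ x
      mult x zero = +ₘ-identity x
      mult x (suc a) = trans (cong (x +ₘ_) (+-comm (suc k) (a * suc k))) (trans (+ₘ-period x (a * suc k)) (mult x a))
      back : ∀ x → (x +ₘ t) +ₘ (t * k) ≡ x
      back x = trans (+ₘ-+ₘ x t (t * k)) (trans (cong (x +ₘ_) (sym (*-suc t k))) (mult x t))

    offset : ∀ (m x : Fin (suc k)) → ∃ λ t → t < suc k × m +ₘ t ≡ x
    offset m x = toℕ (x +ₘ neg m) , toℕ<n (x +ₘ neg m) , (begin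
      m +ₘ toℕ (x +ₘ neg m)           ≡⟨ cong (_+ₘ toℕ (x +ₘ neg m)) (sym (zero+ₘ m)) ⟩
      (fz +ₘ toℕ m) +ₘ toℕ (x +ₘ neg m) ≡⟨ +ₘ-comm fz (toℕ m) _ ⟩
      (fz +ₘ toℕ (x +ₘ neg m)) +ₘ toℕ m ≡⟨ cong (_+ₘ toℕ m) (zero+ₘ (x +ₘ neg m)) ⟩
      (x +ₘ neg m) +ₘ toℕ m           ≡⟨ +ₘ-comm x (neg m) (toℕ m) ⟩
      (x +ₘ toℕ m) +ₘ neg m           ≡⟨ cong (λ z → (z +ₘ toℕ m) +ₘ neg m) (zero+ₘ x) ⟨
      ((fz +ₘ toℕ x) +ₘ toℕ m) +ₘ neg m ≡⟨ cong (_+ₘ neg m) (+ₘ-comm fz (toℕ x) (toℕ m)) ⟩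
      ((fz +ₘ toℕ m) +ₘ toℕ x) +ₘ neg m ≡⟨ cong (λ z → (z +ₘ toℕ x) +ₘ neg m) (zero+ₘ m) ⟩
      (m +ₘ toℕ x) +ₘ neg m           ≡⟨ +ₘ-rebase m (toℕ x) ⟩
      fz +ₘ toℕ x                     ≡⟨ zero+ₘ x ⟩
      x                               ∎)
      where open ≡-Reasoning

    nxt prv : Fin (suc k) → Fin (suc k)
    nxt i = i +ₘ 1
    prv i = i +ₘ k

    nxt-prv : ∀ i → nxt (prv i) ≡ i
    nxt-prv i = trans (+ₘ-+ₘ i k 1) (trans (cong (i +ₘ_) (+-comm k 1)) (+ₘ-cycle i))

    prv-nxt : ∀ i → prv (nxt i) ≡ i
    prv-nxt i = trans (+ₘ-+ₘ i 1 k) (+ₘ-cycle i)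

    nxt-+ₘ : ∀ i t → nxt (i +ₘ t) ≡ i +ₘ suc t
    nxt-+ₘ i t = trans (+ₘ-+ₘ i t 1) (cong (i +ₘ_) (+-comm t 1))

    prv-+ₘ-suc : ∀ i t → prv (i +ₘ suc t) ≡ i +ₘ t
    prv-+ₘ-suc i t = trans (cong prv (sym (nxt-+ₘ i t))) (prv-nxt (i +ₘ t))

    nxt≢ : 1 ≤ k → ∀ i → ¬ nxt i ≡ i
    nxt≢ 1≤k i eq with +ₘ-injective i (s≤s 1≤k) (s≤s z≤n) (trans eq (sym (+ₘ-identity i)))
    ... | ()

    prv≢ : 1 ≤ k → ∀ i → ¬ prv i ≡ i
    prv≢ 1≤k i eq = nxt≢ 1≤k i (trans (cong nxt (sym eq)) (nxt-prv i))

    nxt²≢ : 2 ≤ k → ∀ i → ¬ nxt (nxt i) ≡ i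
    nxt²≢ 2≤k i eq with +ₘ-injective i (s≤s 2≤k) (s≤s z≤n) (trans (sym (+ₘ-+ₘ i 1 1)) (trans eq (sym (+ₘ-identity i))))
    ... | ()

    nxt²≡ : k ≡ 1 → ∀ i → nxt (nxt i) ≡ i
    nxt²≡ refl i = trans (+ₘ-+ₘ i 1 1) (+ₘ-cycle i)

module NilCoxeter (k : ℕ) (1≤k : 1 ℕ.≤ k) where
  open Unfolding
  open Shift
  open import Algebra.Bundles using (Ring; AbelianGroup)
  open import Data.Bool using (Bool; true; false; if_then_else_; not; _∧_; _∨_; T)
  open import Data.Empty using (⊥; ⊥-elim)
  open import Data.Fin as Fin using (Fin; toℕ; _≟_; fromℕ<) renaming (zero to fz; suc to fs)
  open import Data.Fin.Permutation using (permutation)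
  open import Data.Fin.Properties using (any?; toℕ<n; toℕ-injective; suc-injective; toℕ-fromℕ<)
  open import Data.Fin.Subset using (Subset; _⊆_)
  open import Data.Fin.Subset.Properties using (p⊆q⇒∣p∣≤∣q∣; p⊂q⇒∣p∣<∣q∣)
  open import Data.Integer using (ℤ; _+_; +≤+; _-_; -_; 0ℤ; 1ℤ; _≤_; _<_; _≤?_; _*_; -[1+_]; ∣_∣) renaming (+_ to pos)
  import Data.Integer.DivMod as ℤDivMod
  open import Data.Integer.Properties hiding (_≟_)
  open import Data.Integer.Tactic.RingSolver using (solve-∀)
  open import Data.List using (List; []; _∷_; foldr; _++_; map; length; reverse; filter; upTo; replicate)
  open import Data.List.Membership.Propositional using (_∈_)
  open import Data.List.Membership.Propositional.Properties using (∈-∃++; ∈-map⁺; ∈-map⁻; ∈-filter⁺; ∈-filter⁻; ∈-upTo⁺; ∈-++⁺ˡ; ∈-++⁺ʳ; ∈-++⁻)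
  open import Data.List.Properties using (map-++; length-++; unfold-reverse; ++-assoc; length-map; map-∘; filter-accept; filter-reject; filter-++; applyUpTo-∷ʳ; ∷-injectiveˡ; ∷-injectiveʳ; filter-all)
  open import Data.List.Relation.Binary.Permutation.Propositional as Perm using (_↭_; ↭-refl; ↭-prep; ↭-trans)
  open import Data.List.Relation.Binary.Permutation.Propositional.Properties using (shift; ↭-length) renaming (map⁺ to ↭-map⁺)
  open import Data.List.Relation.Unary.All as All using (All; []; _∷_)
  import Data.List.Relation.Unary.All.Properties as Allₚ
  open import Data.List.Relation.Unary.AllPairs as AllPairs using (AllPairs; []; _∷_)
  import Data.List.Relation.Unary.AllPairs.Properties as AllPairsₚ
  open import Data.List.Relation.Unary.Any using (here; there)
  open import Data.List.Relation.Unary.Linked using (Linked; []; [-]; _∷_)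
  open import Data.List.Relation.Unary.Unique.Propositional using (Unique)
  import Data.List.Relation.Unary.Unique.Propositional.Properties as Uniqueₚ
  open import Data.Maybe using (Maybe; just; nothing)
  open import Data.Maybe.Properties as Maybeₚ using (just-injective)
  open import Data.Nat.DivMod as DivMod using (_mod_)
  import Data.Nat.Properties as ℕₚ
  open import Data.Product using (∃; Σ; _×_; _,_; proj₁; proj₂)
  open import Data.Sum using (_⊎_; inj₁; inj₂)
  open import Data.Unit using (⊤; tt)
  open import Data.Vec as Vec using (Vec; lookup; tabulate)
  open import Data.Vec.Properties as Vecₚ using (lookup∘tabulate; tabulate∘lookup; tabulate-cong; ≡-dec; lookup⇒[]=; []=⇒lookup)
  open import Function.Bundles using (Equivalence; _⇔_)
  open import Relation.Binary.Definitions using (tri<; tri≈; tri>)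
  open import Relation.Binary.PropositionalEquality
  import Relation.Binary.Reasoning.Setoid as SetoidReasoning
  open import Relation.Nullary using (¬_; Dec; yes; no; does)
  open import Relation.Nullary.Decidable using (_×-dec_; _⊎-dec_)
  open import Relation.Unary using (Decidable)


  -- Abacus states and their moves

  Letter : Set
  Letter = Fin (suc k)

  Word : Set
  Word = List Letter

  -- A vector b assigns to each residue x modulo n = k + 1 the last bead b(x) of that residue on the abacus of a core.
  -- The same moves on an arbitrary start vector describe the regular action of the affine symmetric group.
  State : Set
  State = Vec ℤ (suc k)

  infixl 8 _!_

  abstract
    _!_ : State → Letter → ℤ
    _!_ = lookup

    fromFun : (Letter → ℤ) → State
    fromFun = tabulate

    fromFun-! : ∀ f x → fromFun f ! x ≡ f x
    fromFun-! = lookup∘tabulate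

    lookup-injective : {a b : State} → (∀ x → a ! x ≡ b ! x) → a ≡ b
    lookup-injective {a} {b} eq = trans (sym (tabulate∘lookup a)) (trans (tabulate-cong eq) (tabulate∘lookup b))

  -- Linear arithmetic: an inequality follows once its slack is written as the sum of the slacks of
  -- the hypotheses and a natural number. What remains is an identity of commutative rings.
  lin₁ : ∀ {a b c d : ℤ} (m : ℕ) → c ≤ d → b - a ≡ (d - c) + pos m → a ≤ b
  lin₁ m p eq = 0≤i-j⇒j≤i (≤-trans (+-mono-≤ (i≤j⇒0≤j-i p) (+≤+ ℕ.z≤n)) (≤-reflexive (sym eq)))

  lin₂ : ∀ {a b c d e f : ℤ} (m : ℕ) → c ≤ d → e ≤ f → b - a ≡ (d - c) + (f - e) + pos m → a ≤ b
  lin₂ m p q eq = 0≤i-j⇒j≤i (≤-trans (+-mono-≤ (+-mono-≤ (i≤j⇒0≤j-i p) (i≤j⇒0≤j-i q)) (+≤+ ℕ.z≤n)) (≤-reflexive (sym eq)))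

  lin₃ : ∀ {a b c d e f g h : ℤ} (m : ℕ) → c ≤ d → e ≤ f → g ≤ h → b - a ≡ (d - c) + (f - e) + (h - g) + pos m → a ≤ b
  lin₃ m p q r eq = 0≤i-j⇒j≤i (≤-trans (+-mono-≤ (+-mono-≤ (+-mono-≤ (i≤j⇒0≤j-i p) (i≤j⇒0≤j-i q)) (i≤j⇒0≤j-i r)) (+≤+ ℕ.z≤n)) (≤-reflexive (sym eq)))

  ≰⇒1+≤ : ∀ {a b : ℤ} → ¬ a ≤ b → b + 1ℤ ≤ a
  ≰⇒1+≤ {a} {b} ¬p = ≤-trans (≤-reflexive (+-comm b 1ℤ)) (i<j⇒suc[i]≤j (≰⇒> ¬p))

  1+≤⇒≰ : ∀ {a b : ℤ} → b + 1ℤ ≤ a → ¬ a ≤ b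
  1+≤⇒≰ {a} {b} p q = <⇒≱ (suc[i]≤j⇒i<j (≤-trans (≤-reflexive (+-comm 1ℤ b)) p)) q

  -- The simple reflection exchanges neighbouring runners: a bead of residue `prv i` moves one
  -- position up and a bead of residue `i` one position down, whence the corrections by 1.
  swapFun : Letter → (Letter → ℤ) → Letter → ℤ
  swapFun i f x with x ≟ i
  ... | yes _ = f (prv i) + 1ℤ
  ... | no _ with x ≟ prv i
  ...   | yes _ = f i - 1ℤ
  ...   | no _  = f x

  abstract
    swapAt : Letter → State → State
    swapAt i b = fromFun (swapFun i (b !_))

    swapAt-at : ∀ i b → swapAt i b ! i ≡ b ! prv i + 1ℤ
    swapAt-at i b rewrite fromFun-! (swapFun i (b !_)) i with i ≟ i
    ... | yes _ = refl
    ... | no i≢i = ⊥-elim (i≢i refl)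

    swapAt-prv : ∀ i b → swapAt i b ! prv i ≡ b ! i - 1ℤ
    swapAt-prv i b rewrite fromFun-! (swapFun i (b !_)) (prv i) with prv i ≟ i
    ... | yes eq = ⊥-elim (prv≢ 1≤k i eq)
    ... | no _ with prv i ≟ prv i
    ...   | yes _ = refl
    ...   | no i≢i = ⊥-elim (i≢i refl)

    swapAt-other : ∀ i b {x} → ¬ x ≡ i → ¬ x ≡ prv i → swapAt i b ! x ≡ b ! x
    swapAt-other i b {x} x≢i x≢p rewrite fromFun-! (swapFun i (b !_)) x with x ≟ i
    ... | yes eq = ⊥-elim (x≢i eq)
    ... | no _ with x ≟ prv i
    ...   | yes eq = ⊥-elim (x≢p eq)
    ...   | no _  = refl

  swapAt-ext : ∀ i (a b : State) → a ! i ≡ b ! prv i + 1ℤ → a ! prv i ≡ b ! i - 1ℤ →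
    (∀ x → ¬ x ≡ i → ¬ x ≡ prv i → a ! x ≡ b ! x) → a ≡ swapAt i b
  swapAt-ext i a b p q r = lookup-injective pointwise
    where
    pointwise : ∀ x → a ! x ≡ swapAt i b ! x
    pointwise x with x ≟ i
    ... | yes refl = trans p (sym (swapAt-at i b))
    ... | no x≢i with x ≟ prv i
    ...   | yes refl = trans q (sym (swapAt-prv i b))
    ...   | no x≢p = trans (r x x≢i x≢p) (sym (swapAt-other i b x≢i x≢p))

  private
    +1-1 : ∀ a → a ≡ (a - 1ℤ) + 1ℤ
    +1-1 = solve-∀
    -1+1 : ∀ a → a ≡ (a + 1ℤ) - 1ℤ
    -1+1 = solve-∀

  swapAt-involutive : ∀ i b → swapAt i (swapAt i b) ≡ b
  swapAt-involutive i b = sym (swapAt-ext i b (swapAt i b)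
    (trans (+1-1 _) (cong (_+ 1ℤ) (sym (swapAt-prv i b))))
    (trans (-1+1 _) (cong (_- 1ℤ) (sym (swapAt-at i b))))
    (λ x p q → sym (swapAt-other i b p q)))

  -- On a core these mean that some box of content `i` can be added, that some can be removed, and
  -- that neither is possible. The tie `Neut` is the fixed point of `swapAt i`, so it sits at a
  -- difference of 1 and not at equal values.
  Asc Desc Neut : Letter → State → Set
  Asc i b = b ! i ≤ b ! prv i
  Desc i b = b ! prv i + pos 2 ≤ b ! i
  Neut i b = b ! i ≡ b ! prv i + 1ℤ

  Asc? : ∀ i b → Dec (Asc i b)
  Asc? i b = b ! i ≤? b ! prv i

  data Trichotomy (i : Letter) (b : State) : Set where
    asc  : Asc i b → Trichotomy i b
    desc : Desc i b → Trichotomy i b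
    neut : Neut i b → Trichotomy i b

  private
    two : ∀ a → (a + 1ℤ) + 1ℤ ≡ a + pos 2
    two = solve-∀

  trichotomy : ∀ i b → Trichotomy i b
  trichotomy i b with Asc? i b
  ... | yes p = asc p
  ... | no ¬p with b ! i ≤? b ! prv i + 1ℤ
  ...   | yes q = neut (≤-antisym q (≰⇒1+≤ ¬p))
  ...   | no ¬q = desc (≤-trans (≤-reflexive (sym (two (b ! prv i)))) (≰⇒1+≤ ¬q))

  Desc⇒¬Asc : ∀ {i b} → Desc i b → ¬ Asc i b
  Desc⇒¬Asc {i} {b} p = 1+≤⇒≰ (lin₁ 1 p (e (b ! i) (b ! prv i)))
    where
    e : ∀ A B → A - (B + 1ℤ) ≡ (A - (B + pos 2)) + pos 1
    e = solve-∀

  -- The algebra and its action on functions of states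

  𝔸-ring : Ring _ _
  𝔸-ring = record
    { Carrier = 𝔸 k ; _≈_ = _≈_ ; _+_ = _⊕_ ; _*_ = _⊗_ ; -_ = ⊖_ ; 0# = 𝟘 ; 1# = 𝟙
    ; isRing = record
      { +-isAbelianGroup = record
        { isGroup = record
          { isMonoid = record
            { isSemigroup = record
              { isMagma = record { isEquivalence = record { refl = ≈-refl ; sym = ≈-sym ; trans = ≈-trans } ; ∙-cong = ⊕-cong }
              ; assoc = ⊕-assoc }
            ; identity = ⊕-idˡ , λ x → ≈-trans (⊕-comm x 𝟘) (⊕-idˡ x) }
          ; inverse = ⊖-invˡ , λ x → ≈-trans (⊕-comm x (⊖ x)) (⊖-invˡ x)
          ; ⁻¹-cong = ⊖-cong }
        ; comm = ⊕-comm }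
      ; *-cong = ⊗-cong
      ; *-assoc = ⊗-assoc
      ; *-identity = ⊗-idˡ , ⊗-idʳ
      ; distrib = distribˡ , distribʳ } }

  open Ring 𝔸-ring public using () renaming (zeroˡ to ⊗-zeroˡ; zeroʳ to ⊗-zeroʳ; setoid to 𝔸-setoid; +-identityʳ to ⊕-idʳ; -‿inverseʳ to ⊖-invʳ; reflexive to ≈-reflexive)
  module ≈-Reasoning = SetoidReasoning 𝔸-setoid

  uw-++ : ∀ (v w : Word) → uw (v ++ w) ≈ uw v ⊗ uw w
  uw-++ [] w = ≈-sym (⊗-idˡ _)
  uw-++ (i ∷ v) w = ≈-trans (⊗-cong ≈-refl (uw-++ v w)) (≈-sym (⊗-assoc _ _ _))

  nil-⊗ : ∀ i (x : 𝔸 k) → u i ⊗ (u i ⊗ x) ≈ 𝟘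
  nil-⊗ i x = ≈-trans (≈-sym (⊗-assoc _ _ _)) (≈-trans (⊗-cong (nil i) ≈-refl) (⊗-zeroˡ x))

  comm-⊗ : ∀ i j (x : 𝔸 k) → ¬ Adjacent k i j → u i ⊗ (u j ⊗ x) ≈ u j ⊗ (u i ⊗ x)
  comm-⊗ i j x ¬adj = ≈-trans (≈-sym (⊗-assoc _ _ _)) (≈-trans (⊗-cong (comm i j ¬adj) ≈-refl) (⊗-assoc _ _ _))

  braid-⊗ : 2 ℕ.≤ k → ∀ i (x : 𝔸 k) → u i ⊗ (u (nxt i) ⊗ (u i ⊗ x)) ≈ u (nxt i) ⊗ (u i ⊗ (u (nxt i) ⊗ x))
  braid-⊗ 2≤k i x = ≈-trans (assoc³ i (nxt i) i) (≈-trans (⊗-cong (braid 2≤k i) ≈-refl) (≈-sym (assoc³ (nxt i) i (nxt i))))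
    where
    assoc³ : ∀ a b c → u a ⊗ (u b ⊗ (u c ⊗ x)) ≈ u a ⊗ u b ⊗ u c ⊗ x
    assoc³ a b c = ≈-trans (≈-sym (⊗-assoc _ _ _)) (≈-sym (⊗-assoc _ _ _))

  adjacent? : ∀ i j → Dec (Adjacent k i j)
  adjacent? i j = (j ≟ nxt i) ⊎-dec (i ≟ nxt j)

  prv-injective : ∀ {i j : Letter} → prv i ≡ prv j → i ≡ j
  prv-injective {i} {j} = +ₘ-cancelʳ i j

  module Apart {i j : Letter} (i≢j : ¬ i ≡ j) (¬adj : ¬ Adjacent k i j) where
    p≢p : ¬ prv i ≡ prv j
    p≢p eq = i≢j (prv-injective eq)
    i≢pj : ¬ i ≡ prv j
    i≢pj eq = ¬adj (inj₁ (trans (sym (nxt-prv j)) (cong nxt (sym eq))))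
    pi≢j : ¬ prv i ≡ j
    pi≢j eq = ¬adj (inj₂ (trans (sym (nxt-prv i)) (cong nxt eq)))

    at-i : ∀ b → swapAt j b ! i ≡ b ! i
    at-i b = swapAt-other j b i≢j i≢pj
    at-pi : ∀ b → swapAt j b ! prv i ≡ b ! prv i
    at-pi b = swapAt-other j b pi≢j p≢p

  apart-sym : ∀ {i j : Letter} → ¬ Adjacent k i j → ¬ Adjacent k j i
  apart-sym ¬adj (inj₁ e) = ¬adj (inj₂ e)
  apart-sym ¬adj (inj₂ e) = ¬adj (inj₁ e)

  swapAt-comm : ∀ {i j : Letter} → ¬ i ≡ j → ¬ Adjacent k i j → ∀ b → swapAt j (swapAt i b) ≡ swapAt i (swapAt j b)
  swapAt-comm {i} {j} i≢j ¬adj b = swapAt-ext i _ (swapAt j b)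
    (trans (I.at-i (swapAt i b)) (trans (swapAt-at i b) (cong (_+ 1ℤ) (sym (I.at-pi b)))))
    (trans (I.at-pi (swapAt i b)) (trans (swapAt-prv i b) (cong (_- 1ℤ) (sym (I.at-i b)))))
    other
    where
    module I = Apart i≢j ¬adj
    module J = Apart (λ e → i≢j (sym e)) (apart-sym ¬adj)
    other : ∀ x → ¬ x ≡ i → ¬ x ≡ prv i → swapAt j (swapAt i b) ! x ≡ swapAt j b ! x
    other x x≢i x≢pi with x ≟ j
    ... | yes refl = trans (swapAt-at x _) (trans (cong (_+ 1ℤ) (J.at-pi b)) (sym (swapAt-at x b)))
    ... | no x≢j with x ≟ prv j
    ...   | yes refl = trans (swapAt-prv j _) (trans (cong (_- 1ℤ) (J.at-i b)) (sym (swapAt-prv j b)))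
    ...   | no x≢pj = trans (swapAt-other j _ x≢j x≢pj) (trans (swapAt-other i b x≢i x≢pi) (sym (swapAt-other j b x≢j x≢pj)))

  record Triple (i : Letter) (b : State) (A B C : ℤ) : Set where
    constructor triple
    field
      lo : b ! prv i ≡ A
      mi : b ! i ≡ B
      hi : b ! nxt i ≡ C

  -- For `k ≥ 2` the residues `prv i`, `i`, `nxt i` are distinct, and the letters `i` and `j` act on
  -- their values like the two adjacent transpositions of three positions. A braid touches nothing
  -- else.
  module Three (2≤k : 2 ℕ.≤ k) (i : Letter) where
    j : Letter
    j = nxt i

    j≢i : ¬ j ≡ i
    j≢i = nxt≢ 1≤k i
    j≢p : ¬ j ≡ prv i
    j≢p eq = nxt²≢ 2≤k (prv i) (trans (cong nxt (nxt-prv i)) eq)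
    p≢i : ¬ prv i ≡ i
    p≢i = prv≢ 1≤k i

    the : ∀ b → Triple i b (b ! prv i) (b ! i) (b ! j)
    the b = triple refl refl refl

    at-j : ∀ b → swapAt j b ! i ≡ b ! j - 1ℤ
    at-j b = trans (cong (swapAt j b !_) (sym (prv-nxt i))) (swapAt-prv j b)

    swapᵢ : ∀ {b A B C} → Triple i b A B C → Triple i (swapAt i b) (B - 1ℤ) (A + 1ℤ) C
    swapᵢ {b} (triple refl refl refl) = triple (swapAt-prv i b) (swapAt-at i b) (swapAt-other i b j≢i j≢p)

    swapⱼ : ∀ {b A B C} → Triple i b A B C → Triple i (swapAt j b) A (C - 1ℤ) (B + 1ℤ)
    swapⱼ {b} (triple refl refl refl) = triple
      (swapAt-other j b (λ e → j≢p (sym e)) (λ e → p≢i (trans e (prv-nxt i))))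
      (at-j b)
      (trans (swapAt-at j b) (cong (λ z → b ! z + 1ℤ) (prv-nxt i)))

    ascᵢ : ∀ {b A B C} → Triple i b A B C → B ≤ A → Asc i b
    ascᵢ (triple refl refl refl) p = p
    ascᵢ⁻ : ∀ {b A B C} → Triple i b A B C → Asc i b → B ≤ A
    ascᵢ⁻ (triple refl refl refl) p = p
    descᵢ : ∀ {b A B C} → Triple i b A B C → A + pos 2 ≤ B → Desc i b
    descᵢ (triple refl refl refl) p = p
    descᵢ⁻ : ∀ {b A B C} → Triple i b A B C → Desc i b → A + pos 2 ≤ B
    descᵢ⁻ (triple refl refl refl) p = p
    neutᵢ : ∀ {b A B C} → Triple i b A B C → B ≡ A + 1ℤ → Neut i b
    neutᵢ (triple refl refl refl) p = p
    neutᵢ⁻ : ∀ {b A B C} → Triple i b A B C → Neut i b → B ≡ A + 1ℤ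
    neutᵢ⁻ (triple refl refl refl) p = p

    ascⱼ : ∀ {b A B C} → Triple i b A B C → C ≤ B → Asc j b
    ascⱼ {b} (triple refl refl refl) p = subst (λ z → b ! j ≤ b ! z) (sym (prv-nxt i)) p
    ascⱼ⁻ : ∀ {b A B C} → Triple i b A B C → Asc j b → C ≤ B
    ascⱼ⁻ {b} (triple refl refl refl) p = subst (λ z → b ! j ≤ b ! z) (prv-nxt i) p
    descⱼ : ∀ {b A B C} → Triple i b A B C → B + pos 2 ≤ C → Desc j b
    descⱼ {b} (triple refl refl refl) p = subst (λ z → b ! z + pos 2 ≤ b ! j) (sym (prv-nxt i)) p
    descⱼ⁻ : ∀ {b A B C} → Triple i b A B C → Desc j b → B + pos 2 ≤ C
    descⱼ⁻ {b} (triple refl refl refl) p = subst (λ z → b ! z + pos 2 ≤ b ! j) (prv-nxt i) p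
    neutⱼ : ∀ {b A B C} → Triple i b A B C → C ≡ B + 1ℤ → Neut j b
    neutⱼ {b} (triple refl refl refl) p = subst (λ z → b ! j ≡ b ! z + 1ℤ) (sym (prv-nxt i)) p
    neutⱼ⁻ : ∀ {b A B C} → Triple i b A B C → Neut j b → C ≡ B + 1ℤ
    neutⱼ⁻ {b} (triple refl refl refl) p = subst (λ z → b ! j ≡ b ! z + 1ℤ) (prv-nxt i) p

    swapAt-braid : ∀ b → swapAt i (swapAt j (swapAt i b)) ≡ swapAt j (swapAt i (swapAt j b))
    swapAt-braid b = lookup-injective pointwise
      where
      L = swapᵢ (swapⱼ (swapᵢ (the b)))
      R = swapⱼ (swapᵢ (swapⱼ (the b)))
      e : ∀ A → A + 1ℤ - 1ℤ ≡ A - 1ℤ + 1ℤ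
      e = solve-∀
      pointwise : ∀ x → swapAt i (swapAt j (swapAt i b)) ! x ≡ swapAt j (swapAt i (swapAt j b)) ! x
      pointwise x with x ≟ prv i
      ... | yes refl = trans (Triple.lo L) (sym (Triple.lo R))
      ... | no x≢p with x ≟ i
      ...   | yes refl = trans (Triple.mi L) (trans (sym (e (b ! x))) (sym (Triple.mi R)))
      ...   | no x≢i with x ≟ j
      ...     | yes refl = trans (Triple.hi L) (sym (Triple.hi R))
      ...     | no x≢j = trans (offᵢ _) (trans (offⱼ _) (trans (offᵢ b) (sym (trans (offⱼ _) (trans (offᵢ _) (offⱼ b))))))
        where
        offᵢ : ∀ b → swapAt i b ! x ≡ b ! x
        offᵢ b = swapAt-other i b x≢i x≢p
        offⱼ : ∀ b → swapAt j b ! x ≡ b ! x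
        offⱼ b = swapAt-other j b x≢j (λ e → x≢i (trans e (prv-nxt i)))

  -- `⟦ x ⟧ φ b` is the value at `x b` of the linear extension of `φ`, that is, the transpose of the
  -- action. Functions replace formal sums of states, and in `x ⊗ y` it is `y` that meets the state
  -- first.
  ⟦_⟧ : 𝔸 k → (State → ℤ) → State → ℤ
  ⟦ gen i ⟧ φ b = if does (Asc? i b) then φ (swapAt i b) else 0ℤ
  ⟦ 𝟘 ⟧ φ b = 0ℤ
  ⟦ 𝟙 ⟧ φ b = φ b
  ⟦ x ⊕ y ⟧ φ b = ⟦ x ⟧ φ b + ⟦ y ⟧ φ b
  ⟦ x ⊗ y ⟧ φ b = ⟦ y ⟧ (⟦ x ⟧ φ) b
  ⟦ ⊖ x ⟧ φ b = - ⟦ x ⟧ φ b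

  ⟦gen⟧-asc : ∀ φ {i b} → Asc i b → ⟦ gen i ⟧ φ b ≡ φ (swapAt i b)
  ⟦gen⟧-asc φ {i} {b} p with Asc? i b
  ... | yes _ = refl
  ... | no ¬p = ⊥-elim (¬p p)

  ⟦gen⟧-¬asc : ∀ φ {i b} → ¬ Asc i b → ⟦ gen i ⟧ φ b ≡ 0ℤ
  ⟦gen⟧-¬asc φ {i} {b} ¬p with Asc? i b
  ... | yes p = ⊥-elim (¬p p)
  ... | no _ = refl

  ⟦⟧-cong : ∀ x {φ ψ : State → ℤ} → (∀ b → φ b ≡ ψ b) → ∀ b → ⟦ x ⟧ φ b ≡ ⟦ x ⟧ ψ b
  ⟦⟧-cong (gen i) e b with does (Asc? i b)
  ... | true = e (swapAt i b)
  ... | false = refl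
  ⟦⟧-cong 𝟘 e b = refl
  ⟦⟧-cong 𝟙 e b = e b
  ⟦⟧-cong (x ⊕ y) e b = cong₂ _+_ (⟦⟧-cong x e b) (⟦⟧-cong y e b)
  ⟦⟧-cong (x ⊗ y) e b = ⟦⟧-cong y (⟦⟧-cong x e) b
  ⟦⟧-cong (⊖ x) e b = cong -_ (⟦⟧-cong x e b)

  private
    interchange : ∀ p q r s → (p + q) + (r + s) ≡ (p + r) + (q + s)
    interchange = solve-∀

  ⟦⟧-+ : ∀ x φ ψ b → ⟦ x ⟧ (λ c → φ c + ψ c) b ≡ ⟦ x ⟧ φ b + ⟦ x ⟧ ψ b
  ⟦⟧-+ (gen i) φ ψ b with does (Asc? i b)
  ... | true = refl
  ... | false = refl
  ⟦⟧-+ 𝟘 φ ψ b = refl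
  ⟦⟧-+ 𝟙 φ ψ b = refl
  ⟦⟧-+ (x ⊕ y) φ ψ b = trans (cong₂ _+_ (⟦⟧-+ x φ ψ b) (⟦⟧-+ y φ ψ b))
    (interchange (⟦ x ⟧ φ b) (⟦ x ⟧ ψ b) (⟦ y ⟧ φ b) (⟦ y ⟧ ψ b))
  ⟦⟧-+ (x ⊗ y) φ ψ b = trans (⟦⟧-cong y (⟦⟧-+ x φ ψ) b) (⟦⟧-+ y (⟦ x ⟧ φ) (⟦ x ⟧ ψ) b)
  ⟦⟧-+ (⊖ x) φ ψ b = trans (cong -_ (⟦⟧-+ x φ ψ b)) (neg-distrib-+ (⟦ x ⟧ φ b) (⟦ x ⟧ ψ b))

  private
    asc-nil : ∀ i b → ¬ Asc i (swapAt i b) ⊎ ¬ Asc i b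
    asc-nil i b with Asc? i b
    ... | no ¬p = inj₂ ¬p
    ... | yes p = inj₁ (Desc⇒¬Asc {i} (subst₂ (λ x y → x + pos 2 ≤ y) (sym (swapAt-prv i b)) (sym (swapAt-at i b)) (lin₁ 0 p (e (b ! i) (b ! prv i)))))
      where
      e : ∀ A B → (B + 1ℤ) - (A - 1ℤ + pos 2) ≡ (B - A) + 0ℤ
      e = solve-∀

    nil-sound : ∀ i φ b → ⟦ gen i ⟧ (⟦ gen i ⟧ φ) b ≡ 0ℤ
    nil-sound i φ b with Asc? i b
    ... | no ¬p = refl
    ... | yes p with asc-nil i b
    ...   | inj₁ ¬q = ⟦gen⟧-¬asc φ ¬q
    ...   | inj₂ ¬q = ⊥-elim (¬q p)

    comm-sound : ∀ i j φ b → ¬ Adjacent k i j → ⟦ gen j ⟧ (⟦ gen i ⟧ φ) b ≡ ⟦ gen i ⟧ (⟦ gen j ⟧ φ) b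
    comm-sound i j φ b ¬adj with i ≟ j
    ... | yes refl = refl
    ... | no i≢j = main
      where
      module I = Apart i≢j ¬adj
      module J = Apart (λ e → i≢j (sym e)) (apart-sym ¬adj)
      iff-i : does (Asc? i (swapAt j b)) ≡ does (Asc? i b)
      iff-i = cong₂ (λ x y → does (x ≤? y)) (I.at-i b) (I.at-pi b)
      iff-j : does (Asc? j (swapAt i b)) ≡ does (Asc? j b)
      iff-j = cong₂ (λ x y → does (x ≤? y)) (J.at-i b) (J.at-pi b)
      main : ⟦ gen j ⟧ (⟦ gen i ⟧ φ) b ≡ ⟦ gen i ⟧ (⟦ gen j ⟧ φ) b
      main rewrite iff-i | iff-j | swapAt-comm i≢j ¬adj b with does (Asc? i b) | does (Asc? j b)
      ... | true | true = refl
      ... | true | false = refl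
      ... | false | true = refl
      ... | false | false = refl

    -- Each side survives exactly when the three values weakly decrease, `B ≤ A` and `C ≤ B`; `both`
    -- is this common description, and the two sides are compared with it separately.
    braid-sound : (2≤k : 2 ℕ.≤ k) → ∀ i φ b →
      ⟦ gen i ⟧ (⟦ gen (nxt i) ⟧ (⟦ gen i ⟧ φ)) b ≡ ⟦ gen (nxt i) ⟧ (⟦ gen i ⟧ (⟦ gen (nxt i) ⟧ φ)) b
    braid-sound 2≤k i φ b = trans left (sym right)
      where
      open Three 2≤k i
      A = b ! prv i
      B = b ! i
      C = b ! j
      T₁ = swapᵢ (the b)
      T₂ = swapⱼ T₁
      S₁ = swapⱼ (the b)
      S₂ = swapᵢ S₁
      both : ℤ
      both = if does (B ≤? A) then (if does (C ≤? B) then φ (swapAt i (swapAt j (swapAt i b))) else 0ℤ) else 0ℤ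
      left : ⟦ gen i ⟧ (⟦ gen j ⟧ (⟦ gen i ⟧ φ)) b ≡ both
      left with B ≤? A | C ≤? B
      ... | no ¬p | _ = refl
      ... | yes p | yes q = trans (⟦gen⟧-asc (⟦ gen i ⟧ φ) (ascⱼ T₁ (lin₂ 1 p q (e₁ A B C)))) (⟦gen⟧-asc φ (ascᵢ T₂ (lin₁ 0 q (e₂ B C))))
        where
        e₁ : ∀ A B C → A + 1ℤ - C ≡ (A - B) + (B - C) + 1ℤ
        e₁ = solve-∀
        e₂ : ∀ B C → B - 1ℤ - (C - 1ℤ) ≡ (B - C) + 0ℤ
        e₂ = solve-∀
      ... | yes p | no ¬q with Asc? j (swapAt i b)
      ...   | no _ = refl
      ...   | yes _ = ⟦gen⟧-¬asc φ (λ r → ¬q (lin₁ 0 (ascᵢ⁻ T₂ r) (e₃ B C)))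
        where
        e₃ : ∀ B C → B - C ≡ (B - 1ℤ - (C - 1ℤ)) + 0ℤ
        e₃ = solve-∀
      right : ⟦ gen j ⟧ (⟦ gen i ⟧ (⟦ gen j ⟧ φ)) b ≡ both
      right with Asc? j b
      ... | no ¬q = sym (trans (cong (λ z → if does (B ≤? A) then z else 0ℤ) zero′) (collapse (does (B ≤? A))))
        where
        collapse : ∀ t → (if t then 0ℤ else 0ℤ) ≡ 0ℤ
        collapse true = refl
        collapse false = refl
        zero′ : (if does (C ≤? B) then φ (swapAt i (swapAt j (swapAt i b))) else 0ℤ) ≡ 0ℤ
        zero′ with C ≤? B
        ... | yes q = ⊥-elim (¬q (ascⱼ (the b) q))
        ... | no _ = refl
      ... | yes q with B ≤? A | C ≤? B
      ...   | _ | no ¬q = ⊥-elim (¬q (ascⱼ⁻ (the b) q))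
      ...   | yes p | yes q′ = trans (⟦gen⟧-asc (⟦ gen j ⟧ φ) (ascᵢ S₁ (lin₂ 1 p q′ (e₄ A B C))))
                               (trans (⟦gen⟧-asc φ (ascⱼ S₂ (lin₁ 0 p (e₅ A B)))) (cong φ (sym (swapAt-braid b))))
        where
        e₄ : ∀ A B C → A - (C - 1ℤ) ≡ (A - B) + (B - C) + 1ℤ
        e₄ = solve-∀
        e₅ : ∀ A B → A + 1ℤ - (B + 1ℤ) ≡ (A - B) + 0ℤ
        e₅ = solve-∀
      ...   | no ¬p | yes q′ with Asc? i (swapAt j b)
      ...     | no _ = refl
      ...     | yes _ = ⟦gen⟧-¬asc φ (λ r → ¬p (lin₁ 0 (ascⱼ⁻ S₂ r) (e₆ A B)))
        where
        e₆ : ∀ A B → A - B ≡ (A + 1ℤ - (B + 1ℤ)) + 0ℤ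
        e₆ = solve-∀

  ⟦⟧-sound : ∀ {x y : 𝔸 k} → x ≈ y → ∀ φ b → ⟦ x ⟧ φ b ≡ ⟦ y ⟧ φ b
  ⟦⟧-sound ≈-refl φ b = refl
  ⟦⟧-sound (≈-sym e) φ b = sym (⟦⟧-sound e φ b)
  ⟦⟧-sound (≈-trans e f) φ b = trans (⟦⟧-sound e φ b) (⟦⟧-sound f φ b)
  ⟦⟧-sound (⊕-cong e f) φ b = cong₂ _+_ (⟦⟧-sound e φ b) (⟦⟧-sound f φ b)
  ⟦⟧-sound (⊗-cong {x} {x′} {y} {y′} e f) φ b = trans (⟦⟧-cong y (⟦⟧-sound e φ) b) (⟦⟧-sound f (⟦ x′ ⟧ φ) b)
  ⟦⟧-sound (⊖-cong e) φ b = cong -_ (⟦⟧-sound e φ b)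
  ⟦⟧-sound (⊕-assoc x y z) φ b = +-assoc (⟦ x ⟧ φ b) (⟦ y ⟧ φ b) (⟦ z ⟧ φ b)
  ⟦⟧-sound (⊕-comm x y) φ b = +-comm (⟦ x ⟧ φ b) (⟦ y ⟧ φ b)
  ⟦⟧-sound (⊕-idˡ x) φ b = +-identityˡ (⟦ x ⟧ φ b)
  ⟦⟧-sound (⊖-invˡ x) φ b = +-inverseˡ (⟦ x ⟧ φ b)
  ⟦⟧-sound (⊗-assoc x y z) φ b = refl
  ⟦⟧-sound (⊗-idˡ x) φ b = refl
  ⟦⟧-sound (⊗-idʳ x) φ b = refl
  ⟦⟧-sound (distribˡ x y z) φ b = refl
  ⟦⟧-sound (distribʳ x y z) φ b = ⟦⟧-+ x (⟦ y ⟧ φ) (⟦ z ⟧ φ) b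
  ⟦⟧-sound (nil i) φ b = nil-sound i φ b
  ⟦⟧-sound (comm i j ¬adj) φ b = comm-sound i j φ b ¬adj
  ⟦⟧-sound (braid 2≤k i) φ b = braid-sound 2≤k i φ b

  run : Word → State → State
  run w b = foldr swapAt b w

  Valid : Word → State → Set
  Valid [] b = ⊤
  Valid (i ∷ w) b = Asc i (run w b) × Valid w b

  valid? : ∀ w b → Dec (Valid w b)
  valid? [] b = yes tt
  valid? (i ∷ w) b = Asc? i (run w b) ×-dec valid? w b

  ⟦uw⟧-valid : ∀ w φ {b} → Valid w b → ⟦ uw w ⟧ φ b ≡ φ (run w b)
  ⟦uw⟧-valid [] φ v = refl
  ⟦uw⟧-valid (i ∷ w) φ (a , v) = trans (⟦uw⟧-valid w _ v) (⟦gen⟧-asc φ a)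

  ⟦uw⟧-¬valid : ∀ w φ {b} → ¬ Valid w b → ⟦ uw w ⟧ φ b ≡ 0ℤ
  ⟦uw⟧-¬valid [] φ ¬v = ⊥-elim (¬v tt)
  ⟦uw⟧-¬valid (i ∷ w) φ {b} ¬v with valid? w b
  ... | no ¬w = ⟦uw⟧-¬valid w _ ¬w
  ... | yes v = trans (⟦uw⟧-valid w _ v) (⟦gen⟧-¬asc φ (λ a → ¬v (a , v)))

  run-++ : ∀ v w b → run (v ++ w) b ≡ run v (run w b)
  run-++ [] w b = refl
  run-++ (i ∷ v) w b = cong (swapAt i) (run-++ v w b)

  valid-++ : ∀ v w {b} → Valid v (run w b) → Valid w b → Valid (v ++ w) b
  valid-++ [] w _ q = q
  valid-++ (i ∷ v) w {b} (a , p) q = subst (Asc i) (sym (run-++ v w b)) a , valid-++ v w p q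

  valid-++ʳ : ∀ v w {b} → Valid (v ++ w) b → Valid w b
  valid-++ʳ [] w p = p
  valid-++ʳ (i ∷ v) w (_ , p) = valid-++ʳ v w p

  valid-++ˡ : ∀ v w {b} → Valid (v ++ w) b → Valid v (run w b)
  valid-++ˡ [] w p = tt
  valid-++ˡ (i ∷ v) w {b} (a , p) = subst (Asc i) (run-++ v w b) a , valid-++ˡ v w p

  -- Reduced words

  infix 4 _≅_
  -- Many words represent 𝟘, so equality in the algebra determines neither the permutation nor the
  -- length of a word. The rewriting steps preserve all three, and they are carried along together.
  record _≅_ (v w : Word) : Set where
    constructor equiv
    field
      alg : uw v ≈ uw w
      same-run : ∀ b → run v b ≡ run w b
      same-length : length v ≡ length w
  open _≅_ public

  ≅-refl : ∀ {w} → w ≅ w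
  ≅-refl = equiv ≈-refl (λ _ → refl) refl

  ≅-sym : ∀ {v w} → v ≅ w → w ≅ v
  ≅-sym (equiv a s l) = equiv (≈-sym a) (λ b → sym (s b)) (sym l)

  ≅-trans : ∀ {v w x} → v ≅ w → w ≅ x → v ≅ x
  ≅-trans (equiv a s l) (equiv a′ s′ l′) = equiv (≈-trans a a′) (λ b → trans (s b) (s′ b)) (trans l l′)

  ≅-∷ : ∀ i {v w} → v ≅ w → i ∷ v ≅ i ∷ w
  ≅-∷ i (equiv a s l) = equiv (⊗-cong ≈-refl a) (λ b → cong (swapAt i) (s b)) (cong suc l)

  ≅-swap : ∀ {i j} w → ¬ Adjacent k i j → i ∷ j ∷ w ≅ j ∷ i ∷ w
  ≅-swap {i} {j} w ¬adj = equiv (comm-⊗ i j _ ¬adj) same refl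
    where
    same : ∀ b → swapAt i (swapAt j (run w b)) ≡ swapAt j (swapAt i (run w b))
    same b with i ≟ j
    ... | yes refl = refl
    ... | no i≢j = sym (swapAt-comm i≢j ¬adj (run w b))

  ≅-braid : 2 ℕ.≤ k → ∀ i w → i ∷ nxt i ∷ i ∷ w ≅ nxt i ∷ i ∷ nxt i ∷ w
  ≅-braid 2≤k i w = equiv (braid-⊗ 2≤k i _) (λ b → Three.swapAt-braid 2≤k i (run w b)) refl

  Asc⇒Desc : ∀ {i b} → Asc i b → Desc i (swapAt i b)
  Asc⇒Desc {i} {b} p = subst₂ (λ x y → x + pos 2 ≤ y) (sym (swapAt-prv i b)) (sym (swapAt-at i b)) (lin₁ 0 p (e (b ! i) (b ! prv i)))
    where
    e : ∀ A B → (B + 1ℤ) - (A - 1ℤ + pos 2) ≡ (B - A) + 0ℤ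
    e = solve-∀

  Desc⇒Asc : ∀ {i b} → Desc i b → Asc i (swapAt i b)
  Desc⇒Asc {i} {b} p = subst₂ _≤_ (sym (swapAt-at i b)) (sym (swapAt-prv i b)) (lin₁ 0 p (e (b ! i) (b ! prv i)))
    where
    e : ∀ A B → (A - 1ℤ) - (B + 1ℤ) ≡ (A - (B + pos 2)) + 0ℤ
    e = solve-∀

  Neut⇒¬Desc : ∀ {i b} → Neut i b → ¬ Desc i b
  Neut⇒¬Desc {i} {b} n d = 1+≤⇒≰ {b ! i} {b ! prv i + 1ℤ} (lin₁ 0 d (e (b ! i) (b ! prv i))) (≤-reflexive n)
    where
    e : ∀ A B → A - (B + 1ℤ + 1ℤ) ≡ (A - (B + pos 2)) + 0ℤ
    e = solve-∀

  k≡1⊎2≤k : k ≡ 1 ⊎ 2 ℕ.≤ k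
  k≡1⊎2≤k with 2 ℕ.≤? k
  ... | yes p = inj₂ p
  ... | no ¬p = inj₁ (ℕₚ.≤-antisym (ℕₚ.≤-pred (ℕₚ.≰⇒> ¬p)) 1≤k)

  two-letters : k ≡ 1 → ∀ {i j} → Adjacent k i j → i ≡ prv j × j ≡ prv i
  two-letters k≡1 {i} (inj₁ refl) = sym (prv-nxt i) , trans (sym (prv-nxt (nxt i))) (cong prv (nxt²≡ k≡1 i))
  two-letters k≡1 {i} {j} (inj₂ refl) = trans (sym (prv-nxt (nxt j))) (cong prv (nxt²≡ k≡1 j)) , sym (prv-nxt j)

  -- After exchanging the two values, the descent at i leaves no descent or tie at the other letter.
  two-letters-⊥ : k ≡ 1 → ∀ {i j b} → Adjacent k i j → Desc i b → ¬ (b ! prv j + 1ℤ ≤ b ! j)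
  two-letters-⊥ k≡1 {i} {j} {b} adj d p with two-letters k≡1 adj
  ... | refl , i≡ = 1+≤⇒≰ {b ! j} {b ! j} (lin₂ 2 (subst (λ z → b ! z + pos 2 ≤ b ! prv j) (sym i≡) d) p (e (b ! prv j) (b ! j))) ≤-refl
    where
    e : ∀ A B → B - (B + 1ℤ) ≡ (A - (B + pos 2)) + (B - (A + 1ℤ)) + pos 2
    e = solve-∀

  run-cancel : ∀ {i v w} → i ∷ v ≅ w → ∀ b → run v b ≡ swapAt i (run w b)
  run-cancel {i} {v} e b = trans (sym (swapAt-involutive i (run v b))) (cong (swapAt i) (same-run e b))

  module _ {b₀ : State} (¬desc₀ : ∀ i → ¬ Desc i b₀) where

    -- The exchange condition. If `i` and `j` are adjacent and `k ≥ 2`, the state after `i ∷ w`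
    -- descends so far that `j` can be pulled out of `w` and then `i` out of the rest, and a braid
    -- brings `j` to the front; for `k = 1` the two descents exclude each other. `m` bounds the
    -- length because the second call is on the word returned by the first, which is not a part of
    -- `w`.
    exchange : ∀ m w → length w ℕ.≤ m → Valid w b₀ → ∀ j → Desc j (run w b₀) →
      ∃ λ d → Valid (j ∷ d) b₀ × j ∷ d ≅ w
    exchange m [] _ _ j d = ⊥-elim (¬desc₀ j d)
    exchange (suc m) (i ∷ w) (ℕ.s≤s l) (a , v) j d with i ≟ j
    ... | yes refl = w , (a , v) , ≅-refl
    ... | no i≢j with adjacent? i j
    ...   | no ¬adj = far (exchange m w l v j
                        (subst₂ (λ x y → x + pos 2 ≤ y) (J.at-pi (run w b₀)) (J.at-i (run w b₀)) d))
      where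
      module I = Apart i≢j ¬adj
      module J = Apart (λ e → i≢j (sym e)) (apart-sym ¬adj)
      far : (∃ λ e → Valid (j ∷ e) b₀ × j ∷ e ≅ w) → ∃ λ d → Valid (j ∷ d) b₀ × j ∷ d ≅ i ∷ w
      far (e , (aj , ve) , eq) = i ∷ e
        , (subst₂ _≤_ (sym (J.at-i (run e b₀))) (sym (J.at-pi (run e b₀))) aj
          , subst₂ _≤_ (trans (cong (_! i) (sym (same-run eq b₀))) (I.at-i (run e b₀)))
                       (trans (cong (_! prv i) (sym (same-run eq b₀))) (I.at-pi (run e b₀))) a
          , ve)
        , ≅-trans (≅-swap e (apart-sym ¬adj)) (≅-∷ i eq)
    ...   | yes adj with k≡1⊎2≤k
    ...     | inj₁ k≡1 = ⊥-elim (two-letters-⊥ k≡1 adj (Asc⇒Desc a) (≤-trans (+-monoʳ-≤ (run (i ∷ w) b₀ ! prv j) (+≤+ {1} {2} (ℕ.s≤s ℕ.z≤n))) d))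
    ...     | inj₂ 2≤k = near adj
      where
      b′ = run w b₀

      upper : j ≡ nxt i → ∃ λ d → Valid (j ∷ d) b₀ × j ∷ d ≅ i ∷ w
      -- With values `A`, `B`, `C` before `i` is applied, its ascent gives `B ≤ A` and the later
      -- descent at `j` gives `A + 3 ≤ C`. So `w` descends at `j`, and once `j` is removed it
      -- descends at `i`, as `A + 2 ≤ C - 1`.
      upper refl = step₁ (exchange m w l v j (descⱼ (the b′) (lin₂ 1 BA AC (e₁ A B C))))
        where
        open Three 2≤k i hiding (j)
        A = b′ ! prv i
        B = b′ ! i
        C = b′ ! nxt i
        BA : B ≤ A
        BA = a
        AC : A + 1ℤ + pos 2 ≤ C
        AC = descⱼ⁻ (swapᵢ (the b′)) d
        e₁ : ∀ A B C → C - (B + pos 2) ≡ (A - B) + (C - (A + 1ℤ + pos 2)) + pos 1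
        e₁ = solve-∀
        e₂ : ∀ A C → C - 1ℤ - (A + pos 2) ≡ (C - (A + 1ℤ + pos 2)) + pos 0
        e₂ = solve-∀
        e₃ : ∀ A B → A + 1ℤ - (B + 1ℤ) ≡ (A - B) + pos 0
        e₃ = solve-∀
        e₄ : ∀ A B C → C - 1ℤ - 1ℤ - (B + 1ℤ - 1ℤ) ≡ (A - B) + (C - (A + 1ℤ + pos 2)) + pos 1
        e₄ = solve-∀
        e₅ : ∀ A C → C - 1ℤ - 1ℤ + 1ℤ - (A + 1ℤ + 1ℤ) ≡ (C - (A + 1ℤ + pos 2)) + pos 0
        e₅ = solve-∀
        step₁ : (∃ λ e → Valid (j ∷ e) b₀ × j ∷ e ≅ w) → ∃ λ d → Valid (j ∷ d) b₀ × j ∷ d ≅ i ∷ w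
        step₁ (e , (aj , ve) , eq) = step₂ (exchange m e
            (ℕₚ.≤-trans (ℕₚ.n≤1+n _) (ℕₚ.≤-trans (ℕₚ.≤-reflexive (same-length eq)) l)) ve i (descᵢ Te (lin₁ 0 AC (e₂ A C))))
          where
          Te : Triple i (run e b₀) A (C - 1ℤ) (B + 1ℤ)
          Te = subst (λ z → Triple i z A (C - 1ℤ) (B + 1ℤ)) (sym (run-cancel eq b₀)) (swapⱼ (the b′))
          step₂ : (∃ λ f → Valid (i ∷ f) b₀ × i ∷ f ≅ e) → ∃ λ d → Valid (j ∷ d) b₀ × j ∷ d ≅ i ∷ w
          step₂ (f , (ai , vf) , eq′) = i ∷ j ∷ f
            , ( ascⱼ (swapᵢ (swapⱼ Tf)) (lin₁ 0 AC (e₅ A C))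
              , ascᵢ (swapⱼ Tf) (lin₂ 1 BA AC (e₄ A B C))
              , ascⱼ Tf (lin₁ 0 BA (e₃ A B)) , vf)
            , ≅-trans (≅-sym (≅-braid 2≤k i f)) (≅-∷ i (≅-trans (≅-∷ j eq′) eq))
            where
            Tf : Triple i (run f b₀) (C - 1ℤ - 1ℤ) (A + 1ℤ) (B + 1ℤ)
            Tf = subst (λ z → Triple i z (C - 1ℤ - 1ℤ) (A + 1ℤ) (B + 1ℤ)) (sym (run-cancel eq′ b₀)) (swapᵢ Te)

      lower : i ≡ nxt j → ∃ λ d → Valid (j ∷ d) b₀ × j ∷ d ≅ i ∷ w
      lower refl = step₁ (exchange m w l v j (descᵢ (the b′) (lin₂ 1 CB AC (e₁ A B C))))
        where
        open Three 2≤k j hiding (j)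
        A = b′ ! prv j
        B = b′ ! j
        C = b′ ! nxt j
        CB : C ≤ B
        CB = ascⱼ⁻ (the b′) a
        AC : A + pos 2 ≤ C - 1ℤ
        AC = descᵢ⁻ (swapⱼ (the b′)) d
        e₁ : ∀ A B C → B - (A + pos 2) ≡ (B - C) + (C - 1ℤ - (A + pos 2)) + pos 1
        e₁ = solve-∀
        e₂ : ∀ A C → C - (A + 1ℤ + pos 2) ≡ (C - 1ℤ - (A + pos 2)) + pos 0
        e₂ = solve-∀
        e₃ : ∀ B C → B - 1ℤ - (C - 1ℤ) ≡ (B - C) + pos 0
        e₃ = solve-∀
        e₄ : ∀ A B C → B - 1ℤ + 1ℤ - (A + 1ℤ + 1ℤ) ≡ (B - C) + (C - 1ℤ - (A + pos 2)) + pos 1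
        e₄ = solve-∀
        e₅ : ∀ A C → C - 1ℤ - 1ℤ - (A + 1ℤ + 1ℤ - 1ℤ) ≡ (C - 1ℤ - (A + pos 2)) + pos 0
        e₅ = solve-∀
        step₁ : (∃ λ e → Valid (j ∷ e) b₀ × j ∷ e ≅ w) → ∃ λ d → Valid (j ∷ d) b₀ × j ∷ d ≅ i ∷ w
        step₁ (e , (aj , ve) , eq) = step₂ (exchange m e
            (ℕₚ.≤-trans (ℕₚ.n≤1+n _) (ℕₚ.≤-trans (ℕₚ.≤-reflexive (same-length eq)) l)) ve i (descⱼ Te (lin₁ 0 AC (e₂ A C))))
          where
          Te : Triple j (run e b₀) (B - 1ℤ) (A + 1ℤ) C
          Te = subst (λ z → Triple j z (B - 1ℤ) (A + 1ℤ) C) (sym (run-cancel eq b₀)) (swapᵢ (the b′))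
          step₂ : (∃ λ f → Valid (i ∷ f) b₀ × i ∷ f ≅ e) → ∃ λ d → Valid (j ∷ d) b₀ × j ∷ d ≅ i ∷ w
          step₂ (f , (ai , vf) , eq′) = i ∷ j ∷ f
            , ( ascᵢ (swapⱼ (swapᵢ Tf)) (lin₁ 0 AC (e₅ A C))
              , ascⱼ (swapᵢ Tf) (lin₂ 1 CB AC (e₄ A B C))
              , ascᵢ Tf (lin₁ 0 CB (e₃ B C)) , vf)
            , ≅-trans (≅-braid 2≤k j f) (≅-∷ i (≅-trans (≅-∷ j eq′) eq))
            where
            Tf : Triple j (run f b₀) (B - 1ℤ) (C - 1ℤ) (A + 1ℤ + 1ℤ)
            Tf = subst (λ z → Triple j z (B - 1ℤ) (C - 1ℤ) (A + 1ℤ + 1ℤ)) (sym (run-cancel eq′ b₀)) (swapⱼ Te)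

      near : Adjacent k i j → ∃ λ d → Valid (j ∷ d) b₀ × j ∷ d ≅ i ∷ w
      near (inj₁ e) = upper e
      near (inj₂ e) = lower e

    ¬asc-desc-zero : ∀ w → Valid w b₀ → ∀ j → Desc j (run w b₀) → uw (j ∷ w) ≈ 𝟘
    ¬asc-desc-zero w v j d with exchange (length w) w ℕₚ.≤-refl v j d
    ... | e , _ , eq = ≈-trans (⊗-cong ≈-refl (≈-sym (alg eq))) (nil-⊗ j (uw e))

    -- The leftmost letter of `v` is a descent of the common end state, so `exchange` moves it to
    -- the front of `w`, where it cancels. An end state on `coreStart` is only a coset of `W_0`, but
    -- valid words represent its minimal element, so they are still determined.
    matsumoto : ∀ v w → Valid v b₀ → Valid w b₀ → run v b₀ ≡ run w b₀ → v ≅ w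
    matsumoto [] [] _ _ _ = ≅-refl
    matsumoto [] (j ∷ w) _ (a , _) eq = ⊥-elim (¬desc₀ j (subst (Desc j) (sym eq) (Asc⇒Desc a)))
    matsumoto (i ∷ v) w (a , pv) pw eq with exchange (length w) w ℕₚ.≤-refl pw i (subst (Desc i) eq (Asc⇒Desc a))
    ... | d , (_ , pd) , e = ≅-trans (≅-∷ i (matsumoto v d pv pd
        (trans (run-cancel (≅-refl {i ∷ v}) b₀) (trans (cong (swapAt i) eq) (sym (run-cancel e b₀)))))) e

    -- As in `matsumoto`, except that `v` starts from an arbitrary state `x`; what is left of `w` is
    -- then a word for `x`. This later splits a word of a core into its first row and a word for the
    -- other rows.
    peel : ∀ v w x → Valid v x → Valid w b₀ → run v x ≡ run w b₀ →
      ∃ λ d → Valid d b₀ × run d b₀ ≡ x × v ++ d ≅ w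
    peel [] w x _ pw eq = w , pw , sym eq , ≅-refl
    peel (i ∷ v) w x (a , pv) pw eq with exchange (length w) w ℕₚ.≤-refl pw i (subst (Desc i) eq (Asc⇒Desc a))
    ... | d , (_ , pd) , e with peel v d x pv pd
            (trans (trans (sym (swapAt-involutive i _)) (cong (swapAt i) eq)) (sym (run-cancel e b₀)))
    ...   | f , pf , r , e′ = f , pf , r , ≅-trans (≅-∷ i e′) e

    -- Deodhar's lemma: if `s_j` fixes the end state of `w`, then `s_j w = w s_l` for a letter `l`
    -- fixing the start. The tie is followed through `w`; at an adjacent letter `i` a braid turns
    -- the tie at `j` into a tie at `i`.
    neutral-move : ∀ m w → length w ℕ.≤ m → Valid w b₀ → ∀ j → Neut j (run w b₀) →
      ∃ λ l → Neut l b₀ × uw (j ∷ w) ≈ uw w ⊗ u l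
    neutral-move m [] _ _ j n = j , n , ≈-trans (⊗-idʳ _) (≈-sym (⊗-idˡ _))
    neutral-move (suc m) (i ∷ w) (ℕ.s≤s l) (a , v) j n with i ≟ j
    ... | yes refl = ⊥-elim (Neut⇒¬Desc n (Asc⇒Desc a))
    ... | no i≢j with adjacent? i j
    ...   | no ¬adj = far (neutral-move m w l v j
                        (trans (sym (J.at-i b′)) (trans n (cong (_+ 1ℤ) (J.at-pi b′)))))
      where
      b′ = run w b₀
      module J = Apart (λ e → i≢j (sym e)) (apart-sym ¬adj)
      far : (∃ λ l → Neut l b₀ × uw (j ∷ w) ≈ uw w ⊗ u l) → ∃ λ l → Neut l b₀ × uw (j ∷ i ∷ w) ≈ uw (i ∷ w) ⊗ u l
      far (l , nl , eq) = l , nl , ≈-trans (comm-⊗ j i _ (apart-sym ¬adj)) (≈-trans (⊗-cong ≈-refl eq) (≈-sym (⊗-assoc _ _ _)))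
    ...   | yes adj with k≡1⊎2≤k
    ...     | inj₁ k≡1 = ⊥-elim (two-letters-⊥ k≡1 adj (Asc⇒Desc a) (≤-reflexive (sym n)))
    ...     | inj₂ 2≤k = near adj
      where
      b′ = run w b₀
      Goal = ∃ λ l → Neut l b₀ × uw (j ∷ i ∷ w) ≈ uw (i ∷ w) ⊗ u l

      finish : ∀ e → j ∷ e ≅ w → (∀ x → u j ⊗ (u i ⊗ (u j ⊗ x)) ≈ u i ⊗ (u j ⊗ (u i ⊗ x))) →
        (∃ λ l → Neut l b₀ × uw (i ∷ e) ≈ uw e ⊗ u l) → Goal
      finish e eq br (l , nl , eq′) = l , nl , (begin
        u j ⊗ (u i ⊗ uw w)               ≈⟨ ⊗-cong ≈-refl (⊗-cong ≈-refl (≈-sym (alg eq))) ⟩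
        u j ⊗ (u i ⊗ (u j ⊗ uw e))       ≈⟨ br (uw e) ⟩
        u i ⊗ (u j ⊗ (u i ⊗ uw e))       ≈⟨ ⊗-cong ≈-refl (⊗-cong ≈-refl eq′) ⟩
        u i ⊗ (u j ⊗ (uw e ⊗ u l))       ≈⟨ ⊗-cong ≈-refl (≈-sym (⊗-assoc _ _ _)) ⟩
        u i ⊗ ((u j ⊗ uw e) ⊗ u l)       ≈⟨ ⊗-cong ≈-refl (⊗-cong (alg eq) ≈-refl) ⟩
        u i ⊗ (uw w ⊗ u l)               ≈⟨ ⊗-assoc _ _ _ ⟨
        (u i ⊗ uw w) ⊗ u l               ∎)
        where open ≈-Reasoning

      shorter : ∀ {e} → j ∷ e ≅ w → length e ℕ.≤ m
      shorter eq = ℕₚ.≤-trans (ℕₚ.n≤1+n _) (ℕₚ.≤-trans (ℕₚ.≤-reflexive (same-length eq)) l)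

      upper : j ≡ nxt i → Goal
      upper refl = step (exchange m w l v j (descⱼ (the b′) (lin₂ 0 a (≤-reflexive (sym C≡)) (e₁ A B C))))
        where
        open Three 2≤k i hiding (j)
        A = b′ ! prv i
        B = b′ ! i
        C = b′ ! nxt i
        C≡ : C ≡ A + 1ℤ + 1ℤ
        C≡ = neutⱼ⁻ (swapᵢ (the b′)) n
        e₁ : ∀ A B C → C - (B + pos 2) ≡ (A - B) + (C - (A + 1ℤ + 1ℤ)) + pos 0
        e₁ = solve-∀
        e₂ : ∀ A → A + 1ℤ + 1ℤ - 1ℤ ≡ A + 1ℤ
        e₂ = solve-∀
        step : (∃ λ e → Valid (j ∷ e) b₀ × j ∷ e ≅ w) → Goal
        step (e , (aj , ve) , eq) = finish e eq (λ x → ≈-sym (braid-⊗ 2≤k i x)) (neutral-move m e (shorter eq) ve i (neutᵢ Te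
            (trans (cong (_- 1ℤ) C≡) (e₂ A))))
          where
          Te : Triple i (run e b₀) A (C - 1ℤ) (B + 1ℤ)
          Te = subst (λ z → Triple i z A (C - 1ℤ) (B + 1ℤ)) (sym (run-cancel eq b₀)) (swapⱼ (the b′))

      lower : i ≡ nxt j → Goal
      lower refl = step (exchange m w l v j (descᵢ (the b′) (lin₂ 0 (ascⱼ⁻ (the b′) a) (≤-reflexive (sym C≡)) (e₁ A B C))))
        where
        open Three 2≤k j hiding (j)
        A = b′ ! prv j
        B = b′ ! j
        C = b′ ! nxt j
        C≡ : C - 1ℤ ≡ A + 1ℤ
        C≡ = neutᵢ⁻ (swapⱼ (the b′)) n
        e₁ : ∀ A B C → B - (A + pos 2) ≡ (B - C) + (C - 1ℤ - (A + 1ℤ)) + pos 0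
        e₁ = solve-∀
        e₂ : ∀ C → C ≡ C - 1ℤ + 1ℤ
        e₂ = solve-∀
        step : (∃ λ e → Valid (j ∷ e) b₀ × j ∷ e ≅ w) → Goal
        step (e , (aj , ve) , eq) = finish e eq (braid-⊗ 2≤k j) (neutral-move m e (shorter eq) ve i (neutⱼ Te
            (trans (e₂ C) (cong (_+ 1ℤ) C≡))))
          where
          Te : Triple j (run e b₀) (B - 1ℤ) (A + 1ℤ) C
          Te = subst (λ z → Triple j z (B - 1ℤ) (A + 1ℤ) C) (sym (run-cancel eq b₀)) (swapᵢ (the b′))

      near : Adjacent k i j → Goal
      near (inj₁ e) = upper e
      near (inj₂ e) = lower e

  -- Linear combinations of words and their cancellation

  SignedWord : Set
  SignedWord = Bool × Word

  -- An arbitrary abelian group, because the same cancellation is carried out for elements of the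
  -- algebra and for integer values of functions.
  module Total {c ℓ} (G : AbelianGroup c ℓ) where
    open AbelianGroup G using (Carrier; _∙_; ε; _⁻¹; assoc; identityˡ; identityʳ; ∙-cong; inverseˡ; inverseʳ) renaming (comm to ∙-comm; setoid to ≋-setoid; _≈_ to _≋_; refl to ≋-refl; sym to ≋-sym; trans to ≋-trans; ⁻¹-cong to inv-cong)

    sign : Bool → Carrier → Carrier
    sign true  a = a
    sign false a = a ⁻¹

    ±-cong : ∀ s {a b} → a ≋ b → sign s a ≋ sign s b
    ±-cong true  e = e
    ±-cong false e = inv-cong e

    ±-cancel : ∀ s {a b} → a ≋ b → sign s a ∙ sign (not s) b ≋ ε
    ±-cancel true  e = ≋-trans (∙-cong e ≋-refl) (inverseʳ _)
    ±-cancel false e = ≋-trans (∙-cong (inv-cong e) ≋-refl) (inverseˡ _)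

    ±-ε : ∀ s {a} → a ≋ ε → sign s a ≋ ε
    ±-ε true e = e
    ±-ε false e = ≋-trans (inv-cong e) (≋-trans (≋-sym (identityˡ _)) (inverseʳ ε))

    total : (Word → Carrier) → List SignedWord → Carrier
    total F [] = ε
    total F ((s , w) ∷ ts) = sign s (F w) ∙ total F ts

    total-pull : ∀ F ts₁ s w ts₂ → total F (ts₁ ++ (s , w) ∷ ts₂) ≋ sign s (F w) ∙ total F (ts₁ ++ ts₂)
    total-pull F [] s w ts₂ = ≋-refl
    total-pull F ((s′ , w′) ∷ ts₁) s w ts₂ = begin
      sign s′ (F w′) ∙ total F (ts₁ ++ (s , w) ∷ ts₂)     ≈⟨ ∙-cong ≋-refl (total-pull F ts₁ s w ts₂) ⟩
      sign s′ (F w′) ∙ (sign s (F w) ∙ total F (ts₁ ++ ts₂)) ≈⟨ assoc _ _ _ ⟨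
      (sign s′ (F w′) ∙ sign s (F w)) ∙ total F (ts₁ ++ ts₂) ≈⟨ ∙-cong (∙-comm _ _) ≋-refl ⟩
      (sign s (F w) ∙ sign s′ (F w′)) ∙ total F (ts₁ ++ ts₂) ≈⟨ assoc _ _ _ ⟩
      sign s (F w) ∙ (sign s′ (F w′) ∙ total F (ts₁ ++ ts₂)) ∎
      where open SetoidReasoning ≋-setoid

    total-cancel : ∀ F s w w′ ts₁ ts₂ → F w ≋ F w′ →
      total F ((s , w) ∷ ts₁ ++ (not s , w′) ∷ ts₂) ≋ total F (ts₁ ++ ts₂)
    total-cancel F s w w′ ts₁ ts₂ e = begin
      sign s (F w) ∙ total F (ts₁ ++ (not s , w′) ∷ ts₂) ≈⟨ ∙-cong ≋-refl (total-pull F ts₁ (not s) w′ ts₂) ⟩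
      sign s (F w) ∙ (sign (not s) (F w′) ∙ total F (ts₁ ++ ts₂)) ≈⟨ assoc _ _ _ ⟨
      (sign s (F w) ∙ sign (not s) (F w′)) ∙ total F (ts₁ ++ ts₂) ≈⟨ ∙-cong (±-cancel s e) ≋-refl ⟩
      ε ∙ total F (ts₁ ++ ts₂) ≈⟨ identityˡ _ ⟩
      total F (ts₁ ++ ts₂) ∎
      where open SetoidReasoning ≋-setoid

  open Total +-0-abelianGroup using () renaming (total to totalℤ; sign to signℤ; total-cancel to totalℤ-cancel) public
  open Total (Ring.+-abelianGroup 𝔸-ring) using () renaming (total to total𝔸; sign to sign𝔸) public

  _≟ₛ_ : (a b : Maybe State) → Dec (a ≡ b)
  _≟ₛ_ = Maybeₚ.≡-dec (Vecₚ.≡-dec Data.Integer._≟_)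

  nothing-≢ : ∀ {b : State} {m} → m ≡ nothing → ¬ m ≡ just b
  nothing-≢ refl ()

  module _ (key : Word → Maybe State) where

    indicator : State → Word → ℤ
    indicator b w = if does (key w ≟ₛ just b) then 1ℤ else 0ℤ

    indicator-≡ : ∀ {b w} → key w ≡ just b → indicator b w ≡ 1ℤ
    indicator-≡ {b} {w} e with key w ≟ₛ just b
    ... | yes _ = refl
    ... | no ¬e = ⊥-elim (¬e e)

    indicator-≢ : ∀ {b w} → ¬ key w ≡ just b → indicator b w ≡ 0ℤ
    indicator-≢ {b} {w} ¬e with key w ≟ₛ just b
    ... | yes e = ⊥-elim (¬e e)
    ... | no _ = refl

    indicator-cong : ∀ b {v w} → key v ≡ key w → indicator b v ≡ indicator b w
    indicator-cong b e = cong (λ z → if does (z ≟ₛ just b) then 1ℤ else 0ℤ) e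

    Opposite : Bool → State → List SignedWord → Set
    Opposite s b ts = ∃ λ ts₁ → ∃ λ w → ∃ λ ts₂ → ts ≡ ts₁ ++ (not s , w) ∷ ts₂ × key w ≡ just b

    sign-+ : ∀ s a b → signℤ s (a + b) ≡ signℤ s a + signℤ s b
    sign-+ true a b = refl
    sign-+ false a b = neg-distrib-+ a b

    sign-sign : ∀ s a → signℤ s (signℤ s a) ≡ a
    sign-sign true a = refl
    sign-sign false a = neg-involutive a

    -- Without a term of key `b` and the sign opposite to `s`, all contributions to the count of `b`
    -- have sign `s` and cannot cancel.
    find-opposite : ∀ s b ts → Opposite s b ts ⊎ 0ℤ ≤ signℤ s (totalℤ (indicator b) ts)
    find-opposite true b [] = inj₂ ≤-refl
    find-opposite false b [] = inj₂ ≤-refl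
    find-opposite s b ((s′ , w) ∷ ts) with find-opposite s b ts
    ... | inj₁ (ts₁ , w′ , ts₂ , refl , e) = inj₁ ((s′ , w) ∷ ts₁ , w′ , ts₂ , refl , e)
    ... | inj₂ nonneg with key w ≟ₛ just b
    ...   | no ¬e = inj₂ (≤-trans nonneg (≤-reflexive (cong (signℤ s) (sym (drop s′)))))
      where
      drop : ∀ s′ → signℤ s′ 0ℤ + totalℤ (indicator b) ts ≡ totalℤ (indicator b) ts
      drop true = +-identityˡ _
      drop false = +-identityˡ _
    ...   | yes e with s | s′
    ...     | true | false = inj₁ ([] , w , ts , refl , e)
    ...     | false | true = inj₁ ([] , w , ts , refl , e)
    ...     | true | true = inj₂ (+-mono-≤ {0ℤ} {1ℤ} (+≤+ ℕ.z≤n) nonneg)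
    ...     | false | false = inj₂ (≤-trans (+-mono-≤ {0ℤ} {1ℤ} (+≤+ ℕ.z≤n) nonneg)
                  (≤-reflexive (sym (neg-distrib-+ (- 1ℤ) (totalℤ (indicator b) ts)))))

    module _ {c ℓ} (G : AbelianGroup c ℓ) where
      open Total G
      open AbelianGroup G using (Carrier; ε; identityˡ; ∙-cong) renaming (_≈_ to _≋_; refl to ≋-refl; sym to ≋-sym; trans to ≋-trans)

      -- The first term contributes to the count of its key; since that count is 0, a term of the
      -- same key and opposite sign exists, and the pair is removed. Terms with key `nothing` are
      -- dropped. `Good` restricts the counts that have to be known to a class containing all keys
      -- that occur.
      total≋ε : (F : Word → Carrier) → (∀ w → key w ≡ nothing → F w ≋ ε) → (∀ v w → key v ≡ key w → F v ≋ F w) →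
        (Good : State → Set) → ∀ m ts → length ts ℕ.≤ m →
        All (λ t → ∀ b → key (proj₂ t) ≡ just b → Good b) ts →
        (∀ b → Good b → totalℤ (indicator b) ts ≡ 0ℤ) → total F ts ≋ ε
      total≋ε F F-nothing F-key Good m [] _ _ _ = ≋-refl
      total≋ε F F-nothing F-key Good (suc m) ((s , w) ∷ ts) (ℕ.s≤s l) (g ∷ gs) coeff = by-key (key w) refl
        where
        by-key : ∀ κ → key w ≡ κ → total F ((s , w) ∷ ts) ≋ ε
        by-key nothing eq = ≋-trans (∙-cong (±-ε s (F-nothing w eq)) ≋-refl) (≋-trans (identityˡ _)
              (total≋ε F F-nothing F-key Good m ts l gs (λ b gb → trans (sym (drop s)) (coeff b gb))))
          where
          drop : ∀ s {b} → signℤ s (indicator b w) + totalℤ (indicator b) ts ≡ totalℤ (indicator b) ts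
          drop s {b} rewrite indicator-≢ {b} {w} (nothing-≢ eq) with s
          ... | true = +-identityˡ _
          ... | false = +-identityˡ _
        by-key (just b₁) eq with find-opposite s b₁ ts
        ... | inj₂ nonneg = ⊥-elim (1+≤⇒≰ {1ℤ} {0ℤ} ≤-refl (≤-trans
                (≤-trans (≤-reflexive (sym (+-identityʳ 1ℤ))) (+-monoʳ-≤ 1ℤ nonneg)) (≤-reflexive one+)))
          where
          one+ : 1ℤ + signℤ s (totalℤ (indicator b₁) ts) ≡ 0ℤ
          one+ = begin
            1ℤ + signℤ s (totalℤ (indicator b₁) ts) ≡⟨ cong (_+ signℤ s (totalℤ (indicator b₁) ts)) (sign-sign s 1ℤ) ⟨
            signℤ s (signℤ s 1ℤ) + signℤ s (totalℤ (indicator b₁) ts) ≡⟨ sign-+ s _ _ ⟨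
            signℤ s (signℤ s 1ℤ + totalℤ (indicator b₁) ts) ≡⟨ cong (λ z → signℤ s (signℤ s z + totalℤ (indicator b₁) ts)) (indicator-≡ {b₁} {w} eq) ⟨
            signℤ s (signℤ s (indicator b₁ w) + totalℤ (indicator b₁) ts) ≡⟨ cong (signℤ s) (coeff b₁ (g b₁ eq)) ⟩
            signℤ s 0ℤ ≡⟨ zero-sign s ⟩
            0ℤ ∎
            where
            open ≡-Reasoning
            zero-sign : ∀ s → signℤ s 0ℤ ≡ 0ℤ
            zero-sign true = refl
            zero-sign false = refl
        ... | inj₁ (ts₁ , w′ , ts₂ , refl , e) = ≋-trans (total-cancel F s w w′ ts₁ ts₂ (F-key w w′ (trans eq (sym e))))
                (total≋ε F F-nothing F-key Good m (ts₁ ++ ts₂) shorter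
                  (Allₚ.++⁺ (Allₚ.++⁻ˡ ts₁ gs) (All.tail (Allₚ.++⁻ʳ ts₁ gs)))
                  (λ b gb → trans (sym (totalℤ-cancel (indicator b) s w w′ ts₁ ts₂ (indicator-cong b (trans eq (sym e))))) (coeff b gb)))
          where
          shorter : length (ts₁ ++ ts₂) ℕ.≤ m
          shorter = ℕₚ.≤-trans (ℕₚ.≤-trans (ℕₚ.≤-reflexive (length-++ ts₁)) (ℕₚ.+-monoʳ-≤ (length ts₁) (ℕₚ.n≤1+n _)))
            (ℕₚ.≤-trans (ℕₚ.≤-reflexive (sym (length-++ ts₁))) l)

  flipAll : List SignedWord → List SignedWord
  flipAll = map (λ (s , w) → not s , w)

  times : SignedWord → List SignedWord → List SignedWord
  times (s , v) = map (λ (s′ , w) → (if s then s′ else not s′) , v ++ w)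

  timesAll : List SignedWord → List SignedWord → List SignedWord
  timesAll [] us = []
  timesAll (t ∷ ts) us = times t us ++ timesAll ts us

  expand : 𝔸 k → List SignedWord
  expand (gen i) = (true , i ∷ []) ∷ []
  expand 𝟘 = []
  expand 𝟙 = (true , []) ∷ []
  expand (x ⊕ y) = expand x ++ expand y
  expand (x ⊗ y) = timesAll (expand x) (expand y)
  expand (⊖ x) = flipAll (expand x)

  open import Algebra.Properties.Ring 𝔸-ring using (-‿distribˡ-*; -‿distribʳ-*; -‿+-comm; -‿involutive; -0#≈0#)

  total𝔸-++ : ∀ ts us → total𝔸 uw (ts ++ us) ≈ total𝔸 uw ts ⊕ total𝔸 uw us
  total𝔸-++ [] us = ≈-sym (⊕-idˡ _)
  total𝔸-++ (t ∷ ts) us = ≈-trans (⊕-cong ≈-refl (total𝔸-++ ts us)) (≈-sym (⊕-assoc _ _ _))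

  sign-not : ∀ s x → sign𝔸 (not s) x ≈ ⊖ sign𝔸 s x
  sign-not true x = ≈-refl
  sign-not false x = ≈-sym (-‿involutive x)

  total𝔸-flip : ∀ ts → total𝔸 uw (flipAll ts) ≈ ⊖ total𝔸 uw ts
  total𝔸-flip [] = ≈-sym -0#≈0#
  total𝔸-flip ((s , w) ∷ ts) = ≈-trans (⊕-cong (sign-not s (uw w)) (total𝔸-flip ts)) (-‿+-comm _ _)

  sign-times : ∀ s s′ x y → sign𝔸 (if s then s′ else not s′) (x ⊗ y) ≈ sign𝔸 s x ⊗ sign𝔸 s′ y
  sign-times true true x y = ≈-refl
  sign-times true false x y = -‿distribʳ-* x y
  sign-times false true x y = -‿distribˡ-* x y
  sign-times false false x y = ≈-trans (≈-sym (-‿involutive _)) (≈-trans (⊖-cong (-‿distribˡ-* x y)) (-‿distribʳ-* (⊖ x) y))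

  sign-cong𝔸 : ∀ s {x y} → x ≈ y → sign𝔸 s x ≈ sign𝔸 s y
  sign-cong𝔸 = Total.±-cong (Ring.+-abelianGroup 𝔸-ring)

  total𝔸-times : ∀ s v us → total𝔸 uw (times (s , v) us) ≈ sign𝔸 s (uw v) ⊗ total𝔸 uw us
  total𝔸-times s v [] = ≈-sym (⊗-zeroʳ _)
  total𝔸-times s v ((s′ , w) ∷ us) = ≈-trans
    (⊕-cong (≈-trans (sign-cong𝔸 (if s then s′ else not s′) (uw-++ v w)) (sign-times s s′ (uw v) (uw w))) (total𝔸-times s v us))
    (≈-sym (distribˡ _ _ _))

  total𝔸-timesAll : ∀ ts us → total𝔸 uw (timesAll ts us) ≈ total𝔸 uw ts ⊗ total𝔸 uw us
  total𝔸-timesAll [] us = ≈-sym (⊗-zeroˡ _)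
  total𝔸-timesAll ((s , v) ∷ ts) us = ≈-trans (total𝔸-++ (times (s , v) us) _)
    (≈-trans (⊕-cong (total𝔸-times s v us) (total𝔸-timesAll ts us)) (≈-sym (distribʳ _ _ _)))

  expand-correct : ∀ x → x ≈ total𝔸 uw (expand x)
  expand-correct (gen i) = ≈-sym (≈-trans (⊕-idʳ _) (⊗-idʳ _))
  expand-correct 𝟘 = ≈-refl
  expand-correct 𝟙 = ≈-sym (⊕-idʳ 𝟙)
  expand-correct (x ⊕ y) = ≈-trans (⊕-cong (expand-correct x) (expand-correct y)) (≈-sym (total𝔸-++ (expand x) (expand y)))
  expand-correct (x ⊗ y) = ≈-trans (⊗-cong (expand-correct x) (expand-correct y)) (≈-sym (total𝔸-timesAll (expand x) (expand y)))
  expand-correct (⊖ x) = ≈-trans (⊖-cong (expand-correct x)) (≈-sym (total𝔸-flip (expand x)))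

  ⟦total⟧ : ∀ ts φ b → ⟦ total𝔸 uw ts ⟧ φ b ≡ totalℤ (λ w → ⟦ uw w ⟧ φ b) ts
  ⟦total⟧ [] φ b = refl
  ⟦total⟧ ((true , w) ∷ ts) φ b = cong (⟦ uw w ⟧ φ b +_) (⟦total⟧ ts φ b)
  ⟦total⟧ ((false , w) ∷ ts) φ b = cong (- ⟦ uw w ⟧ φ b +_) (⟦total⟧ ts φ b)

  ⟦⟧-expand : ∀ x φ b → ⟦ x ⟧ φ b ≡ totalℤ (λ w → ⟦ uw w ⟧ φ b) (expand x)
  ⟦⟧-expand x φ b = trans (⟦⟧-sound (expand-correct x) φ b) (⟦total⟧ (expand x) φ b)

  totalℤ-cong : ∀ {F F′ : Word → ℤ} → (∀ w → F w ≡ F′ w) → ∀ ts → totalℤ F ts ≡ totalℤ F′ ts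
  totalℤ-cong e [] = refl
  totalℤ-cong e ((s , w) ∷ ts) = cong₂ _+_ (cong (signℤ s) (e w)) (totalℤ-cong e ts)

  -- Congruences modulo n, core states and regular states

  N : ℤ
  N = pos (suc k)

  infix 4 _≡ₙ_
  record _≡ₙ_ (a b : ℤ) : Set where
    constructor modulo
    field
      quotient : ℤ
      equation : a ≡ b + quotient * N

  ≡ₙ-reflexive : ∀ {a b} → a ≡ b → a ≡ₙ b
  ≡ₙ-reflexive {a} refl = modulo 0ℤ (sym (+-identityʳ a))

  ≡ₙ-sym : ∀ {a b} → a ≡ₙ b → b ≡ₙ a
  ≡ₙ-sym {a} {b} (modulo q refl) = modulo (- q) (e b q N)
    where
    e : ∀ b q N → b ≡ b + q * N + - q * N
    e = solve-∀

  ≡ₙ-trans : ∀ {a b c} → a ≡ₙ b → b ≡ₙ c → a ≡ₙ c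
  ≡ₙ-trans {c = c} (modulo q refl) (modulo q′ refl) = modulo (q′ + q) (e c q q′ N)
    where
    e : ∀ c q q′ N → c + q′ * N + q * N ≡ c + (q′ + q) * N
    e = solve-∀

  ≡ₙ-+ : ∀ {a b} c → a ≡ₙ b → a + c ≡ₙ b + c
  ≡ₙ-+ {b = b} c (modulo q refl) = modulo q (e b c (q * N))
    where
    e : ∀ b c r → b + r + c ≡ b + c + r
    e = solve-∀

  private
    pos-nonneg : ∀ m → 0ℤ ≤ pos m
    pos-nonneg m = +≤+ ℕ.z≤n

    N≤sucN : ∀ m → N ≤ pos (suc m) * N
    N≤sucN m = ≤-trans (+≤+ (ℕₚ.m≤m+n (suc k) (m ℕ.* suc k))) (≤-reflexive (pos-* (suc m) (suc k)))

  -- Turns a strict inequality between beads of one runner into a distance of `n`.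
  ≡ₙ-gap : ∀ {a c} → a ≡ₙ c → a + 1ℤ ≤ c → a + N ≤ c
  ≡ₙ-gap {a} {c} (modulo (pos m) refl) a<c = ⊥-elim (1+≤⇒≰ a<c (≤-trans (≤-reflexive (sym (+-identityʳ c)))
    (+-monoʳ-≤ c (≤-trans (pos-nonneg (m ℕ.* suc k)) (≤-reflexive (pos-* m (suc k)))))))
  ≡ₙ-gap {a} {c} (modulo -[1+ m ] refl) _ = lin₁ 0 (N≤sucN m) (e c (pos (suc m)) N)
    where
    e : ∀ c q N → c - (c + - q * N + N) ≡ (q * N - N) + pos 0
    e = solve-∀

  ≡ₙ-close : ∀ {a c} → a ≡ₙ c → a + 1ℤ ≤ c + N → c + 1ℤ ≤ a + N → a ≡ c
  ≡ₙ-close {a} {c} e p q with <-cmp a c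
  ... | tri≈ _ a≡c _ = a≡c
  ... | tri< a<c _ _ = ⊥-elim (1+≤⇒≰ q (≡ₙ-gap e (≤-trans (≤-reflexive (+-comm a 1ℤ)) (i<j⇒suc[i]≤j a<c))))
  ... | tri> _ _ c<a = ⊥-elim (1+≤⇒≰ p (≡ₙ-gap (≡ₙ-sym e) (≤-trans (≤-reflexive (+-comm c 1ℤ)) (i<j⇒suc[i]≤j c<a))))

  posF : Letter → ℤ
  posF x = pos (toℕ x)

  posF-+1≤N : ∀ x → posF x + 1ℤ ≤ N
  posF-+1≤N x = +≤+ (ℕₚ.≤-trans (ℕₚ.≤-reflexive (ℕₚ.+-comm (toℕ x) 1)) (toℕ<n x))

  posF-injectiveₙ : ∀ {x y} → posF x ≡ₙ posF y → x ≡ y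
  posF-injectiveₙ {x} {y} e = toℕ-injective (+-injective (≡ₙ-close e (bound x y) (bound y x)))
    where
    bound : ∀ x y → posF x + 1ℤ ≤ posF y + N
    bound x y = ≤-trans (posF-+1≤N x) (≤-trans (≤-reflexive (sym (+-identityˡ N))) (+-monoˡ-≤ N (pos-nonneg (toℕ y))))

  posF-+ₘ : ∀ x t → posF (x +ₘ t) ≡ₙ posF x + pos t
  posF-+ₘ x t = ≡ₙ-sym (modulo (pos (s DivMod./ suc k)) (begin
    posF x + pos t ≡⟨ pos-+ (toℕ x) t ⟨
    pos s ≡⟨ cong pos (DivMod.m≡m%n+[m/n]*n s (suc k)) ⟩
    pos (s DivMod.% suc k ℕ.+ s DivMod./ suc k ℕ.* suc k) ≡⟨ pos-+ (s DivMod.% suc k) _ ⟩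
    pos (s DivMod.% suc k) + pos (s DivMod./ suc k ℕ.* suc k) ≡⟨ cong₂ _+_ (cong pos (sym (toℕ-+ₘ x t))) (pos-* (s DivMod./ suc k) (suc k)) ⟩
    posF (x +ₘ t) + pos (s DivMod./ suc k) * N ∎))
    where
    open ≡-Reasoning
    s = toℕ x ℕ.+ t

  posF-prv : ∀ i → posF (prv i) + 1ℤ ≡ₙ posF i
  posF-prv i = ≡ₙ-trans (≡ₙ-sym (posF-+ₘ (prv i) 1)) (≡ₙ-reflexive (cong posF (nxt-prv i)))

  toℕ-prv-suc : ∀ {i : Letter} {m} → toℕ i ≡ suc m → toℕ (prv i) ≡ m
  toℕ-prv-suc {i} {m} e = trans (toℕ-+ₘ i k) (trans (cong (λ z → (z ℕ.+ k) DivMod.% suc k) e)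
    (trans (cong (DivMod._% suc k) (sym (ℕₚ.+-suc m k))) (trans (DivMod.[m+n]%n≡m%n m (suc k))
    (DivMod.m<n⇒m%n≡m (ℕₚ.<-trans (ℕₚ.≤-reflexive (sym e)) (toℕ<n i))))))

  -- In the empty core all positions up to `k` are filled, so the last bead of runner `x` is `x`
  -- itself. The zero vector is the displacement of the identity of `W`.
  coreStart zeroState : State
  coreStart = fromFun posF
  zeroState = fromFun (λ _ → 0ℤ)

  coreStart-¬Desc : ∀ i → ¬ Desc i coreStart
  coreStart-¬Desc i d = by-value (toℕ i) refl
    where
    d′ : toℕ (prv i) ℕ.+ 2 ℕ.≤ toℕ i
    d′ = drop‿+≤+ (subst₂ (λ x y → x + pos 2 ≤ y) (fromFun-! posF (prv i)) (fromFun-! posF i) d)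
    by-value : ∀ m → toℕ i ≡ m → ⊥
    by-value zero e with () ← ℕₚ.≤-trans (ℕₚ.m≤n+m 2 (toℕ (prv i))) (ℕₚ.≤-trans d′ (ℕₚ.≤-reflexive e))
    by-value (suc m) e = ℕₚ.1+n≰n (ℕₚ.≤-trans (ℕₚ.≤-reflexive (ℕₚ.+-comm 2 m))
      (ℕₚ.≤-trans (ℕₚ.≤-reflexive (cong (ℕ._+ 2) (sym (toℕ-prv-suc {i} e)))) (ℕₚ.≤-trans d′ (ℕₚ.≤-reflexive e))))

  zeroState-¬Desc : ∀ i → ¬ Desc i zeroState
  zeroState-¬Desc i d rewrite fromFun-! (λ _ → 0ℤ) i | fromFun-! (λ _ → 0ℤ) (prv i) with d
  ... | +≤+ ()

  IsCore : State → Set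
  IsCore b = ∀ x → b ! x ≡ₙ posF x

  -- The residue of x - b(x) is the position, modulo n, that the affine permutation with displacements b sends to x.
  IsRegular : State → Set
  IsRegular b = ∀ x y → posF x - b ! x ≡ₙ posF y - b ! y → x ≡ y

  coreStart-IsCore : IsCore coreStart
  coreStart-IsCore x = ≡ₙ-reflexive (fromFun-! posF x)

  zeroState-IsRegular : IsRegular zeroState
  zeroState-IsRegular x y e = posF-injectiveₙ (subst₂ _≡ₙ_ (e₀ x) (e₀ y) e)
    where
    e₀ : ∀ x → posF x - zeroState ! x ≡ posF x
    e₀ x = trans (cong (λ z → posF x - z) (fromFun-! (λ _ → 0ℤ) x)) (+-identityʳ (posF x))

  swapAt-IsCore : ∀ i {b} → IsCore b → IsCore (swapAt i b)
  swapAt-IsCore i {b} c x with x ≟ i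
  ... | yes refl = ≡ₙ-trans (≡ₙ-reflexive (swapAt-at x b)) (≡ₙ-trans (≡ₙ-+ 1ℤ (c (prv x))) (posF-prv x))
  ... | no x≢i with x ≟ prv i
  ...   | yes refl = ≡ₙ-trans (≡ₙ-reflexive (swapAt-prv i b)) (≡ₙ-trans (≡ₙ-+ (- 1ℤ) (≡ₙ-trans (c i) (≡ₙ-sym (posF-prv i))))
                       (≡ₙ-reflexive (e (posF (prv i)))))
    where
    e : ∀ a → a + 1ℤ - 1ℤ ≡ a
    e = solve-∀
  ...   | no x≢p = ≡ₙ-trans (≡ₙ-reflexive (swapAt-other i b x≢i x≢p)) (c x)

  run-IsCore : ∀ w {b} → IsCore b → IsCore (run w b)
  run-IsCore [] c = c
  run-IsCore (i ∷ w) c = swapAt-IsCore i (run-IsCore w c)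

  transposed : Letter → Letter → Letter
  transposed i x with x ≟ i
  ... | yes _ = prv i
  ... | no _ with x ≟ prv i
  ...   | yes _ = i
  ...   | no _ = x

  transposed-injective : ∀ i x y → transposed i x ≡ transposed i y → x ≡ y
  transposed-injective i x y e with x ≟ i | y ≟ i
  ... | yes refl | yes refl = refl
  ... | yes refl | no y≢i with y ≟ prv x
  ...   | yes refl = ⊥-elim (prv≢ 1≤k x e)
  ...   | no y≢p = ⊥-elim (y≢p (sym e))
  transposed-injective i x y e | no x≢i | yes refl with x ≟ prv y
  ...   | yes refl = ⊥-elim (prv≢ 1≤k y (sym e))
  ...   | no x≢p = ⊥-elim (x≢p e)
  transposed-injective i x y e | no x≢i | no y≢i with x ≟ prv i | y ≟ prv i
  ...   | yes refl | yes refl = refl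
  ...   | yes refl | no _ = ⊥-elim (y≢i (sym e))
  ...   | no _ | yes refl = ⊥-elim (x≢i e)
  ...   | no _ | no _ = e

  position-swapAt : ∀ i b x → posF x - swapAt i b ! x ≡ₙ posF (transposed i x) - b ! transposed i x
  position-swapAt i b x with x ≟ i
  ... | yes refl = ≡ₙ-trans (≡ₙ-reflexive (trans (cong (λ z → posF x - z) (swapAt-at x b)) (e₁ (posF x) (b ! prv x))))
      (≡ₙ-trans (≡ₙ-+ (- (b ! prv x) - 1ℤ) (≡ₙ-sym (posF-prv x))) (≡ₙ-reflexive (e₂ (posF (prv x)) (b ! prv x))))
    where
    e₁ : ∀ X A → X - (A + 1ℤ) ≡ X + (- A - 1ℤ)
    e₁ = solve-∀
    e₂ : ∀ P A → P + 1ℤ + (- A - 1ℤ) ≡ P - A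
    e₂ = solve-∀
  ... | no x≢i with x ≟ prv i
  ...   | yes refl = ≡ₙ-trans (≡ₙ-reflexive (trans (cong (λ z → posF (prv i) - z) (swapAt-prv i b)) (e₁ (posF (prv i)) (b ! i))))
      (≡ₙ-+ (- (b ! i)) (posF-prv i))
    where
    e₁ : ∀ P B → P - (B - 1ℤ) ≡ P + 1ℤ + - B
    e₁ = solve-∀
  ...   | no x≢p = ≡ₙ-reflexive (cong (λ z → posF x - z) (swapAt-other i b x≢i x≢p))

  swapAt-IsRegular : ∀ i {b} → IsRegular b → IsRegular (swapAt i b)
  swapAt-IsRegular i {b} r x y e = transposed-injective i x y (r _ _
    (≡ₙ-trans (≡ₙ-sym (position-swapAt i b x)) (≡ₙ-trans e (position-swapAt i b y))))

  run-IsRegular : ∀ w {b} → IsRegular b → IsRegular (run w b)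
  run-IsRegular [] r = r
  run-IsRegular (i ∷ w) r = swapAt-IsRegular i (run-IsRegular w r)

  -- A tie would send `i` and `prv i` to the same position modulo `n`. So on the regular orbit a
  -- letter that does not ascend descends, and the word vanishes in the algebra.
  IsRegular⇒¬Neut : ∀ {i b} → IsRegular b → ¬ Neut i b
  IsRegular⇒¬Neut {i} {b} r n = prv≢ 1≤k i (sym (r i (prv i)
    (≡ₙ-trans (≡ₙ-reflexive (trans (cong (λ z → posF i - z) n) (e₁ (posF i) (b ! prv i))))
      (≡ₙ-trans (≡ₙ-+ (- (b ! prv i) - 1ℤ) (≡ₙ-sym (posF-prv i))) (≡ₙ-reflexive (e₂ (posF (prv i)) (b ! prv i)))))))
    where
    e₁ : ∀ X A → X - (A + 1ℤ) ≡ X + (- A - 1ℤ)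
    e₁ = solve-∀
    e₂ : ∀ P A → P + 1ℤ + (- A - 1ℤ) ≡ P - A
    e₂ = solve-∀

  regular-zero : ∀ w → ¬ Valid w zeroState → uw w ≈ 𝟘
  regular-zero [] ¬v = ⊥-elim (¬v tt)
  regular-zero (i ∷ w) ¬v with valid? w zeroState
  ... | no ¬w = ≈-trans (⊗-cong ≈-refl (regular-zero w ¬w)) (⊗-zeroʳ _)
  ... | yes v with trichotomy i (run w zeroState)
  ...   | asc a = ⊥-elim (¬v (a , v))
  ...   | desc d = ¬asc-desc-zero zeroState-¬Desc w v i d
  ...   | neut n = ⊥-elim (IsRegular⇒¬Neut {i} (run-IsRegular w zeroState-IsRegular) n)

  -- At the first letter that fails, a descent makes the word vanish, while a tie is moved to the
  -- right end by `neutral-move`. Up to zero, words killing ∅ therefore lie in the left ideal of the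
  -- letters that fix ∅.
  core-zero : ∀ w → ¬ Valid w coreStart → uw w ≈ 𝟘 ⊎ ∃ λ x → ∃ λ l → Neut l coreStart × uw w ≈ x ⊗ u l
  core-zero [] ¬v = ⊥-elim (¬v tt)
  core-zero (i ∷ w) ¬v with valid? w coreStart
  ... | no ¬w with core-zero w ¬w
  ...   | inj₁ e = inj₁ (≈-trans (⊗-cong ≈-refl e) (⊗-zeroʳ _))
  ...   | inj₂ (x , l , n , e) = inj₂ (u i ⊗ x , l , n , ≈-trans (⊗-cong ≈-refl e) (≈-sym (⊗-assoc _ _ _)))
  core-zero (i ∷ w) ¬v | yes v with trichotomy i (run w coreStart)
  ...   | asc a = ⊥-elim (¬v (a , v))
  ...   | desc d = inj₁ (¬asc-desc-zero coreStart-¬Desc w v i d)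
  ...   | neut n with neutral-move coreStart-¬Desc (length w) w ℕₚ.≤-refl v i n
  ...     | l , nl , e = inj₂ (uw w , l , nl , e)

  -- Inversions and reachable cores

  ΣF : ∀ {m} → (Fin m → ℤ) → ℤ
  ΣF {zero} f = 0ℤ
  ΣF {suc m} f = f fz + ΣF (λ x → f (fs x))

  ΣF-cong : ∀ {m} {f g : Fin m → ℤ} → (∀ x → f x ≡ g x) → ΣF f ≡ ΣF g
  ΣF-cong {zero} e = refl
  ΣF-cong {suc m} e = cong₂ _+_ (e fz) (ΣF-cong (λ x → e (fs x)))

  ΣF-+ : ∀ {m} (f g : Fin m → ℤ) → ΣF (λ x → f x + g x) ≡ ΣF f + ΣF g
  ΣF-+ {zero} f g = refl
  ΣF-+ {suc m} f g = trans (cong (f fz + g fz +_) (ΣF-+ (λ x → f (fs x)) (λ x → g (fs x)))) (e (f fz) (g fz) _ _)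
    where
    e : ∀ a b c d → a + b + (c + d) ≡ a + c + (b + d)
    e = solve-∀

  ΣF-* : ∀ {m} (f : Fin m → ℤ) c → ΣF (λ x → f x * c) ≡ ΣF f * c
  ΣF-* {zero} f c = refl
  ΣF-* {suc m} f c = trans (cong (f fz * c +_) (ΣF-* (λ x → f (fs x)) c)) (sym (*-distribʳ-+ c (f fz) _))

  ΣF-zero : ∀ m → ΣF {m} (λ _ → 0ℤ) ≡ 0ℤ
  ΣF-zero zero = refl
  ΣF-zero (suc m) = trans (+-identityˡ _) (ΣF-zero m)

  ΣF-update : ∀ {m} (f g : Fin m → ℤ) i → (∀ x → ¬ x ≡ i → f x ≡ g x) → ΣF f + g i ≡ ΣF g + f i
  ΣF-update f g fz e = trans (cong (λ z → f fz + z + g fz) (ΣF-cong (λ x → e (fs x) (λ ())))) (e₁ (f fz) (g fz) _)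
    where
    e₁ : ∀ a b s → a + s + b ≡ b + s + a
    e₁ = solve-∀
  ΣF-update f g (fs i) e = begin
    f fz + ΣF (λ x → f (fs x)) + g (fs i)   ≡⟨ +-assoc (f fz) _ _ ⟩
    f fz + (ΣF (λ x → f (fs x)) + g (fs i)) ≡⟨ cong₂ _+_ (e fz (λ ())) (ΣF-update _ _ i (λ x x≢i → e (fs x) (λ p → x≢i (suc-injective p)))) ⟩
    g fz + (ΣF (λ x → g (fs x)) + f (fs i)) ≡⟨ +-assoc (g fz) _ _ ⟨
    g fz + ΣF (λ x → g (fs x)) + f (fs i)   ∎
    where open ≡-Reasoning

  ΣF-update₂ : ∀ {m} (f g : Fin m → ℤ) i j → ¬ j ≡ i → (∀ x → ¬ x ≡ i → ¬ x ≡ j → f x ≡ g x) →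
    ΣF f + (g i + g j) ≡ ΣF g + (f i + f j)
  ΣF-update₂ f g i j j≢i e = begin
    ΣF f + (g i + g j) ≡⟨ cong (λ z → ΣF f + (z + g j)) (h-i) ⟨
    ΣF f + (h i + g j) ≡⟨ e₁ (ΣF f) (h i) (g j) ⟩
    ΣF f + h i + g j   ≡⟨ cong (_+ g j) (ΣF-update f h i (λ x x≢i → sym (h-other x x≢i))) ⟩
    ΣF h + f i + g j   ≡⟨ e₂ (ΣF h) (f i) (g j) ⟩
    ΣF h + g j + f i   ≡⟨ cong (_+ f i) (ΣF-update h g j off-j) ⟩
    ΣF g + h j + f i   ≡⟨ cong (λ z → ΣF g + z + f i) (h-other j j≢i) ⟩
    ΣF g + f j + f i   ≡⟨ e₃ (ΣF g) (f j) (f i) ⟩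
    ΣF g + (f i + f j) ∎
    where
    open ≡-Reasoning
    h : _ → ℤ
    h x with x ≟ i
    ... | yes _ = g i
    ... | no _ = f x
    h-i : h i ≡ g i
    h-i with i ≟ i
    ... | yes _ = refl
    ... | no i≢i = ⊥-elim (i≢i refl)
    h-other : ∀ x → ¬ x ≡ i → h x ≡ f x
    h-other x x≢i with x ≟ i
    ... | yes p = ⊥-elim (x≢i p)
    ... | no _ = refl
    off-j : ∀ x → ¬ x ≡ j → h x ≡ g x
    off-j x x≢j with x ≟ i
    ... | yes refl = refl
    ... | no x≢i = e x x≢i x≢j
    e₁ : ∀ a b c → a + (b + c) ≡ a + b + c
    e₁ = solve-∀
    e₂ : ∀ a b c → a + b + c ≡ a + c + b
    e₂ = solve-∀
    e₃ : ∀ a b c → a + b + c ≡ a + (c + b)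
    e₃ = solve-∀

  sumState sumSq : State → ℤ
  sumState b = ΣF (b !_)
  sumSq b = ΣF (λ x → (b ! x) * (b ! x))

  sumState-swapAt : ∀ i b → sumState (swapAt i b) ≡ sumState b
  sumState-swapAt i b = cancel (begin
    sumState (swapAt i b) + (b ! i + b ! prv i) ≡⟨ ΣF-update₂ (swapAt i b !_) (b !_) i (prv i) (prv≢ 1≤k i) (λ x p q → swapAt-other i b p q) ⟩
    sumState b + (swapAt i b ! i + swapAt i b ! prv i) ≡⟨ cong (sumState b +_) (cong₂ _+_ (swapAt-at i b) (swapAt-prv i b)) ⟩
    sumState b + (b ! prv i + 1ℤ + (b ! i - 1ℤ)) ≡⟨ cong (sumState b +_) (e (b ! i) (b ! prv i)) ⟩
    sumState b + (b ! i + b ! prv i) ∎)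
    where
    open ≡-Reasoning
    e : ∀ B A → A + 1ℤ + (B - 1ℤ) ≡ B + A
    e = solve-∀
    cancel : ∀ {x y c} → x + c ≡ y + c → x ≡ y
    cancel {x} {y} {c} p = trans (c₁ x c) (trans (cong (_- c) p) (sym (c₁ y c)))
      where
      c₁ : ∀ x c → x ≡ x + c - c
      c₁ = solve-∀

  sumState-run : ∀ w b → sumState (run w b) ≡ sumState b
  sumState-run [] b = refl
  sumState-run (i ∷ w) b = trans (sumState-swapAt i (run w b)) (sumState-run w b)

  -- No word for the core is known yet, so length cannot serve as a measure. Undoing a descent
  -- between values `A` and `B` lowers the sum of squares by `2 (B - A - 1)`, which is at least 2.
  sumSq-swapAt : ∀ i b → Desc i b → sumSq (swapAt i b) + 1ℤ ≤ sumSq b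
  sumSq-swapAt i b d = lin₂ 1 d d (e₂ S S′ B A (begin
    S′ + (B * B + A * A) ≡⟨ ΣF-update₂ (λ x → (swapAt i b ! x) * (swapAt i b ! x)) (λ x → (b ! x) * (b ! x)) i (prv i) (prv≢ 1≤k i)
        (λ x p q → cong (λ z → z * z) (swapAt-other i b p q)) ⟩
    S + (swapAt i b ! i * swapAt i b ! i + swapAt i b ! prv i * swapAt i b ! prv i)
      ≡⟨ cong (S +_) (cong₂ _+_ (cong (λ z → z * z) (swapAt-at i b)) (cong (λ z → z * z) (swapAt-prv i b))) ⟩
    S + ((A + 1ℤ) * (A + 1ℤ) + (B - 1ℤ) * (B - 1ℤ)) ∎))
    where
    open ≡-Reasoning
    S = sumSq b
    S′ = sumSq (swapAt i b)
    B = b ! i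
    A = b ! prv i
    e₂ : ∀ S S′ B A → S′ + (B * B + A * A) ≡ S + ((A + 1ℤ) * (A + 1ℤ) + (B - 1ℤ) * (B - 1ℤ)) →
      S - (S′ + 1ℤ) ≡ (B - (A + pos 2)) + (B - (A + pos 2)) + pos 1
    e₂ S S′ B A eq = trans (e₃ S S′ B A) (trans (cong (λ z → S + (B * B + A * A) - z - 1ℤ) eq) (e₄ S B A))
      where
      e₃ : ∀ S S′ B A → S - (S′ + 1ℤ) ≡ S + (B * B + A * A) - (S′ + (B * B + A * A)) - 1ℤ
      e₃ = solve-∀
      e₄ : ∀ S B A → S + (B * B + A * A) - (S + ((A + 1ℤ) * (A + 1ℤ) + (B - 1ℤ) * (B - 1ℤ))) - 1ℤ ≡ (B - (A + pos 2)) + (B - (A + pos 2)) + pos 1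
      e₄ = solve-∀

  square-nonneg : ∀ a → 0ℤ ≤ a * a
  square-nonneg (pos zero) = ≤-refl
  square-nonneg (pos (suc m)) = +≤+ ℕ.z≤n
  square-nonneg -[1+ m ] = +≤+ ℕ.z≤n

  ΣF-nonneg : ∀ {m} {f : Fin m → ℤ} → (∀ x → 0ℤ ≤ f x) → 0ℤ ≤ ΣF f
  ΣF-nonneg {zero} p = ≤-refl
  ΣF-nonneg {suc m} p = +-mono-≤ (p fz) (ΣF-nonneg (λ x → p (fs x)))

  ΣF-nonneg-zero : ∀ {m} {f : Fin m → ℤ} → (∀ x → 0ℤ ≤ f x) → ΣF f ≡ 0ℤ → ∀ x → f x ≡ 0ℤ
  ΣF-nonneg-zero {suc m} {f} p e fz = ≤-antisym (≤-trans (≤-trans (≤-reflexive (sym (+-identityʳ (f fz)))) (+-monoʳ-≤ (f fz) (ΣF-nonneg (λ x → p (fs x))))) (≤-reflexive e)) (p fz)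
  ΣF-nonneg-zero {suc m} {f} p e (fs x) = ΣF-nonneg-zero (λ x → p (fs x))
    (trans (sym (trans (cong (_+ ΣF (λ x → f (fs x))) (ΣF-nonneg-zero p e fz)) (+-identityˡ _))) e) x

  -- A core state without descents is the empty core: its excess over the empty core is weakly decreasing around
  -- the window, is a multiple of n, and sums to zero.
  sorted-core : ∀ b → IsCore b → sumState b ≡ sumState coreStart → (∀ i → ¬ Desc i b) → b ≡ coreStart
  sorted-core b core sum≡ ¬desc = lookup-injective λ x → trans (trans (e₀ (b ! x) (posF x)) (trans (cong (_+ posF x) (excess≡0 x)) (+-identityˡ (posF x)))) (sym (fromFun-! posF x))
    where
    open ≡-Reasoning
    e₀ : ∀ a c → a ≡ a - c + c
    e₀ = solve-∀
    excess : Letter → ℤ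
    excess x = b ! x - posF x
    slope : ∀ i → b ! i ≤ b ! prv i + 1ℤ
    slope i with trichotomy i b
    ... | asc a = ≤-trans a (i≤i+j (b ! prv i) 1ℤ)
    ... | desc d = ⊥-elim (¬desc i d)
    ... | neut n = ≤-reflexive n
    at : ℕ → ℤ
    at t = excess (fz +ₘ t)
    pos-at : ∀ {t} → t ℕ.< suc k → posF (fz +ₘ t) ≡ pos t
    pos-at t<n = cong pos (fz+ₘ t<n)
    decreasing : ∀ t → suc t ℕ.< suc k → at (suc t) ≤ at t
    decreasing t lt = lin₁ 0 (slope (fz +ₘ suc t)) (trans
      (cong₂ (λ p q → b ! (fz +ₘ t) - p - (b ! (fz +ₘ suc t) - q)) (pos-at (ℕₚ.<-trans (ℕₚ.n<1+n t) lt)) (trans (pos-at lt) (pos-+ 1 t)))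
      (trans (e₁ (b ! (fz +ₘ t)) (b ! (fz +ₘ suc t)) (pos t))
        (cong (λ z → b ! z + 1ℤ - b ! (fz +ₘ suc t) + 0ℤ) (sym (prv-+ₘ-suc fz t)))))
      where
      e₁ : ∀ A B t → A - t - (B - (1ℤ + t)) ≡ (A + 1ℤ - B) + 0ℤ
      e₁ = solve-∀
    below-first : ∀ t → t ℕ.< suc k → at t ≤ at 0
    below-first zero _ = ≤-refl
    below-first (suc t) lt = ≤-trans (decreasing t lt) (below-first t (ℕₚ.<-trans (ℕₚ.n<1+n t) lt))
    above-last : ∀ d t → t ℕ.+ d ≡ k → at k ≤ at t
    above-last zero t refl = ≤-reflexive (cong at (ℕₚ.+-identityʳ t))
    above-last (suc d) t e = ≤-trans (above-last d (suc t) (trans (sym (ℕₚ.+-suc t d)) e))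
      (decreasing t (ℕ.s≤s (ℕₚ.≤-trans (ℕₚ.m≤m+n (suc t) d) (ℕₚ.≤-reflexive (trans (sym (ℕₚ.+-suc t d)) e)))))
    sum-excess : ΣF excess ≡ 0ℤ
    sum-excess = begin
      ΣF excess ≡⟨ ΣF-+ (b !_) (λ x → - posF x) ⟩
      sumState b + ΣF (λ x → - posF x) ≡⟨ cong₂ _+_ (trans sum≡ (ΣF-cong (fromFun-! posF))) (trans (ΣF-cong {f = λ x → - posF x} {g = λ x → posF x * - 1ℤ} (λ x → e₂ (posF x))) (ΣF-* posF (- 1ℤ))) ⟩
      ΣF posF + ΣF posF * - 1ℤ ≡⟨ e₃ (ΣF posF) ⟩
      0ℤ ∎
      where
      e₂ : ∀ a → - a ≡ a * - 1ℤ
      e₂ = solve-∀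
      e₃ : ∀ a → a + a * - 1ℤ ≡ 0ℤ
      e₃ = solve-∀
    wrap : at 0 ≤ at k + N
    wrap = lin₁ 0 (slope (fz +ₘ 0)) (trans (cong₂ (λ p q → b ! (fz +ₘ k) - p + N - (b ! (fz +ₘ 0) - q)) (pos-at (ℕₚ.n<1+n k)) (pos-at (ℕ.s≤s ℕ.z≤n)))
      (trans (cong (λ z → b ! (fz +ₘ k) - pos k + z - (b ! (fz +ₘ 0) - 0ℤ)) (pos-+ 1 k))
        (trans (e₁ (b ! (fz +ₘ k)) (b ! (fz +ₘ 0)) (pos k)) (cong (λ z → b ! z + 1ℤ - b ! (fz +ₘ 0) + 0ℤ)
          (cong prv (sym (+ₘ-identity fz)))))))
      where
      e₁ : ∀ A B t → A - t + (1ℤ + t) - (B - 0ℤ) ≡ (A + 1ℤ - B) + 0ℤ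
      e₁ = solve-∀
    excess-at : ∀ x → at (toℕ x) ≡ excess x
    excess-at x = cong excess (zero+ₘ x)
    excess≡ₙ0 : ∀ x → excess x ≡ₙ 0ℤ
    excess≡ₙ0 x = ≡ₙ-trans (≡ₙ-+ (- posF x) (core x)) (≡ₙ-reflexive (+-inverseʳ (posF x)))
    neg-sum : ΣF (λ x → - excess x) ≡ 0ℤ
    neg-sum = trans (ΣF-cong {f = λ x → - excess x} {g = λ x → excess x * - 1ℤ} (λ x → e₂ (excess x))) (trans (ΣF-* excess (- 1ℤ)) (cong (_* - 1ℤ) sum-excess))
      where
      e₂ : ∀ a → - a ≡ a * - 1ℤ
      e₂ = solve-∀
    excess≡0 : ∀ x → excess x ≡ 0ℤ
    -- If the first excess is at most 0, all are, and they sum to zero. If it is positive, it is at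
    -- least `n` by divisibility, so the last one is at least 0 by `wrap`, and again all have the
    -- same sign.
    excess≡0 x with excess (fz +ₘ 0) ≤? 0ℤ
    ... | yes p = trans (sym (neg-involutive (excess x))) (cong -_ (ΣF-nonneg-zero {f = λ y → - excess y}
            (λ y → neg-mono-≤ (≤-trans (≤-trans (≤-reflexive (sym (excess-at y))) (below-first (toℕ y) (toℕ<n y))) p)) neg-sum x))
    ... | no ¬p = ΣF-nonneg-zero (λ y → ≤-trans last≥0 (≤-trans (above-last (k ℕ.∸ toℕ y) (toℕ y) (ℕₚ.m+[n∸m]≡n (ℕₚ.≤-pred (toℕ<n y)))) (≤-reflexive (excess-at y)))) sum-excess x
      where
      last≥0 : 0ℤ ≤ at k
      last≥0 = lin₂ 0 (≡ₙ-gap (≡ₙ-sym (excess≡ₙ0 (fz +ₘ 0))) (≰⇒1+≤ ¬p)) wrap (e₄ (at 0) (at k) N)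
        where
        e₄ : ∀ a c N → c - 0ℤ ≡ (a - (0ℤ + N)) + (c + N - a) + 0ℤ
        e₄ = solve-∀

  desc? : ∀ b → Dec (∃ λ i → Desc i b)
  desc? b = any? (λ i → b ! prv i + pos 2 ≤? b ! i)

  Reachable : State → Set
  Reachable b = ∃ λ w → Valid w coreStart × run w coreStart ≡ b

  reachable-swapAt : ∀ i {b} → Desc i b → Reachable (swapAt i b) → Reachable b
  reachable-swapAt i {b} d (w , v , r) = i ∷ w , (subst (Asc i) (sym r) (Desc⇒Asc d) , v) , trans (cong (swapAt i) r) (swapAt-involutive i b)

  bound-pred : ∀ {s s′} m → s′ + 1ℤ ≤ s → s ≤ pos (suc m) → s′ ≤ pos m
  bound-pred {s} {s′} m p q = lin₂ 0 p q (trans (e (pos m) s′ s) (cong (λ z → s - (s′ + 1ℤ) + (z - s) + 0ℤ) (sym (pos-+ 1 m))))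
    where
    e : ∀ m S′ S → m - S′ ≡ (S - (S′ + 1ℤ)) + (1ℤ + m - S) + 0ℤ
    e = solve-∀

  sumSq-nonneg : ∀ b → 0ℤ ≤ sumSq b
  sumSq-nonneg b = ΣF-nonneg (λ x → square-nonneg (b ! x))

  reach : ∀ m b → sumSq b ≤ pos m → IsCore b → sumState b ≡ sumState coreStart → Reachable b
  reach m b bound core sum≡ = by-desc m bound (desc? b)
    where
    by-desc : ∀ m → sumSq b ≤ pos m → Dec (∃ λ i → Desc i b) → Reachable b
    by-desc m bound (no ¬d) = [] , tt , sym (sorted-core b core sum≡ (λ i d → ¬d (i , d)))
    by-desc zero bound (yes (i , d)) = ⊥-elim (1+≤⇒≰ {sumSq b} {0ℤ}
      (≤-trans (+-monoˡ-≤ 1ℤ (sumSq-nonneg (swapAt i b))) (sumSq-swapAt i b d)) bound)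
    by-desc (suc m) bound (yes (i , d)) = reachable-swapAt i d (reach m (swapAt i b)
      (bound-pred m (sumSq-swapAt i b d) bound) (swapAt-IsCore i core) (trans (sumState-swapAt i b) sum≡))

  reachable : ∀ b → IsCore b → sumState b ≡ sumState coreStart → Reachable b
  reachable b = reach ∣ sumSq b ∣ b (≤-reflexive (sym (0≤i⇒+∣i∣≡i (sumSq-nonneg b))))

  -- The affine permutation b inverts the positions x and x + t, where y is the residue of x + t.
  Inv : State → Letter → Letter → ℕ → Set
  Inv b x y t = b ! x + pos t + 1ℤ ≤ b ! y

  _⊆ᵢ_ : State → State → Set
  β ⊆ᵢ B = ∀ x y t → x +ₘ t ≡ y → Inv β x y t → Inv B x y t

  module _ (i : Letter) {x y x̂ ŷ : Letter} {t t̂ : ℕ} (δ ε : ℤ)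
    (at-x : ∀ b → swapAt i b ! x ≡ b ! x̂ + δ) (at-y : ∀ b → swapAt i b ! y ≡ b ! ŷ + ε)
    (shift : pos t̂ + ε ≡ pos t + δ) where

    -- The hypotheses say that the pair `x`, `y` at distance `t` after the swap is the pair `x̂`,
    -- `ŷ` at distance `t̂` before it; the changes of the two values and of the distance balance, so
    -- the inversion condition is the same.
    Inv-transport : ∀ {β B} → (Inv β x̂ ŷ t̂ → Inv B x̂ ŷ t̂) → Inv (swapAt i β) x y t → Inv (swapAt i B) x y t
    Inv-transport {β} {B} f p = from B (f (to β p))
      where
      to : ∀ b → Inv (swapAt i b) x y t → Inv b x̂ ŷ t̂
      to b p = lin₁ 0 p (trans (e₁ (b ! x̂) (b ! ŷ) (pos t) (pos t̂) ε) (trans (cong (λ z → b ! ŷ + ε - (b ! x̂ + z + 1ℤ) + 0ℤ) shift)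
        (trans (e₂ (b ! x̂) (b ! ŷ) (pos t) δ ε) (sym (cong₂ (λ p q → q - (p + pos t + 1ℤ) + 0ℤ) (at-x b) (at-y b))))))
        where
        e₁ : ∀ X Y t t̂ ε → Y - (X + t̂ + 1ℤ) ≡ Y + ε - (X + (t̂ + ε) + 1ℤ) + 0ℤ
        e₁ = solve-∀
        e₂ : ∀ X Y t δ ε → Y + ε - (X + (t + δ) + 1ℤ) + 0ℤ ≡ Y + ε - (X + δ + t + 1ℤ) + 0ℤ
        e₂ = solve-∀
      from : ∀ b → Inv b x̂ ŷ t̂ → Inv (swapAt i b) x y t
      from b p = subst₂ (λ u v → u + pos t + 1ℤ ≤ v) (sym (at-x b)) (sym (at-y b))
        (lin₁ 0 p (trans (e₁ (b ! x̂) (b ! ŷ) (pos t) δ ε) (trans (cong (λ z → b ! ŷ + ε - (b ! x̂ + z + 1ℤ) + 0ℤ) (sym shift)) (e₂ (b ! x̂) (b ! ŷ) (pos t̂) ε))))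
        where
        e₁ : ∀ X Y t δ ε → Y + ε - (X + δ + t + 1ℤ) ≡ Y + ε - (X + (t + δ) + 1ℤ) + 0ℤ
        e₁ = solve-∀
        e₂ : ∀ X Y t̂ ε → Y + ε - (X + (t̂ + ε) + 1ℤ) + 0ℤ ≡ Y - (X + t̂ + 1ℤ) + 0ℤ
        e₂ = solve-∀

  -- Undoing the descent `i` of `β` deletes the inversion of `prv i` and `i` at distance 1 and
  -- permutes the others. The cases record how exchanging `prv i` and `i` changes the distance of a
  -- pair, by at most 2.
  swapAt-⊆ᵢ : ∀ i {β B} → Desc i β → β ⊆ᵢ B → swapAt i β ⊆ᵢ swapAt i B
  swapAt-⊆ᵢ i {β} {B} d H x y t x+t≡y p with y ≟ x
  ... | yes refl = ⊥-elim (1+≤⇒≰ p (i≤i+j (swapAt i β ! x) (pos t)))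
  ... | no y≢x with x ≟ i | y ≟ i
  swapAt-⊆ᵢ i {β} {B} d H x y t x+t≡y p | no y≢x | yes refl | yes refl = ⊥-elim (y≢x refl)
  swapAt-⊆ᵢ i {β} {B} d H x y t x+t≡y p | no y≢x | yes refl | no y≢i with y ≟ prv i
  ... | yes refl = Inv-transport i {t = t} {suc (suc t)} 1ℤ (- 1ℤ) (swapAt-at i) (swapAt-prv i) (cong pos (ℕₚ.+-comm 1 t))
        (H (prv i) i (suc (suc t)) (trans (sym (+ₘ-+ₘ (prv i) 1 (suc t))) (trans (cong (_+ₘ suc t) (nxt-prv i)) (trans (sym (nxt-+ₘ i t)) (trans (cong nxt x+t≡y) (nxt-prv i)))))) p
  ... | no y≢p = Inv-transport i {t = t} {suc t} 1ℤ 0ℤ (swapAt-at i) (λ b → trans (swapAt-other i b y≢i y≢p) (sym (+-identityʳ _)))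
        (trans (+-identityʳ (pos (suc t))) (cong pos (ℕₚ.+-comm 1 t)))
        (H (prv i) y (suc t) (trans (sym (+ₘ-+ₘ (prv i) 1 t)) (trans (cong (_+ₘ t) (nxt-prv i)) x+t≡y))) p
  swapAt-⊆ᵢ i {β} {B} d H x y t x+t≡y p | no y≢x | no x≢i | yes refl with x ≟ prv y
  swapAt-⊆ᵢ i {β} {B} d H x y zero x+t≡y p | no y≢x | no x≢i | yes refl | _ = ⊥-elim (y≢x (trans (sym x+t≡y) (+ₘ-identity x)))
  -- This is the deleted inversion: `swapAt i β` no longer has it.
  swapAt-⊆ᵢ i {β} {B} d H x y (suc zero) x+t≡y p | no y≢x | no x≢i | yes refl | yes refl =
    ⊥-elim (1+≤⇒≰ {β ! i} {β ! prv i + 1ℤ} (≤-trans (≤-reflexive (e (β ! prv i))) d)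
      (lin₁ 1 (subst₂ (λ u v → u + pos 1 + 1ℤ ≤ v) (swapAt-prv i β) (swapAt-at i β) p) (e₂ (β ! i) (β ! prv i))))
    where
    e : ∀ A → A + 1ℤ + 1ℤ ≡ A + pos 2
    e = solve-∀
    e₂ : ∀ B A → A + 1ℤ - B ≡ A + 1ℤ - (B - 1ℤ + pos 1 + 1ℤ) + 1ℤ
    e₂ = solve-∀
  swapAt-⊆ᵢ i {β} {B} d H x y (suc (suc t)) x+t≡y p | no y≢x | no x≢i | yes refl | yes refl =
    Inv-transport i {t = suc (suc t)} {t} (- 1ℤ) 1ℤ (swapAt-prv i) (swapAt-at i) (cong pos (ℕₚ.+-comm t 1))
      (H i (prv i) t (trans (sym (prv-+ₘ-suc i t)) (cong prv (trans (trans (cong (_+ₘ suc t) (sym (nxt-prv i))) (+ₘ-+ₘ (prv i) 1 (suc t))) x+t≡y)))) p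
  swapAt-⊆ᵢ i {β} {B} d H x y (suc t) x+t≡y p | no y≢x | no x≢i | yes refl | no x≢p =
    Inv-transport i {t = suc t} {t} 0ℤ 1ℤ (λ b → trans (swapAt-other i b x≢i x≢p) (sym (+-identityʳ _))) (swapAt-at i)
      (trans (cong pos (ℕₚ.+-comm t 1)) (sym (+-identityʳ (pos (suc t)))))
      (H x (prv i) t (trans (sym (prv-+ₘ-suc x t)) (cong prv x+t≡y))) p
  swapAt-⊆ᵢ i {β} {B} d H x y t x+t≡y p | no y≢x | no x≢i | no y≢i with x ≟ prv i | y ≟ prv i
  ... | yes refl | yes refl = ⊥-elim (y≢x refl)
  ... | no x≢p | yes refl = Inv-transport i {t = t} {suc t} 0ℤ (- 1ℤ) (λ b → trans (swapAt-other i b x≢i x≢p) (sym (+-identityʳ _))) (swapAt-prv i)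
        (sym (+-identityʳ (pos t)))
        (H x i (suc t) (trans (sym (nxt-+ₘ x t)) (trans (cong nxt x+t≡y) (nxt-prv i)))) p
  ... | no x≢p | no y≢p = Inv-transport i {t = t} {t} 0ℤ 0ℤ (λ b → trans (swapAt-other i b x≢i x≢p) (sym (+-identityʳ _)))
        (λ b → trans (swapAt-other i b y≢i y≢p) (sym (+-identityʳ _))) refl (H x y t x+t≡y) p
  swapAt-⊆ᵢ i {β} {B} d H x y zero x+t≡y p | no y≢x | no x≢i | no y≢i | yes refl | no y≢p = ⊥-elim (y≢x (trans (sym x+t≡y) (+ₘ-identity x)))
  swapAt-⊆ᵢ i {β} {B} d H x y (suc t) x+t≡y p | no y≢x | no x≢i | no y≢i | yes refl | no y≢p =
    Inv-transport i {t = suc t} {t} (- 1ℤ) 0ℤ (swapAt-prv i) (λ b → trans (swapAt-other i b y≢i y≢p) (sym (+-identityʳ _)))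
      (+-identityʳ (pos t))
      (H i y t (trans (cong (_+ₘ t) (sym (nxt-prv i))) (trans (+ₘ-+ₘ (prv i) 1 t) x+t≡y))) p

  Desc⇒Inv : ∀ {i b} → Desc i b → Inv b (prv i) i 1
  Desc⇒Inv {i} {b} d = ≤-trans (≤-reflexive (e (b ! prv i))) d
    where
    e : ∀ A → A + 1ℤ + 1ℤ ≡ A + pos 2
    e = solve-∀

  Inv⇒Desc : ∀ {i b} → Inv b (prv i) i 1 → Desc i b
  Inv⇒Desc {i} {b} d = ≤-trans (≤-reflexive (e (b ! prv i))) d
    where
    e : ∀ A → A + pos 2 ≡ A + 1ℤ + 1ℤ
    e = solve-∀

  -- The outer letter of `v` is an inversion of the end state of `v`, hence of `B`, hence a descent
  -- of `B` that can be undone; `swapAt-⊆ᵢ` restores the containment for the shorter word.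
  unapply : ∀ v → Valid v zeroState → ∀ B → IsCore B → sumState B ≡ sumState coreStart → run v zeroState ⊆ᵢ B →
    ∃ λ B₀ → Valid v B₀ × run v B₀ ≡ B × IsCore B₀ × sumState B₀ ≡ sumState coreStart
  unapply [] _ B core sum≡ _ = B , tt , refl , core , sum≡
  unapply (i ∷ v) (a , pv) B core sum≡ H = finish
      (unapply v pv (swapAt i B) (swapAt-IsCore i core) (trans (sumState-swapAt i B) sum≡)
        (subst (_⊆ᵢ swapAt i B) (swapAt-involutive i (run v zeroState)) (swapAt-⊆ᵢ i dβ H)))
    where
    dβ : Desc i (swapAt i (run v zeroState))
    dβ = Asc⇒Desc a
    dB : Desc i B
    dB = Inv⇒Desc (H (prv i) i 1 (nxt-prv i) (Desc⇒Inv dβ))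
    finish : (∃ λ B₀ → Valid v B₀ × run v B₀ ≡ swapAt i B × IsCore B₀ × sumState B₀ ≡ sumState coreStart) →
      ∃ λ B₀ → Valid (i ∷ v) B₀ × run (i ∷ v) B₀ ≡ B × IsCore B₀ × sumState B₀ ≡ sumState coreStart
    finish (B₀ , pB , r , rest) = B₀ , (subst (Asc i) (sym r) (Desc⇒Asc dB) , pB) , trans (cong (swapAt i) r) (swapAt-involutive i B) , rest

  -- All inversions of β survive its dilation by n.
  dilate : State → State
  dilate β = fromFun (λ x → posF x + β ! x * N)

  dilate-⊆ᵢ : ∀ β → β ⊆ᵢ dilate β
  dilate-⊆ᵢ β x y t _ p = subst₂ (λ u v → u + pos t + 1ℤ ≤ v) (sym (fromFun-! _ x)) (sym (fromFun-! _ y))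
    (lin₃ 0 (*-monoʳ-≤-nonNeg N p) (posF-+1≤N x) tN (e (posF x) (posF y) (β ! x) (β ! y) (pos t) N))
    where
    tN : 0ℤ + pos t ≤ posF y + pos t * N
    tN = +-mono-≤ {0ℤ} {posF y} (+≤+ ℕ.z≤n) (≤-trans (+≤+ (ℕₚ.m≤m*n t (suc k))) (≤-reflexive (pos-* t (suc k))))
    e : ∀ X Y a b t N → Y + b * N - (X + a * N + t + 1ℤ) ≡ (b * N - (a + t + 1ℤ) * N) + (N - (X + 1ℤ)) + (Y + t * N - (0ℤ + t)) + pos 0
    e = solve-∀

  dilate-IsCore : ∀ β → IsCore (dilate β)
  dilate-IsCore β x = modulo (β ! x) (fromFun-! _ x)

  sumState-dilate : ∀ β → sumState β ≡ 0ℤ → sumState (dilate β) ≡ sumState coreStart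
  sumState-dilate β e = begin
    sumState (dilate β) ≡⟨ ΣF-cong (fromFun-! _) ⟩
    ΣF (λ x → posF x + β ! x * N) ≡⟨ ΣF-+ posF (λ x → β ! x * N) ⟩
    ΣF posF + ΣF (λ x → β ! x * N) ≡⟨ cong (ΣF posF +_) (trans (ΣF-* (β !_) N) (cong (_* N) e)) ⟩
    ΣF posF + 0ℤ ≡⟨ +-identityʳ _ ⟩
    ΣF posF ≡⟨ ΣF-cong (λ x → sym (fromFun-! posF x)) ⟩
    sumState coreStart ∎
    where open ≡-Reasoning

  -- The dilated core contains all inversions of `v`, so `v` can be undone from it. The core `B₀`
  -- that remains is reachable from ∅ by some `x`, and `v` survives on it.
  extend-to-core : ∀ v → Valid v zeroState → ∃ λ x → Valid (v ++ x) coreStart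
  extend-to-core v pv = reached (unapply v pv (dilate β) (dilate-IsCore β) (sumState-dilate β sum0) (dilate-⊆ᵢ β))
    where
    β = run v zeroState
    sum0 : sumState β ≡ 0ℤ
    sum0 = trans (sumState-run v zeroState) (trans (ΣF-cong (fromFun-! (λ _ → 0ℤ))) (ΣF-zero (suc k)))
    built : ∀ {B₀} → Valid v B₀ → Reachable B₀ → ∃ λ x → Valid (v ++ x) coreStart
    built pB (x , px , refl) = x , valid-++ v x pB px
    reached : (∃ λ B₀ → Valid v B₀ × run v B₀ ≡ dilate β × IsCore B₀ × sumState B₀ ≡ sumState coreStart) →
      ∃ λ x → Valid (v ++ x) coreStart
    reached (B₀ , pB , _ , core , sum≡) = built pB (reachable B₀ core sum≡)

  run-reverse : ∀ x b → run x (run (reverse x) b) ≡ b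
  run-reverse [] b = refl
  run-reverse (i ∷ x) b = begin
    swapAt i (run x (run (reverse (i ∷ x)) b)) ≡⟨ cong (λ z → swapAt i (run x (run z b))) (unfold-reverse i x) ⟩
    swapAt i (run x (run (reverse x ++ i ∷ []) b)) ≡⟨ cong (λ z → swapAt i (run x z)) (run-++ (reverse x) (i ∷ []) b) ⟩
    swapAt i (run x (run (reverse x) (swapAt i b))) ≡⟨ cong (swapAt i) (run-reverse x (swapAt i b)) ⟩
    swapAt i (swapAt i b) ≡⟨ swapAt-involutive i b ⟩
    b ∎
    where open ≡-Reasoning

  -- By `matsumoto` the two long words agree on every state, not only on ∅; starting them at the
  -- image of `b` under the inverse of `x` cancels `x`.
  cancelʳ : ∀ v w x → Valid (v ++ x) coreStart → Valid (w ++ x) coreStart →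
    run (v ++ x) coreStart ≡ run (w ++ x) coreStart → ∀ b → run v b ≡ run w b
  cancelʳ v w x pv pw e b = begin
    run v b ≡⟨ cong (run v) (run-reverse x b) ⟨
    run v (run x b′) ≡⟨ run-++ v x b′ ⟨
    run (v ++ x) b′ ≡⟨ same-run (matsumoto coreStart-¬Desc (v ++ x) (w ++ x) pv pw e) b′ ⟩
    run (w ++ x) b′ ≡⟨ run-++ w x b′ ⟩
    run w (run x b′) ≡⟨ cong (run w) (run-reverse x b) ⟩
    run w b ∎
    where
    open ≡-Reasoning
    b′ = run (reverse x) b

  -- Faithfulness of the action on cores

  keyFrom : State → Word → Maybe State
  keyFrom b₀ w = if does (valid? w b₀) then just (run w b₀) else nothing

  keyFrom-valid : ∀ {b₀ w} → Valid w b₀ → keyFrom b₀ w ≡ just (run w b₀)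
  keyFrom-valid {b₀} {w} v with valid? w b₀
  ... | yes _ = refl
  ... | no ¬v = ⊥-elim (¬v v)

  keyFrom-nothing : ∀ {b₀} w → keyFrom b₀ w ≡ nothing → ¬ Valid w b₀
  keyFrom-nothing {b₀} w e v with () ← trans (sym e) (keyFrom-valid {b₀} {w} v)

  keyFrom-just : ∀ {b₀ b} w → keyFrom b₀ w ≡ just b → Valid w b₀ × run w b₀ ≡ b
  keyFrom-just {b₀} w e with valid? w b₀
  ... | yes v = v , just-injective e
  keyFrom-just {b₀} w () | no _

  δ : State → State → ℤ
  δ b c = if does (≡-dec Data.Integer._≟_ c b) then 1ℤ else 0ℤ

  δ-≡ : ∀ {b c} → c ≡ b → δ b c ≡ 1ℤ
  δ-≡ {b} {c} e with ≡-dec Data.Integer._≟_ c b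
  ... | yes _ = refl
  ... | no ¬e = ⊥-elim (¬e e)

  δ-≢ : ∀ {b c} → ¬ c ≡ b → δ b c ≡ 0ℤ
  δ-≢ {b} {c} ¬e with ≡-dec Data.Integer._≟_ c b
  ... | yes e = ⊥-elim (¬e e)
  ... | no _ = refl

  Vanishes : 𝔸 k → Set
  Vanishes z = ∀ x → Valid x coreStart → ∀ φ → ⟦ z ⟧ φ (run x coreStart) ≡ 0ℤ

  -- The action on cores is faithful: two reduced words v, w that agree on a core x∅ with vx∅ ≠ 0 are equal in W.
  faithful : ∀ z → Vanishes z → z ≈ 𝟘
  faithful z vanish = ≈-trans (expand-correct z) (total≋ε key (Ring.+-abelianGroup 𝔸-ring) uw
      (λ w e → regular-zero w (keyFrom-nothing w e)) same-key Good (length (expand z)) (expand z) ℕₚ.≤-refl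
      (All.universal (λ t b e → proj₂ t , keyFrom-just (proj₂ t) e) (expand z)) coefficient)
    where
    key = keyFrom zeroState
    Good : State → Set
    Good b = ∃ λ v → Valid v zeroState × run v zeroState ≡ b
    same-key : ∀ v w → key v ≡ key w → uw v ≈ uw w
    same-key v w e with valid? v zeroState | valid? w zeroState
    ... | yes pv | yes pw = alg (matsumoto zeroState-¬Desc v w pv pw (just-injective e))
    ... | no ¬v | no ¬w = ≈-trans (regular-zero v ¬v) (≈-sym (regular-zero w ¬w))
    same-key v w () | yes pv | no ¬w
    same-key v w () | no ¬v | yes pw
    coefficient : ∀ b → Good b → totalℤ (indicator key b) (expand z) ≡ 0ℤ
    coefficient b (v , pv , refl) = detect (extend-to-core v pv)
      where
      -- The delta function at the end state of `v` on the core `x∅` extracts the coefficient of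
      -- `v`: any word that survives on `x∅` and ends there equals `v` in `W` by `cancelʳ`.
      detect : (∃ λ x → Valid (v ++ x) coreStart) → totalℤ (indicator key b) (expand z) ≡ 0ℤ
      detect (x , pvx) = trans (totalℤ-cong (λ w → sym (pointwise w)) (expand z))
          (trans (sym (⟦⟧-expand z (δ target) (run x coreStart))) (vanish x (valid-++ʳ v x pvx) (δ target)))
        where
        target : State
        target = run v (run x coreStart)
        -- A word that survives on some state is not zero in the algebra, so by `regular-zero` it
        -- must also be valid on `zeroState`.
        regular : ∀ w → Valid w (run x coreStart) → Valid w zeroState
        regular w pw with valid? w zeroState
        ... | yes p = p
        ... | no ¬p with () ← trans (sym (⟦uw⟧-valid w (λ _ → 1ℤ) pw)) (⟦⟧-sound (regular-zero w ¬p) (λ _ → 1ℤ) (run x coreStart))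
        agree : ∀ w → Valid w (run x coreStart) → run w (run x coreStart) ≡ target → key w ≡ just b
        agree w pw r = trans (keyFrom-valid {w = w} (regular w pw)) (cong just
          (cancelʳ w v x (valid-++ w x pw (valid-++ʳ v x pvx)) pvx (trans (run-++ w x coreStart) (trans r (sym (run-++ v x coreStart)))) zeroState))
        pointwise : ∀ w → ⟦ uw w ⟧ (δ target) (run x coreStart) ≡ indicator key b w
        pointwise w = by-key (key w ≟ₛ just b)
          where
          by-validity : ¬ key w ≡ just b → Dec (Valid w (run x coreStart)) → ⟦ uw w ⟧ (δ target) (run x coreStart) ≡ 0ℤ
          by-validity ¬e (no ¬w) = ⟦uw⟧-¬valid w (δ target) ¬w
          by-validity ¬e (yes pw) = trans (⟦uw⟧-valid w (δ target) pw) (δ-≢ λ r → ¬e (agree w pw r))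
          by-key : Dec (key w ≡ just b) → ⟦ uw w ⟧ (δ target) (run x coreStart) ≡ indicator key b w
          by-key (yes e) = trans (⟦⟧-sound (alg (matsumoto zeroState-¬Desc w v (proj₁ (keyFrom-just w e)) pv (proj₂ (keyFrom-just w e)))) (δ target) (run x coreStart))
            (trans (⟦uw⟧-valid v (δ target) (valid-++ˡ v x pvx)) (trans (δ-≡ {target} refl) (sym (indicator-≡ key {b} {w} e))))
          by-key (no ¬e) = trans (by-validity ¬e (valid? w (run x coreStart))) (sym (indicator-≢ key {b} {w} ¬e))

  -- Rotation of the generators

  rot : ℕ → 𝔸 k → 𝔸 k
  rot c = eval (λ i → gen (i +ₘ c))

  rotW : ℕ → Word → Word
  rotW c = map (_+ₘ c)

  Adjacent-+ₘ : ∀ c {i j} → Adjacent k (i +ₘ c) (j +ₘ c) → Adjacent k i j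
  Adjacent-+ₘ c {i} {j} (inj₁ e) = inj₁ (+ₘ-cancelʳ j (nxt i) (trans e (+ₘ-comm i c 1)))
  Adjacent-+ₘ c {i} {j} (inj₂ e) = inj₂ (+ₘ-cancelʳ i (nxt j) (trans e (+ₘ-comm j c 1)))

  rot-cong : ∀ c {x y} → x ≈ y → rot c x ≈ rot c y
  rot-cong c ≈-refl = ≈-refl
  rot-cong c (≈-sym e) = ≈-sym (rot-cong c e)
  rot-cong c (≈-trans e f) = ≈-trans (rot-cong c e) (rot-cong c f)
  rot-cong c (⊕-cong e f) = ⊕-cong (rot-cong c e) (rot-cong c f)
  rot-cong c (⊗-cong e f) = ⊗-cong (rot-cong c e) (rot-cong c f)
  rot-cong c (⊖-cong e) = ⊖-cong (rot-cong c e)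
  rot-cong c (⊕-assoc x y z) = ⊕-assoc _ _ _
  rot-cong c (⊕-comm x y) = ⊕-comm _ _
  rot-cong c (⊕-idˡ x) = ⊕-idˡ _
  rot-cong c (⊖-invˡ x) = ⊖-invˡ _
  rot-cong c (⊗-assoc x y z) = ⊗-assoc _ _ _
  rot-cong c (⊗-idˡ x) = ⊗-idˡ _
  rot-cong c (⊗-idʳ x) = ⊗-idʳ _
  rot-cong c (distribˡ x y z) = distribˡ _ _ _
  rot-cong c (distribʳ x y z) = distribʳ _ _ _
  rot-cong c (nil i) = nil _
  rot-cong c (comm i j ¬adj) = comm _ _ (λ adj → ¬adj (Adjacent-+ₘ c adj))
  rot-cong c (braid 2≤k i) = subst (λ j → u (i +ₘ c) ⊗ u j ⊗ u (i +ₘ c) ≈ u j ⊗ u (i +ₘ c) ⊗ u j) (+ₘ-comm i c 1) (braid 2≤k (i +ₘ c))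

  rot-uw : ∀ c w → rot c (uw w) ≡ uw (rotW c w)
  rot-uw c [] = refl
  rot-uw c (i ∷ w) = cong (u (i +ₘ c) ⊗_) (rot-uw c w)

  rot-total : ∀ c ts φ b → ⟦ rot c (total𝔸 uw ts) ⟧ φ b ≡ totalℤ (λ w → ⟦ rot c (uw w) ⟧ φ b) ts
  rot-total c [] φ b = refl
  rot-total c ((true , w) ∷ ts) φ b = cong (⟦ rot c (uw w) ⟧ φ b +_) (rot-total c ts φ b)
  rot-total c ((false , w) ∷ ts) φ b = cong (- ⟦ rot c (uw w) ⟧ φ b +_) (rot-total c ts φ b)

  -- The module generated by the empty core is the quotient of the algebra by the left ideal generated by the letters
  -- that fix the empty core, so it maps to any module element annihilated by the rotated letters.
  transfer : ∀ c (R : State) → (∀ l → Neut l coreStart → ¬ Asc (l +ₘ c) R) →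
    ∀ z → (∀ φ → ⟦ z ⟧ φ coreStart ≡ 0ℤ) → ∀ φ → ⟦ rot c z ⟧ φ R ≡ 0ℤ
  transfer c R killed z vanish φ = trans (⟦⟧-sound (rot-cong c (expand-correct z)) φ R) (trans (rot-total c (expand z) φ R)
      (total≋ε key +-0-abelianGroup F F-nothing F-key (λ _ → ⊤) (length (expand z)) (expand z) ℕₚ.≤-refl
        (All.universal (λ _ _ _ → tt) (expand z)) (λ b _ → coefficient b)))
    where
    key = keyFrom coreStart
    F : Word → ℤ
    F w = ⟦ rot c (uw w) ⟧ φ R
    F-nothing : ∀ w → key w ≡ nothing → F w ≡ 0ℤ
    F-nothing w e with core-zero w (keyFrom-nothing w e)
    ... | inj₁ z = ⟦⟧-sound (rot-cong c z) φ R
    ... | inj₂ (x , l , n , z) = trans (⟦⟧-sound (rot-cong c z) φ R) (⟦gen⟧-¬asc (⟦ rot c x ⟧ φ) (killed l n))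
    F-key : ∀ v w → key v ≡ key w → F v ≡ F w
    F-key v w e with key w in ew
    ... | nothing = trans (F-nothing v e) (sym (F-nothing w ew))
    ... | just b = ⟦⟧-sound (rot-cong c (alg (matsumoto coreStart-¬Desc v w (proj₁ (keyFrom-just v e)) (proj₁ (keyFrom-just w ew))
            (trans (proj₂ (keyFrom-just v e)) (sym (proj₂ (keyFrom-just w ew))))))) φ R
    coefficient : ∀ b → totalℤ (indicator key b) (expand z) ≡ 0ℤ
    coefficient b = trans (totalℤ-cong (λ w → sym (pointwise w)) (expand z)) (trans (sym (⟦⟧-expand z (δ b) coreStart)) (vanish (δ b)))
      where
      pointwise : ∀ w → ⟦ uw w ⟧ (δ b) coreStart ≡ indicator key b w
      pointwise w = by-key (key w ≟ₛ just b)
        where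
        by-validity : ¬ key w ≡ just b → Dec (Valid w coreStart) → ⟦ uw w ⟧ (δ b) coreStart ≡ 0ℤ
        by-validity ¬e (no ¬w) = ⟦uw⟧-¬valid w (δ b) ¬w
        by-validity ¬e (yes pw) = trans (⟦uw⟧-valid w (δ b) pw) (δ-≢ λ r → ¬e (trans (keyFrom-valid {w = w} pw) (cong just r)))
        by-key : Dec (key w ≡ just b) → ⟦ uw w ⟧ (δ b) coreStart ≡ indicator key b w
        by-key (yes e) = trans (⟦uw⟧-valid w (δ b) (proj₁ (keyFrom-just w e))) (trans (δ-≡ (proj₂ (keyFrom-just w e))) (sym (indicator-≡ key {b} {w} e)))
        by-key (no ¬e) = trans (by-validity ¬e (valid? w coreStart)) (sym (indicator-≢ key {b} {w} ¬e))

  -- Cyclically decreasing words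

  SameMembers : ∀ {a} {A : Set a} → List A → List A → Set a
  SameMembers xs ys = (∀ {x} → x ∈ xs → x ∈ ys) × (∀ {x} → x ∈ ys → x ∈ xs)

  ∈-insert⁻ : ∀ {a} {A : Set a} {x y : A} (xs : List A) {ys} → x ∈ xs ++ y ∷ ys → x ≡ y ⊎ x ∈ xs ++ ys
  ∈-insert⁻ xs p with ∈-++⁻ xs p
  ... | inj₁ q = inj₂ (∈-++⁺ˡ q)
  ... | inj₂ (here e) = inj₁ e
  ... | inj₂ (there q) = inj₂ (∈-++⁺ʳ xs q)

  ∈-insert⁺ : ∀ {a} {A : Set a} {x y : A} (xs : List A) {ys} → x ∈ xs ++ ys → x ∈ xs ++ y ∷ ys
  ∈-insert⁺ xs p with ∈-++⁻ xs p
  ... | inj₁ q = ∈-++⁺ˡ q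
  ... | inj₂ q = ∈-++⁺ʳ xs (there q)

  module _ {a} {A : Set a} {ℓ} {R : A → A → Set ℓ} where
    AllPairs-extract : ∀ xs {y ys} → AllPairs R (xs ++ y ∷ ys) →
      All (λ z → R z y) xs × All (R y) ys × AllPairs R (xs ++ ys)
    AllPairs-extract [] (p ∷ ps) = [] , p , ps
    AllPairs-extract (x ∷ xs) {y} {ys} (p ∷ ps) with AllPairs-extract xs ps
    ... | before , after , rest = All.lookup p (∈-++⁺ʳ xs (here refl)) ∷ before , after
      , All.tabulate (λ z∈ → All.lookup p (∈-insert⁺ xs z∈)) ∷ rest

  no-members : ∀ {a} {A : Set a} (xs : List A) → (∀ {x} → ¬ x ∈ xs) → xs ≡ []
  no-members [] _ = refl
  no-members (x ∷ xs) p = ⊥-elim (p (here refl))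

  members-extract : ∀ {a} {A : Set a} xs {y : A} {ys zs} → SameMembers (xs ++ y ∷ ys) (y ∷ zs) →
    All (λ z → ¬ z ≡ y) xs → All (λ z → ¬ y ≡ z) ys → All (λ z → ¬ y ≡ z) zs → SameMembers (xs ++ ys) zs
  members-extract xs {y} {ys} {zs} (to , from) before after fresh = to′ , from′
    where
    to′ : ∀ {x} → x ∈ xs ++ ys → x ∈ zs
    to′ p with to (∈-insert⁺ xs p)
    ... | there q = q
    ... | here refl with ∈-++⁻ xs p
    ...   | inj₁ q = ⊥-elim (All.lookup before q refl)
    ...   | inj₂ q = ⊥-elim (All.lookup after q refl)
    from′ : ∀ {x} → x ∈ zs → x ∈ xs ++ ys
    from′ p with ∈-insert⁻ xs (from (there p))
    ... | inj₂ q = q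
    ... | inj₁ refl = ⊥-elim (All.lookup fresh p refl)

  unique-↭ : ∀ {a} {A : Set a} {xs ys : List A} → Unique xs → Unique ys → SameMembers xs ys → xs ↭ ys
  unique-↭ {xs = xs} {[]} _ _ (to , _) with no-members xs (λ p → case (to p))
    where
    case : ∀ {x} → ¬ x ∈ []
    case ()
  ... | refl = ↭-refl
  unique-↭ {xs = xs} {y ∷ ys} ux (fresh ∷ uy) sm with ∈-∃++ (proj₂ sm (here refl))
  ... | xs₁ , xs₂ , refl with AllPairs-extract xs₁ ux
  ...   | before , after , rest = ↭-trans (shift y xs₁ xs₂) (↭-prep y (unique-↭ rest uy (members-extract xs₁ sm before after fresh)))

  Cyclic : Letter → Letter → Set
  Cyclic x z = ¬ x ≡ z × ¬ z ≡ nxt x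

  CycDec : Word → Set
  CycDec = AllPairs Cyclic

  CycDec⇒Unique : ∀ {w} → CycDec w → Unique w
  CycDec⇒Unique = AllPairs.map proj₁

  move-front : ∀ v y w → All (λ z → ¬ Adjacent k y z) v → v ++ y ∷ w ≅ y ∷ v ++ w
  move-front [] y w _ = ≅-refl
  move-front (z ∷ v) y w (p ∷ ps) = ≅-trans (≅-∷ z (move-front v y w ps)) (≅-swap (v ++ w) (apart-sym p))

  -- The first letter `y` of the second word can be moved to the front of `v`: a letter `z` standing
  -- before it in `v` is not `y - 1` because `v` is cyclically decreasing, and not `y + 1` because
  -- `z` comes after `y` in the other word.
  cycDec-≅ : ∀ v w → CycDec v → CycDec w → SameMembers v w → v ≅ w
  cycDec-≅ v [] _ _ (to , _) with no-members v (λ p → case (to p))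
    where
    case : ∀ {x : Letter} → ¬ x ∈ []
    case ()
  ... | refl = ≅-refl
  cycDec-≅ v (y ∷ w) cv (cy ∷ cw) sm with ∈-∃++ (proj₂ sm (here refl))
  ... | v₁ , v₂ , refl with AllPairs-extract v₁ cv
  ...   | before , after , rest = ≅-trans (move-front v₁ y v₂ (All.tabulate apart))
          (≅-∷ y (cycDec-≅ (v₁ ++ v₂) w rest cw (members-extract v₁ sm (All.map proj₁ before) (All.map proj₁ after) (All.map proj₁ cy))))
    where
    apart : ∀ {z} → z ∈ v₁ → ¬ Adjacent k y z
    apart z∈ (inj₂ y≡) = proj₂ (All.lookup before z∈) y≡
    apart z∈ (inj₁ z≡) with proj₁ sm (∈-++⁺ˡ z∈)
    ... | here refl = proj₁ (All.lookup before z∈) refl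
    ... | there z∈w = proj₂ (All.lookup cy z∈w) z≡

  mem : Subset (suc k) → Letter → Bool
  mem = Vec.lookup

  Spells : Word → Subset (suc k) → Set
  Spells w D = (∀ {x} → x ∈ w → mem D x ≡ true) × (∀ {x} → mem D x ≡ true → x ∈ w)

  spells-same : ∀ {v w D} → Spells v D → Spells w D → SameMembers v w
  spells-same (a , b) (c , d) = (λ p → d (a p)) , (λ p → b (c p))

  wordFrom-CycDec : ∀ D m → CycDec (wordFrom D m)
  wordFrom-CycDec D m = AllPairsₚ.filter⁺ _ (AllPairsₚ.map⁺ (AllPairsₚ.map⁺ (AllPairsₚ.applyUpTo⁺₁ (λ t → t) k cyclic)))
    where
    letter : ℕ → Letter
    letter t = (toℕ m ℕ.+ suc k ℕ.∸ suc t) mod suc k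
    letter≡ : ∀ {t} → t ℕ.≤ k → letter t ≡ m +ₘ (k ℕ.∸ t)
    letter≡ {t} t≤k = cong (_mod suc k) (ℕₚ.+-∸-assoc (toℕ m) {suc k} {suc t} (ℕ.s≤s t≤k))
    k∸< : ∀ t → k ℕ.∸ t ℕ.< suc k
    k∸< t = ℕ.s≤s (ℕₚ.m∸n≤m k t)
    cyclic : ∀ {i j} → i ℕ.< j → j ℕ.< k → Cyclic (letter i) (letter j)
    cyclic {i} {j} i<j j<k = distinct , not-next
      where
      i≤k = ℕₚ.<⇒≤ (ℕₚ.<-trans i<j j<k)
      less : k ℕ.∸ j ℕ.< k ℕ.∸ i
      less = ℕₚ.∸-monoʳ-< i<j (ℕₚ.<⇒≤ j<k)
      distinct : ¬ letter i ≡ letter j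
      distinct e = ℕₚ.<⇒≢ less (sym (+ₘ-injective m (k∸< i) (k∸< j) (trans (sym (letter≡ i≤k)) (trans e (letter≡ (ℕₚ.<⇒≤ j<k))))))
      not-next : ¬ letter j ≡ nxt (letter i)
      not-next e = wrap i eq
        where
        eq : m +ₘ (k ℕ.∸ j) ≡ m +ₘ suc (k ℕ.∸ i)
        eq = trans (sym (letter≡ (ℕₚ.<⇒≤ j<k))) (trans e (trans (cong nxt (letter≡ i≤k)) (nxt-+ₘ m (k ℕ.∸ i))))
        -- The offset can wrap around only for `i = 0`, where the successor of the letter is `m`
        -- itself; but every letter has an offset from `m` between 1 and `k`.
        wrap : ∀ i′ → m +ₘ (k ℕ.∸ j) ≡ m +ₘ suc (k ℕ.∸ i) → ⊥
        wrap _ eq with suc (k ℕ.∸ i) ℕ.<? suc k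
        ... | yes lt = ℕₚ.<⇒≢ (ℕₚ.<-trans less (ℕₚ.n<1+n _)) (+ₘ-injective m (k∸< j) lt eq)
        ... | no ¬lt = ℕₚ.<⇒≢ (ℕₚ.m<n⇒0<n∸m j<k) (sym (+ₘ-injective m (k∸< j) (ℕ.s≤s ℕ.z≤n)
                (trans eq (trans (cong (m +ₘ_) (ℕₚ.≤-antisym (ℕ.s≤s (ℕₚ.m∸n≤m k i)) (ℕₚ.≮⇒≥ ¬lt))) (trans (+ₘ-cycle m) (sym (+ₘ-identity m)))))))

  wordFrom-Spells : ∀ D m → mem D m ≡ false → Spells (wordFrom D m) D
  wordFrom-Spells D m m∉D = (λ p → proj₂ (∈-filter⁻ _ {xs = L} p)) , λ {x} p → ∈-filter⁺ _ (listed x p) p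
    where
    f : ℕ → Letter
    f t = (toℕ m ℕ.+ suc k ℕ.∸ t) mod suc k
    L = map f (map suc (upTo k))
    listed : ∀ x → mem D x ≡ true → x ∈ L
    listed x p with offset m x
    ... | zero , _ , refl with () ← trans (sym p) (trans (cong (mem D) (+ₘ-identity m)) m∉D)
    ... | suc t , t<n , refl = subst (_∈ L) (trans (cong (_mod suc k) (ℕₚ.+-∸-assoc (toℕ m) {suc k} {k ℕ.∸ t} (ℕₚ.≤-trans (ℕₚ.m∸n≤m k t) (ℕₚ.n≤1+n k)))) (cong (m +ₘ_) back))
        (∈-map⁺ f (subst (_∈ map suc (upTo k)) step≡ (∈-map⁺ suc (∈-upTo⁺ small))))
      where
      t<k : t ℕ.< k
      t<k = ℕₚ.≤-pred t<n
      back : suc k ℕ.∸ (k ℕ.∸ t) ≡ suc t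
      back = trans (ℕₚ.+-∸-assoc 1 (ℕₚ.m∸n≤m k t)) (cong suc (ℕₚ.m∸[m∸n]≡n (ℕₚ.<⇒≤ t<k)))
      step≡ : suc (k ℕ.∸ suc t) ≡ k ℕ.∸ t
      step≡ = trans (sym (ℕₚ.+-∸-assoc 1 t<k)) refl
      small : k ℕ.∸ suc t ℕ.< k
      small = ℕₚ.≤-trans (ℕₚ.≤-reflexive step≡) (ℕₚ.m∸n≤m k t)

  -- `uD` is built from the least letter outside `D`, but every cyclically decreasing word on `D`
  -- gives the same product. This frees the choice of the base point, which rotations and passes
  -- need.
  uD-word : ∀ D m w → mem D m ≡ false → CycDec w → Spells w D → uD D ≈ uw w
  uD-word D m w m∉D cw sw with uD-wordFrom k D m m∉D
  ... | m′ , m′∉D , e = ≈-trans (≈-reflexive e) (alg (cycDec-≅ (wordFrom D m′) w (wordFrom-CycDec D m′) cw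
          (spells-same {D = D} (wordFrom-Spells D m′ m′∉D) sw)))

  elements : ∀ {n} → Subset n → List (Fin n)
  elements Vec.[] = []
  elements (true Vec.∷ D) = fz ∷ map fs (elements D)
  elements (false Vec.∷ D) = map fs (elements D)

  length-elements : ∀ {n} (D : Subset n) → length (elements D) ≡ Data.Fin.Subset.∣ D ∣
  length-elements Vec.[] = refl
  length-elements (true Vec.∷ D) = cong suc (trans (length-map fs (elements D)) (length-elements D))
  length-elements (false Vec.∷ D) = trans (length-map fs (elements D)) (length-elements D)

  elements-∈ : ∀ {n} (D : Subset n) x → Vec.lookup D x ≡ true → x ∈ elements D
  elements-∈ (true Vec.∷ D) fz e = here refl
  elements-∈ (true Vec.∷ D) (fs x) e = there (∈-map⁺ fs (elements-∈ D x e))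
  elements-∈ (false Vec.∷ D) (fs x) e = ∈-map⁺ fs (elements-∈ D x e)

  ∈-elements : ∀ {n} (D : Subset n) {x} → x ∈ elements D → Vec.lookup D x ≡ true
  ∈-elements (true Vec.∷ D) (here refl) = refl
  ∈-elements (true Vec.∷ D) (there p) with ∈-map⁻ fs p
  ... | y , q , refl = ∈-elements D q
  ∈-elements (false Vec.∷ D) p with ∈-map⁻ fs p
  ... | y , q , refl = ∈-elements D q

  elements-unique : ∀ {n} (D : Subset n) → Unique (elements D)
  elements-unique Vec.[] = []
  elements-unique (true Vec.∷ D) = All.tabulate fresh ∷ Uniqueₚ.map⁺ suc-injective (elements-unique D)
    where
    fresh : ∀ {x} → x ∈ map fs (elements D) → ¬ fz ≡ x
    fresh p refl with ∈-map⁻ fs p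
    ... | _ , _ , ()
  elements-unique (false Vec.∷ D) = Uniqueₚ.map⁺ suc-injective (elements-unique D)

  length-spells : ∀ {w D} → Unique w → Spells w D → length w ≡ Data.Fin.Subset.∣ D ∣
  length-spells {w} {D} uq (a , b) = trans (↭-length (unique-↭ uq (elements-unique D) ((λ p → elements-∈ D _ (a p)) , (λ p → b (∈-elements D p))))) (length-elements D)

  subset-ext : ∀ {n} {D E : Subset n} → (∀ x → Vec.lookup D x ≡ Vec.lookup E x) → D ≡ E
  subset-ext {D = D} {E} e = trans (sym (Vecₚ.tabulate∘lookup D)) (trans (Vecₚ.tabulate-cong e) (Vecₚ.tabulate∘lookup E))

  allSubsets-complete : ∀ {n} (D : Subset n) → D ∈ allSubsets n
  allSubsets-complete Vec.[] = here refl
  allSubsets-complete {suc n} (false Vec.∷ D) = ∈-++⁺ˡ (∈-map⁺ (false Vec.∷_) (allSubsets-complete D))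
  allSubsets-complete {suc n} (true Vec.∷ D) = ∈-++⁺ʳ (map (false Vec.∷_) (allSubsets n)) (∈-map⁺ (true Vec.∷_) (allSubsets-complete D))

  allSubsets-unique : ∀ n → Unique (allSubsets n)
  allSubsets-unique zero = [] ∷ []
  allSubsets-unique (suc n) = Uniqueₚ.++⁺ (Uniqueₚ.map⁺ Vecₚ.∷-injectiveʳ (allSubsets-unique n)) (Uniqueₚ.map⁺ Vecₚ.∷-injectiveʳ (allSubsets-unique n)) disjoint
    where
    disjoint : ∀ {D} → D ∈ map (false Vec.∷_) (allSubsets n) × D ∈ map (true Vec.∷_) (allSubsets n) → ⊥
    disjoint (p , q) with ∈-map⁻ _ p | ∈-map⁻ _ q
    ... | _ , _ , refl | _ , _ , ()

  subsetsOf : ℕ → List (Subset (suc k))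
  subsetsOf i = filter (λ D → Data.Fin.Subset.∣ D ∣ ℕ.≟ i) (allSubsets (suc k))

  subsetsOf-unique : ∀ i → Unique (subsetsOf i)
  subsetsOf-unique i = Uniqueₚ.filter⁺ _ (allSubsets-unique (suc k))

  ∈-subsetsOf : ∀ {i D} → Data.Fin.Subset.∣ D ∣ ≡ i → D ∈ subsetsOf i
  ∈-subsetsOf e = ∈-filter⁺ _ (allSubsets-complete _) e

  subsetsOf-∈ : ∀ {i D} → D ∈ subsetsOf i → Data.Fin.Subset.∣ D ∣ ≡ i
  subsetsOf-∈ {i} p = proj₂ (∈-filter⁻ (λ D → Data.Fin.Subset.∣ D ∣ ℕ.≟ i) {xs = allSubsets (suc k)} p)

  Σ⊕-↭ : ∀ {xs ys : List (𝔸 k)} → xs ↭ ys → Σ⊕ xs ≈ Σ⊕ ys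
  Σ⊕-↭ Perm.refl = ≈-refl
  Σ⊕-↭ (Perm.prep x p) = ⊕-cong ≈-refl (Σ⊕-↭ p)
  Σ⊕-↭ (Perm.swap x y p) = ≈-trans (≈-sym (⊕-assoc _ _ _)) (≈-trans (⊕-cong (⊕-comm x y) (Σ⊕-↭ p)) (⊕-assoc _ _ _))
  Σ⊕-↭ (Perm.trans p q) = ≈-trans (Σ⊕-↭ p) (Σ⊕-↭ q)

  Σ⊕-cong : ∀ {a} {A : Set a} (xs : List A) {f g : A → 𝔸 k} → (∀ {x} → x ∈ xs → f x ≈ g x) → Σ⊕ (map f xs) ≈ Σ⊕ (map g xs)
  Σ⊕-cong [] e = ≈-refl
  Σ⊕-cong (x ∷ xs) e = ⊕-cong (e (here refl)) (Σ⊕-cong xs (λ p → e (there p)))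

  outside : ∀ {D : Subset (suc k)} → Data.Fin.Subset.∣ D ∣ ℕ.≤ k → ∃ λ m → mem D m ≡ false
  outside {D} le = go D le
    where
    go : ∀ {n} (D : Subset (suc n)) → Data.Fin.Subset.∣ D ∣ ℕ.≤ n → ∃ λ m → Vec.lookup D m ≡ false
    go (false Vec.∷ D) le = fz , refl
    go {suc n} (true Vec.∷ D) (ℕ.s≤s le) with go D le
    ... | m , e = fs m , e

  abstract
    fromMem : (Letter → Bool) → Subset (suc k)
    fromMem = Vec.tabulate

    mem-fromMem : ∀ f x → mem (fromMem f) x ≡ f x
    mem-fromMem = Vecₚ.lookup∘tabulate

  -- Membership of `x` is asked of `x - c`: the shift by `c * k` inverts the shift by `c`, because
  -- `c + c * k` is a multiple of `n`.
  rotD : ℕ → Subset (suc k) → Subset (suc k)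
  rotD c D = fromMem (λ x → mem D (x +ₘ (c ℕ.* k)))

  +ₘ-undo : ∀ (x : Letter) c → (x +ₘ c) +ₘ (c ℕ.* k) ≡ x
  +ₘ-undo x c = trans (+ₘ-+ₘ x c (c ℕ.* k)) (trans (cong (x +ₘ_) (sym (ℕₚ.*-suc c k))) (mult c))
    where
    mult : ∀ a → x +ₘ (a ℕ.* suc k) ≡ x
    mult zero = +ₘ-identity x
    mult (suc a) = trans (cong (x +ₘ_) (ℕₚ.+-comm (suc k) (a ℕ.* suc k))) (trans (+ₘ-period x (a ℕ.* suc k)) (mult a))

  rotD-mem : ∀ c D x → mem (rotD c D) (x +ₘ c) ≡ mem D x
  rotD-mem c D x = trans (mem-fromMem _ (x +ₘ c)) (cong (mem D) (+ₘ-undo x c))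

  unrot : ∀ c (x : Letter) → (x +ₘ (c ℕ.* k)) +ₘ c ≡ x
  unrot c x = trans (+ₘ-comm x (c ℕ.* k) c) (+ₘ-undo x c)

  rotD-spells : ∀ c {D w} → Spells w D → Spells (rotW c w) (rotD c D)
  rotD-spells c {D} {w} (a , b) = to , λ {x} p → subst (_∈ rotW c w) (unrot c x) (∈-map⁺ (_+ₘ c) (b (trans (sym (mem-fromMem _ x)) p)))
    where
    to : ∀ {x} → x ∈ rotW c w → mem (rotD c D) x ≡ true
    to p with ∈-map⁻ (_+ₘ c) p
    ... | y , q , refl = trans (rotD-mem c D y) (a q)

  rotW-CycDec : ∀ c {w} → CycDec w → CycDec (rotW c w)
  rotW-CycDec c cw = AllPairsₚ.map⁺ (AllPairs.map (λ {x} {z} (p , q) →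
    (λ e → p (+ₘ-cancelʳ x z e)) , (λ e → q (+ₘ-cancelʳ z (nxt x) (trans e (+ₘ-comm x c 1))))) cw)

  rotD-card : ∀ c D → Data.Fin.Subset.∣ rotD c D ∣ ≡ Data.Fin.Subset.∣ D ∣
  rotD-card c D = trans (sym (length-spells {D = rotD c D} (Uniqueₚ.map⁺ (λ {x} {y} → +ₘ-cancelʳ x y) (elements-unique D)) (rotD-spells c {D} ((λ p → ∈-elements D p) , elements-∈ D _))))
    (trans (length-map (_+ₘ c) (elements D)) (length-elements D))

  rotD-injective : ∀ c {D E} → rotD c D ≡ rotD c E → D ≡ E
  rotD-injective c {D} {E} e = subset-ext (λ x → trans (sym (rotD-mem c D x)) (trans (cong (λ z → mem z (x +ₘ c)) e) (rotD-mem c E x)))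

  rotD-surjective : ∀ c E → rotD c (fromMem (λ x → mem E (x +ₘ c))) ≡ E
  rotD-surjective c E = subset-ext λ x → trans (mem-fromMem _ x) (trans (mem-fromMem _ (x +ₘ (c ℕ.* k))) (cong (mem E) (unrot c x)))

  rot-uD : ∀ c D → Data.Fin.Subset.∣ D ∣ ℕ.≤ k → uD (rotD c D) ≈ rot c (uD D)
  rot-uD c D le with outside {D} le
  ... | m , m∉D = ≈-trans (uD-word (rotD c D) (m +ₘ c) (rotW c w) (trans (rotD-mem c D m) m∉D) (rotW-CycDec c (wordFrom-CycDec D m)) (rotD-spells c {D} (wordFrom-Spells D m m∉D)))
      (≈-trans (≈-reflexive (sym (rot-uw c w))) (rot-cong c (≈-sym (uD-word D m w m∉D (wordFrom-CycDec D m) (wordFrom-Spells D m m∉D)))))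
    where
    w = wordFrom D m

  rot-Σ⊕ : ∀ c {a} {A : Set a} (f : A → 𝔸 k) xs → rot c (Σ⊕ (map f xs)) ≡ Σ⊕ (map (λ x → rot c (f x)) xs)
  rot-Σ⊕ c f [] = refl
  rot-Σ⊕ c f (x ∷ xs) = cong (rot c (f x) ⊕_) (rot-Σ⊕ c f xs)

  -- Rotation permutes the subsets of size `i`, and a rotated cyclically decreasing word is again
  -- cyclically decreasing.
  rot-𝐡 : ∀ c {i} → i ℕ.≤ k → rot c (𝐡 k i) ≈ 𝐡 k i
  rot-𝐡 c {i} i≤k = begin
    rot c (Σ⊕ (map uD (subsetsOf i)))             ≈⟨ ≈-reflexive (rot-Σ⊕ c uD (subsetsOf i)) ⟩
    Σ⊕ (map (λ D → rot c (uD D)) (subsetsOf i))   ≈⟨ Σ⊕-cong (subsetsOf i) (λ {D} p → ≈-sym (rot-uD c D (subst (ℕ._≤ k) (sym (subsetsOf-∈ p)) i≤k))) ⟩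
    Σ⊕ (map (λ D → uD (rotD c D)) (subsetsOf i))  ≈⟨ ≈-reflexive (cong Σ⊕ (map-∘ (subsetsOf i))) ⟩
    Σ⊕ (map uD (map (rotD c) (subsetsOf i)))      ≈⟨ Σ⊕-↭ (↭-map⁺ uD (unique-↭ (Uniqueₚ.map⁺ (rotD-injective c) (subsetsOf-unique i)) (subsetsOf-unique i) (to , from))) ⟩
    Σ⊕ (map uD (subsetsOf i))                     ∎
    where
    open ≈-Reasoning
    to : ∀ {D} → D ∈ map (rotD c) (subsetsOf i) → D ∈ subsetsOf i
    to p with ∈-map⁻ (rotD c) p
    ... | E , q , refl = ∈-subsetsOf (trans (rotD-card c E) (subsetsOf-∈ q))
    from : ∀ {D} → D ∈ subsetsOf i → D ∈ map (rotD c) (subsetsOf i)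
    from {D} p = subst (_∈ map (rotD c) (subsetsOf i)) (rotD-surjective c D)
      (∈-map⁺ (rotD c) {x = E} (∈-subsetsOf (trans (sym (rotD-card c E)) (trans (cong Data.Fin.Subset.∣_∣ (rotD-surjective c D)) (subsetsOf-∈ p)))))
      where
      E = fromMem (λ x → mem D (x +ₘ c))

  -- The letters of D, read upwards from a position m outside D, act on b(m + t) - t as one pass of adjacent swaps: a
  -- carried value travels through the letters of D and is dropped, in exchange for a new one, at every other position.
  module Pass (D : Subset (suc k)) (m : Letter) (m∉D : mem D m ≡ false) where

    passWord : ℕ → Word
    passWord zero = []
    passWord (suc t) = if mem D (m +ₘ suc t) then (m +ₘ suc t) ∷ passWord t else passWord t

    passWord-true : ∀ {t} → mem D (m +ₘ suc t) ≡ true → passWord (suc t) ≡ (m +ₘ suc t) ∷ passWord t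
    passWord-true {t} e = cong (λ z → if z then (m +ₘ suc t) ∷ passWord t else passWord t) e

    passWord-false : ∀ {t} → mem D (m +ₘ suc t) ≡ false → passWord (suc t) ≡ passWord t
    passWord-false {t} e = cong (λ z → if z then (m +ₘ suc t) ∷ passWord t else passWord t) e

    bool-case : ∀ (b : Bool) → b ≡ true ⊎ b ≡ false
    bool-case true = inj₁ refl
    bool-case false = inj₂ refl

    passWord-∈ : ∀ t {x} → x ∈ passWord t → ∃ λ s → s ℕ.< t × x ≡ m +ₘ suc s × mem D x ≡ true
    passWord-∈ (suc t) p with bool-case (mem D (m +ₘ suc t))
    ... | inj₂ e with passWord-∈ t (subst (_ ∈_) (passWord-false e) p)
    ...   | s , s<t , rest = s , ℕₚ.m<n⇒m<1+n s<t , rest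
    passWord-∈ (suc t) p | inj₁ e with subst (_ ∈_) (passWord-true e) p
    ... | here refl = t , ℕₚ.n<1+n t , refl , e
    ... | there q with passWord-∈ t q
    ...   | s , s<t , rest = s , ℕₚ.m<n⇒m<1+n s<t , rest

    ∈-passWord : ∀ {s} t → s ℕ.< t → mem D (m +ₘ suc s) ≡ true → m +ₘ suc s ∈ passWord t
    ∈-passWord {s} (suc t) s<t e with s ℕ.≟ t
    ... | yes refl = subst (m +ₘ suc s ∈_) (sym (passWord-true e)) (here refl)
    ... | no s≢t with bool-case (mem D (m +ₘ suc t))
    ...   | inj₁ e′ = subst (m +ₘ suc s ∈_) (sym (passWord-true e′)) (there (∈-passWord t (ℕₚ.≤∧≢⇒< (ℕₚ.≤-pred s<t) s≢t) e))
    ...   | inj₂ e′ = subst (m +ₘ suc s ∈_) (sym (passWord-false e′)) (∈-passWord t (ℕₚ.≤∧≢⇒< (ℕₚ.≤-pred s<t) s≢t) e)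

    passWord-CycDec : ∀ t → t ℕ.≤ k → CycDec (passWord t)
    passWord-CycDec zero _ = []
    passWord-CycDec (suc t) le with bool-case (mem D (m +ₘ suc t))
    ... | inj₂ e = subst CycDec (sym (passWord-false e)) (passWord-CycDec t (ℕₚ.<⇒≤ le))
    ... | inj₁ e = subst CycDec (sym (passWord-true e)) (All.tabulate cyclic ∷ passWord-CycDec t (ℕₚ.<⇒≤ le))
      where
      cyclic : ∀ {z} → z ∈ passWord t → Cyclic (m +ₘ suc t) z
      cyclic p with passWord-∈ t p
      ... | s , s<t , refl , _ = (λ q → ℕₚ.<⇒≢ s<t (ℕₚ.suc-injective (sym (+ₘ-injective m (ℕ.s≤s le) s<n q)))) , not-next
        where
        s<n : suc s ℕ.< suc k
        s<n = ℕ.s≤s (ℕₚ.<-trans s<t le)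
        not-next : ¬ m +ₘ suc s ≡ nxt (m +ₘ suc t)
        not-next q with suc (suc t) ℕ.<? suc k
        ... | yes lt = ℕₚ.<⇒≢ (ℕₚ.<-trans s<t (ℕₚ.n<1+n t)) (ℕₚ.suc-injective (+ₘ-injective m s<n lt (trans q (nxt-+ₘ m (suc t)))))
        ... | no ¬lt with +ₘ-injective m s<n (ℕ.s≤s ℕ.z≤n) (trans q (trans (nxt-+ₘ m (suc t))
                (trans (cong (m +ₘ_) (ℕₚ.≤-antisym (ℕ.s≤s le) (ℕₚ.≮⇒≥ ¬lt))) (trans (+ₘ-cycle m) (sym (+ₘ-identity m))))))
        ...   | ()

    passWord-Spells : Spells (passWord k) D
    passWord-Spells = (λ p → proj₂ (proj₂ (proj₂ (passWord-∈ k p)))) , from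
      where
      from : ∀ {x} → mem D x ≡ true → x ∈ passWord k
      from {x} e with offset m x
      ... | zero , _ , refl with () ← trans (sym e) (trans (cong (mem D) (+ₘ-identity m)) m∉D)
      ... | suc t , lt , refl = ∈-passWord k (ℕₚ.≤-pred lt) e

    uD-passWord : uD D ≈ uw (passWord k)
    uD-passWord = uD-word D m (passWord k) m∉D (passWord-CycDec k ℕₚ.≤-refl) passWord-Spells

    length-passWord : length (passWord k) ≡ Data.Fin.Subset.∣ D ∣
    length-passWord = length-spells {D = D} (CycDec⇒Unique (passWord-CycDec k ℕₚ.≤-refl)) passWord-Spells

    module On (β : State) where

      -- Subtracting `t` absorbs the corrections by 1 in `swapAt`: in these coordinates a letter
      -- exchanges two neighbouring values unchanged.
      level : ℕ → ℤ
      level t = β ! (m +ₘ t) - pos t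

      carried : ℕ → ℤ
      carried zero = level 0
      carried (suc t) = if mem D (m +ₘ suc t) then carried t else level (suc t)

      carried-true : ∀ {t} → mem D (m +ₘ suc t) ≡ true → carried (suc t) ≡ carried t
      carried-true {t} e = cong (λ z → if z then carried t else level (suc t)) e

      carried-false : ∀ {t} → mem D (m +ₘ suc t) ≡ false → carried (suc t) ≡ level (suc t)
      carried-false {t} e = cong (λ z → if z then carried t else level (suc t)) e

      settled : ℕ → ℤ
      settled t = if mem D (m +ₘ suc t) then level (suc t) else carried t

      settled-true : ∀ {t} → mem D (m +ₘ suc t) ≡ true → settled t ≡ level (suc t)
      settled-true {t} e = cong (λ z → if z then level (suc t) else carried t) e

      settled-false : ∀ {t} → mem D (m +ₘ suc t) ≡ false → settled t ≡ carried t
      settled-false {t} e = cong (λ z → if z then level (suc t) else carried t) e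

      after : ℕ → State
      after t = run (passWord t) β

      after-true : ∀ {t} → mem D (m +ₘ suc t) ≡ true → after (suc t) ≡ swapAt (m +ₘ suc t) (after t)
      after-true e = cong (λ w → run w β) (passWord-true e)

      after-false : ∀ {t} → mem D (m +ₘ suc t) ≡ false → after (suc t) ≡ after t
      after-false e = cong (λ w → run w β) (passWord-false e)

      level-pos : ∀ t → level t + pos t ≡ β ! (m +ₘ t)
      level-pos t = e (β ! (m +ₘ t)) (pos t)
        where
        e : ∀ a t → a - t + t ≡ a
        e = solve-∀

      apart : ∀ {s t} → s ℕ.≤ k → t ℕ.≤ k → ¬ s ≡ t → ¬ m +ₘ s ≡ m +ₘ t
      apart s≤k t≤k s≢t e = s≢t (+ₘ-injective m (ℕ.s≤s s≤k) (ℕ.s≤s t≤k) e)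

      ahead : ∀ t x → t ℕ.< x → x ℕ.≤ k → after t ! (m +ₘ x) ≡ β ! (m +ₘ x)
      ahead zero x _ _ = refl
      ahead (suc t) x t<x x≤k with bool-case (mem D (m +ₘ suc t))
      ... | inj₂ e = trans (cong (_! (m +ₘ x)) (after-false e)) (ahead t x (ℕₚ.<-trans (ℕₚ.n<1+n t) t<x) x≤k)
      ... | inj₁ e = trans (cong (_! (m +ₘ x)) (after-true e)) (trans
            (swapAt-other (m +ₘ suc t) (after t)
              (apart x≤k (ℕₚ.<⇒≤ (ℕₚ.≤-trans t<x x≤k)) (λ q → ℕₚ.<⇒≢ t<x (sym q)))
              (λ q → apart x≤k (ℕₚ.<⇒≤ (ℕₚ.<-trans (ℕₚ.n<1+n t) (ℕₚ.≤-trans t<x x≤k))) (λ q → ℕₚ.<⇒≢ (ℕₚ.<-trans (ℕₚ.n<1+n t) t<x) (sym q)) (trans q (prv-+ₘ-suc m t))))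
            (ahead t x (ℕₚ.<-trans (ℕₚ.n<1+n t) t<x) x≤k))

      front : ∀ t → t ℕ.≤ k → after t ! (m +ₘ t) ≡ carried t + pos t
      front zero _ = sym (level-pos 0)
      front (suc t) le with bool-case (mem D (m +ₘ suc t))
      ... | inj₂ e = trans (cong (_! (m +ₘ suc t)) (after-false e)) (trans (ahead t (suc t) (ℕₚ.n<1+n t) le)
            (trans (sym (level-pos (suc t))) (cong (_+ pos (suc t)) (sym (carried-false e)))))
      ... | inj₁ e = trans (cong (_! (m +ₘ suc t)) (after-true e)) (trans (swapAt-at (m +ₘ suc t) (after t))
            (trans (cong (λ z → after t ! z + 1ℤ) (prv-+ₘ-suc m t)) (trans (cong (_+ 1ℤ) (front t (ℕₚ.<⇒≤ le)))
            (trans (e₁ (carried t) (pos t)) (cong (_+ (1ℤ + pos t)) (sym (carried-true e)))))))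
        where
        e₁ : ∀ c t → c + t + 1ℤ ≡ c + (1ℤ + t)
        e₁ = solve-∀

      behind : ∀ t x → x ℕ.< t → t ℕ.≤ k → after t ! (m +ₘ x) ≡ settled x + pos x
      behind (suc t) x x<t le with x ℕ.≟ t
      ... | yes refl with bool-case (mem D (m +ₘ suc t))
      ...   | inj₂ e = trans (cong (_! (m +ₘ t)) (after-false e)) (trans (front t (ℕₚ.<⇒≤ le)) (cong (_+ pos t) (sym (settled-false e))))
      ...   | inj₁ e = trans (cong₂ _!_ (after-true e) (sym (prv-+ₘ-suc m t))) (trans (swapAt-prv (m +ₘ suc t) (after t))
              (trans (cong (_- 1ℤ) (trans (ahead t (suc t) (ℕₚ.n<1+n t) le) (sym (level-pos (suc t)))))
              (trans (e₁ (level (suc t)) (pos t)) (cong (_+ pos t) (sym (settled-true e))))))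
        where
        e₁ : ∀ c t → c + (1ℤ + t) - 1ℤ ≡ c + t
        e₁ = solve-∀
      behind (suc t) x x<t le | no x≢t with bool-case (mem D (m +ₘ suc t))
      ... | inj₂ e = trans (cong (_! (m +ₘ x)) (after-false e)) (behind t x (ℕₚ.≤∧≢⇒< (ℕₚ.≤-pred x<t) x≢t) (ℕₚ.<⇒≤ le))
      ... | inj₁ e = trans (cong (_! (m +ₘ x)) (after-true e)) (trans
            (swapAt-other (m +ₘ suc t) (after t)
              (apart x≤k le (ℕₚ.<⇒≢ x<t))
              (λ q → apart x≤k (ℕₚ.<⇒≤ le) x≢t (trans q (prv-+ₘ-suc m t))))
            (behind t x (ℕₚ.≤∧≢⇒< (ℕₚ.≤-pred x<t) x≢t) (ℕₚ.<⇒≤ le)))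
        where
        x≤k : x ℕ.≤ k
        x≤k = ℕₚ.≤-trans (ℕₚ.<⇒≤ x<t) le

      Passes : Set
      Passes = ∀ t → t ℕ.< k → mem D (m +ₘ suc t) ≡ true → level (suc t) + 1ℤ ≤ carried t

      asc-letter : ∀ t → t ℕ.< k → Asc (m +ₘ suc t) (after t) → level (suc t) + 1ℤ ≤ carried t
      asc-letter t lt a = lin₁ 0 (subst₂ _≤_ (trans (ahead t (suc t) (ℕₚ.n<1+n t) lt) (sym (level-pos (suc t))))
          (trans (cong (after t !_) (prv-+ₘ-suc m t)) (front t (ℕₚ.<⇒≤ lt))) a) (e (level (suc t)) (carried t) (pos t))
        where
        e : ∀ l c t → c - (l + 1ℤ) ≡ (c + t - (l + (1ℤ + t))) + 0ℤ
        e = solve-∀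

      letter-asc : ∀ t → t ℕ.< k → level (suc t) + 1ℤ ≤ carried t → Asc (m +ₘ suc t) (after t)
      letter-asc t lt p = subst₂ _≤_ (sym (trans (ahead t (suc t) (ℕₚ.n<1+n t) lt) (sym (level-pos (suc t)))))
          (sym (trans (cong (after t !_) (prv-+ₘ-suc m t)) (front t (ℕₚ.<⇒≤ lt)))) (lin₁ 0 p (e (level (suc t)) (carried t) (pos t)))
        where
        e : ∀ l c t → c + t - (l + (1ℤ + t)) ≡ (c - (l + 1ℤ)) + 0ℤ
        e = solve-∀

      valid⇒passes : Valid (passWord k) β → Passes
      valid⇒passes v t lt e = asc-letter t lt (proj₁ (subst (λ w → Valid w β) (passWord-true e) (prefix k ℕₚ.≤-refl (suc t) lt v)))
        where
        prefix : ∀ s → s ℕ.≤ k → ∀ t → t ℕ.≤ s → Valid (passWord s) β → Valid (passWord t) β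
        prefix zero _ zero _ v = v
        prefix (suc s) le t t≤ v with t ℕ.≟ suc s
        ... | yes refl = v
        ... | no t≢ with bool-case (mem D (m +ₘ suc s))
        ...   | inj₁ e = prefix s (ℕₚ.<⇒≤ le) t (ℕₚ.≤-pred (ℕₚ.≤∧≢⇒< t≤ t≢)) (proj₂ (subst (λ w → Valid w β) (passWord-true e) v))
        ...   | inj₂ e = prefix s (ℕₚ.<⇒≤ le) t (ℕₚ.≤-pred (ℕₚ.≤∧≢⇒< t≤ t≢)) (subst (λ w → Valid w β) (passWord-false e) v)

      passes⇒valid : Passes → Valid (passWord k) β
      passes⇒valid p = build k ℕₚ.≤-refl
        where
        build : ∀ t → t ℕ.≤ k → Valid (passWord t) β
        build zero _ = tt
        build (suc t) le with bool-case (mem D (m +ₘ suc t))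
        ... | inj₁ e = subst (λ w → Valid w β) (sym (passWord-true e)) (letter-asc t le (p t le e) , build t (ℕₚ.<⇒≤ le))
        ... | inj₂ e = subst (λ w → Valid w β) (sym (passWord-false e)) (build t (ℕₚ.<⇒≤ le))

  -- The first row of a core as a strip

  card : Subset (suc k) → ℕ
  card D = Data.Fin.Subset.∣ D ∣

  _≼_ : Subset (suc k) → Subset (suc k) → Set
  D ≼ E = ∀ y → mem D y ≡ true → mem E y ≡ true

  ≼⇒⊆ : ∀ {D E} → D ≼ E → D ⊆ E
  ≼⇒⊆ {D} {E} h {x} p = lookup⇒[]= x E (h x ([]=⇒lookup p))

  card-mono : ∀ {D E} → D ≼ E → card D ℕ.≤ card E
  card-mono {D} {E} h = p⊆q⇒∣p∣≤∣q∣ {p = D} {E} (≼⇒⊆ {D} {E} h)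

  ≼-card-≡ : ∀ {D E} → D ≼ E → card D ≡ card E → D ≡ E
  ≼-card-≡ {D} {E} h e = subset-ext pointwise
    where
    pointwise : ∀ x → mem D x ≡ mem E x
    pointwise x with mem D x in d | mem E x in e′
    ... | true | true = refl
    ... | false | false = refl
    ... | true | false with () ← trans (sym (h x d)) e′
    ... | false | true = ⊥-elim (ℕₚ.<⇒≢ (p⊂q⇒∣p∣<∣q∣ {p = D} {E} (≼⇒⊆ {D} {E} h , x , lookup⇒[]= x E e′ , (λ p → false≢true (trans (sym d) ([]=⇒lookup p))))) e)
      where
      false≢true : ¬ false ≡ true
      false≢true ()

  card-nonempty : ∀ {D y} → mem D y ≡ true → 1 ℕ.≤ card D
  card-nonempty {D} {y} e with card D in c
  ... | suc _ = ℕ.s≤s ℕ.z≤n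
  ... | zero with elements D | elements-∈ D y e | trans (length-elements D) c
  ...   | [] | () | _

  argmax : ∀ {m} (f : Fin (suc m) → ℤ) → ∃ λ x → ∀ y → f y ≤ f x
  argmax {zero} f = fz , λ { fz → ≤-refl }
  argmax {suc m} f with argmax (λ x → f (fs x))
  ... | x , p with f fz ≤? f (fs x)
  ...   | yes q = fs x , λ { fz → q ; (fs y) → p y }
  ...   | no ¬q = fz , λ { fz → ≤-refl ; (fs y) → ≤-trans (p y) (<⇒≤ (≰⇒> ¬q)) }

  does-true : ∀ {a} {A : Set a} (d : Dec A) → A → does d ≡ true
  does-true (yes _) _ = refl
  does-true (no ¬p) p = ⊥-elim (¬p p)

  true-does : ∀ {a} {A : Set a} (d : Dec A) → does d ≡ true → A
  true-does (yes p) _ = p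

  does-false : ∀ {a} {A : Set a} (d : Dec A) → ¬ A → does d ≡ false
  does-false (yes p) ¬p = ⊥-elim (¬p p)
  does-false (no _) _ = refl

  false-does : ∀ {a} {A : Set a} (d : Dec A) → does d ≡ false → ¬ A
  false-does (no ¬p) _ = ¬p

  abstract
    top : State → Letter
    top b = proj₁ (argmax (b !_))

    top-max : ∀ b y → b ! y ≤ b ! top b
    top-max b = proj₂ (argmax (b !_))

  -- b(x) is the position of the last bead of residue x. The first row of the core corresponds to the largest such
  -- position; lowNext collects the x + 1 for which b(x) is smaller than it by at least n, and their number is the
  -- number of cells of the first row with hook length at most k.
  lowNext : State → Subset (suc k)
  lowNext b = fromMem (λ y → does (b ! prv y + N ≤? b ! top b))

  lowNext-true : ∀ b {y} → mem (lowNext b) y ≡ true → b ! prv y + N ≤ b ! top b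
  lowNext-true b {y} e = true-does (_ ≤? _) (trans (sym (mem-fromMem _ y)) e)

  true-lowNext : ∀ b {y} → b ! prv y + N ≤ b ! top b → mem (lowNext b) y ≡ true
  true-lowNext b {y} p = trans (mem-fromMem _ y) (does-true (_ ≤? _) p)

  lowNext-false : ∀ b {y} → mem (lowNext b) y ≡ false → ¬ b ! prv y + N ≤ b ! top b
  lowNext-false b {y} e = false-does (_ ≤? _) (trans (sym (mem-fromMem _ y)) e)

  false-lowNext : ∀ b {y} → ¬ b ! prv y + N ≤ b ! top b → mem (lowNext b) y ≡ false
  false-lowNext b {y} p = trans (mem-fromMem _ y) (does-false (_ ≤? _) p)

  1≤N : 1ℤ ≤ N
  1≤N = +≤+ (ℕ.s≤s ℕ.z≤n)

  nxt-top∉lowNext : ∀ b → mem (lowNext b) (nxt (top b)) ≡ false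
  nxt-top∉lowNext b = false-lowNext b λ p → 1+≤⇒≰ {b ! top b + N} {b ! top b} (+-monoʳ-≤ (b ! top b) 1≤N)
    (subst (λ z → b ! z + N ≤ b ! top b) (prv-nxt (top b)) p)

  pos-≤k+1 : ∀ {s} → s ℕ.≤ k → pos s + 1ℤ ≤ N
  pos-≤k+1 {s} s≤k = +≤+ (ℕₚ.≤-trans (ℕₚ.≤-reflexive (ℕₚ.+-comm s 1)) (ℕ.s≤s s≤k))

  -- Removing the first row of a core (all other rows move up by one).
  tail : State → State
  tail b = fromFun (λ y → if does (prv y ≟ top b) then b ! top b + 1ℤ - N else b ! prv y + 1ℤ)

  tail-top : ∀ b y → prv y ≡ top b → tail b ! y ≡ b ! top b + 1ℤ - N
  tail-top b y e = trans (fromFun-! _ y) (cong (λ z → if z then b ! top b + 1ℤ - N else b ! prv y + 1ℤ) (does-true (prv y ≟ top b) e))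

  tail-other : ∀ b y → ¬ prv y ≡ top b → tail b ! y ≡ b ! prv y + 1ℤ
  tail-other b y e = trans (fromFun-! _ y) (cong (λ z → if z then b ! top b + 1ℤ - N else b ! prv y + 1ℤ) (does-false (prv y ≟ top b) e))

  module _ {b : State} (core : IsCore b) where
    private
      x₀ = top b
      M = b ! x₀
      κ = tail b
      m = nxt x₀
    open Pass (lowNext b) m (nxt-top∉lowNext b)
    open On κ

    private
      -- The value of `κ` on runner `m`: the top runner of `b` without its last bead, moved up by
      -- one position.
      q : ℤ
      q = M + 1ℤ - N

      level-zero : level 0 ≡ q
      level-zero = trans (+-identityʳ (κ ! (m +ₘ 0))) (tail-top b (m +ₘ 0) (trans (cong prv (+ₘ-identity m)) (prv-nxt x₀)))

      m+ₘ≡ : ∀ s → m +ₘ s ≡ x₀ +ₘ suc s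
      m+ₘ≡ s = +ₘ-+ₘ x₀ 1 s

      level-suc : ∀ s → s ℕ.< k → level (suc s) ≡ b ! (m +ₘ s) - pos s
      level-suc s s<k = trans (cong (_- pos (suc s)) (trans (tail-other b (m +ₘ suc s) not-top) (cong (λ z → b ! z + 1ℤ) (prv-+ₘ-suc m s))))
          (e (b ! (m +ₘ s)) (pos s))
        where
        e : ∀ a s → a + 1ℤ - (1ℤ + s) ≡ a - s
        e = solve-∀
        not-top : ¬ prv (m +ₘ suc s) ≡ x₀
        not-top eq with +ₘ-injective x₀ (ℕ.s≤s s<k) (ℕ.s≤s ℕ.z≤n) (trans (sym (m+ₘ≡ s)) (trans (sym (prv-+ₘ-suc m s)) (trans eq (sym (+ₘ-identity x₀)))))
        ... | ()

      low : ∀ s → mem (lowNext b) (m +ₘ suc s) ≡ true → b ! (m +ₘ s) + N ≤ M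
      low s e = subst (λ z → b ! z + N ≤ M) (prv-+ₘ-suc m s) (lowNext-true b e)

      high : ∀ s → mem (lowNext b) (m +ₘ suc s) ≡ false → M + 1ℤ ≤ b ! (m +ₘ s) + N
      high s e = ≰⇒1+≤ (subst (λ z → ¬ b ! z + N ≤ M) (prv-+ₘ-suc m s) (lowNext-false b e))

      -- A bead less than `n` below the top lies in a window of length `n` and is fixed by its
      -- residue. Its level is `q`, so the pass drops and picks up equal values, and `carried` is
      -- constant.
      level-high : ∀ s → s ℕ.< k → mem (lowNext b) (m +ₘ suc s) ≡ false → b ! (m +ₘ s) ≡ q + pos s
      level-high s s<k e = ≡ₙ-close residue upper lower
        where
        residue : b ! (m +ₘ s) ≡ₙ q + pos s
        residue = ≡ₙ-trans (core (m +ₘ s)) (≡ₙ-trans (≡ₙ-reflexive (cong posF (m+ₘ≡ s))) (≡ₙ-trans (posF-+ₘ x₀ (suc s))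
          (≡ₙ-trans (≡ₙ-+ (pos (suc s)) (≡ₙ-sym (core x₀))) (modulo 1ℤ (e₁ M (pos s) N)))))
          where
          e₁ : ∀ M s N → M + (1ℤ + s) ≡ M + 1ℤ - N + s + 1ℤ * N
          e₁ = solve-∀
        upper : b ! (m +ₘ s) + 1ℤ ≤ q + pos s + N
        upper = lin₁ s (top-max b (m +ₘ s)) (e₂ (b ! (m +ₘ s)) M (pos s) N)
          where
          e₂ : ∀ a M s N → M + 1ℤ - N + s + N - (a + 1ℤ) ≡ (M - a) + s
          e₂ = solve-∀
        lower : q + pos s + 1ℤ ≤ b ! (m +ₘ s) + N
        lower = lin₂ 0 (high s e) (pos-≤k+1 (ℕₚ.<⇒≤ s<k)) (e₃ (b ! (m +ₘ s)) M (pos s) N)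
          where
          e₃ : ∀ a M s N → a + N - (M + 1ℤ - N + s + 1ℤ) ≡ (a + N - (M + 1ℤ)) + (N - (s + 1ℤ)) + pos 0
          e₃ = solve-∀

      carried-q : ∀ t → t ℕ.≤ k → carried t ≡ q
      carried-q zero _ = level-zero
      carried-q (suc t) le with bool-case (mem (lowNext b) (m +ₘ suc t))
      ... | inj₁ e = trans (carried-true e) (carried-q t (ℕₚ.<⇒≤ le))
      ... | inj₂ e = trans (carried-false e) (trans (level-suc t le) (trans (cong (_- pos t) (level-high t le e)) (e₁ q (pos t))))
        where
        e₁ : ∀ q t → q + t - t ≡ q
        e₁ = solve-∀

      settled-≡ : ∀ t → t ℕ.< k → settled t + pos t ≡ b ! (m +ₘ t)
      settled-≡ t t<k with bool-case (mem (lowNext b) (m +ₘ suc t))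
      ... | inj₁ e = trans (cong (_+ pos t) (trans (settled-true e) (level-suc t t<k))) (e₁ (b ! (m +ₘ t)) (pos t))
        where
        e₁ : ∀ a t → a - t + t ≡ a
        e₁ = solve-∀
      ... | inj₂ e = trans (cong (_+ pos t) (trans (settled-false e) (carried-q t (ℕₚ.<⇒≤ t<k)))) (sym (level-high t t<k e))

    tail-IsCore : IsCore κ
    tail-IsCore y with prv y ≟ x₀
    ... | yes e = ≡ₙ-trans (≡ₙ-reflexive (tail-top b y e)) (≡ₙ-trans (modulo (- 1ℤ) (e₁ M N)) (≡ₙ-trans (≡ₙ-+ 1ℤ (core x₀))
            (≡ₙ-trans (≡ₙ-reflexive (cong (λ z → posF z + 1ℤ) (sym e))) (posF-prv y))))
      where
      e₁ : ∀ M N → M + 1ℤ - N ≡ M + 1ℤ + - 1ℤ * N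
      e₁ = solve-∀
    ... | no ne = ≡ₙ-trans (≡ₙ-reflexive (tail-other b y ne)) (≡ₙ-trans (≡ₙ-+ 1ℤ (core (prv y))) (posF-prv y))

    firstRow-valid : Valid (passWord k) κ
    firstRow-valid = passes⇒valid λ t t<k e → lin₁ t (low t e) (trans (cong₂ (λ c l → c - (l + 1ℤ)) (carried-q t (ℕₚ.<⇒≤ t<k)) (level-suc t t<k))
        (e₁ M (b ! (m +ₘ t)) (pos t) N))
      where
      e₁ : ∀ M a t N → M + 1ℤ - N - (a - t + 1ℤ) ≡ M - (a + N) + t
      e₁ = solve-∀

    firstRow-run : run (passWord k) κ ≡ b
    firstRow-run = lookup-injective pointwise
      where
      last : after k ! (m +ₘ k) ≡ b ! (m +ₘ k)
      last = trans (front k ℕₚ.≤-refl) (trans (cong (_+ pos k) (carried-q k ℕₚ.≤-refl))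
        (trans (cong (λ z → M + 1ℤ - z + pos k) (pos-+ 1 k)) (trans (e₁ M (pos k)) (cong (b !_) (sym (prv-nxt x₀))))))
        where
        e₁ : ∀ M k → M + 1ℤ - (1ℤ + k) + k ≡ M
        e₁ = solve-∀
      pointwise : ∀ x → after k ! x ≡ b ! x
      pointwise x with offset m x
      ... | t , lt , refl with t ℕ.≟ k
      ...   | yes refl = last
      ...   | no t≢k = trans (behind k t t<k ℕₚ.≤-refl) (settled-≡ t t<k)
        where
        t<k : t ℕ.< k
        t<k = ℕₚ.≤∧≢⇒< (ℕₚ.≤-pred lt) t≢k

    lowNext-nonempty : ∀ {i} → Desc i b → 1 ℕ.≤ card (lowNext b)
    lowNext-nonempty {i} d = card-nonempty {lowNext b} (true-lowNext b {i} (lin₂ 1 gap (top-max b i) (e (b ! prv i) (b ! i) M N)))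
      where
      gap : b ! prv i + 1ℤ + N ≤ b ! i
      gap = ≡ₙ-gap (≡ₙ-trans (≡ₙ-+ 1ℤ (core (prv i))) (≡ₙ-trans (posF-prv i) (≡ₙ-sym (core i)))) (≤-trans (≤-reflexive (e₀ (b ! prv i))) d)
        where
        e₀ : ∀ a → a + 1ℤ + 1ℤ ≡ a + pos 2
        e₀ = solve-∀
      e : ∀ a c M N → M - (a + N) ≡ (c - (a + 1ℤ + N)) + (M - c) + pos 1
      e = solve-∀

  card-≤k : ∀ {D m} → mem D m ≡ false → card D ℕ.≤ k
  card-≤k {D} {m} m∉D = ℕₚ.≤-trans (ℕₚ.≤-reflexive (sym length-passWord)) (bounded k)
    where
    open Pass D m m∉D
    bounded : ∀ t → length (passWord t) ℕ.≤ t
    bounded zero = ℕ.z≤n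
    bounded (suc t) with bool-case (mem D (m +ₘ suc t))
    ... | inj₁ e = ℕₚ.≤-trans (ℕₚ.≤-reflexive (cong length (passWord-true e))) (ℕ.s≤s (bounded t))
    ... | inj₂ e = ℕₚ.≤-trans (ℕₚ.≤-reflexive (cong length (passWord-false e))) (ℕₚ.m≤n⇒m≤1+n (bounded t))

  module _ {κ : State} (core : IsCore κ) (D : Subset (suc k)) (m : Letter) (m∉D : mem D m ≡ false) where
    open Pass D m m∉D
    open On κ

    private
      level-residue : ∀ t → level t ≡ₙ posF m
      level-residue t = ≡ₙ-trans (≡ₙ-+ (- pos t) (≡ₙ-trans (core (m +ₘ t)) (posF-+ₘ m t))) (≡ₙ-reflexive (e (posF m) (pos t)))
        where
        e : ∀ a t → a + t - t ≡ a
        e = solve-∀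

      carried-residue : ∀ t → carried t ≡ₙ posF m
      carried-residue zero = level-residue 0
      carried-residue (suc t) with bool-case (mem D (m +ₘ suc t))
      ... | inj₁ e = ≡ₙ-trans (≡ₙ-reflexive (carried-true e)) (carried-residue t)
      ... | inj₂ e = ≡ₙ-trans (≡ₙ-reflexive (carried-false e)) (level-residue (suc t))

      gap : Passes → ∀ t → t ℕ.< k → mem D (m +ₘ suc t) ≡ true → level (suc t) + N ≤ carried t
      gap p t t<k e = ≡ₙ-gap (≡ₙ-trans (level-residue (suc t)) (≡ₙ-sym (carried-residue t))) (p t t<k e)

      -- The value carried past `t` is put down at some later position, at the latest at `k`, and is
      -- then visible in the final state.
      dropped : ∀ d t → t ℕ.+ d ≡ k → ∃ λ x → t ℕ.≤ x × after k ! (m +ₘ x) ≡ carried t + pos x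
      dropped zero t e = t , ℕₚ.≤-refl , subst (λ j → after j ! (m +ₘ t) ≡ carried t + pos t) t≡k (front t (ℕₚ.≤-reflexive t≡k))
        where
        t≡k : t ≡ k
        t≡k = trans (sym (ℕₚ.+-identityʳ t)) e
      dropped (suc d) t e with bool-case (mem D (m +ₘ suc t))
      ... | inj₂ f = t , ℕₚ.≤-refl , trans (behind k t t<k ℕₚ.≤-refl) (cong (_+ pos t) (settled-false f))
        where
        t<k : t ℕ.< k
        t<k = ℕₚ.≤-trans (ℕ.s≤s (ℕₚ.m≤m+n t d)) (ℕₚ.≤-reflexive (trans (sym (ℕₚ.+-suc t d)) e))
      ... | inj₁ f with dropped d (suc t) (trans (sym (ℕₚ.+-suc t d)) e)
      ...   | x , le , r = x , ℕₚ.≤-trans (ℕₚ.n≤1+n t) le , trans r (cong (_+ pos x) (carried-true f))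

    -- When a letter of `D` is passed, the value left behind is at least `n` below the carried one.
    -- The carried value is put down at a later position, so the largest bead of the new state is at
    -- least `n` above the one left behind.
    strip-≼-lowNext : Valid (passWord k) κ → D ≼ lowNext (run (passWord k) κ)
    strip-≼-lowNext v y y∈D with offset m y
    ... | zero , _ , refl with () ← trans (sym y∈D) (trans (cong (mem D) (+ₘ-identity m)) m∉D)
    ... | suc t , lt , refl with dropped (k ℕ.∸ t) t (ℕₚ.m+[n∸m]≡n (ℕₚ.<⇒≤ (ℕₚ.≤-pred lt)))
    ...   | x , t≤x , r = true-lowNext b′ (lin₃ 0 (gap (valid⇒passes v) t t<k y∈D) (top-max b′ (m +ₘ x)) (+≤+ t≤x)
          (trans (cong (λ z → b′ ! top b′ - (b′ ! z + N)) (prv-+ₘ-suc m t))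
            (trans (cong (λ z → b′ ! top b′ - (z + N)) (trans (behind k t t<k ℕₚ.≤-refl) (cong (_+ pos t) (settled-true y∈D))))
            (trans (e (b′ ! top b′) (carried t) (pos x) (pos t) (level (suc t)) N) (cong (λ z → (carried t - (level (suc t) + N)) + (b′ ! top b′ - z) + (pos x - pos t) + pos 0) (sym r))))))
      where
      b′ = run (passWord k) κ
      t<k : t ℕ.< k
      t<k = ℕₚ.≤-pred lt
      e : ∀ M c x t l N → M - (l + t + N) ≡ (c - (l + N)) + (M - (c + x)) + (x - t) + pos 0
      e = solve-∀

    -- If equality holds, all carried values coincide, so D consists of the positions with a smaller value.
    strip-lower : Valid (passWord k) κ → D ≡ lowNext (run (passWord k) κ) → nxt (top (run (passWord k) κ)) ≡ m →
      ∀ y → (mem D y ≡ true → κ ! y + 1ℤ ≤ κ ! m) × (κ ! y + 1ℤ ≤ κ ! m → mem D y ≡ true)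
    strip-lower v D≡ top≡ y with offset m y
    ... | zero , _ , refl = (λ e → ⊥-elim (false≢true (trans (sym (trans (cong (mem D) (+ₘ-identity m)) m∉D)) e)))
        , λ p → ⊥-elim (1+≤⇒≰ {κ ! m} {κ ! (m +ₘ 0)} p (≤-reflexive (cong (κ !_) (sym (+ₘ-identity m)))))
      where
      false≢true : ¬ false ≡ true
      false≢true ()
    ... | suc t , lt , refl = to , from
      where
      b′ = run (passWord k) κ
      M = b′ ! top b′
      q = carried k
      t<k : t ℕ.< k
      t<k = ℕₚ.≤-pred lt
      top-m : top b′ ≡ m +ₘ k
      top-m = trans (sym (prv-nxt (top b′))) (cong prv top≡)
      M≡ : M ≡ q + pos k
      M≡ = trans (cong (b′ !_) top-m) (front k ℕₚ.≤-refl)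
      carried-q : ∀ d t → t ℕ.+ d ≡ k → carried t ≡ q
      carried-q zero t e = cong carried (trans (sym (ℕₚ.+-identityʳ t)) e)
      carried-q (suc d) t e with bool-case (mem D (m +ₘ suc t))
      ... | inj₁ f = trans (sym (carried-true f)) (carried-q d (suc t) (trans (sym (ℕₚ.+-suc t d)) e))
      -- Outside `D`, which is `lowNext b′`, a last bead is less than `n` below the top. The value
      -- dropped here and the final value `q` are congruent and now closer than `n`, hence equal.
      ... | inj₂ f = ≡ₙ-close (≡ₙ-trans (carried-residue t) (≡ₙ-sym (carried-residue k)))
            (lin₂ 0 upper (+≤+ {0} {t} ℕ.z≤n) (trans (cong (λ z → q + z - (carried t + 1ℤ)) (pos-+ 1 k)) (e₁ q (carried t) (pos t) (pos k))))
            (lin₂ 0 lower (+≤+ t≤k) (e₂ q (carried t) (pos t) (pos k) N))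
        where
        t<k′ : t ℕ.< k
        t<k′ = ℕₚ.≤-trans (ℕ.s≤s (ℕₚ.m≤m+n t d)) (ℕₚ.≤-reflexive (trans (sym (ℕₚ.+-suc t d)) e))
        t≤k : t ℕ.≤ k
        t≤k = ℕₚ.<⇒≤ t<k′
        value : b′ ! (m +ₘ t) ≡ carried t + pos t
        value = trans (behind k t t<k′ ℕₚ.≤-refl) (cong (_+ pos t) (settled-false f))
        upper : carried t + pos t ≤ q + pos k
        upper = subst₂ _≤_ value M≡ (top-max b′ (m +ₘ t))
        lower : q + pos k + 1ℤ ≤ carried t + pos t + N
        lower = subst₂ (λ u v → v + 1ℤ ≤ u + N) value M≡ (≰⇒1+≤ (subst (λ z → ¬ b′ ! z + N ≤ M) (prv-+ₘ-suc m t)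
          (lowNext-false b′ (trans (cong (λ E → mem E (m +ₘ suc t)) (sym D≡)) f))))
        e₁ : ∀ q c t k → q + (1ℤ + k) - (c + 1ℤ) ≡ (q + k - (c + t)) + (t - 0ℤ) + pos 0
        e₁ = solve-∀
        e₂ : ∀ q c t k N → c + N - (q + 1ℤ) ≡ (c + t + N - (q + k + 1ℤ)) + (k - t) + pos 0
        e₂ = solve-∀
      carried≡ : ∀ t → t ℕ.≤ k → carried t ≡ q
      carried≡ t t≤k = carried-q (k ℕ.∸ t) t (ℕₚ.m+[n∸m]≡n t≤k)
      κm≡ : κ ! m ≡ q
      κm≡ = trans (cong (κ !_) (sym (+ₘ-identity m))) (trans (sym (+-identityʳ _)) (carried≡ 0 ℕ.z≤n))
      to : mem D (m +ₘ suc t) ≡ true → κ ! (m +ₘ suc t) + 1ℤ ≤ κ ! m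
      to e = lin₂ 0 (gap (valid⇒passes v) t t<k e) (pos-≤k+1 {suc t} t<k) (trans (cong₂ (λ u w → u - (w + 1ℤ)) (trans κm≡ (sym (carried≡ t (ℕₚ.<⇒≤ t<k)))) (sym (level-pos (suc t))))
          (e₁ (carried t) (level (suc t)) (pos (suc t)) N))
        where
        e₁ : ∀ c l s N → c - (l + s + 1ℤ) ≡ (c - (l + N)) + (N - (s + 1ℤ)) + pos 0
        e₁ = solve-∀
      from : κ ! (m +ₘ suc t) + 1ℤ ≤ κ ! m → mem D (m +ₘ suc t) ≡ true
      from p with bool-case (mem D (m +ₘ suc t))
      ... | inj₁ e = e
      ... | inj₂ e = ⊥-elim (1+≤⇒≰ {κ ! m} {κ ! (m +ₘ suc t)} p (lin₁ 0 (+≤+ {0} {suc t} ℕ.z≤n) (trans (cong₂ _-_ (trans (sym (level-pos (suc t))) (cong (_+ pos (suc t)) (trans (sym (carried-false e)) (carried≡ (suc t) t<k)))) κm≡) (e₁ q (pos (suc t))))))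
        where
        e₁ : ∀ q s → q + s - q ≡ (s - 0ℤ) + pos 0
        e₁ = solve-∀

  -- Beads of partitions

  Bound : Maybe ℕ → ℕ → Set
  Bound nothing x = ⊤
  Bound (just p) x = x ℕ.≤ p

  Part : Maybe ℕ → List ℕ → Set
  Part p [] = ⊤
  Part p (x ∷ xs) = Bound p x × 1 ℕ.≤ x × Part (just x) xs

  Positive : Maybe ℕ → Set
  Positive nothing = ⊤
  Positive (just p) = 1 ℕ.≤ p

  -- Row r of length x contributes the bead x - r + n; the rows beyond the end of the list have length 0.
  bead : ℕ → ℕ → ℤ
  bead r x = pos x + N - pos r

  Bead : ℕ → List ℕ → ℤ → Set
  Bead r [] y = y ≤ bead r 0
  Bead r (x ∷ xs) y = y ≡ bead r x ⊎ Bead (suc r) xs y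

  Under : Maybe ℕ → ℕ → ℤ → Set
  Under nothing r y = ⊤
  Under (just p) r y = y ≤ bead r p

  bead-suc : ∀ r x → bead r (suc x) ≡ bead r x + 1ℤ
  bead-suc r x = e (pos x) N (pos r)
    where
    e : ∀ x N r → 1ℤ + x + N - r ≡ x + N - r + 1ℤ
    e = solve-∀

  bead-row : ∀ r x → bead r x ≡ bead (suc r) x + 1ℤ
  bead-row r x = e (pos x) N (pos r)
    where
    e : ∀ x N r → x + N - r ≡ x + N - (1ℤ + r) + 1ℤ
    e = solve-∀

  bead-mono : ∀ r {x y} → x ℕ.≤ y → bead r x ≤ bead r y
  bead-mono r x≤y = +-monoˡ-≤ (- pos r) (+-monoˡ-≤ N (+≤+ x≤y))

  bead-cancel : ∀ r {x y} → bead r x ≤ bead r y → x ℕ.≤ y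
  bead-cancel r {x} {y} p = drop‿+≤+ (lin₁ 0 p (e (pos x) (pos y) N (pos r)))
    where
    e : ∀ x y N r → y - x ≡ (y + N - r - (x + N - r)) + 0ℤ
    e = solve-∀

  Bead-≤ : ∀ p r xs → Part (just p) xs → ∀ {y} → Bead r xs y → y ≤ bead r p
  Bead-≤ p r [] _ b = ≤-trans b (bead-mono r ℕ.z≤n)
  Bead-≤ p r (x ∷ xs) (x≤p , _ , part) (inj₁ refl) = bead-mono r x≤p
  Bead-≤ p r (x ∷ xs) (x≤p , _ , part) {y} (inj₂ b) = ≤-trans (Bead-≤ x (suc r) xs part b)
    (≤-trans (≤-trans (i≤i+j _ 1ℤ) (≤-reflexive (sym (bead-row r x)))) (bead-mono r x≤p))

  Bead-< : ∀ x r xs → Part (just x) xs → ∀ {y} → Bead (suc r) xs y → y + 1ℤ ≤ bead r x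
  Bead-< x r xs part b = ≤-trans (+-monoˡ-≤ 1ℤ (Bead-≤ x (suc r) xs part b)) (≤-reflexive (sym (bead-row r x)))

  bead-step≢ : ∀ {a b} → a + 1ℤ ≤ b → ¬ a ≡ b
  bead-step≢ p refl = 1+≤⇒≰ p ≤-refl

  content-residue : ∀ r j → pos (content k r j) ≡ₙ bead r j
  content-residue r j = ≡ₙ-trans (≡ₙ-sym (modulo (pos (s DivMod./ suc k)) (begin
      pos s ≡⟨ cong pos (DivMod.m≡m%n+[m/n]*n s (suc k)) ⟩
      pos (s DivMod.% suc k ℕ.+ s DivMod./ suc k ℕ.* suc k) ≡⟨ pos-+ (s DivMod.% suc k) _ ⟩
      pos (s DivMod.% suc k) + pos (s DivMod./ suc k ℕ.* suc k) ≡⟨ cong (pos (s DivMod.% suc k) +_) (pos-* (s DivMod./ suc k) (suc k)) ⟩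
      pos (s DivMod.% suc k) + pos (s DivMod./ suc k) * N ∎)))
    (modulo (pos r - 1ℤ) (begin
      pos (j ℕ.+ k ℕ.* r) ≡⟨ pos-+ j (k ℕ.* r) ⟩
      pos j + pos (k ℕ.* r) ≡⟨ cong (pos j +_) (pos-* k r) ⟩
      pos j + pos k * pos r ≡⟨ e (pos j) (pos k) (pos r) ⟩
      pos j + (1ℤ + pos k) - pos r + (pos r - 1ℤ) * (1ℤ + pos k) ≡⟨ cong (λ z → pos j + z - pos r + (pos r - 1ℤ) * z) (pos-+ 1 k) ⟨
      bead r j + (pos r - 1ℤ) * N ∎))
    where
    open ≡-Reasoning
    s = j ℕ.+ k ℕ.* r
    e : ∀ j k r → j + k * r ≡ j + (1ℤ + k) - r + (r - 1ℤ) * (1ℤ + k)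
    e = solve-∀

  content⇒residue : ∀ r j (i : Letter) → content k r j ≡ toℕ i → bead r j ≡ₙ posF i
  content⇒residue r j i e = ≡ₙ-trans (≡ₙ-sym (content-residue r j)) (≡ₙ-reflexive (cong pos e))

  residue⇒content : ∀ r j (i : Letter) → bead r j ≡ₙ posF i → content k r j ≡ toℕ i
  residue⇒content r j i e = +-injective (≡ₙ-close (≡ₙ-trans (content-residue r j) e) (below (content k r j) (toℕ i) (DivMod.m%n<n (j ℕ.+ k ℕ.* r) (suc k))) (below (toℕ i) (content k r j) (toℕ<n i)))
    where
    below : ∀ a c → a ℕ.< suc k → pos a + 1ℤ ≤ pos c + N
    below a c a<n = ≤-trans (+≤+ (ℕₚ.≤-trans (ℕₚ.≤-reflexive (ℕₚ.+-comm a 1)) a<n)) (≤-trans (≤-reflexive (sym (+-identityˡ N))) (+-monoˡ-≤ N (+≤+ {0} {c} ℕ.z≤n)))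

  isFree : Maybe ℕ → ℕ → Bool
  isFree nothing x = true
  isFree (just p) x = x ℕ.<ᵇ p

  module Adding (i : Letter) where

    addsAt : Maybe ℕ → ℕ → ℕ → Bool
    addsAt p r x = isFree p x ∧ (content k r (suc x) ℕ.≡ᵇ toℕ i)

    abstract
      add : Maybe ℕ → ℕ → List ℕ → List ℕ
      add = addFrom k (toℕ i)

      hasAdd : Maybe ℕ → ℕ → List ℕ → Bool
      hasAdd = hasAddableFrom k (toℕ i)

      add-[] : ∀ p r → add p r [] ≡ (if addsAt p r 0 then 1 ∷ [] else [])
      add-[] nothing r = refl
      add-[] (just p) r = refl

      add-∷ : ∀ p r x xs → add p r (x ∷ xs) ≡ (if addsAt p r x then suc x else x) ∷ add (just x) (suc r) xs
      add-∷ nothing r x xs = refl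
      add-∷ (just p) r x xs = refl

      hasAdd-[] : ∀ p r → hasAdd p r [] ≡ addsAt p r 0
      hasAdd-[] nothing r = refl
      hasAdd-[] (just p) r = refl

      hasAdd-∷ : ∀ p r x xs → hasAdd p r (x ∷ xs) ≡ addsAt p r x ∨ hasAdd (just x) (suc r) xs
      hasAdd-∷ nothing r x xs = refl
      hasAdd-∷ (just p) r x xs = refl

      HasAddable≡ : ∀ ν → HasAddable k i ν ≡ hasAdd nothing 1 ν
      HasAddable≡ = HasAddable-unfold k i

      act≡ : ∀ ν → HasAddable k i ν ≡ true → act k i ν ≡ add nothing 1 ν
      act≡ = act-unfold k i

    ∧-true : ∀ {a b} → a ∧ b ≡ true → a ≡ true × b ≡ true
    ∧-true {true} {true} _ = refl , refl

    ≡ᵇ-true : ∀ m n → (m ℕ.≡ᵇ n) ≡ true → m ≡ n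
    ≡ᵇ-true m n e = ℕₚ.≡ᵇ⇒≡ m n (subst T (sym e) tt)

    true-≡ᵇ : ∀ m n → m ≡ n → (m ℕ.≡ᵇ n) ≡ true
    true-≡ᵇ m n e with m ℕ.≡ᵇ n | ℕₚ.≡⇒≡ᵇ m n e
    ... | true | _ = refl

    <ᵇ-true : ∀ m n → (m ℕ.<ᵇ n) ≡ true → m ℕ.< n
    <ᵇ-true m n e = ℕₚ.<ᵇ⇒< m n (subst T (sym e) tt)

    true-<ᵇ : ∀ m n → m ℕ.< n → (m ℕ.<ᵇ n) ≡ true
    true-<ᵇ m n e with m ℕ.<ᵇ n | ℕₚ.<⇒<ᵇ e
    ... | true | _ = refl

    add-part : ∀ p p′ r xs → (∀ {x} → Bound p x → Bound p′ x) → Positive p → Part p xs → Part p′ (add p r xs)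
    add-part p p′ r [] mono posp _ rewrite add-[] p r with addsAt p r 0
    ... | true = mono (one p posp) , ℕ.s≤s ℕ.z≤n , tt
      where
      one : ∀ p → Positive p → Bound p 1
      one nothing _ = tt
      one (just p) q = q
    ... | false = tt
    add-part p p′ r (x ∷ xs) mono posp (bx , 1≤x , part) rewrite add-∷ p r x xs with addsAt p r x in eq
    ... | true = mono (free p (proj₁ (∧-true eq))) , ℕ.s≤s ℕ.z≤n , add-part (just x) (just (suc x)) (suc r) xs (λ q → ℕₚ.m≤n⇒m≤1+n q) 1≤x part
      where
      free : ∀ p → isFree p x ≡ true → Bound p (suc x)
      free nothing _ = tt
      free (just p) q = <ᵇ-true x p q
    ... | false = mono bx , 1≤x , add-part (just x) (just x) (suc r) xs (λ q → q) 1≤x part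

    -- `G` is the bead set of the whole partition and stays fixed while the recursion descends the
    -- rows; `Agrees` ties it to the rows that remain. Addability becomes a question about `G`
    -- alone: the next position has residue `i` and is vacant.
    module Local (G : ℤ → Set) where

      Adds : ℤ → Set
      Adds y = y + 1ℤ ≡ₙ posF i × ¬ G (y + 1ℤ)

      PrevG : Maybe ℕ → ℕ → Set
      PrevG nothing r = ⊤
      PrevG (just p) r = G (bead r p + 1ℤ)

      Agrees : Maybe ℕ → ℕ → List ℕ → Set
      Agrees p r xs = ∀ y → Under p r y → (G y → Bead r xs y) × (Bead r xs y → G y)

      NewBead : ℕ → List ℕ → ℤ → Set
      NewBead r xs y = ∃ λ y₀ → Bead r xs y₀ × ((Adds y₀ × y ≡ y₀ + 1ℤ) ⊎ (¬ Adds y₀ × y ≡ y₀))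

      adds⇒ : ∀ p r x → (Under p r (bead r x + 1ℤ) → ¬ G (bead r x + 1ℤ)) → addsAt p r x ≡ true → Adds (bead r x)
      adds⇒ p r x none e = subst (_≡ₙ posF i) (bead-suc r x) (content⇒residue r (suc x) i (≡ᵇ-true _ _ (proj₂ (∧-true e))))
        , none (under p (proj₁ (∧-true e)))
        where
        under : ∀ p → isFree p x ≡ true → Under p r (bead r x + 1ℤ)
        under nothing _ = tt
        under (just p) q = subst (_≤ bead r p) (bead-suc r x) (bead-mono r (<ᵇ-true x p q))

      adds⇐ : ∀ p r x → Bound p x → PrevG p r → Adds (bead r x) → addsAt p r x ≡ true
      adds⇐ p r x bx prev (res , ¬g) = both p bx prev
        where
        c : (content k r (suc x) ℕ.≡ᵇ toℕ i) ≡ true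
        c = true-≡ᵇ _ _ (residue⇒content r (suc x) i (subst (_≡ₙ posF i) (sym (bead-suc r x)) res))
        both : ∀ p → Bound p x → PrevG p r → isFree p x ∧ (content k r (suc x) ℕ.≡ᵇ toℕ i) ≡ true
        both nothing _ _ = c
        both (just p) x≤p g with x ℕ.≟ p
        ... | yes refl = ⊥-elim (¬g g)
        ... | no x≢p = cong₂ _∧_ (true-<ᵇ x p (ℕₚ.≤∧≢⇒< x≤p x≢p)) c

      agrees-tail : ∀ p r x xs → Part p (x ∷ xs) → Agrees p r (x ∷ xs) → Agrees (just x) (suc r) xs
      agrees-tail p r x xs (bx , 1≤x , part) agree y y≤ = to , λ b → proj₂ (agree y (under p bx)) (inj₂ b)
        where
        y+1≤ : y + 1ℤ ≤ bead r x
        y+1≤ = ≤-trans (+-monoˡ-≤ 1ℤ y≤) (≤-reflexive (sym (bead-row r x)))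
        under : ∀ p → Bound p x → Under p r y
        under nothing _ = tt
        under (just p) x≤p = ≤-trans (≤-trans (i≤i+j y 1ℤ) y+1≤) (bead-mono r x≤p)
        to : G y → Bead (suc r) xs y
        to g with proj₁ (agree y (under p bx)) g
        ... | inj₁ e = ⊥-elim (bead-step≢ y+1≤ e)
        ... | inj₂ b = b

      prev-tail : ∀ p r x xs → Part p (x ∷ xs) → Agrees p r (x ∷ xs) → PrevG (just x) (suc r)
      prev-tail p r x xs (bx , _) agree = subst G (bead-row r x) (proj₂ (agree (bead r x) (under p bx)) (inj₁ refl))
        where
        under : ∀ p → Bound p x → Under p r (bead r x)
        under nothing _ = tt
        under (just p) x≤p = bead-mono r x≤p

      above-none : ∀ p r x xs → Part p (x ∷ xs) → Agrees p r (x ∷ xs) → Under p r (bead r x + 1ℤ) → ¬ G (bead r x + 1ℤ)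
      above-none p r x xs (_ , _ , part) agree un g with proj₁ (agree _ un) g
      ... | inj₁ e = bead-step≢ ≤-refl (sym e)
      ... | inj₂ b = 1+≤⇒≰ (Bead-< x r xs part b) (≤-trans (i≤i+j _ 1ℤ) ≤-refl)

      above-none-[] : ∀ p r → Agrees p r [] → Under p r (bead r 0 + 1ℤ) → ¬ G (bead r 0 + 1ℤ)
      above-none-[] p r agree un g = 1+≤⇒≰ {bead r 0 + 1ℤ} {bead r 0} ≤-refl (proj₁ (agree _ un) g)

      -- Among the rows of length 0 only the first can receive a box: for a later one the next
      -- position is the bead of the empty row before it.
      below-[] : ∀ p r y → Positive p → Agrees p r [] → y ≤ bead r 0 → ¬ y ≡ bead r 0 → ¬ Adds y
      below-[] p r y posp agree y≤ y≢ (_ , ¬g) = ¬g (proj₂ (agree (y + 1ℤ) (under p posp)) y+1≤)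
        where
        y+1≤ : y + 1ℤ ≤ bead r 0
        y+1≤ = ≤-trans (≤-reflexive (+-comm y 1ℤ)) (i<j⇒suc[i]≤j (≤∧≢⇒< y≤ y≢))
        under : ∀ p → Positive p → Under p r (y + 1ℤ)
        under nothing _ = tt
        under (just p) _ = ≤-trans y+1≤ (bead-mono r ℕ.z≤n)

      bound-zero : ∀ p → Bound p 0
      bound-zero nothing = tt
      bound-zero (just p) = ℕ.z≤n

      -- `add` compares each row with the old length of the row before it, so all movable beads move
      -- at once, and whether a bead moves refers to the old set `G`.
      add-bead⇒ : ∀ p r xs → Positive p → Part p xs → PrevG p r → Agrees p r xs → ∀ {y} → Bead r (add p r xs) y → NewBead r xs y
      add-bead⇒ p r [] posp part prev agree {y} b rewrite add-[] p r with addsAt p r 0 in eq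
      add-bead⇒ p r [] posp part prev agree {y} (inj₁ e) | true = bead r 0 , ≤-refl , inj₁ (adds⇒ p r 0 (above-none-[] p r agree) eq , trans e (bead-suc r 0))
      add-bead⇒ p r [] posp part prev agree {y} (inj₂ b) | true = y , y≤ , inj₂ (below-[] p r y posp agree y≤ (bead-step≢ y+1≤) , refl)
        where
        y+1≤ : y + 1ℤ ≤ bead r 0
        y+1≤ = ≤-trans (+-monoˡ-≤ 1ℤ b) (≤-reflexive (sym (bead-row r 0)))
        y≤ : y ≤ bead r 0
        y≤ = ≤-trans (i≤i+j y 1ℤ) y+1≤
      add-bead⇒ p r [] posp part prev agree {y} b | false = y , b , inj₂ (stays , refl)
        where
        stays : ¬ Adds y
        stays a with y Data.Integer.≟ bead r 0
        ... | yes refl with () ← trans (sym (adds⇐ p r 0 (bound-zero p) prev a)) eq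
        ... | no y≢ = below-[] p r y posp agree b y≢ a
      add-bead⇒ p r (x ∷ xs) posp part@(bx , 1≤x , part′) prev agree b rewrite add-∷ p r x xs with addsAt p r x in eq
      add-bead⇒ p r (x ∷ xs) posp part@(bx , 1≤x , part′) prev agree (inj₁ e) | true =
        bead r x , inj₁ refl , inj₁ (adds⇒ p r x (above-none p r x xs part agree) eq , trans e (bead-suc r x))
      add-bead⇒ p r (x ∷ xs) posp part@(bx , 1≤x , part′) prev agree (inj₁ e) | false =
        bead r x , inj₁ refl , inj₂ ((λ a → true≢false (trans (sym (adds⇐ p r x bx prev a)) eq)) , e)
        where
        true≢false : ¬ true ≡ false
        true≢false ()
      add-bead⇒ p r (x ∷ xs) posp part@(bx , 1≤x , part′) prev agree (inj₂ b) | _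
        with add-bead⇒ (just x) (suc r) xs 1≤x part′ (prev-tail p r x xs part agree) (agrees-tail p r x xs part agree) b
      ... | y₀ , b₀ , rest = y₀ , inj₂ b₀ , rest

      add-bead⇐ : ∀ p r xs → Positive p → Part p xs → PrevG p r → Agrees p r xs → ∀ {y} → NewBead r xs y → Bead r (add p r xs) y
      add-bead⇐ p r [] posp part prev agree {y} (y₀ , b₀ , move) rewrite add-[] p r with addsAt p r 0 in eq | y₀ Data.Integer.≟ bead r 0 | move
      ... | true | yes refl | inj₁ (a , e) = inj₁ (trans e (sym (bead-suc r 0)))
      ... | true | yes refl | inj₂ (¬a , e) = ⊥-elim (¬a (adds⇒ p r 0 (above-none-[] p r agree) eq))
      ... | _ | no ne | inj₁ (a , e) = ⊥-elim (below-[] p r y₀ posp agree b₀ ne a)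
      ... | true | no ne | inj₂ (¬a , refl) = inj₂ (lin₁ 0 (≤-trans (≤-reflexive (+-comm y₀ 1ℤ)) (i<j⇒suc[i]≤j (≤∧≢⇒< b₀ ne)))
            (trans (e₁ (bead (suc r) 0) y₀) (cong (λ z → z - (y₀ + 1ℤ) + 0ℤ) (sym (bead-row r 0)))))
        where
        e₁ : ∀ b y → b - y ≡ b + 1ℤ - (y + 1ℤ) + 0ℤ
        e₁ = solve-∀
      ... | false | yes refl | inj₁ (a , e) with () ← trans (sym (adds⇐ p r 0 (bound-zero p) prev a)) eq
      add-bead⇐ p r [] posp part prev agree {y} (y₀ , b₀ , move) | false | yes _ | inj₂ (¬a , refl) = b₀
      add-bead⇐ p r [] posp part prev agree {y} (y₀ , b₀ , move) | false | no _ | inj₂ (¬a , refl) = b₀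
      add-bead⇐ p r (x ∷ xs) posp part@(bx , 1≤x , part′) prev agree (y₀ , inj₂ b₀ , move) rewrite add-∷ p r x xs =
        inj₂ (add-bead⇐ (just x) (suc r) xs 1≤x part′ (prev-tail p r x xs part agree) (agrees-tail p r x xs part agree) (y₀ , b₀ , move))
      add-bead⇐ p r (x ∷ xs) posp part@(bx , 1≤x , part′) prev agree (y₀ , inj₁ refl , move) rewrite add-∷ p r x xs with addsAt p r x in eq | move
      ... | true | inj₁ (a , e) = inj₁ (trans e (sym (bead-suc r x)))
      ... | true | inj₂ (¬a , e) = ⊥-elim (¬a (adds⇒ p r x (above-none p r x xs part agree) eq))
      ... | false | inj₂ (¬a , e) = inj₁ e
      ... | false | inj₁ (a , e) with () ← trans (sym (adds⇐ p r x bx prev a)) eq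

      hasAdd⇒ : ∀ p r xs → Positive p → Part p xs → Agrees p r xs → hasAdd p r xs ≡ true → ∃ λ y → Bead r xs y × Adds y
      hasAdd⇒ p r [] posp part agree e = bead r 0 , ≤-refl , adds⇒ p r 0 (above-none-[] p r agree) (trans (sym (hasAdd-[] p r)) e)
      hasAdd⇒ p r (x ∷ xs) posp part@(bx , 1≤x , part′) agree e with addsAt p r x in eq
      ... | true = bead r x , inj₁ refl , adds⇒ p r x (above-none p r x xs part agree) eq
      ... | false with hasAdd⇒ (just x) (suc r) xs 1≤x part′ (agrees-tail p r x xs part agree) (trans (sym (trans (hasAdd-∷ p r x xs) (cong (_∨ hasAdd (just x) (suc r) xs) eq))) e)
      ...   | y , b , a = y , inj₂ b , a

      hasAdd⇐ : ∀ p r xs → Positive p → Part p xs → PrevG p r → Agrees p r xs → ∀ {y} → Bead r xs y → Adds y → hasAdd p r xs ≡ true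
      hasAdd⇐ p r [] posp part prev agree {y} b a with y Data.Integer.≟ bead r 0
      ... | yes refl = trans (hasAdd-[] p r) (adds⇐ p r 0 (bound-zero p) prev a)
      ... | no ne = ⊥-elim (below-[] p r y posp agree b ne a)
      hasAdd⇐ p r (x ∷ xs) posp part@(bx , 1≤x , part′) prev agree (inj₁ refl) a =
        trans (hasAdd-∷ p r x xs) (cong (_∨ hasAdd (just x) (suc r) xs) (adds⇐ p r x bx prev a))
      hasAdd⇐ p r (x ∷ xs) posp part@(bx , 1≤x , part′) prev agree (inj₂ b) a = trans (hasAdd-∷ p r x xs) (trans
        (cong (addsAt p r x ∨_) (hasAdd⇐ (just x) (suc r) xs 1≤x part′ (prev-tail p r x xs part agree) (agrees-tail p r x xs part agree) b a)) (or-true (addsAt p r x)))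
        where
        or-true : ∀ t → t ∨ true ≡ true
        or-true true = refl
        or-true false = refl

  -- Every runner is filled without gaps up to `b ! x` and is empty beyond: the abacus form of being
  -- a core.
  Represents : List ℕ → State → Set
  Represents ν b = ∀ x y → y ≡ₙ posF x → (Bead 1 ν y → y ≤ b ! x) × (y ≤ b ! x → Bead 1 ν y)

  residue : ∀ y → ∃ λ x → y ≡ₙ posF x
  residue y = fromℕ< r<n , ≡ₙ-trans (modulo (y ℤDivMod./ℕ suc k) (ℤDivMod.a≡a%ℕn+[a/ℕn]*n y (suc k))) (≡ₙ-reflexive (cong pos (sym (toℕ-fromℕ< r<n))))
    where
    r<n : y ℤDivMod.%ℕ suc k ℕ.< suc k
    r<n = ℤDivMod.n%ℕd<d y (suc k)

  ≡ₙ-unique : ∀ {y x x′} → y ≡ₙ posF x → y ≡ₙ posF x′ → x ≡ x′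
  ≡ₙ-unique e e′ = posF-injectiveₙ (≡ₙ-trans (≡ₙ-sym e) e′)

  pred-residue : ∀ {y i} → y + 1ℤ ≡ₙ posF i → y ≡ₙ posF (prv i)
  pred-residue {y} {i} e = ≡ₙ-trans (≡ₙ-reflexive (e₁ y)) (≡ₙ-trans (≡ₙ-+ (- 1ℤ) (≡ₙ-trans e (≡ₙ-sym (posF-prv i)))) (≡ₙ-reflexive (e₂ (posF (prv i)))))
    where
    e₁ : ∀ y → y ≡ y + 1ℤ - 1ℤ
    e₁ = solve-∀
    e₂ : ∀ y → y + 1ℤ - 1ℤ ≡ y
    e₂ = solve-∀

  succ-residue : ∀ {y i} → y ≡ₙ posF (prv i) → y + 1ℤ ≡ₙ posF i
  succ-residue {y} {i} e = ≡ₙ-trans (≡ₙ-+ 1ℤ e) (posF-prv i)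

  coreStart-represents : Represents [] coreStart
  coreStart-represents x y e = (λ b → ≤-trans (to b) (≤-reflexive (sym (fromFun-! posF x)))) , λ p → from (≤-trans p (≤-reflexive (fromFun-! posF x)))
    where
    to : y ≤ 0ℤ + N - 1ℤ → y ≤ posF x
    to b with y ≤? posF x
    ... | yes p = p
    ... | no ¬p = ⊥-elim (1+≤⇒≰ (lin₂ 0 (≡ₙ-gap (≡ₙ-sym e) (≰⇒1+≤ ¬p)) (+≤+ {0} {toℕ x} ℕ.z≤n) (e₁ y (posF x) N)) b)
      where
      e₁ : ∀ y x N → y - (0ℤ + N - 1ℤ + 1ℤ) ≡ (y - (x + N)) + (x - 0ℤ) + 0ℤ
      e₁ = solve-∀
    from : y ≤ posF x → y ≤ 0ℤ + N - 1ℤ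
    from p = lin₂ 0 p (posF-+1≤N x) (e₁ y (posF x) N)
      where
      e₁ : ∀ y x N → 0ℤ + N - 1ℤ - y ≡ (x - y) + (N - (x + 1ℤ)) + 0ℤ
      e₁ = solve-∀

  module Step (i : Letter) {ν : List ℕ} {b : State} (core : IsCore b) (part : Part nothing ν) (rep : Represents ν b) where
    open Adding i
    G : ℤ → Set
    G = Bead 1 ν
    open Local G

    agrees : Agrees nothing 1 ν
    agrees y _ = (λ g → g) , (λ g → g)

    G? : ∀ y → Dec (G y)
    G? y with residue y
    ... | x , e with y ≤? b ! x
    ...   | yes p = yes (proj₂ (rep x y e) p)
    ...   | no ¬p = no (λ g → ¬p (proj₁ (rep x y e) g))

    adds⇒asc : ∀ {y} → G y → Adds y → Asc i b
    adds⇒asc {y} g (res , ¬g) = lin₂ 0 (proj₁ (rep (prv i) y (pred-residue res)) g) (≰⇒1+≤ (λ p → ¬g (proj₂ (rep i (y + 1ℤ) res) p))) (e (b ! i) (b ! prv i) y)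
      where
      e : ∀ B A y → A - B ≡ (A - y) + (y + 1ℤ - (B + 1ℤ)) + 0ℤ
      e = solve-∀

    asc⇒adds : Asc i b → G (b ! prv i) × Adds (b ! prv i)
    asc⇒adds a = proj₂ (rep (prv i) (b ! prv i) (core (prv i))) ≤-refl , succ-residue (core (prv i))
      , λ g → 1+≤⇒≰ {b ! prv i + 1ℤ} {b ! prv i} ≤-refl (≤-trans (proj₁ (rep i _ (succ-residue (core (prv i)))) g) a)

    addable⇒asc : HasAddable k i ν ≡ true → Asc i b
    addable⇒asc e with hasAdd⇒ nothing 1 ν tt part agrees (trans (sym (HasAddable≡ ν)) e)
    ... | y , g , a = adds⇒asc g a

    asc⇒addable : Asc i b → HasAddable k i ν ≡ true
    asc⇒addable a = trans (HasAddable≡ ν) (hasAdd⇐ nothing 1 ν tt part tt agrees (proj₁ (asc⇒adds a)) (proj₂ (asc⇒adds a)))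

    act-part : Asc i b → Part nothing (act k i ν)
    act-part a = subst (Part nothing) (sym (act≡ ν (asc⇒addable a))) (add-part nothing nothing 1 ν (λ q → q) tt part)

    act-represents : Asc i b → Represents (act k i ν) (swapAt i b)
    act-represents a = subst (λ μ → Represents μ (swapAt i b)) (sym (act≡ ν (asc⇒addable a)))
        (λ x y e → (λ g → to x y e (add-bead⇒ nothing 1 ν tt part tt agrees g)) , (λ p → add-bead⇐ nothing 1 ν tt part tt agrees (from x y e p)))
      where
      to : ∀ x y → y ≡ₙ posF x → NewBead 1 ν y → y ≤ swapAt i b ! x
      to x y e (y₀ , g , inj₁ (ad , refl)) with ≡ₙ-unique e (proj₁ ad)
      ... | refl = ≤-trans (+-monoˡ-≤ 1ℤ (proj₁ (rep (prv i) y₀ (pred-residue (proj₁ ad))) g)) (≤-reflexive (sym (swapAt-at i b)))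
      to x y e (y₀ , g , inj₂ (¬ad , refl)) with x ≟ i
      ... | yes refl = ≤-trans (proj₁ (rep x y e) g) (≤-trans a (≤-trans (i≤i+j _ 1ℤ) (≤-reflexive (sym (swapAt-at i b)))))
      ... | no x≢i with x ≟ prv i
      ...   | no x≢p = ≤-trans (proj₁ (rep x y e) g) (≤-reflexive (sym (swapAt-other i b x≢i x≢p)))
      -- A bead of residue `prv i` stays only if `y + 1` is occupied. That position has residue `i`,
      -- so `y + 1 ≤ b ! i`, which is the new bound on this runner.
      ...   | yes refl with G? (y + 1ℤ)
      ...     | no ¬g = ⊥-elim (¬ad (succ-residue e , ¬g))
      ...     | yes g′ = ≤-trans (lin₁ 0 (proj₁ (rep i (y + 1ℤ) (succ-residue e)) g′) (e₁ (b ! i) y)) (≤-reflexive (sym (swapAt-prv i b)))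
        where
        e₁ : ∀ B y → B - 1ℤ - y ≡ (B - (y + 1ℤ)) + 0ℤ
        e₁ = solve-∀
      from : ∀ x y → y ≡ₙ posF x → y ≤ swapAt i b ! x → NewBead 1 ν y
      from x y e p with x ≟ i
      ... | yes refl with G? y
      ...   | yes g = y , g , inj₂ ((λ (res , _) → prv≢ 1≤k i (sym (≡ₙ-unique e (pred-residue res)))) , refl)
      ...   | no ¬g = y - 1ℤ , proj₂ (rep (prv i) (y - 1ℤ) (pred-residue res)) (lin₁ 0 (≤-trans p (≤-reflexive (swapAt-at i b))) (e₁ (b ! prv i) y))
              , inj₁ ((res , subst (λ z → ¬ G z) (e₂ y) ¬g) , e₂ y)
        where
        e₁ : ∀ A y → A - (y - 1ℤ) ≡ (A + 1ℤ - y) + 0ℤ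
        e₁ = solve-∀
        e₂ : ∀ y → y ≡ y - 1ℤ + 1ℤ
        e₂ = solve-∀
        res : y - 1ℤ + 1ℤ ≡ₙ posF i
        res = ≡ₙ-trans (≡ₙ-reflexive (sym (e₂ y))) e
      from x y e p | no x≢i with x ≟ prv i
      ... | no x≢p = y , proj₂ (rep x y e) (≤-trans p (≤-reflexive (swapAt-other i b x≢i x≢p)))
            , inj₂ ((λ (res , _) → x≢p (≡ₙ-unique e (pred-residue res))) , refl)
      ... | yes refl = y , proj₂ (rep (prv i) y e) (≤-trans (i≤i+j y 1ℤ) (≤-trans y+1≤ a))
            , inj₂ ((λ (_ , ¬g) → ¬g (proj₂ (rep i (y + 1ℤ) (succ-residue e)) y+1≤)) , refl)
        where
        y+1≤ : y + 1ℤ ≤ b ! i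
        y+1≤ = lin₁ 0 (≤-trans p (≤-reflexive (swapAt-prv i b))) (e₁ (b ! i) y)
          where
          e₁ : ∀ B y → B - (y + 1ℤ) ≡ (B - 1ℤ - y) + 0ℤ
          e₁ = solve-∀

  valid-represents : ∀ w → Valid w coreStart → Part nothing (actW k w) × Represents (actW k w) (run w coreStart)
  valid-represents [] _ = tt , coreStart-represents
  valid-represents (i ∷ w) (a , v) with valid-represents w v
  ... | part , rep = act-part a , act-represents a
    where open Step i (run-IsCore w coreStart-IsCore) part rep

  valid⇒builds : ∀ w → Valid w coreStart → Builds k w
  valid⇒builds [] _ = tt
  valid⇒builds (i ∷ w) (a , v) = valid⇒builds w v , subst T (sym (asc⇒addable a)) tt
    where open Step i (run-IsCore w coreStart-IsCore) (proj₁ (valid-represents w v)) (proj₂ (valid-represents w v))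

  builds⇒valid : ∀ w → Builds k w → Valid w coreStart
  builds⇒valid [] _ = tt
  builds⇒valid (i ∷ w) (bw , t) = addable⇒asc (true-T t) , v
    where
    v = builds⇒valid w bw
    open Step i (run-IsCore w coreStart-IsCore) (proj₁ (valid-represents w v)) (proj₂ (valid-represents w v))
    true-T : ∀ {x} → T x → x ≡ true
    true-T {true} _ = refl

  represents-state : ∀ {ν b b′} → IsCore b → IsCore b′ → Represents ν b → Represents ν b′ → b ≡ b′
  represents-state {b = b} {b′} core core′ rep rep′ = lookup-injective λ x → ≤-antisym
    (proj₁ (rep′ x (b ! x) (core x)) (proj₂ (rep x (b ! x) (core x)) ≤-refl))
    (proj₁ (rep x (b′ ! x) (core′ x)) (proj₂ (rep′ x (b′ ! x) (core′ x)) ≤-refl))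

  beads-list : ∀ p p′ r ν ν′ → Part p ν → Part p′ ν′ → (∀ y → Bead r ν y → Bead r ν′ y) → (∀ y → Bead r ν′ y → Bead r ν y) → ν ≡ ν′
  beads-list p p′ r [] [] _ _ _ _ = refl
  beads-list p p′ r [] (x ∷ xs) _ (_ , 1≤x , _) f g = ⊥-elim (ℕₚ.1+n≰n (ℕₚ.≤-trans 1≤x (bead-cancel r (g (bead r x) (inj₁ refl)))))
  beads-list p p′ r (x ∷ xs) [] (_ , 1≤x , _) _ f g = ⊥-elim (ℕₚ.1+n≰n (ℕₚ.≤-trans 1≤x (bead-cancel r (f (bead r x) (inj₁ refl)))))
  beads-list p p′ r (x ∷ xs) (x′ ∷ xs′) (_ , _ , part) (_ , _ , part′) f g with heads
    where
    upper : ∀ {x x′ xs′} → Part (just x′) xs′ → Bead r (x′ ∷ xs′) (bead r x) → x ℕ.≤ x′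
    upper {x} part (inj₁ e) = bead-cancel r (≤-reflexive e)
    upper {x} {x′} {xs′} part (inj₂ b) = bead-cancel r (≤-trans (i≤i+j _ 1ℤ) (Bead-< x′ r xs′ part b))
    heads : x ≡ x′
    heads = ℕₚ.≤-antisym (upper part′ (f _ (inj₁ refl))) (upper part (g _ (inj₁ refl)))
  ... | refl = cong (x ∷_) (beads-list (just x) (just x) (suc r) xs xs′ part part′ (λ y b → strip part f b) (λ y b → strip part′ g b))
    where
    strip : ∀ {xs xs′ y} → Part (just x) xs → (∀ y → Bead r (x ∷ xs) y → Bead r (x ∷ xs′) y) → Bead (suc r) xs y → Bead (suc r) xs′ y
    strip {xs} {xs′} {y} part f b with f y (inj₂ b)
    ... | inj₂ b′ = b′
    ... | inj₁ e = ⊥-elim (bead-step≢ (Bead-< x r xs part b) e)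

  represents-list : ∀ {ν ν′ b} → Part nothing ν → Part nothing ν′ → Represents ν b → Represents ν′ b → ν ≡ ν′
  represents-list {ν} {ν′} part part′ rep rep′ = beads-list nothing nothing 1 ν ν′ part part′ (move rep rep′) (move rep′ rep)
    where
    move : ∀ {ν ν′ b} → Represents ν b → Represents ν′ b → ∀ y → Bead 1 ν y → Bead 1 ν′ y
    move rep rep′ y g with residue y
    ... | x , e = proj₂ (rep′ x y e) (proj₁ (rep x y e) g)

  -- Bounded partitions

  colLen-≤ : ∀ {x j} xs → j ℕ.≤ x → colLen (x ∷ xs) j ≡ suc (colLen xs j)
  colLen-≤ {x} {j} xs p = cong length (filter-accept (j ℕ.≤?_) {x} {xs} p)

  colLen-> : ∀ {x j} xs → ¬ j ℕ.≤ x → colLen (x ∷ xs) j ≡ colLen xs j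
  colLen-> {x} {j} xs p = cong length (filter-reject (j ℕ.≤?_) {x} {xs} p)

  colLen-zero : ∀ {p j} xs → Part (just p) xs → p ℕ.< j → colLen xs j ≡ 0
  colLen-zero [] _ _ = refl
  colLen-zero (x ∷ xs) (x≤p , _ , part) p<j = trans (colLen-> xs (λ j≤x → ℕₚ.1+n≰n (ℕₚ.≤-trans p<j (ℕₚ.≤-trans j≤x x≤p))))
    (colLen-zero xs part (ℕₚ.≤-<-trans x≤p p<j))

  colLen-anti : ∀ {j j′} xs → j ℕ.≤ j′ → colLen xs j′ ℕ.≤ colLen xs j
  colLen-anti [] _ = ℕ.z≤n
  colLen-anti {j} {j′} (x ∷ xs) le with j′ ℕ.≤? x
  ... | no ¬p = ℕₚ.≤-trans (ℕₚ.≤-trans (ℕₚ.≤-reflexive (colLen-> {x} {j′} xs ¬p)) (colLen-anti xs le)) (more (j ℕ.≤? x))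
    where
    more : Dec (j ℕ.≤ x) → colLen xs j ℕ.≤ colLen (x ∷ xs) j
    more (yes q) = ℕₚ.≤-trans (ℕₚ.n≤1+n _) (ℕₚ.≤-reflexive (sym (colLen-≤ xs q)))
    more (no q) = ℕₚ.≤-reflexive (sym (colLen-> xs q))
  ... | yes p = ℕₚ.≤-trans (ℕₚ.≤-reflexive (colLen-≤ xs p)) (ℕₚ.≤-trans (ℕ.s≤s (colLen-anti xs le)) (ℕₚ.≤-reflexive (sym (colLen-≤ xs (ℕₚ.≤-trans le p)))))

  rowHook : ℕ → List ℕ → ℕ → ℕ
  rowHook x xs j = (x ℕ.∸ j) ℕ.+ colLen xs j ℕ.+ 1

  module Count {P : ℕ → Set} (P? : Decidable P) where
    count : ℕ → ℕ
    count x = length (filter P? (map suc (upTo x)))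

    count-suc : ∀ x → count (suc x) ≡ count x ℕ.+ length (filter P? (suc x ∷ []))
    count-suc x = begin
      length (filter P? (map suc (upTo (suc x)))) ≡⟨ cong (λ l → length (filter P? (map suc l))) (applyUpTo-∷ʳ (λ t → t) x) ⟨
      length (filter P? (map suc (upTo x ++ x ∷ []))) ≡⟨ cong (λ l → length (filter P? l)) (map-++ suc (upTo x) (x ∷ [])) ⟩
      length (filter P? (map suc (upTo x) ++ suc x ∷ [])) ≡⟨ cong length (filter-++ P? (map suc (upTo x)) (suc x ∷ [])) ⟩
      length (filter P? (map suc (upTo x)) ++ filter P? (suc x ∷ [])) ≡⟨ length-++ (filter P? (map suc (upTo x))) ⟩
      count x ℕ.+ length (filter P? (suc x ∷ [])) ∎
      where open ≡-Reasoning

    count-yes : ∀ x → P (suc x) → count (suc x) ≡ suc (count x)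
    count-yes x p = trans (count-suc x) (trans (cong (λ l → count x ℕ.+ length l) (filter-accept P? {suc x} {[]} p)) (ℕₚ.+-comm (count x) 1))

    count-no : ∀ x → ¬ P (suc x) → count (suc x) ≡ count x
    count-no x p = trans (count-suc x) (trans (cong (λ l → count x ℕ.+ length l) (filter-reject P? {suc x} {[]} p)) (ℕₚ.+-identityʳ (count x)))

    count-≤ : ∀ x → count x ℕ.≤ x
    count-≤ zero = ℕ.z≤n
    count-≤ (suc x) with P? (suc x)
    ... | yes p = ℕₚ.≤-trans (ℕₚ.≤-reflexive (count-yes x p)) (ℕ.s≤s (count-≤ x))
    ... | no ¬p = ℕₚ.≤-trans (ℕₚ.≤-reflexive (count-no x ¬p)) (ℕₚ.m≤n⇒m≤1+n (count-≤ x))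

    -- A predicate that persists to the right holds on a final segment of the row, so its number of
    -- solutions tells where the segment begins. It is applied to short hooks, which shrink along a
    -- row.
    threshold : ∀ x → (∀ j → 1 ℕ.≤ j → j ℕ.< x → P j → P (suc j)) →
      ∀ j → 1 ℕ.≤ j → j ℕ.≤ x → (P j → x ℕ.< j ℕ.+ count x) × (x ℕ.< j ℕ.+ count x → P j)
    threshold zero up j 1≤j j≤0 with () ← ℕₚ.≤-trans 1≤j j≤0
    threshold (suc x) up j 1≤j j≤x with P? (suc x)
    ... | yes p rewrite count-yes x p with j ℕ.≟ suc x
    ...   | yes refl = (λ _ → ℕₚ.≤-trans (ℕ.s≤s (ℕ.s≤s (ℕₚ.m≤m+n x (count x)))) (ℕₚ.≤-reflexive (cong suc (sym (ℕₚ.+-suc x (count x)))))) , λ _ → p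
    ...   | no j≢ with threshold x (λ j a b → up j a (ℕₚ.m<n⇒m<1+n b)) j 1≤j (ℕₚ.≤-pred (ℕₚ.≤∧≢⇒< j≤x j≢))
    ...     | to , from = (λ q → ℕₚ.≤-trans (ℕ.s≤s (to q)) (ℕₚ.≤-reflexive (sym (ℕₚ.+-suc j (count x)))))
                        , λ q → from (ℕₚ.≤-pred (ℕₚ.≤-trans q (ℕₚ.≤-reflexive (ℕₚ.+-suc j (count x)))))
    threshold (suc x) up j 1≤j j≤x | no ¬p = (λ q → ⊥-elim (¬p (climb (suc x ℕ.∸ j) j 1≤j (ℕₚ.m+[n∸m]≡n j≤x) q)))
        , λ q → ⊥-elim (ℕₚ.1+n≰n (ℕₚ.≤-trans q (ℕₚ.≤-trans (ℕₚ.≤-reflexive (trans (cong (j ℕ.+_) (trans (count-no x ¬p) none)) (ℕₚ.+-identityʳ j))) j≤x)))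
      where
      climb : ∀ d j → 1 ℕ.≤ j → j ℕ.+ d ≡ suc x → P j → P (suc x)
      climb zero j _ e q = subst P (trans (sym (ℕₚ.+-identityʳ j)) e) q
      climb (suc d) j 1≤j e q = climb d (suc j) (ℕ.s≤s ℕ.z≤n) (trans (sym (ℕₚ.+-suc j d)) e)
        (up j 1≤j (ℕₚ.≤-trans (ℕ.s≤s (ℕₚ.m≤m+n j d)) (ℕₚ.≤-reflexive (trans (sym (ℕₚ.+-suc j d)) e))) q)
      none : count x ≡ 0
      none with x ℕ.≟ 0
      ... | yes refl = refl
      ... | no x≢0 with count x in c
      ...   | zero = refl
      ...   | suc t = ⊥-elim (¬p (up x 1≤x (ℕₚ.n<1+n x) (proj₂ (threshold x (λ j a b → up j a (ℕₚ.m<n⇒m<1+n b)) x 1≤x ℕₚ.≤-refl)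
                (ℕₚ.≤-trans (ℕₚ.m<m+n x {suc t} (ℕ.s≤s ℕ.z≤n)) (ℕₚ.≤-reflexive (cong (x ℕ.+_) (sym c)))))))
        where
        1≤x : 1 ℕ.≤ x
        1≤x = ℕₚ.n≢0⇒n>0 x≢0

  count-cong : ∀ {P Q : ℕ → Set} (P? : Decidable P) (Q? : Decidable Q) x → (∀ j → 1 ℕ.≤ j → j ℕ.≤ x → (P j → Q j) × (Q j → P j)) →
    Count.count P? x ≡ Count.count Q? x
  count-cong P? Q? zero _ = refl
  count-cong P? Q? (suc x) e with P? (suc x) | count-cong P? Q? x (λ j a b → e j a (ℕₚ.m≤n⇒m≤1+n b))
  ... | yes p | ih = trans (Count.count-yes P? x p) (trans (cong suc ih) (sym (Count.count-yes Q? x (proj₁ (e (suc x) (ℕ.s≤s ℕ.z≤n) ℕₚ.≤-refl) p))))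
  ... | no ¬p | ih = trans (Count.count-no P? x ¬p) (trans ih (sym (Count.count-no Q? x (λ q → ¬p (proj₂ (e (suc x) (ℕ.s≤s ℕ.z≤n) ℕₚ.≤-refl) q)))))

  short? : ∀ x xs → Decidable (λ j → rowHook x xs j ℕ.≤ k)
  short? x xs j = rowHook x xs j ℕ.≤? k

  cells : ℕ → List ℕ → ℕ
  cells x xs = Count.count (short? x xs) x

  rows : List ℕ → List ℕ
  rows [] = []
  rows (x ∷ xs) = cells x xs ∷ rows xs

  rowHook-anti : ∀ x xs {j j′} → j ℕ.≤ j′ → rowHook x xs j′ ℕ.≤ rowHook x xs j
  rowHook-anti x xs le = ℕₚ.+-monoˡ-≤ 1 (ℕₚ.+-mono-≤ (ℕₚ.∸-monoʳ-≤ x le) (colLen-anti xs le))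

  cells-threshold : ∀ x xs j → 1 ℕ.≤ j → j ℕ.≤ x → (rowHook x xs j ℕ.≤ k → x ℕ.< j ℕ.+ cells x xs) × (x ℕ.< j ℕ.+ cells x xs → rowHook x xs j ℕ.≤ k)
  cells-threshold x xs = Count.threshold (short? x xs) x (λ j _ _ p → ℕₚ.≤-trans (rowHook-anti x xs (ℕₚ.n≤1+n j)) p)

  hook≡ : ∀ ν x xs r j → j ℕ.≤ x → colLen ν j ≡ r ℕ.+ colLen (x ∷ xs) j → hook ν (suc r) x j ≡ rowHook x xs j
  hook≡ ν x xs r j j≤x e = cong (λ z → (x ℕ.∸ j) ℕ.+ z ℕ.+ 1) (begin
    colLen ν j ℕ.∸ suc r ≡⟨ cong (ℕ._∸ suc r) (trans e (cong (r ℕ.+_) (colLen-≤ xs j≤x))) ⟩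
    r ℕ.+ suc (colLen xs j) ℕ.∸ suc r ≡⟨ cong (ℕ._∸ suc r) (ℕₚ.+-suc r (colLen xs j)) ⟩
    r ℕ.+ colLen xs j ℕ.∸ r ≡⟨ ℕₚ.m+n∸m≡n r (colLen xs j) ⟩
    colLen xs j ∎)
    where open ≡-Reasoning

  cellsUpTo≡ : ∀ ν x xs r → (∀ j → 1 ℕ.≤ j → j ℕ.≤ x → colLen ν j ≡ r ℕ.+ colLen (x ∷ xs) j) → cellsUpTo k ν (suc r) x ≡ cells x xs
  cellsUpTo≡ ν x xs r e = count-cong (λ j → hook ν (suc r) x j ℕ.≤? k) (short? x xs) x λ j 1≤j j≤x →
    subst (ℕ._≤ k) (hook≡ ν x xs r j j≤x (e j 1≤j j≤x)) , subst (ℕ._≤ k) (sym (hook≡ ν x xs r j j≤x (e j 1≤j j≤x)))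

  boundedFrom≡ : ∀ p ν r xs → Part p xs → (∀ j → 1 ℕ.≤ j → Bound p j → colLen ν j ≡ r ℕ.+ colLen xs j) → boundedFrom k ν (suc r) xs ≡ rows xs
  boundedFrom≡ p ν r [] _ _ = refl
  boundedFrom≡ p ν r (x ∷ xs) (bx , _ , part) e = cong₂ _∷_ (cellsUpTo≡ ν x xs r (λ j a b → e j a (bound p b bx)))
      (boundedFrom≡ (just x) ν (suc r) xs part (λ j a b → trans (e j a (bound p b bx)) (trans (cong (r ℕ.+_) (colLen-≤ xs b)) (ℕₚ.+-suc r (colLen xs j)))))
    where
    bound : ∀ p {j} → j ℕ.≤ x → Bound p x → Bound p j
    bound nothing _ _ = tt
    bound (just p) j≤x x≤p = ℕₚ.≤-trans j≤x x≤p

  boundedPartition≡ : ∀ ν → Part nothing ν → boundedPartition k ν ≡ filter (1 ℕ.≤?_) (rows ν)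
  boundedPartition≡ [] _ = refl
  boundedPartition≡ (x ∷ xs) part = trans (boundedPartition-unfold k x xs) (cong (filter (1 ℕ.≤?_))
    (cong₂ _∷_ (cellsUpTo≡ (x ∷ xs) x xs 0 (λ _ _ _ → refl)) (boundedFrom≡ (just x) (x ∷ xs) 1 xs (proj₂ (proj₂ part)) (λ j _ b → colLen-≤ xs b))))

  -- The hook condition for cores: no hook has length `n`. Hooks that grow in steps of at most one
  -- then cannot become long without passing through `n`.
  Clean : List ℕ → Set
  Clean [] = ⊤
  Clean (x ∷ xs) = (∀ j → 1 ℕ.≤ j → j ℕ.≤ x → ¬ rowHook x xs j ≡ suc k) × Clean xs

  ≤n∧≢ : ∀ {h} → h ℕ.≤ suc k → ¬ h ≡ suc k → h ℕ.≤ k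
  ≤n∧≢ le ne = ℕₚ.≤-pred (ℕₚ.≤∧≢⇒< le ne)

  rowHook-end : ∀ x xs → rowHook x xs x ≡ suc (colLen xs x)
  rowHook-end x xs = trans (cong (λ z → z ℕ.+ colLen xs x ℕ.+ 1) (ℕₚ.n∸n≡0 x)) (ℕₚ.+-comm (colLen xs x) 1)

  -- The hook of the last cell is 1 if the next row is shorter, and one more than that of the next
  -- row's last cell if the lengths agree. Starting from at most `k` it would have to take the value
  -- `n`.
  end-short : ∀ x xs → Part (just x) xs → 1 ℕ.≤ x → Clean (x ∷ xs) → rowHook x xs x ℕ.≤ k
  end-short x [] _ _ _ = ℕₚ.≤-trans (ℕₚ.≤-reflexive (rowHook-end x [])) 1≤k
  end-short x (y ∷ ys) (y≤x , 1≤y , part) 1≤x (noHook , clean) with y ℕ.≟ x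
  ... | no y≢x = ℕₚ.≤-trans (ℕₚ.≤-reflexive (trans (rowHook-end x (y ∷ ys)) (cong suc (colLen-zero {y} (y ∷ ys) (ℕₚ.≤-refl , 1≤y , part) (ℕₚ.≤∧≢⇒< y≤x y≢x))))) 1≤k
  ... | yes refl = ≤n∧≢ (ℕₚ.≤-trans (ℕₚ.≤-reflexive (trans (rowHook-end y (y ∷ ys)) (cong suc (colLen-≤ ys ℕₚ.≤-refl))))
          (ℕ.s≤s (ℕₚ.≤-trans (ℕₚ.≤-reflexive (sym (rowHook-end y ys))) (end-short y ys part 1≤y clean)))) (noHook y 1≤x ℕₚ.≤-refl)

  cells-positive : ∀ x xs → Part (just x) xs → 1 ℕ.≤ x → Clean (x ∷ xs) → 1 ℕ.≤ cells x xs
  cells-positive x xs part 1≤x clean with cells x xs | proj₁ (cells-threshold x xs x 1≤x ℕₚ.≤-refl) (end-short x xs part 1≤x clean)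
  ... | zero | lt = ⊥-elim (ℕₚ.1+n≰n (ℕₚ.≤-trans lt (ℕₚ.≤-reflexive (ℕₚ.+-identityʳ x))))
  ... | suc _ | _ = ℕ.s≤s ℕ.z≤n

  -- Short cells fill the end of the row, so `j` is the leftmost of them and its arm has length
  -- `cells x xs - 1`.
  module Leftmost (x : ℕ) (xs : List ℕ) (t≥1 : 1 ℕ.≤ cells x xs) where
    t = cells x xs
    t≤x : t ℕ.≤ x
    t≤x = Count.count-≤ (short? x xs) x
    j : ℕ
    j = suc (x ℕ.∸ t)
    j+t : j ℕ.+ t ≡ suc x
    j+t = cong suc (ℕₚ.m∸n+n≡m t≤x)
    j≤x : j ℕ.≤ x
    j≤x = ℕₚ.≤-pred (ℕₚ.≤-trans (ℕₚ.≤-trans (ℕₚ.≤-reflexive (ℕₚ.+-comm 1 j)) (ℕₚ.+-monoʳ-≤ j t≥1)) (ℕₚ.≤-reflexive j+t))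
    short : rowHook x xs j ℕ.≤ k
    short = proj₂ (cells-threshold x xs j (ℕ.s≤s ℕ.z≤n) j≤x) (ℕₚ.≤-reflexive (sym j+t))
    arm : suc (x ℕ.∸ j) ≡ t
    arm = ℕₚ.+-cancelˡ-≡ (x ℕ.∸ t) _ _ (trans (ℕₚ.+-suc (x ℕ.∸ t) (x ℕ.∸ j)) (trans (ℕₚ.m+[n∸m]≡n j≤x) (sym (ℕₚ.m∸n+n≡m t≤x))))
    hook-value : rowHook x xs j ≡ t ℕ.+ colLen xs j
    hook-value = trans (ℕₚ.+-comm _ 1) (cong (ℕ._+ colLen xs j) arm)

  cells-≤k : ∀ x xs → 1 ℕ.≤ cells x xs → cells x xs ℕ.≤ k
  cells-≤k x xs t≥1 = ℕₚ.≤-trans (ℕₚ.m≤m+n t (colLen xs j)) (ℕₚ.≤-trans (ℕₚ.≤-reflexive (sym hook-value)) short)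
    where open Leftmost x xs t≥1

  -- Take the cell `i` of the upper row with the same arm as the leftmost short cell of the lower
  -- row. Its leg is longer by at most one, so its hook is at most `n`, and `n` itself is excluded.
  cells-decreasing : ∀ x y ys → y ℕ.≤ x → Part (just y) ys → (∀ j → 1 ℕ.≤ j → j ℕ.≤ x → ¬ rowHook x (y ∷ ys) j ≡ suc k) →
    1 ℕ.≤ cells y ys → cells y ys ℕ.≤ cells x (y ∷ ys)
  cells-decreasing x y ys y≤x part noHook t≥1 = ℕₚ.+-cancelˡ-≤ i _ _ (ℕₚ.≤-trans (ℕₚ.≤-reflexive i+t) (proj₁ (cells-threshold x (y ∷ ys) i (ℕ.s≤s ℕ.z≤n) i≤x) short′))
    where
    open Leftmost y ys t≥1
    i : ℕ
    i = suc (x ℕ.∸ t)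
    t≤x′ : t ℕ.≤ x
    t≤x′ = ℕₚ.≤-trans t≤x y≤x
    i+t : i ℕ.+ t ≡ suc x
    i+t = cong suc (ℕₚ.m∸n+n≡m t≤x′)
    i≤x : i ℕ.≤ x
    i≤x = ℕₚ.≤-pred (ℕₚ.≤-trans (ℕₚ.≤-trans (ℕₚ.≤-reflexive (ℕₚ.+-comm 1 i)) (ℕₚ.+-monoʳ-≤ i t≥1)) (ℕₚ.≤-reflexive i+t))
    arm′ : suc (x ℕ.∸ i) ≡ t
    arm′ = ℕₚ.+-cancelˡ-≡ (x ℕ.∸ t) _ _ (trans (ℕₚ.+-suc (x ℕ.∸ t) (x ℕ.∸ i)) (trans (ℕₚ.m+[n∸m]≡n i≤x) (sym (ℕₚ.m∸n+n≡m t≤x′))))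
    value′ : rowHook x (y ∷ ys) i ≡ t ℕ.+ colLen (y ∷ ys) i
    value′ = trans (ℕₚ.+-comm _ 1) (cong (ℕ._+ colLen (y ∷ ys) i) arm′)
    j≤i : j ℕ.≤ i
    j≤i = ℕ.s≤s (ℕₚ.∸-monoˡ-≤ t y≤x)
    col : colLen (y ∷ ys) i ℕ.≤ suc (colLen ys j)
    col with i ℕ.≤? y
    ... | yes p = ℕₚ.≤-trans (ℕₚ.≤-reflexive (colLen-≤ ys p)) (ℕ.s≤s (colLen-anti ys j≤i))
    ... | no p = ℕₚ.≤-trans (ℕₚ.≤-reflexive (colLen-> ys p)) (ℕₚ.≤-trans (colLen-anti ys j≤i) (ℕₚ.n≤1+n _))
    short′ : rowHook x (y ∷ ys) i ℕ.≤ k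
    short′ = ≤n∧≢ (ℕₚ.≤-trans (ℕₚ.≤-reflexive value′) (ℕₚ.≤-trans (ℕₚ.+-monoʳ-≤ t col) (ℕₚ.≤-trans (ℕₚ.≤-reflexive (trans (ℕₚ.+-suc t _) (cong suc (sym hook-value)))) (ℕ.s≤s short))))
      (noHook i (ℕ.s≤s ℕ.z≤n) i≤x)

  -- A longer row on top of the same rows with as many short hooks would have a hook of length n.
  cells-injective-< : ∀ x x′ xs → (∀ j → 1 ℕ.≤ j → j ℕ.≤ x′ → ¬ rowHook x′ xs j ≡ suc k) → 1 ℕ.≤ cells x xs → cells x xs ≡ cells x′ xs → ¬ x ℕ.< x′
  cells-injective-< x x′ xs noHook t≥1 e x<x′ = ℕₚ.1+n≰n (ℕₚ.≤-trans (proj₁ (cells-threshold x′ xs i 1≤i (ℕₚ.m∸n≤m x′ t)) short′)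
      (ℕₚ.≤-reflexive (trans (cong (i ℕ.+_) (sym e)) i+t)))
    where
    open Leftmost x xs t≥1
    i : ℕ
    i = x′ ℕ.∸ t
    t≤x′ : t ℕ.≤ x′
    t≤x′ = ℕₚ.≤-trans t≤x (ℕₚ.<⇒≤ x<x′)
    i+t : i ℕ.+ t ≡ x′
    i+t = ℕₚ.m∸n+n≡m t≤x′
    j≤i : j ℕ.≤ i
    j≤i = ℕₚ.≤-trans (ℕₚ.≤-reflexive (sym (ℕₚ.+-∸-assoc 1 t≤x))) (ℕₚ.∸-monoˡ-≤ t x<x′)
    1≤i : 1 ℕ.≤ i
    1≤i = ℕₚ.≤-trans (ℕ.s≤s ℕ.z≤n) j≤i
    value′ : rowHook x′ xs i ≡ t ℕ.+ colLen xs i ℕ.+ 1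
    value′ = cong (λ z → z ℕ.+ colLen xs i ℕ.+ 1) (ℕₚ.m∸[m∸n]≡n t≤x′)
    short′ : rowHook x′ xs i ℕ.≤ k
    short′ = ≤n∧≢ (ℕₚ.≤-trans (ℕₚ.≤-reflexive value′) (ℕₚ.≤-trans (ℕₚ.+-monoˡ-≤ 1 (ℕₚ.+-monoʳ-≤ t (colLen-anti xs j≤i)))
        (ℕₚ.≤-trans (ℕₚ.≤-reflexive (trans (ℕₚ.+-comm _ 1) (cong suc (sym hook-value)))) (ℕ.s≤s short))))
      (noHook i 1≤i (ℕₚ.m∸n≤m x′ t))

  rows-positive : ∀ p xs → Part p xs → Clean xs → All (1 ℕ.≤_) (rows xs)
  rows-positive p [] _ _ = []
  rows-positive p (x ∷ xs) (_ , 1≤x , part) clean = cells-positive x xs part 1≤x clean ∷ rows-positive (just x) xs part (proj₂ clean)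

  rows-≤k : ∀ xs → All (1 ℕ.≤_) (rows xs) → All (ℕ._≤ k) (rows xs)
  rows-≤k [] _ = []
  rows-≤k (x ∷ xs) (p ∷ ps) = cells-≤k x xs p ∷ rows-≤k xs ps

  rows-linked : ∀ p xs → Part p xs → Clean xs → Linked (λ a b → b ℕ.≤ a) (rows xs)
  rows-linked p [] _ _ = []
  rows-linked p (x ∷ []) _ _ = [-]
  rows-linked p (x ∷ y ∷ ys) (_ , _ , part@(y≤x , 1≤y , part′)) (noHook , clean) =
    cells-decreasing x y ys y≤x part′ noHook (cells-positive y ys part′ 1≤y clean) ∷ rows-linked (just x) (y ∷ ys) part clean

  -- A core is rebuilt from its bottom row upwards: once the rows below agree, the number of short
  -- cells fixes the length of the row.
  rows-injective : ∀ p p′ xs ys → Part p xs → Part p′ ys → Clean xs → Clean ys → rows xs ≡ rows ys → xs ≡ ys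
  rows-injective p p′ [] [] _ _ _ _ _ = refl
  rows-injective p p′ (x ∷ xs) (y ∷ ys) (_ , 1≤x , part) (_ , 1≤y , part′) (nx , cx) (ny , cy) e
    with rows-injective (just x) (just y) xs ys part part′ cx cy (∷-injectiveʳ e)
  ... | refl = cong (_∷ xs) (ℕₚ.≤-antisym
        (ℕₚ.≮⇒≥ (cells-injective-< y x xs nx (cells-positive y xs part′ 1≤y (ny , cy)) (sym (∷-injectiveˡ e))))
        (ℕₚ.≮⇒≥ (cells-injective-< x y xs ny (cells-positive x xs part 1≤x (nx , cx)) (∷-injectiveˡ e))))

  shape≡rows : ∀ ν → Part nothing ν → Clean ν → boundedPartition k ν ≡ rows ν
  shape≡rows ν part clean = trans (boundedPartition≡ ν part) (filter-all (1 ℕ.≤?_) (rows-positive nothing ν part clean))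

  -- Beads are the vertical steps of the boundary and vacancies the horizontal ones; this is the
  -- position of the step under column `j` when that column has length `l`.
  gap : ℕ → ℕ → ℤ
  gap j l = pos j - 1ℤ + N - pos l

  ¬Bead-gap : ∀ p r xs j → Part p xs → 1 ℕ.≤ j → ¬ Bead (suc r) xs (gap j (r ℕ.+ colLen xs j))
  ¬Bead-gap p r [] (suc j) _ _ b = 1+≤⇒≰ {gap (suc j) (r ℕ.+ 0)} {bead (suc r) 0} (lin₁ 0 (+≤+ {0} {j} ℕ.z≤n)
      (trans (cong (λ z → pos (suc j) - 1ℤ + N - pos z - (bead (suc r) 0 + 1ℤ)) (ℕₚ.+-identityʳ r)) (e (pos j) N (pos r)))) b
    where
    e : ∀ j N r → 1ℤ + j - 1ℤ + N - r - (0ℤ + N - (1ℤ + r) + 1ℤ) ≡ (j - 0ℤ) + 0ℤ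
    e = solve-∀
  ¬Bead-gap p r (x ∷ xs) j (_ , _ , part) 1≤j b with j ℕ.≤? x
  ... | yes j≤x with subst (Bead (suc r) (x ∷ xs)) (cong (gap j) (trans (cong (r ℕ.+_) (colLen-≤ xs j≤x)) (ℕₚ.+-suc r _))) b
  ...   | inj₂ b′ = ¬Bead-gap (just x) (suc r) xs j part 1≤j b′
  ...   | inj₁ eq = bead-step≢ (lin₂ 0 (+≤+ j≤x) (+≤+ (ℕₚ.m≤m+n r (colLen xs j))) (e (pos j) (pos x) N (pos r) (pos (r ℕ.+ colLen xs j)))) eq
    where
    e : ∀ j x N r l → x + N - (1ℤ + r) - (j - 1ℤ + N - (1ℤ + l) + 1ℤ) ≡ (x - j) + (l - r) + 0ℤ
    e = solve-∀
  ¬Bead-gap p r (x ∷ xs) j (_ , _ , part) 1≤j b | no j≰x with subst (Bead (suc r) (x ∷ xs))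
    (cong (gap j) (trans (cong (r ℕ.+_) (trans (colLen-> xs j≰x) (colLen-zero xs part (ℕₚ.≰⇒> j≰x)))) (ℕₚ.+-identityʳ r))) b
  ... | b′ = 1+≤⇒≰ {gap j r} {bead (suc r) x} (lin₁ 0 (+≤+ (ℕₚ.≰⇒> j≰x)) (e (pos j) (pos x) N (pos r))) (below b′)
    where
    e : ∀ j x N r → j - 1ℤ + N - r - (x + N - (1ℤ + r) + 1ℤ) ≡ (j - (1ℤ + x)) + 0ℤ
    e = solve-∀
    below : Bead (suc r) (x ∷ xs) (gap j r) → gap j r ≤ bead (suc r) x
    below (inj₁ q) = ≤-reflexive q
    below (inj₂ q) = ≤-trans (i≤i+j _ 1ℤ) (Bead-< x (suc r) xs part q)

  -- The length of a hook is the distance between the bead of its row and the vacancy of its column.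
  -- A hook of length `n` would put a vacancy `n` positions below a bead.
  clean : ∀ ν → Part nothing ν → (∀ y → Bead 1 ν y → Bead 1 ν (y - N)) → Clean ν
  clean ν part flush = go nothing 0 ν part (λ j _ _ → refl) (λ b → b)
    where
    go : ∀ p r xs → Part p xs → (∀ j → 1 ℕ.≤ j → Bound p j → colLen ν j ≡ r ℕ.+ colLen xs j) → (∀ {y} → Bead (suc r) xs y → Bead 1 ν y) → Clean xs
    go p r [] _ _ _ = tt
    go p r (x ∷ xs) (bx , 1≤x , part′) col sub = noHook , go (just x) (suc r) xs part′
        (λ j a b → trans (col j a (bound p b bx)) (trans (cong (r ℕ.+_) (colLen-≤ xs b)) (ℕₚ.+-suc r (colLen xs j)))) (λ b → sub (inj₂ b))
      where
      bound : ∀ p {j} → j ℕ.≤ x → Bound p x → Bound p j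
      bound nothing _ _ = tt
      bound (just p) j≤x x≤p = ℕₚ.≤-trans j≤x x≤p
      noHook : ∀ j → 1 ℕ.≤ j → j ℕ.≤ x → ¬ rowHook x xs j ≡ suc k
      noHook j 1≤j j≤x h = ¬Bead-gap nothing 0 ν j part 1≤j (subst (Bead 1 ν) position (flush _ (sub (inj₁ refl))))
        where
        colj : colLen ν j ≡ suc (r ℕ.+ colLen xs j)
        colj = trans (col j 1≤j (bound p j≤x bx)) (trans (cong (r ℕ.+_) (colLen-≤ xs j≤x)) (ℕₚ.+-suc r (colLen xs j)))
        N≡ : N ≡ pos (x ℕ.∸ j) + pos (colLen xs j) + 1ℤ
        N≡ = trans (cong pos (sym h)) (trans (pos-+ (x ℕ.∸ j ℕ.+ colLen xs j) 1) (cong (_+ 1ℤ) (pos-+ (x ℕ.∸ j) (colLen xs j))))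
        x≡ : pos x ≡ pos j + pos (x ℕ.∸ j)
        x≡ = trans (cong pos (sym (ℕₚ.m+[n∸m]≡n j≤x))) (pos-+ j (x ℕ.∸ j))
        e : ∀ j d c N r → j + d + N - (1ℤ + r) - (d + c + 1ℤ) ≡ j - 1ℤ + N - (1ℤ + (r + c))
        e = solve-∀
        position : bead (suc r) x - N ≡ gap j (colLen ν j)
        position = trans (cong₂ (λ u v → u + N - pos (suc r) - v) x≡ N≡) (trans (e (pos j) (pos (x ℕ.∸ j)) (pos (colLen xs j)) N (pos r))
          (cong (λ z → pos j - 1ℤ + N - z) (trans (cong (1ℤ +_) (sym (pos-+ r (colLen xs j)))) (trans (sym (pos-+ 1 (r ℕ.+ colLen xs j))) (cong pos (sym colj))))))

  represents-clean : ∀ {ν b} → Part nothing ν → Represents ν b → Clean ν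
  represents-clean {ν} {b} part rep = clean ν part flush
    where
    flush : ∀ y → Bead 1 ν y → Bead 1 ν (y - N)
    flush y g with residue y
    ... | x , e = proj₂ (rep x (y - N) (≡ₙ-trans (modulo (- 1ℤ) (e₁ y N)) e)) (≤-trans (lin₁ 0 (+≤+ {0} {suc k} ℕ.z≤n) (e₂ y N)) (proj₁ (rep x y e) g))
      where
      open import Data.Integer using (_*_)
      e₁ : ∀ y N → y - N ≡ y + - 1ℤ * N
      e₁ = solve-∀
      e₂ : ∀ y N → y - (y - N) ≡ (N - 0ℤ) + 0ℤ
      e₂ = solve-∀

  -- Shapes of valid words

  shape : Word → List ℕ
  shape w = boundedPartition k (actW k w)

  module _ {w : Word} (v : Valid w coreStart) where
    private
      part = proj₁ (valid-represents w v)
      rep = proj₂ (valid-represents w v)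
      cl = represents-clean part rep

    shape≡ : shape w ≡ rows (actW k w)
    shape≡ = shape≡rows (actW k w) part cl

    shape-KBounded : KBounded k (shape w)
    shape-KBounded = subst (KBounded k) (sym shape≡) ((rows-linked nothing _ part cl , rows-positive nothing _ part cl) , rows-≤k _ (rows-positive nothing _ part cl))

    ReducedWordOf-shape : ReducedWordOf k (shape w) w
    ReducedWordOf-shape = valid⇒builds w v , refl

  shape-injective : ∀ {v w} → Valid v coreStart → Valid w coreStart → shape v ≡ shape w → run v coreStart ≡ run w coreStart
  shape-injective {v} {w} pv pw e = represents-state (run-IsCore v coreStart-IsCore) (run-IsCore w coreStart-IsCore) repv
      (subst (λ ν → Represents ν (run w coreStart)) (sym lists) (proj₂ (valid-represents w pw)))
    where
    partv = proj₁ (valid-represents v pv)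
    repv = proj₂ (valid-represents v pv)
    lists : actW k v ≡ actW k w
    lists = rows-injective nothing nothing _ _ partv (proj₁ (valid-represents w pw)) (represents-clean partv repv)
      (represents-clean (proj₁ (valid-represents w pw)) (proj₂ (valid-represents w pw))) (trans (sym (shape≡ pv)) (trans e (shape≡ pw)))

  shape-cong : ∀ {v w} → Valid v coreStart → Valid w coreStart → run v coreStart ≡ run w coreStart → shape v ≡ shape w
  shape-cong {v} {w} pv pw e = cong (boundedPartition k) (represents-list (proj₁ (valid-represents v pv)) (proj₁ (valid-represents w pw))
    (proj₂ (valid-represents v pv)) (subst (Represents (actW k w)) (sym e) (proj₂ (valid-represents w pw))))

  shape-of : ∀ {w ν} → Valid w coreStart → Part nothing ν → Represents ν (run w coreStart) → shape w ≡ boundedPartition k ν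
  shape-of {w} pw part rep = cong (boundedPartition k) (represents-list (proj₁ (valid-represents w pw)) part (proj₂ (valid-represents w pw)) rep)

  replicate-part : ∀ p r c → 1 ℕ.≤ c → Bound p c → Part p (replicate r c)
  replicate-part p zero c _ _ = tt
  replicate-part p (suc r) c 1≤c bc = bc , 1≤c , replicate-part (just c) r c 1≤c ℕₚ.≤-refl

  colLen-replicate : ∀ r c j → colLen (replicate r c) j ℕ.≤ r
  colLen-replicate zero c j = ℕ.z≤n
  colLen-replicate (suc r) c j with j ℕ.≤? c
  ... | yes p = ℕₚ.≤-trans (ℕₚ.≤-reflexive (colLen-≤ (replicate r c) p)) (ℕ.s≤s (colLen-replicate r c j))
  ... | no p = ℕₚ.≤-trans (ℕₚ.≤-reflexive (colLen-> (replicate r c) p)) (ℕₚ.m≤n⇒m≤1+n (colLen-replicate r c j))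

  -- No hook of the rectangle exceeds `c + r - 1`, which is at most `k`, so every cell is counted.
  rows-replicate : ∀ r c → 1 ℕ.≤ c → c ℕ.+ r ℕ.≤ suc k → rows (replicate r c) ≡ replicate r c
  rows-replicate zero c _ _ = refl
  rows-replicate (suc r) c 1≤c le = cong₂ _∷_ (ℕₚ.≤-antisym (Count.count-≤ (short? c (replicate r c)) c)
        (ℕₚ.≤-pred (proj₁ (cells-threshold c (replicate r c) 1 ℕₚ.≤-refl 1≤c) short)))
      (rows-replicate r c 1≤c (ℕₚ.≤-trans (ℕₚ.+-monoʳ-≤ c (ℕₚ.n≤1+n r)) le))
    where
    short : rowHook c (replicate r c) 1 ℕ.≤ k
    short = ℕₚ.≤-pred (ℕₚ.≤-trans (ℕₚ.≤-trans (ℕₚ.≤-reflexive (e (c ℕ.∸ 1) (colLen (replicate r c) 1)))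
        (ℕₚ.+-mono-≤ (ℕₚ.≤-reflexive (ℕₚ.m+[n∸m]≡n 1≤c)) (ℕ.s≤s (colLen-replicate r c 1)))) le)
      where
      e : ∀ a b → suc (a ℕ.+ b ℕ.+ 1) ≡ (1 ℕ.+ a) ℕ.+ (1 ℕ.+ b)
      e a b = cong suc (trans (ℕₚ.+-assoc a b 1) (cong (a ℕ.+_) (ℕₚ.+-comm b 1)))

  shape-replicate : ∀ r c → 1 ℕ.≤ c → c ℕ.+ r ℕ.≤ suc k → boundedPartition k (replicate r c) ≡ replicate r c
  shape-replicate r c 1≤c le = trans (boundedPartition≡ (replicate r c) (replicate-part nothing r c 1≤c tt))
    (trans (cong (filter (1 ℕ.≤?_)) (rows-replicate r c 1≤c le)) (filter-all (1 ℕ.≤?_) (positive r)))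
    where
    positive : ∀ r → All (1 ℕ.≤_) (replicate r c)
    positive zero = []
    positive (suc r) = 1≤c ∷ positive r

  -- Horizontal strips

  -- The constant function 1 detects whether a word survives, and a delta function detects where it
  -- ends; both tests respect `≈`.
  ≈-valid : ∀ {v w b} → uw v ≈ uw w → Valid w b → Valid v b × run v b ≡ run w b
  ≈-valid {v} {w} {b} e pw = pv , agree
    where
    pv : Valid v b
    pv with valid? v b
    ... | yes p = p
    ... | no ¬p with () ← trans (sym (⟦uw⟧-¬valid v (λ _ → 1ℤ) ¬p)) (trans (⟦⟧-sound e (λ _ → 1ℤ) b) (⟦uw⟧-valid w (λ _ → 1ℤ) pw))
    agree : run v b ≡ run w b
    agree with Vecₚ.≡-dec Data.Integer._≟_ (run v b) (run w b)
    ... | yes q = q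
    ... | no ¬q with () ← trans (sym (δ-≢ {run w b} {run v b} ¬q)) (trans (sym (⟦uw⟧-valid v (δ (run w b)) pv))
          (trans (⟦⟧-sound e (δ (run w b)) b) (trans (⟦uw⟧-valid w (δ (run w b)) pw) (δ-≡ {run w b} refl))))

  -- From the regular starting point a letter of D shows up as a negative displacement.
  zero-run : ∀ {D m} (m∉D : mem D m ≡ false) y →
    (mem D y ≡ true → run (Pass.passWord D m m∉D k) zeroState ! prv y ≡ - 1ℤ) ×
    (mem D y ≡ false → 0ℤ ≤ run (Pass.passWord D m m∉D k) zeroState ! prv y)
  zero-run {D} {m} m∉D y with offset m y
  ... | zero , _ , refl = (λ e → ⊥-elim (absurd (trans (sym e) (trans (cong (mem D) (+ₘ-identity m)) m∉D))))
      , λ _ → subst (λ z → 0ℤ ≤ after k ! z) (sym (cong prv (+ₘ-identity m))) (≤-trans (nonneg k) (≤-reflexive (sym (front k ℕₚ.≤-refl))))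
    where
    open Pass D m m∉D
    open On zeroState
    absurd : ¬ true ≡ false
    absurd ()
    level≡ : ∀ t → level t ≡ - pos t
    level≡ t = trans (cong (_- pos t) (fromFun-! (λ _ → 0ℤ) (m +ₘ t))) (+-identityˡ (- pos t))
    nonneg : ∀ t → 0ℤ ≤ carried t + pos t
    nonneg zero = ≤-reflexive (sym (trans (cong (_+ 0ℤ) (level≡ 0)) refl))
    nonneg (suc t) with bool-case (mem D (m +ₘ suc t))
    ... | inj₁ e = lin₁ 1 (nonneg t) (trans (cong (λ z → z + pos (suc t) - 0ℤ) (carried-true e)) (e₁ (carried t) (pos t)))
      where
      e₁ : ∀ c t → c + (1ℤ + t) - 0ℤ ≡ (c + t - 0ℤ) + 1ℤ
      e₁ = solve-∀
    ... | inj₂ e = ≤-reflexive (sym (trans (cong (_+ pos (suc t)) (trans (carried-false e) (level≡ (suc t)))) (+-inverseˡ (pos (suc t)))))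
  ... | suc t , lt , refl = (λ e → trans value (trans (cong (_+ pos t) (trans (settled-true e) (level≡ (suc t)))) (e₁ (pos t))))
      , λ e → ≤-trans (nonneg t) (≤-reflexive (sym (trans value (cong (_+ pos t) (settled-false e)))))
    where
    open Pass D m m∉D
    open On zeroState
    value : after k ! prv (m +ₘ suc t) ≡ settled t + pos t
    value = trans (cong (after k !_) (prv-+ₘ-suc m t)) (behind k t (ℕₚ.≤-pred lt) ℕₚ.≤-refl)
    e₁ : ∀ t → - (1ℤ + t) + t ≡ - 1ℤ
    e₁ = solve-∀
    level≡ : ∀ t → level t ≡ - pos t
    level≡ t = trans (cong (_- pos t) (fromFun-! (λ _ → 0ℤ) (m +ₘ t))) (+-identityˡ (- pos t))
    nonneg : ∀ t → 0ℤ ≤ carried t + pos t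
    nonneg zero = ≤-reflexive (sym (trans (cong (_+ 0ℤ) (level≡ 0)) refl))
    nonneg (suc t) with bool-case (mem D (m +ₘ suc t))
    ... | inj₁ e = lin₁ 1 (nonneg t) (trans (cong (λ z → z + pos (suc t) - 0ℤ) (carried-true e)) (e₂ (carried t) (pos t)))
      where
      e₂ : ∀ c t → c + (1ℤ + t) - 0ℤ ≡ (c + t - 0ℤ) + 1ℤ
      e₂ = solve-∀
    ... | inj₂ e = ≤-reflexive (sym (trans (cong (_+ pos (suc t)) (trans (carried-false e) (level≡ (suc t)))) (+-inverseˡ (pos (suc t)))))

  StripWord : Word → Subset (suc k) → Set
  StripWord w D = CycDec w × Spells w D

  strip-≅ : ∀ {v w D} → StripWord v D → StripWord w D → v ≅ w
  strip-≅ {v} {w} {D} (cv , sv) (cw , sw) = cycDec-≅ v w cv cw (spells-same {D = D} sv sw)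

  passWord-strip : ∀ {D m} (m∉D : mem D m ≡ false) → StripWord (Pass.passWord D m m∉D k) D
  passWord-strip {D} {m} m∉D = Pass.passWord-CycDec D m m∉D k ℕₚ.≤-refl , Pass.passWord-Spells D m m∉D

  strip-injective : ∀ {D E v w} → card D ℕ.≤ k → card E ℕ.≤ k → StripWord v D → StripWord w E → run v zeroState ≡ run w zeroState → D ≡ E
  strip-injective {D} {E} {v} {w} le le′ sv sw e with outside {D} le | outside {E} le′
  ... | m , m∉D | m′ , m′∉E = subset-ext pointwise
    where
    e′ : run (Pass.passWord D m m∉D k) zeroState ≡ run (Pass.passWord E m′ m′∉E k) zeroState
    e′ = trans (same-run (strip-≅ {D = D} (passWord-strip m∉D) sv) zeroState) (trans e (same-run (strip-≅ {D = E} sw (passWord-strip m′∉E)) zeroState))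
    clash : ∀ {a} → a ≡ - 1ℤ → ¬ 0ℤ ≤ a
    clash refl ()
    pointwise : ∀ y → mem D y ≡ mem E y
    pointwise y with mem D y in d | mem E y in d′
    ... | true | true = refl
    ... | false | false = refl
    ... | true | false = ⊥-elim (clash (trans (cong (_! prv y) (sym e′)) (proj₁ (zero-run m∉D y) d)) (proj₂ (zero-run m′∉E y) d′))
    ... | false | true = ⊥-elim (clash (trans (cong (_! prv y) e′) (proj₁ (zero-run m′∉E y) d′)) (proj₂ (zero-run m∉D y) d))

  stripWord : ∀ D → card D ℕ.≤ k → ∃ λ w → StripWord w D × uD D ≈ uw w
  stripWord D le with outside {D} le
  ... | m , m∉D = Pass.passWord D m m∉D k , passWord-strip m∉D , Pass.uD-passWord D m m∉D

  -- Sublevel sets of one function are nested, so two of the same size coincide.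
  lower-sets : ∀ {D E : Subset (suc k)} {κ : State} {c c′} →
    (∀ y → (mem D y ≡ true → κ ! y + 1ℤ ≤ c) × (κ ! y + 1ℤ ≤ c → mem D y ≡ true)) →
    (∀ y → (mem E y ≡ true → κ ! y + 1ℤ ≤ c′) × (κ ! y + 1ℤ ≤ c′ → mem E y ≡ true)) → card D ≡ card E → D ≡ E
  lower-sets {D} {E} {κ} {c} {c′} d e same with ≤-total c c′
  ... | inj₁ c≤c′ = ≼-card-≡ (λ y p → proj₂ (e y) (≤-trans (proj₁ (d y) p) c≤c′)) same
  ... | inj₂ c′≤c = sym (≼-card-≡ (λ y p → proj₂ (d y) (≤-trans (proj₁ (e y) p) c′≤c)) (sym same))

  -- Adding a strip of the size of the first row of b below which the rest of b lies gives b or a core whose first row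
  -- has more cells of short hook.
  firstRow-triangular : ∀ {b D w} → IsCore b → StripWord w D → card D ≡ card (lowNext b) → Valid w (tail b) →
    card D ℕ.< card (lowNext (run w (tail b))) ⊎ D ≡ lowNext b
  firstRow-triangular {b} {D} {w} core sw same v with card D ℕ.<? card (lowNext b′)
    where
    b′ = run w (tail b)
  ... | yes lt = inj₁ lt
  ... | no ¬lt = inj₂ (lower-sets {κ = κ} lowerD lower₀ same)
    where
    κ = tail b
    b′ = run w κ
    le : card D ℕ.≤ k
    le = ℕₚ.≤-trans (ℕₚ.≤-reflexive same) (card-≤k {lowNext b} (nxt-top∉lowNext b))
    inside : D ≼ lowNext b′
    inside = from (outside {D} le)
      where
      from : (∃ λ m → mem D m ≡ false) → D ≼ lowNext b′
      from (m , m∉D) = subst (λ z → D ≼ lowNext z) (proj₂ moved) (strip-≼-lowNext (tail-IsCore core) D m m∉D (proj₁ moved))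
        where
        moved : Valid (Pass.passWord D m m∉D k) (tail b) × run (Pass.passWord D m m∉D k) (tail b) ≡ run w (tail b)
        moved = ≈-valid (alg (strip-≅ {D = D} (passWord-strip m∉D) sw)) v
    D≡ : D ≡ lowNext b′
    D≡ = ≼-card-≡ inside (ℕₚ.≤-antisym (card-mono {D} {lowNext b′} inside) (ℕₚ.≮⇒≥ ¬lt))
    m′∉D : mem D (nxt (top b′)) ≡ false
    m′∉D = trans (cong (λ E → mem E (nxt (top b′))) D≡) (nxt-top∉lowNext b′)
    moved′ : Valid (Pass.passWord D (nxt (top b′)) m′∉D k) (tail b) × run (Pass.passWord D (nxt (top b′)) m′∉D k) (tail b) ≡ run w (tail b)
    moved′ = ≈-valid (alg (strip-≅ {D = D} (passWord-strip m′∉D) sw)) v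
    lowerD = strip-lower (tail-IsCore core) D (nxt (top b′)) m′∉D (proj₁ moved′) (trans D≡ (cong lowNext (sym (proj₂ moved′))))
      (cong (λ z → nxt (top z)) (proj₂ moved′))
    lower₀ = strip-lower (tail-IsCore core) (lowNext b) (nxt (top b)) (nxt-top∉lowNext b) (firstRow-valid core)
      (cong lowNext (sym (firstRow-run core))) (cong (λ z → nxt (top z)) (firstRow-run core))

  -- Action of the k-Schur functions on the empty core

  sumL : ∀ {a} {A : Set a} → (A → ℤ) → List A → ℤ
  sumL f [] = 0ℤ
  sumL f (x ∷ xs) = f x + sumL f xs

  sumL-cong : ∀ {a} {A : Set a} {f g : A → ℤ} xs → (∀ {x} → x ∈ xs → f x ≡ g x) → sumL f xs ≡ sumL g xs
  sumL-cong [] e = refl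
  sumL-cong (x ∷ xs) e = cong₂ _+_ (e (here refl)) (sumL-cong xs (λ p → e (there p)))

  sumL-isolate : ∀ {a} {A : Set a} {f g : A → ℤ} {x₀} xs → Unique xs → x₀ ∈ xs → (∀ {x} → x ∈ xs → ¬ x ≡ x₀ → f x ≡ g x) →
    sumL f xs ≡ sumL g xs → f x₀ ≡ g x₀
  sumL-isolate {f = f} {g} (x ∷ xs) (fresh ∷ uq) (here refl) e s = cancel (f x) (g x) (sumL g xs)
      (trans (cong (f x +_) (sym (sumL-cong xs (λ p → e (there p) (λ q → All.lookup fresh p (sym q)))))) s)
    where
    cancel : ∀ a b c → a + c ≡ b + c → a ≡ b
    cancel a b c p = trans (c₁ a c) (trans (cong (_- c) p) (sym (c₁ b c)))
      where
      c₁ : ∀ x c → x ≡ x + c - c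
      c₁ = solve-∀
  sumL-isolate {f = f} {g} (x ∷ xs) (fresh ∷ uq) (there p) e s = sumL-isolate xs uq p (λ q → e (there q))
      (cancel (g x) _ _ (trans (cong (_+ sumL f xs) (sym (e (here refl) (λ { refl → All.lookup fresh p refl })))) s))
    where
    cancel : ∀ a b c → a + b ≡ a + c → b ≡ c
    cancel a b c p = trans (c₁ a b) (trans (cong (_- a) p) (sym (c₁ a c)))
      where
      c₁ : ∀ a b → b ≡ a + b - a
      c₁ = solve-∀

  sumL-filter : ∀ {a p} {A : Set a} {P : A → Set p} (P? : ∀ x → Dec (P x)) {f : A → ℤ} xs → (∀ {x} → x ∈ xs → ¬ P x → f x ≡ 0ℤ) →
    sumL f xs ≡ sumL f (filter P? xs)
  sumL-filter P? [] e = refl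
  sumL-filter P? {f} (x ∷ xs) e with P? x
  ... | yes p = cong (f x +_) (sumL-filter P? xs (λ q → e (there q)))
  ... | no ¬p = trans (cong (_+ sumL f xs) (e (here refl) ¬p)) (trans (+-identityˡ _) (sumL-filter P? xs (λ q → e (there q))))

  ⟦Σ⊕⟧ : ∀ {a} {A : Set a} (f : A → 𝔸 k) xs φ b → ⟦ Σ⊕ (map f xs) ⟧ φ b ≡ sumL (λ x → ⟦ f x ⟧ φ b) xs
  ⟦Σ⊕⟧ f [] φ b = refl
  ⟦Σ⊕⟧ f (x ∷ xs) φ b = cong (⟦ f x ⟧ φ b +_) (⟦Σ⊕⟧ f xs φ b)

  shape-≈ : ∀ {v w} → Valid v coreStart → Valid w coreStart → shape v ≡ shape w → v ≅ w
  shape-≈ {v} {w} pv pw e = matsumoto coreStart-¬Desc v w pv pw (shape-injective pv pw e)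

  -- A Pieri step may come with any reduced words. Since the shape determines the word up to `≅`,
  -- the given word `d` and a strip word in front of it can take their place.
  pieri⇒word : ∀ {i d μ} → Valid d coreStart → i ℕ.≤ k → PieriStep k i (shape d) μ →
    ∃ λ D → card D ≡ i × ∃ λ w → StripWord w D × Valid (w ++ d) coreStart × shape (w ++ d) ≡ μ
  pieri⇒word {i} {d} {μ} pd i≤k (D , c , wλ , wμ , (bλ , sλ) , (bμ , sμ) , e) = from (stripWord D (subst (ℕ._≤ k) (sym c) i≤k))
    where
    from : (∃ λ w → StripWord w D × uD D ≈ uw w) → ∃ λ D → card D ≡ i × ∃ λ w → StripWord w D × Valid (w ++ d) coreStart × shape (w ++ d) ≡ μ
    from (w , sw , uD≈) = D , c , w , sw , proj₁ moved , trans (shape-cong {w ++ d} {wμ} (proj₁ moved) pμ (proj₂ moved)) sμ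
      where
      pμ : Valid wμ coreStart
      pμ = builds⇒valid wμ bμ
      eq : uw (w ++ d) ≈ uw wμ
      eq = ≈-trans (uw-++ w d) (≈-trans (⊗-cong (≈-sym uD≈) (alg (shape-≈ {d} {wλ} pd (builds⇒valid wλ bλ) (sym sλ)))) e)
      moved : Valid (w ++ d) coreStart × run (w ++ d) coreStart ≡ run wμ coreStart
      moved = ≈-valid eq pμ

  word⇒pieri : ∀ {i d D w} → card D ≡ i → i ℕ.≤ k → StripWord w D → Valid d coreStart → Valid (w ++ d) coreStart → PieriStep k i (shape d) (shape (w ++ d))
  word⇒pieri {i} {d} {D} {w} c i≤k sw pd pwd = from (stripWord D (subst (ℕ._≤ k) (sym c) i≤k))
    where
    from : (∃ λ w′ → StripWord w′ D × uD D ≈ uw w′) → PieriStep k i (shape d) (shape (w ++ d))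
    from (w′ , sw′ , uD≈) = D , c , d , w ++ d , ReducedWordOf-shape pd , ReducedWordOf-shape pwd
      , ≈-trans (⊗-cong (≈-trans uD≈ (alg (strip-≅ {D = D} sw′ sw))) ≈-refl) (≈-sym (uw-++ w d))

  abstract
    stripOf : Subset (suc k) → Word
    stripOf D = choose (card D ℕ.≤? k)
      where
      choose : Dec (card D ℕ.≤ k) → Word
      choose (yes le) = proj₁ (stripWord D le)
      -- Sets of size above `k` never serve as strips; the empty word is a placeholder.
      choose (no _) = []

    stripOf-spec : ∀ {D} → card D ℕ.≤ k → StripWord (stripOf D) D × uD D ≈ uw (stripOf D)
    stripOf-spec {D} le with card D ℕ.≤? k
    ... | yes le′ = proj₂ (stripWord D le′)
    ... | no ¬le = ⊥-elim (¬le le)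

  module KSchur (s : List ℕ → 𝔸 k) (isK : IsKSchur k s) where

    s-[] : s [] ≈ 𝟙
    s-[] = proj₁ isK

    Acts : Word → Set
    Acts w = ∀ φ → ⟦ s (shape w) ⟧ φ coreStart ≡ φ (run w coreStart)

    module Pieri {d : Word} (pd : Valid d coreStart) {i : ℕ} (1≤i : 1 ℕ.≤ i) (i≤k : i ℕ.≤ k) where
      private
        pieri = proj₂ (proj₂ isK) (shape d) (shape-KBounded pd) i 1≤i i≤k

      terms : List (List ℕ)
      terms = proj₁ pieri

      κ : State
      κ = run d coreStart

      strips : List (Subset (suc k))
      strips = filter (λ D → valid? (stripOf D) κ) (subsetsOf i)

      ∈-strips : ∀ {D} → D ∈ strips → card D ≡ i × Valid (stripOf D) κ
      ∈-strips p with ∈-filter⁻ (λ D → valid? (stripOf D) κ) {xs = subsetsOf i} p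
      ... | q , v = subsetsOf-∈ q , v

      small : ∀ D → card D ≡ i → card D ℕ.≤ k
      small D c = subst (ℕ._≤ k) (sym c) i≤k

      card-≤ : ∀ {D} → D ∈ strips → card D ℕ.≤ k
      card-≤ {D} p = small D (proj₁ (∈-strips p))

      strip-spec : ∀ {D} → D ∈ strips → StripWord (stripOf D) D
      strip-spec {D} p = proj₁ (stripOf-spec {D} (card-≤ p))

      strips-unique : Unique strips
      strips-unique = Uniqueₚ.filter⁺ _ (subsetsOf-unique i)

      grown : Subset (suc k) → List ℕ
      grown D = shape (stripOf D ++ d)

      grown-valid : ∀ {D} → D ∈ strips → Valid (stripOf D ++ d) coreStart
      grown-valid {D} p = valid-++ (stripOf D) d (proj₂ (∈-strips p)) pd

      grown-injective : ∀ {D E} → D ∈ strips → E ∈ strips → grown D ≡ grown E → D ≡ E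
      grown-injective {D} {E} p q e = strip-injective (card-≤ p) (card-≤ q) (strip-spec p) (strip-spec q)
        (cancelʳ (stripOf D) (stripOf E) d (grown-valid p) (grown-valid q) (shape-injective (grown-valid p) (grown-valid q) e) zeroState)

      map-unique : ∀ Ds → (∀ {D} → D ∈ Ds → D ∈ strips) → Unique Ds → Unique (map grown Ds)
      map-unique [] _ _ = []
      map-unique (D ∷ Ds) sub (fresh ∷ uq) = All.tabulate new ∷ map-unique Ds (λ p → sub (there p)) uq
        where
        new : ∀ {μ} → μ ∈ map grown Ds → ¬ grown D ≡ μ
        new p e with ∈-map⁻ grown p
        ... | E , q , refl = All.lookup fresh q (grown-injective (sub (here refl)) (sub (there q)) e)

      -- The given rule sums over shapes. Distinct strips yield distinct shapes by
      -- `grown-injective`, so the sum may be taken over strips.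
      terms-↭ : terms ↭ map grown strips
      terms-↭ = unique-↭ (proj₁ (proj₂ pieri)) (map-unique strips (λ p → p) strips-unique) (to , from)
        where
        to : ∀ {μ} → μ ∈ terms → μ ∈ map grown strips
        to {μ} p = found (pieri⇒word pd i≤k (proj₂ (Equivalence.to (proj₁ (proj₂ (proj₂ pieri)) μ) p)))
          where
          found : (∃ λ D → card D ≡ i × ∃ λ w → StripWord w D × Valid (w ++ d) coreStart × shape (w ++ d) ≡ μ) → μ ∈ map grown strips
          found (D , c , w , sw , pwd , e) = subst (_∈ map grown strips) same (∈-map⁺ grown (∈-filter⁺ _ (∈-subsetsOf c) v′))
            where
            moved : Valid (stripOf D) κ × run (stripOf D) κ ≡ run w κ
            moved = ≈-valid (alg (strip-≅ {D = D} (proj₁ (stripOf-spec {D} (small D c))) sw)) (valid-++ˡ w d pwd)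
            v′ : Valid (stripOf D) κ
            v′ = proj₁ moved
            same : grown D ≡ μ
            same = trans (shape-cong (valid-++ (stripOf D) d v′ pd) pwd (trans (run-++ (stripOf D) d coreStart) (trans (proj₂ moved) (sym (run-++ w d coreStart))))) e
        from : ∀ {μ} → μ ∈ map grown strips → μ ∈ terms
        from p = found (∈-map⁻ grown p)
          where
          found : ∀ {μ} → (∃ λ D → D ∈ strips × μ ≡ grown D) → μ ∈ terms
          found (D , q , refl) = Equivalence.from (proj₁ (proj₂ (proj₂ pieri)) (grown D)) (shape-KBounded (grown-valid q)
            , word⇒pieri {D = D} (proj₁ (∈-strips q)) i≤k (strip-spec q) pd (grown-valid q))

      expansion : 𝐡 k i ⊗ s (shape d) ≈ Σ⊕ (map s (map grown strips))
      expansion = ≈-trans (proj₂ (proj₂ (proj₂ pieri))) (Σ⊕-↭ (↭-map⁺ s terms-↭))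

      -- `𝐡 k i ⊗ s (shape d)` is applied to ∅ in two ways: `s (shape d)` produces the core `κ`, to
      -- which the strips are added, or the product is expanded by the Pieri rule.
      sums : Acts d → ∀ φ → sumL (λ D → φ (run (stripOf D) κ)) strips ≡ sumL (λ D → ⟦ s (grown D) ⟧ φ coreStart) strips
      sums actd φ = begin
        sumL (λ D → φ (run (stripOf D) κ)) strips
          ≡⟨ sumL-cong strips (λ {D} p → sym (trans (⟦⟧-sound (proj₂ (stripOf-spec {D} (card-≤ p))) φ κ) (⟦uw⟧-valid (stripOf D) φ (proj₂ (∈-strips p))))) ⟩
        sumL (λ D → ⟦ uD D ⟧ φ κ) strips
          ≡⟨ sumL-filter (λ D → valid? (stripOf D) κ) (subsetsOf i) (λ {D} p ¬v → trans (⟦⟧-sound (proj₂ (stripOf-spec {D} (small D (subsetsOf-∈ p)))) φ κ) (⟦uw⟧-¬valid (stripOf D) φ ¬v)) ⟨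
        sumL (λ D → ⟦ uD D ⟧ φ κ) (subsetsOf i) ≡⟨ ⟦Σ⊕⟧ uD (subsetsOf i) φ κ ⟨
        ⟦ 𝐡 k i ⟧ φ κ ≡⟨ actd (⟦ 𝐡 k i ⟧ φ) ⟨
        ⟦ 𝐡 k i ⊗ s (shape d) ⟧ φ coreStart ≡⟨ ⟦⟧-sound expansion φ coreStart ⟩
        ⟦ Σ⊕ (map s (map grown strips)) ⟧ φ coreStart ≡⟨ cong (λ l → ⟦ Σ⊕ l ⟧ φ coreStart) (map-∘ strips) ⟨
        ⟦ Σ⊕ (map (λ D → s (grown D)) strips) ⟧ φ coreStart ≡⟨ ⟦Σ⊕⟧ (λ D → s (grown D)) strips φ coreStart ⟩
        sumL (λ D → ⟦ s (grown D) ⟧ φ coreStart) strips ∎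
        where
        open ≡-Reasoning
        open import Data.List.Properties using (map-∘)

    -- Lexicographic in the number of letters and, downwards, in the number of short cells of the first row.
    measure : Word → ℕ
    measure w = length w ℕ.* suc k ℕ.+ (k ℕ.∸ card (lowNext (run w coreStart)))

    -- `b` is `tail b` with its first row added as the strip `D₀`. In `sums` for a word `d` of
    -- `tail b`, every other strip gives a core with more short cells in its first row, where the
    -- claim holds by induction. Those summands agree on both sides, so the one of `D₀` agrees too.
    acts-by : ∀ f w → measure w ℕ.≤ f → Valid w coreStart → Acts w
    acts-by f [] _ _ φ = ⟦⟧-sound s-[] φ coreStart
    acts-by (suc f) (i ∷ w) meas (a , pw) φ = isolate (peel coreStart-¬Desc p (i ∷ w) (tail b) (firstRow-valid core) (a , pw) (firstRow-run core))
      where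
      b = run (i ∷ w) coreStart
      core : IsCore b
      core = run-IsCore (i ∷ w) coreStart-IsCore
      D₀ = lowNext b
      m₀∉ = nxt-top∉lowNext b
      p = Pass.passWord D₀ (nxt (top b)) m₀∉ k
      len-p : length p ≡ card D₀
      len-p = Pass.length-passWord D₀ (nxt (top b)) m₀∉
      1≤i : 1 ℕ.≤ card D₀
      1≤i = lowNext-nonempty core (Asc⇒Desc a)
      i≤k : card D₀ ℕ.≤ k
      i≤k = card-≤k {D₀} m₀∉
      isolate : (∃ λ d → Valid d coreStart × run d coreStart ≡ tail b × p ++ d ≅ i ∷ w) → ⟦ s (shape (i ∷ w)) ⟧ φ coreStart ≡ φ b
      isolate (d , pd , rd , eq) = trans (cong (λ μ → ⟦ s μ ⟧ φ coreStart) (sym shape-D₀))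
          (trans (sym (sumL-isolate {f = λ D → φ (run (stripOf D) κ)} {g = λ D → ⟦ s (grown D) ⟧ φ coreStart} strips strips-unique D₀∈ others (sums actd φ))) (cong φ run-D₀))
        where
        open Pieri pd 1≤i i≤k
        total-length : card D₀ ℕ.+ length d ≡ suc (length w)
        total-length = trans (cong (ℕ._+ length d) (sym len-p)) (trans (sym (length-++ p)) (same-length eq))
        len-d : length d ℕ.≤ length w
        len-d = ℕₚ.≤-pred (ℕₚ.≤-trans (ℕₚ.+-monoˡ-≤ (length d) 1≤i) (ℕₚ.≤-reflexive total-length))
        actd : Acts d
        actd = acts-by f d (ℕₚ.≤-pred (ℕₚ.≤-trans (ℕ.s≤s (ℕₚ.+-mono-≤ (ℕₚ.*-monoˡ-≤ (suc k) len-d) (ℕₚ.m∸n≤m k (card (lowNext (run d coreStart))))))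
          (ℕₚ.≤-trans (ℕₚ.≤-trans (ℕₚ.≤-reflexive (trans (sym (ℕₚ.+-suc _ k)) (ℕₚ.+-comm (length w ℕ.* suc k) (suc k)))) (ℕₚ.m≤m+n _ _)) meas))) pd
        spec₀ = proj₁ (stripOf-spec {D₀} i≤k)
        moved₀ = ≈-valid (alg (strip-≅ {D = D₀} spec₀ (passWord-strip m₀∉))) (subst (Valid p) (sym rd) (firstRow-valid core))
        run-D₀ : run (stripOf D₀) κ ≡ b
        run-D₀ = trans (proj₂ moved₀) (trans (cong (run p) rd) (firstRow-run core))
        D₀∈ : D₀ ∈ strips
        D₀∈ = ∈-filter⁺ _ (∈-subsetsOf refl) (proj₁ moved₀)
        shape-D₀ : grown D₀ ≡ shape (i ∷ w)
        shape-D₀ = shape-cong (grown-valid D₀∈) (a , pw) (trans (run-++ (stripOf D₀) d coreStart) run-D₀)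
        others : ∀ {D} → D ∈ strips → ¬ D ≡ D₀ → φ (run (stripOf D) κ) ≡ ⟦ s (grown D) ⟧ φ coreStart
        others {D} q D≢ = by-size (firstRow-triangular core spec (proj₁ (∈-strips q)) (subst (Valid (stripOf D)) rd (proj₂ (∈-strips q))))
          where
          spec : StripWord (stripOf D) D
          spec = strip-spec q
          grown-run : run (stripOf D ++ d) coreStart ≡ run (stripOf D) κ
          grown-run = run-++ (stripOf D) d coreStart
          len-g : length (stripOf D ++ d) ≡ suc (length w)
          len-g = trans (length-++ (stripOf D)) (trans (cong (ℕ._+ length d)
            (trans (length-spells {D = D} (CycDec⇒Unique (proj₁ spec)) (proj₂ spec)) (proj₁ (∈-strips q)))) total-length)
          by-size : card D ℕ.< card (lowNext (run (stripOf D) (tail b))) ⊎ D ≡ D₀ → φ (run (stripOf D) κ) ≡ ⟦ s (grown D) ⟧ φ coreStart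
          by-size (inj₂ D≡) = ⊥-elim (D≢ D≡)
          by-size (inj₁ lt) = trans (cong φ (sym grown-run)) (sym (acts-by f (stripOf D ++ d) bound (grown-valid q) φ))
            where
            lt′ : card (lowNext b) ℕ.< card (lowNext (run (stripOf D ++ d) coreStart))
            lt′ = subst₂ ℕ._<_ (proj₁ (∈-strips q)) (cong (λ z → card (lowNext z)) (trans (cong (run (stripOf D)) (sym rd)) (sym grown-run))) lt
            drop : k ℕ.∸ card (lowNext (run (stripOf D ++ d) coreStart)) ℕ.< k ℕ.∸ card (lowNext b)
            drop = ℕₚ.∸-monoʳ-< lt′ (card-≤k {lowNext (run (stripOf D ++ d) coreStart)} (nxt-top∉lowNext _))
            bound : measure (stripOf D ++ d) ℕ.≤ f
            bound = ℕₚ.≤-pred (ℕₚ.≤-trans (ℕₚ.+-mono-≤-< (ℕₚ.≤-reflexive (cong (ℕ._* suc k) len-g)) drop) meas)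

    acts : ∀ w → Valid w coreStart → Acts w
    acts w v = acts-by (measure w) w ℕₚ.≤-refl v

  -- Strips on one-row cores

  arc : Letter → ℕ → Word
  arc p zero = []
  arc p (suc l) = (p +ₘ l) ∷ arc p l

  arc-++ : ∀ j a → arc (fz +ₘ j) a ++ arc fz j ≡ arc fz (a ℕ.+ j)
  arc-++ j zero = refl
  arc-++ j (suc a) = cong₂ _∷_ (trans (+ₘ-+ₘ fz j a) (cong (fz +ₘ_) (ℕₚ.+-comm j a))) (arc-++ j a)

  row : ℕ → Word
  row = arc fz

  -- A row of length `j + 1`, at most `k`, moves the top bead of ∅ from `k` to `n + j`. So runner
  -- `j` now ends at `n + j` and runner `k` at -1, and the others are unchanged.
  rowValue : ℕ → ℕ → ℤ
  rowValue zero t = pos t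
  rowValue (suc j) t = if does (t ℕ.≟ j) then N + pos t else (if does (t ℕ.≟ k) then - 1ℤ else pos t)

  rowValue-tip : ∀ j → rowValue (suc j) j ≡ N + pos j
  rowValue-tip j = cong (λ z → if z then N + pos j else (if does (j ℕ.≟ k) then - 1ℤ else pos j)) (does-true (j ℕ.≟ j) refl)

  rowValue-last : ∀ {j} → ¬ k ≡ j → rowValue (suc j) k ≡ - 1ℤ
  rowValue-last {j} ne = trans (cong (λ z → if z then N + pos k else (if does (k ℕ.≟ k) then - 1ℤ else pos k)) (does-false (k ℕ.≟ j) ne))
    (cong (λ z → if z then - 1ℤ else pos k) (does-true (k ℕ.≟ k) refl))

  rowValue-other : ∀ {j t} → ¬ t ≡ j → ¬ t ≡ k → rowValue (suc j) t ≡ pos t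
  rowValue-other {j} {t} ne ne′ = trans (cong (λ z → if z then N + pos t else (if does (t ℕ.≟ k) then - 1ℤ else pos t)) (does-false (t ℕ.≟ j) ne))
    (cong (λ z → if z then - 1ℤ else pos t) (does-false (t ℕ.≟ k) ne′))

  row-≤ : ∀ {s t} → s ℕ.≤ k → t ℕ.≤ k → fz {k} +ₘ s ≡ fz +ₘ t → s ≡ t
  row-≤ s≤k t≤k = +ₘ-injective fz (ℕ.s≤s s≤k) (ℕ.s≤s t≤k)

  row-run-suc : ∀ j → suc (suc j) ℕ.≤ k → (∀ t → t ℕ.≤ k → run (row (suc j)) coreStart ! (fz +ₘ t) ≡ rowValue (suc j) t) →
    ∀ t → t ℕ.≤ k → run (row (suc (suc j))) coreStart ! (fz +ₘ t) ≡ rowValue (suc (suc j)) t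
  row-run-suc j le ih t t≤k with t ℕ.≟ suc j
  ... | yes refl = trans (swapAt-at (fz +ₘ suc j) b) (trans (cong (λ z → b ! z + 1ℤ) (prv-+ₘ-suc fz j)) (trans (cong (_+ 1ℤ)
          (trans (ih j (ℕₚ.<⇒≤ (ℕₚ.<⇒≤ le))) (rowValue-tip j))) (trans (e N (pos j)) (sym (rowValue-tip (suc j))))))
    where
    b = run (row (suc j)) coreStart
    e : ∀ N j → N + j + 1ℤ ≡ N + (1ℤ + j)
    e = solve-∀
  ... | no t≢ with t ℕ.≟ j
  ...   | yes refl = trans (cong (swapAt (fz +ₘ suc t) b !_) (sym (prv-+ₘ-suc fz t))) (trans (swapAt-prv (fz +ₘ suc t) b) (trans (cong (_- 1ℤ)
            (trans (ih (suc t) (ℕₚ.<⇒≤ le)) (rowValue-other {t} {suc t} (λ ()) (ℕₚ.<⇒≢ le)))) (trans (e (pos t)) (sym (rowValue-other {suc t} t≢ (ℕₚ.<⇒≢ (ℕₚ.<⇒≤ le)))))))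
    where
    b = run (row (suc t)) coreStart
    e : ∀ t → 1ℤ + t - 1ℤ ≡ t
    e = solve-∀
  ...   | no t≢j = trans (swapAt-other (fz +ₘ suc j) (run (row (suc j)) coreStart) (λ e → t≢ (row-≤ t≤k (ℕₚ.<⇒≤ le) e)) (λ e → t≢j (row-≤ t≤k (ℕₚ.<⇒≤ (ℕₚ.<⇒≤ le)) (trans e (prv-+ₘ-suc fz j)))))
          (trans (ih t t≤k) same)
    where
    same : rowValue (suc j) t ≡ rowValue (suc (suc j)) t
    same with t ℕ.≟ k
    ... | yes refl = trans (rowValue-last t≢j) (sym (rowValue-last t≢))
    ... | no t≢k = trans (rowValue-other t≢j t≢k) (sym (rowValue-other t≢ t≢k))

  row-run : ∀ j → j ℕ.≤ k → ∀ t → t ℕ.≤ k → run (row j) coreStart ! (fz +ₘ t) ≡ rowValue j t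
  row-run zero _ t t≤k = trans (fromFun-! posF (fz +ₘ t)) (cong pos (fz+ₘ (ℕ.s≤s t≤k)))
  row-run (suc zero) le t t≤k with t ℕ.≟ 0
  ... | yes refl = trans (swapAt-at (fz +ₘ 0) coreStart) (trans (cong (λ z → coreStart ! z + 1ℤ) (cong prv (+ₘ-identity fz))) (trans (cong (_+ 1ℤ) (row-run 0 ℕ.z≤n k ℕₚ.≤-refl))
        (trans (cong pos (ℕₚ.+-comm k 1)) (trans (sym (+-identityʳ N)) (sym (rowValue-tip 0))))))
  ... | no t≢0 with t ℕ.≟ k
  ...   | yes refl = trans (cong (swapAt (fz +ₘ 0) coreStart !_) (cong prv (sym (+ₘ-identity fz)))) (trans (swapAt-prv (fz +ₘ 0) coreStart)
          (trans (cong (_- 1ℤ) (row-run 0 ℕ.z≤n 0 ℕ.z≤n)) (sym (rowValue-last t≢0))))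
  ...   | no t≢k = trans (swapAt-other (fz +ₘ 0) coreStart (λ e → t≢0 (row-≤ t≤k ℕ.z≤n e)) (λ e → t≢k (row-≤ t≤k ℕₚ.≤-refl (trans e (cong prv (+ₘ-identity fz))))))
          (trans (row-run 0 ℕ.z≤n t t≤k) (sym (rowValue-other t≢0 t≢k)))
  row-run (suc (suc j)) le = row-run-suc j le (row-run (suc j) (ℕₚ.<⇒≤ le))

  row-valid : ∀ j → j ℕ.≤ k → Valid (row j) coreStart
  row-valid zero _ = tt
  row-valid (suc zero) le = subst₂ _≤_ (sym (row-run 0 ℕ.z≤n 0 ℕ.z≤n)) (sym (trans (cong (coreStart !_) (cong prv (+ₘ-identity fz))) (row-run 0 ℕ.z≤n k ℕₚ.≤-refl))) (+≤+ ℕ.z≤n) , tt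
  row-valid (suc (suc j)) le = subst₂ _≤_ (sym (trans (row-run (suc j) (ℕₚ.<⇒≤ le) (suc j) (ℕₚ.<⇒≤ le)) (rowValue-other {j} {suc j} (λ ()) (ℕₚ.<⇒≢ le))))
      (sym (trans (cong (run (row (suc j)) coreStart !_) (prv-+ₘ-suc fz j)) (trans (row-run (suc j) (ℕₚ.<⇒≤ le) j (ℕₚ.<⇒≤ (ℕₚ.<⇒≤ le))) (rowValue-tip j))))
      (+≤+ (ℕ.s≤s (ℕₚ.m≤n+m j k)))
    , row-valid (suc j) (ℕₚ.<⇒≤ le)

  row-letters : ∀ x → ∃ λ t → t ℕ.≤ k × fz +ₘ t ≡ x
  row-letters x with offset fz x
  ... | t , lt , e = t , ℕₚ.≤-pred lt , e

  -- Boxes can be added only at the end of the row, with content `j`, and, if the row is nonempty,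
  -- under its first box, with content -1.
  row-asc : ∀ {j} → j ℕ.≤ k → ∀ y → Asc y (run (row j) coreStart) → y ≡ fz +ₘ j ⊎ (y ≡ prv fz × 1 ℕ.≤ j)
  row-asc {j} j≤k y a with row-letters y
  row-asc {zero} j≤k y a | zero , t≤k , refl = inj₁ refl
  row-asc {zero} j≤k y a | suc t , t≤k , refl = ⊥-elim (1+≤⇒≰ {pos (suc t)} {pos t} (≤-reflexive (cong pos (ℕₚ.+-comm t 1)))
    (subst₂ _≤_ (row-run 0 ℕ.z≤n (suc t) t≤k) (trans (cong (coreStart !_) (prv-+ₘ-suc fz t)) (row-run 0 ℕ.z≤n t (ℕₚ.<⇒≤ t≤k))) a))
  row-asc {suc j} j≤k y a | t , t≤k , refl with t ℕ.≟ suc j | t ℕ.≟ k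
  ... | yes refl | _ = inj₁ refl
  ... | no _ | yes refl = inj₂ (refl , ℕ.s≤s ℕ.z≤n)
  row-asc {suc j} j≤k y a | zero , t≤k , refl | no t≢ | no t≢k = ⊥-elim (negative (subst₂ _≤_ (row-run (suc j) j≤k 0 ℕ.z≤n)
      (trans (cong (run (row (suc j)) coreStart !_) (cong prv (+ₘ-identity fz))) (trans (row-run (suc j) j≤k k ℕₚ.≤-refl) (rowValue-last (λ e → ℕₚ.<⇒≢ j≤k (sym e))))) a))
    where
    negative : ¬ rowValue (suc j) 0 ≤ - 1ℤ
    negative p with 0 ℕ.≟ j
    ... | yes refl with () ← subst (_≤ - 1ℤ) (rowValue-tip 0) p
    ... | no ne with () ← subst (_≤ - 1ℤ) (rowValue-other ne t≢k) p
  row-asc {suc j} j≤k y a | suc t , t≤k , refl | no t≢ | no t≢k = ⊥-elim (1+≤⇒≰ (lower (suc t ℕ.≟ j)) (subst₂ _≤_ (row-run (suc j) j≤k (suc t) t≤k) refl (≤-trans a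
      (≤-reflexive (trans (cong (run (row (suc j)) coreStart !_) (prv-+ₘ-suc fz t)) (trans (row-run (suc j) j≤k t (ℕₚ.<⇒≤ t≤k)) (rowValue-other (λ e → t≢ (cong suc e)) (ℕₚ.<⇒≢ t≤k))))))))
    where
    lower : Dec (suc t ≡ j) → pos t + 1ℤ ≤ rowValue (suc j) (suc t)
    lower (yes refl) = ≤-trans (+≤+ (ℕₚ.≤-trans (ℕₚ.≤-reflexive (ℕₚ.+-comm t 1)) (ℕₚ.m≤n+m (suc t) (suc k)))) (≤-reflexive (sym (rowValue-tip (suc t))))
    lower (no ne) = ≤-trans (≤-reflexive (cong pos (ℕₚ.+-comm t 1))) (≤-reflexive (sym (rowValue-other ne t≢k)))

  module Chain {D : Subset (suc k)} {m : Letter} (m∉D : mem D m ≡ false) {β : State} (v : Valid (Pass.passWord D m m∉D k) β) where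
    open Pass D m m∉D
    open On β

    outside-carried : ∀ t → mem D (m +ₘ t) ≡ false → carried t ≡ level t
    outside-carried zero _ = refl
    outside-carried (suc t) e = carried-false e

    start-asc : ∀ t → t ℕ.< k → mem D (m +ₘ suc t) ≡ true → mem D (m +ₘ t) ≡ false → Asc (m +ₘ suc t) β
    start-asc t t<k e f = subst₂ _≤_ (level-pos (suc t)) (trans (level-pos t) (cong (β !_) (sym (prv-+ₘ-suc m t))))
      (lin₁ 0 (≤-trans (valid⇒passes v t t<k e) (≤-reflexive (outside-carried t f))) (e₁ (level (suc t)) (level t) (pos t)))
      where
      e₁ : ∀ l c t → c + t - (l + (1ℤ + t)) ≡ (c - (l + 1ℤ)) + pos 0
      e₁ = solve-∀

    -- Within a run of consecutive letters of `D` the carried value is the one picked up just before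
    -- the run, and the first letter of the run ascends already on the starting state.
    start : ∀ t → t ℕ.< k → mem D (m +ₘ suc t) ≡ true →
      ∃ λ s → s ℕ.≤ t × carried t ≡ level s × mem D (m +ₘ s) ≡ false × Asc (m +ₘ suc s) β
    start zero t<k e = 0 , ℕ.z≤n , refl , out , start-asc 0 t<k e out
      where
      out : mem D (m +ₘ 0) ≡ false
      out = trans (cong (mem D) (+ₘ-identity m)) m∉D
    start (suc t) t<k e with bool-case (mem D (m +ₘ suc t))
    ... | inj₂ f = suc t , ℕₚ.≤-refl , carried-false f , f , start-asc (suc t) t<k e f
    ... | inj₁ f with start t (ℕₚ.<-trans (ℕₚ.n<1+n t) t<k) f
    ...   | s , s≤t , c , rest = s , ℕₚ.m≤n⇒m≤1+n s≤t , trans (carried-true f) c , rest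

    asc-at : ∀ y → mem D y ≡ true → mem D (prv y) ≡ false → Asc y β
    asc-at y e f with offset m y
    ... | zero , _ , refl with () ← trans (sym e) (trans (cong (mem D) (+ₘ-identity m)) m∉D)
    ... | suc t , lt , refl = start-asc t (ℕₚ.≤-pred lt) e (trans (cong (mem D) (sym (prv-+ₘ-suc m t))) f)

  -- The bead at the tip of the row cannot be overtaken, so no strip contains the content of the last cell of the row.
  tip∉ : ∀ {j D m} (j≤k : j ℕ.≤ k) (m∉D : mem D m ≡ false) → Valid (Pass.passWord D m m∉D k) (run (row j) coreStart) →
    mem D (prv (fz +ₘ j)) ≡ false
  tip∉ {j} {D} {m} j≤k m∉D v = decide (bool-case (mem D tip)) (offset m tip)
    where
    open Pass D m m∉D
    open Chain m∉D v
    β = run (row j) coreStart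
    open On β
    tip = prv (fz +ₘ j)
    decide : mem D tip ≡ true ⊎ mem D tip ≡ false → (∃ λ t → t ℕ.< suc k × m +ₘ t ≡ tip) → mem D tip ≡ false
    decide (inj₂ f) _ = f
    decide (inj₁ e) (zero , _ , q) with () ← trans (sym e) (trans (cong (mem D) (trans (sym q) (+ₘ-identity m))) m∉D)
    decide (inj₁ e) (suc t , lt , q) = ⊥-elim (from (start t t<k e′))
      where
      t<k : t ℕ.< k
      t<k = ℕₚ.≤-pred lt
      e′ : mem D (m +ₘ suc t) ≡ true
      e′ = trans (cong (mem D) q) e
      from : ¬ (∃ λ s → s ℕ.≤ t × carried t ≡ level s × mem D (m +ₘ s) ≡ false × Asc (m +ₘ suc s) β)
      from (s , s≤t , c , f , a) with row-asc j≤k (m +ₘ suc s) a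
      ... | inj₁ st with () ← trans (sym e) (trans (cong (mem D) (trans (cong prv (sym st)) (prv-+ₘ-suc m s))) f)
      ... | inj₂ (st , 1≤j) = by-j j refl 1≤j
        where
        m+s : m +ₘ s ≡ prv (prv fz)
        m+s = trans (sym (prv-+ₘ-suc m s)) (cong prv st)
        by-j : ∀ j′ → j′ ≡ j → 1 ℕ.≤ j′ → ⊥
        by-j (suc j′) refl _ = contradict (suc j′ ℕ.≟ k)
          where
          tip≡ : tip ≡ fz +ₘ j′
          tip≡ = prv-+ₘ-suc fz j′
          contradict : Dec (suc j′ ≡ k) → ⊥
          contradict (yes refl) with () ← trans (sym e) (trans (cong (mem D) (trans tip≡ (trans (sym (prv-+ₘ-suc fz j′)) (sym m+s)))) f)
          -- The value carried to the tip was picked up on runner `k - 1` at offset `s`, so its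
          -- level is `k - 1 - s`. The tip bead `n + j - 1` at offset `s + j + 1` has the same
          -- level, whereas passing it requires a strictly larger carried value.
          contradict (no j≢k) = 1+≤⇒≰ final (≤-reflexive (trans c (trans level-s (sym (trans level-t
              (trans (cong₂ (λ n r → n + pos j′ - r) N≡ (trans (cong pos suc-t) (pos-+ s (suc (suc j′))))) (e₁ (pos (k ℕ.∸ 1)) (pos j′) (pos s))))))))
            where
            j<k : suc j′ ℕ.< k
            j<k = ℕₚ.≤∧≢⇒< j≤k j≢k
            d : ℕ
            d = suc t ℕ.∸ s
            s+d : s ℕ.+ d ≡ suc t
            s+d = ℕₚ.m+[n∸m]≡n (ℕₚ.m≤n⇒m≤1+n s≤t)
            d≡ : d ≡ suc (suc j′)
            d≡ = +ₘ-injective (m +ₘ s) (ℕ.s≤s (ℕₚ.≤-trans (ℕₚ.m∸n≤m (suc t) s) t<k)) (ℕ.s≤s j<k)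
              (trans (trans (+ₘ-+ₘ m s d) (trans (cong (m +ₘ_) s+d) (trans q tip≡)))
                (sym (trans (cong (_+ₘ suc (suc j′)) m+s) (trans (sym (+ₘ-+ₘ (prv (prv fz)) 1 (suc j′)))
                  (trans (cong (_+ₘ suc j′) (nxt-prv (prv fz))) (trans (sym (+ₘ-+ₘ (prv fz) 1 j′)) (cong (_+ₘ j′) (nxt-prv fz))))))))
            suc-t : suc t ≡ s ℕ.+ suc (suc j′)
            suc-t = trans (sym s+d) (cong (s ℕ.+_) d≡)
            level-s : level s ≡ pos (k ℕ.∸ 1) - pos s
            level-s = cong (_- pos s) (trans (cong (β !_) (trans m+s prv²)) (trans (row-run (suc j′) j≤k (k ℕ.∸ 1) (ℕₚ.m∸n≤m k 1)) (rowValue-other ne ne′)))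
              where
              k≡ : suc (k ℕ.∸ 1) ≡ k
              k≡ = ℕₚ.m+[n∸m]≡n 1≤k
              prv² : prv (prv fz) ≡ fz +ₘ (k ℕ.∸ 1)
              prv² = trans (cong (λ z → prv (fz +ₘ z)) (sym k≡)) (prv-+ₘ-suc fz (k ℕ.∸ 1))
              ne : ¬ k ℕ.∸ 1 ≡ j′
              ne eq = j≢k (trans (cong suc (sym eq)) k≡)
              ne′ : ¬ k ℕ.∸ 1 ≡ k
              ne′ eq = ℕₚ.1+n≢n (trans k≡ (sym eq))
            level-t : level (suc t) ≡ N + pos j′ - pos (suc t)
            level-t = cong (_- pos (suc t)) (trans (cong (β !_) (trans q tip≡)) (trans (row-run (suc j′) j≤k j′ (ℕₚ.<⇒≤ j≤k)) (rowValue-tip j′)))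
            N≡ : N ≡ pos (k ℕ.∸ 1) + pos 2
            N≡ = cong pos (trans (cong suc (sym (ℕₚ.m+[n∸m]≡n 1≤k))) (ℕₚ.+-comm 2 (k ℕ.∸ 1)))
            final : level (suc t) + 1ℤ ≤ carried t
            final = valid⇒passes v t t<k e′
            e₁ : ∀ K j s → K + pos 2 + j - (s + (pos 2 + j)) ≡ K - s
            e₁ = solve-∀

  open import Data.List.Membership.DecPropositional (_≟_ {suc k}) using (_∈?_)

  cyclic-below : ∀ m {s t} → s ℕ.< t → t ℕ.< k → Cyclic (m +ₘ suc t) (m +ₘ suc s)
  cyclic-below m {s} {t} s<t le = (λ q → ℕₚ.<⇒≢ s<t (ℕₚ.suc-injective (sym (+ₘ-injective m (ℕ.s≤s le) s<n q)))) , not-next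
    where
    s<n : suc s ℕ.< suc k
    s<n = ℕ.s≤s (ℕₚ.<-trans s<t le)
    not-next : ¬ m +ₘ suc s ≡ nxt (m +ₘ suc t)
    not-next q with suc (suc t) ℕ.<? suc k
    ... | yes lt = ℕₚ.<⇒≢ (ℕₚ.<-trans s<t (ℕₚ.n<1+n t)) (ℕₚ.suc-injective (+ₘ-injective m s<n lt (trans q (nxt-+ₘ m (suc t)))))
    ... | no ¬lt with +ₘ-injective m s<n (ℕ.s≤s ℕ.z≤n) (trans q (trans (nxt-+ₘ m (suc t))
            (trans (cong (m +ₘ_) (ℕₚ.≤-antisym (ℕ.s≤s le) (ℕₚ.≮⇒≥ ¬lt))) (trans (+ₘ-cycle m) (sym (+ₘ-identity m))))))
    ...   | ()

  down : ℕ → ℕ → List ℕ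
  down s zero = []
  down s (suc l) = (s ℕ.+ l) ∷ down s l

  down-∈ : ∀ s l {x} → x ∈ down s l → s ℕ.≤ x × x ℕ.< s ℕ.+ l
  down-∈ s (suc l) (here refl) = ℕₚ.m≤m+n s l , ℕₚ.≤-reflexive (sym (ℕₚ.+-suc s l))
  down-∈ s (suc l) (there p) with down-∈ s l p
  ... | a , b = a , ℕₚ.≤-trans b (ℕₚ.+-monoʳ-≤ s (ℕₚ.n≤1+n l))

  ∈-down : ∀ s l {t} → t ℕ.< l → s ℕ.+ t ∈ down s l
  ∈-down s (suc l) {t} t<l with t ℕ.≟ l
  ... | yes refl = here refl
  ... | no t≢l = there (∈-down s l (ℕₚ.≤∧≢⇒< (ℕₚ.≤-pred t<l) t≢l))

  down-decreasing : ∀ s l → AllPairs (λ x y → y ℕ.< x) (down s l)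
  down-decreasing s zero = []
  down-decreasing s (suc l) = All.tabulate (λ p → proj₂ (down-∈ s l p)) ∷ down-decreasing s l

  length-down : ∀ s l → length (down s l) ≡ l
  length-down s zero = refl
  length-down s (suc l) = cong suc (length-down s l)

  initial-run : (P : ℕ → Bool) → ∀ n → (∀ t → suc t ℕ.< n → P (suc t) ≡ true → P t ≡ true) →
    ∃ λ a → a ℕ.≤ n × (∀ t → t ℕ.< n → (P t ≡ true → t ℕ.< a) × (t ℕ.< a → P t ≡ true))
  initial-run P zero _ = 0 , ℕ.z≤n , λ t ()
  initial-run P (suc n) closed with initial-run P n (λ t lt → closed t (ℕₚ.m<n⇒m<1+n lt)) | P n in eq
  ... | a , a≤n , spec | false = a , ℕₚ.m≤n⇒m≤1+n a≤n , extended
    where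
    extended : ∀ t → t ℕ.< suc n → (P t ≡ true → t ℕ.< a) × (t ℕ.< a → P t ≡ true)
    extended t lt with t ℕ.≟ n
    ... | no t≢n = spec t (ℕₚ.≤∧≢⇒< (ℕₚ.≤-pred lt) t≢n)
    ... | yes refl = (λ e → ⊥-elim (false≢true (trans (sym eq) e))) , λ n<a → ⊥-elim (ℕₚ.1+n≰n (ℕₚ.≤-trans n<a a≤n))
      where
      false≢true : ¬ false ≡ true
      false≢true ()
  ... | a , a≤n , spec | true = suc n , ℕₚ.≤-refl , λ t lt → (λ _ → lt) , λ _ → all t lt
    where
    n≤a : ∀ n′ → n′ ≡ n → n′ ℕ.≤ a
    n≤a zero _ = ℕ.z≤n
    n≤a (suc n′) refl = proj₁ (spec n′ (ℕₚ.n<1+n n′)) (closed n′ (ℕₚ.n<1+n n) eq)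
    all : ∀ t → t ℕ.< suc n → P t ≡ true
    all t lt with t ℕ.≟ n
    ... | yes refl = eq
    ... | no t≢n = proj₂ (spec t t<n) (ℕₚ.≤-trans t<n (n≤a n refl))
      where
      t<n : t ℕ.< n
      t<n = ℕₚ.≤∧≢⇒< (ℕₚ.≤-pred lt) t≢n

  module Blocks {j : ℕ} (j≤k : j ℕ.≤ k) where
    p tip : Letter
    p = fz +ₘ j
    tip = prv p

    -- Residues are counted upwards from the excluded tip: indices below `k ∸ j` are the contents
    -- that extend the row, those from `k ∸ j` on the contents of the row below it, beginning with
    -- -1.
    letter : ℕ → Letter
    letter t = tip +ₘ suc t

    letter-low : ∀ t → letter t ≡ p +ₘ t
    letter-low t = trans (sym (+ₘ-+ₘ tip 1 t)) (cong (_+ₘ t) (nxt-prv p))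

    letter-high : ∀ t → letter (k ℕ.∸ j ℕ.+ t) ≡ prv fz +ₘ t
    letter-high t = trans (letter-low _) (trans (+ₘ-+ₘ fz j _) (trans (cong (fz +ₘ_) (trans (sym (ℕₚ.+-assoc j (k ℕ.∸ j) t)) (cong (ℕ._+ t) (ℕₚ.m+[n∸m]≡n j≤k)))) (sym (+ₘ-+ₘ fz k t))))

    -- The strips that can be added to a row of length j: a cells at its end and m cells in the row below it.
    twoRows : ℕ → ℕ → Word
    twoRows m a = arc (prv fz) m ++ arc p a

    indices : ℕ → ℕ → List ℕ
    indices m a = down (k ℕ.∸ j) m ++ down 0 a

    twoRows≡ : ∀ m a → twoRows m a ≡ map letter (indices m a)
    twoRows≡ m a = trans (cong₂ _++_ (high m) (low a)) (sym (map-++ letter (down (k ℕ.∸ j) m) (down 0 a)))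
      where
      low : ∀ a → arc p a ≡ map letter (down 0 a)
      low zero = refl
      low (suc a) = cong₂ _∷_ (sym (letter-low a)) (low a)
      high : ∀ m → arc (prv fz) m ≡ map letter (down (k ℕ.∸ j) m)
      high zero = refl
      high (suc m) = cong₂ _∷_ (sym (letter-high m)) (high m)

    module _ {m a : ℕ} (m≤j : m ℕ.≤ j) (a≤ : a ℕ.≤ k ℕ.∸ j) where

      index<k : ∀ {t} → t ∈ indices m a → t ℕ.< k
      index<k q with ∈-++⁻ (down (k ℕ.∸ j) m) q
      ... | inj₁ r = ℕₚ.≤-trans (proj₂ (down-∈ (k ℕ.∸ j) m r)) (ℕₚ.≤-trans (ℕₚ.+-monoʳ-≤ (k ℕ.∸ j) m≤j) (ℕₚ.≤-reflexive (ℕₚ.m∸n+n≡m j≤k)))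
      ... | inj₂ r = ℕₚ.≤-trans (proj₂ (down-∈ 0 a r)) (ℕₚ.≤-trans a≤ (ℕₚ.m∸n≤m k j))

      indices-decreasing : AllPairs (λ x y → y ℕ.< x) (indices m a)
      indices-decreasing = AllPairsₚ.++⁺ (down-decreasing (k ℕ.∸ j) m) (down-decreasing 0 a)
        (All.tabulate λ q → All.tabulate λ r → ℕₚ.≤-trans (proj₂ (down-∈ 0 a r)) (ℕₚ.≤-trans a≤ (proj₁ (down-∈ (k ℕ.∸ j) m q))))

      twoRows-CycDec : CycDec (twoRows m a)
      twoRows-CycDec = subst CycDec (sym (twoRows≡ m a)) (AllPairsₚ.map⁺ (go (indices m a) (λ q → q) indices-decreasing))
        where
        go : ∀ ts → (∀ {t} → t ∈ ts → t ∈ indices m a) → AllPairs (λ x y → y ℕ.< x) ts → AllPairs (λ x y → Cyclic (letter x) (letter y)) ts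
        go [] _ _ = []
        go (t ∷ ts) sub (below ∷ rest) = All.map (λ s<t → cyclic-below tip s<t (index<k (sub (here refl)))) below ∷ go ts (λ q → sub (there q)) rest

      length-twoRows : length (twoRows m a) ≡ m ℕ.+ a
      length-twoRows = trans (cong length (twoRows≡ m a)) (trans (length-map letter (indices m a)) (trans (length-++ (down (k ℕ.∸ j) m)) (cong₂ ℕ._+_ (length-down (k ℕ.∸ j) m) (length-down 0 a))))

      twoRows-uD : ∀ {D} → mem D tip ≡ false → Spells (twoRows m a) D → card D ≡ m ℕ.+ a × uD D ≈ uw (twoRows m a)
      twoRows-uD {D} out sp = trans (sym (length-spells {D = D} (CycDec⇒Unique twoRows-CycDec) sp)) length-twoRows
        , uD-word D tip (twoRows m a) out twoRows-CycDec sp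

      twoRows-exists : ∃ λ D → card D ≡ m ℕ.+ a × StripWord (twoRows m a) D
      twoRows-exists = D , proj₁ (twoRows-uD {D} out sp) , twoRows-CycDec , sp
        where
        D = fromMem (λ y → does (y ∈? twoRows m a))
        sp : Spells (twoRows m a) D
        sp = (λ {x} q → trans (mem-fromMem _ x) (does-true (x ∈? twoRows m a) q)) , λ {x} e → true-does (x ∈? twoRows m a) (trans (sym (mem-fromMem _ x)) e)
        out : mem D tip ≡ false
        out = trans (mem-fromMem _ tip) (does-false (tip ∈? twoRows m a) tip∉W)
          where
          tip∉W : ¬ tip ∈ twoRows m a
          tip∉W q with ∈-map⁻ letter (subst (tip ∈_) (twoRows≡ m a) q)
          ... | t , r , e with +ₘ-injective tip (ℕ.s≤s ℕ.z≤n) (ℕ.s≤s (index<k r)) (trans (+ₘ-identity tip) e)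
          ...   | ()

    spells-twoRows : ∀ {D} m a → mem D tip ≡ false → m ℕ.≤ j → a ℕ.≤ k ℕ.∸ j →
      (∀ t → t ℕ.< k ℕ.∸ j → (mem D (letter t) ≡ true → t ℕ.< a) × (t ℕ.< a → mem D (letter t) ≡ true)) →
      (∀ t → t ℕ.< j → (mem D (letter (k ℕ.∸ j ℕ.+ t)) ≡ true → t ℕ.< m) × (t ℕ.< m → mem D (letter (k ℕ.∸ j ℕ.+ t)) ≡ true)) →
      Spells (twoRows m a) D
    spells-twoRows {D} m a tip-out m≤j a≤ low high = to , back
      where
      to : ∀ {x} → x ∈ twoRows m a → mem D x ≡ true
      to q with ∈-map⁻ letter (subst (_ ∈_) (twoRows≡ m a) q)
      ... | t , r , refl with ∈-++⁻ (down (k ℕ.∸ j) m) r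
      ...   | inj₂ r₂ = proj₂ (low t (ℕₚ.≤-trans (proj₂ (down-∈ 0 a r₂)) a≤)) (proj₂ (down-∈ 0 a r₂))
      ...   | inj₁ r₁ = subst (λ z → mem D (letter z) ≡ true) split (proj₂ (high t′ (ℕₚ.≤-trans t′<m m≤j)) t′<m)
        where
        t′ = t ℕ.∸ (k ℕ.∸ j)
        split : k ℕ.∸ j ℕ.+ t′ ≡ t
        split = ℕₚ.m+[n∸m]≡n (proj₁ (down-∈ (k ℕ.∸ j) m r₁))
        t′<m : t′ ℕ.< m
        t′<m = ℕₚ.+-cancelˡ-< (k ℕ.∸ j) t′ m (ℕₚ.≤-trans (ℕₚ.≤-reflexive (cong suc split)) (proj₂ (down-∈ (k ℕ.∸ j) m r₁)))
      listed : ∀ {t} → t ∈ indices m a → letter t ∈ twoRows m a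
      listed {t} r = subst (letter t ∈_) (sym (twoRows≡ m a)) (∈-map⁺ letter r)
      back : ∀ {x} → mem D x ≡ true → x ∈ twoRows m a
      back {x} e = place (offset tip x)
        where
        place : (∃ λ t → t ℕ.< suc k × tip +ₘ t ≡ x) → x ∈ twoRows m a
        place (zero , _ , q) with () ← trans (sym e) (trans (cong (mem D) (trans (sym q) (+ₘ-identity tip))) tip-out)
        place (suc t , lt , q) = subst (_∈ twoRows m a) q (block (t ℕ.<? k ℕ.∸ j))
          where
          e′ : mem D (letter t) ≡ true
          e′ = trans (cong (mem D) q) e
          block : Dec (t ℕ.< k ℕ.∸ j) → letter t ∈ twoRows m a
          block (yes t<) = listed (∈-++⁺ʳ (down (k ℕ.∸ j) m) (∈-down 0 a (proj₁ (low t t<) e′)))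
          block (no t≮) = subst (λ z → letter z ∈ twoRows m a) split (listed (∈-++⁺ˡ (∈-down (k ℕ.∸ j) m (proj₁ (high t′ t′<j) (trans (cong (λ z → mem D (letter z)) split) e′)))))
            where
            t′ = t ℕ.∸ (k ℕ.∸ j)
            split : k ℕ.∸ j ℕ.+ t′ ≡ t
            split = ℕₚ.m+[n∸m]≡n (ℕₚ.≮⇒≥ t≮)
            t′<j : t′ ℕ.< j
            t′<j = ℕₚ.+-cancelˡ-< (k ℕ.∸ j) t′ j (ℕₚ.≤-trans (ℕₚ.≤-reflexive (cong suc split)) (ℕₚ.≤-trans (ℕₚ.≤-pred lt) (ℕₚ.≤-reflexive (sym (ℕₚ.m∸n+n≡m j≤k)))))

    letter≡row : ∀ t → letter t ≡ fz +ₘ (j ℕ.+ t)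
    letter≡row t = trans (letter-low t) (+ₘ-+ₘ fz j t)

    high≡row : ∀ t → letter (k ℕ.∸ j ℕ.+ suc t) ≡ fz +ₘ t
    high≡row t = trans (letter-high (suc t)) (trans (sym (+ₘ-+ₘ (prv fz) 1 t)) (cong (_+ₘ t) (nxt-prv fz)))

    module _ {D : Subset (suc k)} (asc-at : ∀ y → mem D y ≡ true → mem D (prv y) ≡ false → Asc y (run (row j) coreStart)) where

      -- By `row-asc` a run of letters of `D` can begin only at content `j` or -1. Every other
      -- letter needs its predecessor in `D`, which makes `D` an initial segment of each of the two
      -- blocks.
      not-start : ∀ {s} → s ℕ.< k → ¬ s ≡ j → mem D (fz +ₘ s) ≡ true → mem D (prv (fz +ₘ s)) ≡ true
      not-start {s} s<k s≢j e = by-bool _ refl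
        where
        by-asc : fz +ₘ s ≡ fz +ₘ j ⊎ (fz +ₘ s ≡ prv fz × 1 ℕ.≤ j) → ⊥
        by-asc (inj₁ q) = s≢j (row-≤ (ℕₚ.<⇒≤ s<k) j≤k q)
        by-asc (inj₂ (q , _)) = ℕₚ.<⇒≢ s<k (row-≤ (ℕₚ.<⇒≤ s<k) ℕₚ.≤-refl q)
        by-bool : ∀ b → mem D (prv (fz +ₘ s)) ≡ b → mem D (prv (fz +ₘ s)) ≡ true
        by-bool true f = f
        by-bool false f = ⊥-elim (by-asc (row-asc j≤k (fz +ₘ s) (asc-at (fz +ₘ s) e f)))

      low-closed : ∀ t → suc t ℕ.< k ℕ.∸ j → mem D (letter (suc t)) ≡ true → mem D (letter t) ≡ true
      low-closed t lt e = trans (cong (mem D) (sym (prv-+ₘ-suc tip (suc t)))) (trans (cong (λ z → mem D (prv z)) (letter≡row (suc t)))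
        (not-start (ℕₚ.≤-trans (ℕₚ.+-monoʳ-< j lt) (ℕₚ.≤-reflexive (ℕₚ.m+[n∸m]≡n j≤k)))
          (λ q → ℕₚ.m≢1+m+n j (trans (sym q) (ℕₚ.+-suc j t))) (trans (cong (mem D) (sym (letter≡row (suc t)))) e)))

      high-closed : ∀ t → suc t ℕ.< j → mem D (letter (k ℕ.∸ j ℕ.+ suc t)) ≡ true → mem D (letter (k ℕ.∸ j ℕ.+ t)) ≡ true
      high-closed t lt e = trans (cong (mem D) (sym (prv-+ₘ-suc tip (suc (k ℕ.∸ j ℕ.+ t))))) (trans (cong (λ z → mem D (prv z)) (trans (cong (λ z → tip +ₘ suc z) (sym (ℕₚ.+-suc (k ℕ.∸ j) t))) (high≡row t)))
        (not-start (ℕₚ.<-≤-trans (ℕₚ.<-trans (ℕₚ.n<1+n t) lt) j≤k) (ℕₚ.<⇒≢ (ℕₚ.<-trans (ℕₚ.n<1+n t) lt)) (trans (cong (mem D) (sym (high≡row t))) e)))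

    TwoRows : Subset (suc k) → Set
    TwoRows D = ∃ λ m → ∃ λ a → m ℕ.≤ j × a ℕ.≤ k ℕ.∸ j × card D ≡ m ℕ.+ a × uD D ≈ uw (twoRows m a)

    classify : ∀ {D w} → card D ℕ.≤ k → StripWord w D → Valid w (run (row j) coreStart) → TwoRows D
    classify {D} {w} le sw v = from (outside {D} le)
      where
      from : (∃ λ m → mem D m ≡ false) → TwoRows D
      from (m′ , m′∉D) = assemble (initial-run (λ t → mem D (letter t)) (k ℕ.∸ j) (low-closed {D} asc-at))
          (initial-run (λ t → mem D (letter (k ℕ.∸ j ℕ.+ t))) j (high-closed {D} asc-at))
        where
        v′ : Valid (Pass.passWord D m′ m′∉D k) (run (row j) coreStart)
        v′ = proj₁ (≈-valid (alg (strip-≅ {D = D} (passWord-strip m′∉D) sw)) v)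
        asc-at : ∀ y → mem D y ≡ true → mem D (prv y) ≡ false → Asc y (run (row j) coreStart)
        asc-at = Chain.asc-at {D} {m′} m′∉D v′
        tip-out : mem D tip ≡ false
        tip-out = tip∉ {D = D} j≤k m′∉D v′
        assemble : (∃ λ a → a ℕ.≤ k ℕ.∸ j × (∀ t → t ℕ.< k ℕ.∸ j → (mem D (letter t) ≡ true → t ℕ.< a) × (t ℕ.< a → mem D (letter t) ≡ true))) →
          (∃ λ m → m ℕ.≤ j × (∀ t → t ℕ.< j → (mem D (letter (k ℕ.∸ j ℕ.+ t)) ≡ true → t ℕ.< m) × (t ℕ.< m → mem D (letter (k ℕ.∸ j ℕ.+ t)) ≡ true))) → TwoRows D
        assemble (a , a≤ , low) (m , m≤j , high) = m , a , m≤j , a≤ , twoRows-uD m≤j a≤ {D} tip-out (spells-twoRows {D} m a tip-out m≤j a≤ low high)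

  record Grown (j i : ℕ) (μ : List ℕ) : Set where
    constructor grownBy
    field
      {m a} : ℕ
      m≤j : m ℕ.≤ j
      a+j≤k : a ℕ.+ j ℕ.≤ k
      m+a≡i : m ℕ.+ a ≡ i
      valid-grown : Valid (arc (prv fz) m ++ row (a ℕ.+ j)) coreStart
      shape-grown : shape (arc (prv fz) m ++ row (a ℕ.+ j)) ≡ μ

  -- The grown word depends only on `m` and `a + j`. As `i` is `m + a`, the same word arises from
  -- the row of length `i` with `j ∸ m` in place of `a`.
  Grown-sym : ∀ {i j μ} → Grown j i μ → Grown i j μ
  Grown-sym {j = j} {μ} (grownBy {m} {a} m≤j a+j≤k refl v e) = grownBy (ℕₚ.m≤m+n m a) (ℕₚ.≤-trans (ℕₚ.≤-reflexive same) a+j≤k) (ℕₚ.m+[n∸m]≡n m≤j)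
      (subst (λ l → Valid (arc (prv fz) m ++ row l) coreStart) (sym same) v) (trans (cong (λ l → shape (arc (prv fz) m ++ row l)) same) e)
    where
    same : j ℕ.∸ m ℕ.+ (m ℕ.+ a) ≡ a ℕ.+ j
    same = trans (sym (ℕₚ.+-assoc (j ℕ.∸ m) m a)) (trans (cong (ℕ._+ a) (ℕₚ.m∸n+n≡m m≤j)) (ℕₚ.+-comm j a))

  module _ {j : ℕ} (j≤k : j ℕ.≤ k) {i : ℕ} (i≤k : i ℕ.≤ k) where
    open Blocks j≤k
    private
      joined : ∀ m a → twoRows m a ++ row j ≡ arc (prv fz) m ++ row (a ℕ.+ j)
      joined m a = trans (++-assoc (arc (prv fz) m) (arc (fz +ₘ j) a) (row j)) (cong (arc (prv fz) m ++_) (arc-++ j a))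

    pieri⇒grown : ∀ {μ} → PieriStep k i (shape (row j)) μ → Grown j i μ
    pieri⇒grown {μ} p = from (pieri⇒word {i} {row j} {μ} (row-valid j j≤k) i≤k p)
      where
      from : (∃ λ D → card D ≡ i × ∃ λ w → StripWord w D × Valid (w ++ row j) coreStart × shape (w ++ row j) ≡ μ) → Grown j i μ
      from (D , c , w , sw , v , e) = blocks (classify {D} {w} le sw (valid-++ˡ w (row j) v)) (stripWord D le)
        where
        le : card D ℕ.≤ k
        le = subst (ℕ._≤ k) (sym c) i≤k
        blocks : TwoRows D → (∃ λ w′ → StripWord w′ D × uD D ≈ uw w′) → Grown j i μ
        blocks (m , a , m≤j , a≤ , c′ , uD≈) (w′ , sw′ , uD≈′) = grownBy m≤j (ℕₚ.≤-trans (ℕₚ.+-monoˡ-≤ j a≤) (ℕₚ.≤-reflexive (ℕₚ.m∸n+n≡m j≤k))) (trans (sym c′) c)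
            (proj₁ moved) (trans (shape-cong {arc (prv fz) m ++ row (a ℕ.+ j)} {w ++ row j} (proj₁ moved) v (proj₂ moved)) e)
          where
          eq : uw (arc (prv fz) m ++ row (a ℕ.+ j)) ≈ uw (w ++ row j)
          eq = ≈-trans (≈-reflexive (cong uw (sym (joined m a)))) (≈-trans (uw-++ (twoRows m a) (row j))
            (≈-trans (⊗-cong (≈-trans (≈-sym uD≈) (≈-trans uD≈′ (alg (strip-≅ {D = D} sw′ sw)))) ≈-refl) (≈-sym (uw-++ w (row j)))))
          moved : Valid (arc (prv fz) m ++ row (a ℕ.+ j)) coreStart × run (arc (prv fz) m ++ row (a ℕ.+ j)) coreStart ≡ run (w ++ row j) coreStart
          moved = ≈-valid eq v

    grown⇒pieri : ∀ {μ} → Grown j i μ → PieriStep k i (shape (row j)) μ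
    grown⇒pieri {μ} (grownBy {m} {a} m≤j a+j≤k m+a≡i v e) = from (twoRows-exists m≤j (ℕₚ.≤-trans (ℕₚ.≤-reflexive (sym (ℕₚ.m+n∸n≡m a j))) (ℕₚ.∸-monoˡ-≤ j a+j≤k)))
      where
      from : (∃ λ D → card D ≡ m ℕ.+ a × StripWord (twoRows m a) D) → PieriStep k i (shape (row j)) μ
      from (D , c , sw) = subst (PieriStep k i (shape (row j))) (trans (cong shape (joined m a)) e)
        (word⇒pieri {i} {row j} {D} {twoRows m a} (trans c m+a≡i) i≤k sw (row-valid j j≤k) (subst (λ w → Valid w coreStart) (sym (joined m a)) v))

    grown-KBounded : ∀ {μ} → Grown j i μ → KBounded k μ
    grown-KBounded (grownBy _ _ _ v e) = subst (KBounded k) e (shape-KBounded v)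

  -- The commutative, rotation-invariant subalgebra

  eval-central : ∀ {G : Set} {h : G → 𝔸 k} {y} → (∀ g → h g ⊗ y ≈ y ⊗ h g) → ∀ e → eval h e ⊗ y ≈ y ⊗ eval h e
  eval-central c (gen g) = c g
  eval-central c 𝟘 = ≈-trans (⊗-zeroˡ _) (≈-sym (⊗-zeroʳ _))
  eval-central c 𝟙 = ≈-trans (⊗-idˡ _) (≈-sym (⊗-idʳ _))
  eval-central c (e ⊕ f) = ≈-trans (distribʳ _ _ _) (≈-trans (⊕-cong (eval-central c e) (eval-central c f)) (≈-sym (distribˡ _ _ _)))
  eval-central c (e ⊗ f) = ≈-trans (⊗-assoc _ _ _) (≈-trans (⊗-cong ≈-refl (eval-central c f)) (≈-trans (≈-sym (⊗-assoc _ _ _))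
    (≈-trans (⊗-cong (eval-central c e) ≈-refl) (⊗-assoc _ _ _))))
  eval-central c (⊖ e) = ≈-trans (≈-sym (-‿distribˡ-* _ _)) (≈-trans (⊖-cong (eval-central c e)) (-‿distribʳ-* _ _))

  eval-commute : ∀ {G : Set} {h : G → 𝔸 k} → (∀ g g′ → h g ⊗ h g′ ≈ h g′ ⊗ h g) → ∀ e f → eval h e ⊗ eval h f ≈ eval h f ⊗ eval h e
  eval-commute c e f = eval-central (λ g → ≈-sym (eval-central (λ g′ → c g′ g) f)) e

  rot-eval : ∀ {G : Set} {h : G → 𝔸 k} c → (∀ g → rot c (h g) ≈ h g) → ∀ e → rot c (eval h e) ≈ eval h e
  rot-eval c inv (gen g) = inv g
  rot-eval c inv 𝟘 = ≈-refl
  rot-eval c inv 𝟙 = ≈-refl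
  rot-eval c inv (e ⊕ f) = ⊕-cong (rot-eval c inv e) (rot-eval c inv f)
  rot-eval c inv (e ⊗ f) = ⊗-cong (rot-eval c inv e) (rot-eval c inv f)
  rot-eval c inv (⊖ e) = ⊖-cong (rot-eval c inv e)

  module Commutativity (s : List ℕ → 𝔸 k) (isK : IsKSchur k s) where

    PieriRule : ℕ → ℕ → Set
    PieriRule j i = Σ (List (List ℕ)) λ L → Unique L × ((∀ {μ} → μ ∈ L → Grown j i μ) × (∀ {μ} → Grown j i μ → μ ∈ L)) × (𝐡 k i ⊗ s (shape (row j)) ≈ Σ⊕ (map s L))

    pieriRule : ∀ {j i} → j ℕ.≤ k → 1 ℕ.≤ i → i ℕ.≤ k → PieriRule j i
    pieriRule {j} {i} j≤k 1≤i i≤k = from (proj₂ (proj₂ isK) (shape (row j)) (shape-KBounded (row-valid j j≤k)) i 1≤i i≤k)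
      where
      from : (Σ (List (List ℕ)) λ L → Unique L × (∀ μ → (μ ∈ L) ⇔ (KBounded k μ × PieriStep k i (shape (row j)) μ)) × (𝐡 k i ⊗ s (shape (row j)) ≈ Σ⊕ (map s L))) → PieriRule j i
      from (L , uq , members , e) = L , uq , ((λ {μ} p → pieri⇒grown j≤k i≤k (proj₂ (Equivalence.to (members μ) p)))
        , (λ {μ} g → Equivalence.from (members μ) (grown-KBounded j≤k i≤k g , grown⇒pieri j≤k i≤k g))) , e

    -- On the empty row only `m = 0` is possible, so the Pieri rule for `s [] ≈ 𝟙` has a single
    -- term. Products of two `𝐡` thus become Pieri sums over `Grown`, which is symmetric.
    𝐡≈row : ∀ {j} → 1 ℕ.≤ j → j ℕ.≤ k → 𝐡 k j ≈ s (shape (row j))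
    𝐡≈row {j} 1≤j j≤k = from (pieriRule {0} {j} ℕ.z≤n 1≤j j≤k)
      where
      from : PieriRule 0 j → 𝐡 k j ≈ s (shape (row j))
      from (L , uq , (to , back) , e) = ≈-trans (≈-sym (⊗-idʳ _)) (≈-trans (⊗-cong ≈-refl (≈-sym (proj₁ isK))) (≈-trans e
          (≈-trans (Σ⊕-↭ (↭-map⁺ s (unique-↭ uq ([] ∷ []) (single , many)))) (⊕-idʳ _))))
        where
        single : ∀ {μ} → μ ∈ L → μ ∈ shape (row j) ∷ []
        single p = only (to p)
          where
          only : ∀ {μ} → Grown 0 j μ → μ ∈ shape (row j) ∷ []
          only (grownBy {zero} {a} _ _ refl _ e) = here (sym (trans (cong (λ l → shape (row l)) (sym (ℕₚ.+-identityʳ a))) e))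
        many : ∀ {μ} → μ ∈ shape (row j) ∷ [] → μ ∈ L
        many (here refl) = back (grownBy {m = 0} {a = j} ℕ.z≤n (subst (ℕ._≤ k) (sym (ℕₚ.+-identityʳ j)) j≤k) refl
          (subst (λ l → Valid (row l) coreStart) (sym (ℕₚ.+-identityʳ j)) (row-valid j j≤k)) (cong (λ l → shape (row l)) (ℕₚ.+-identityʳ j)))

    𝐡-comm : ∀ {i j} → 1 ℕ.≤ i → i ℕ.≤ k → 1 ℕ.≤ j → j ℕ.≤ k → 𝐡 k i ⊗ 𝐡 k j ≈ 𝐡 k j ⊗ 𝐡 k i
    𝐡-comm {i} {j} 1≤i i≤k 1≤j j≤k = ≈-trans (⊗-cong ≈-refl (𝐡≈row 1≤j j≤k)) (≈-trans
        (same (pieriRule {j} {i} j≤k 1≤i i≤k) (pieriRule {i} {j} i≤k 1≤j j≤k)) (⊗-cong ≈-refl (≈-sym (𝐡≈row 1≤i i≤k))))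
      where
      same : PieriRule j i → PieriRule i j → 𝐡 k i ⊗ s (shape (row j)) ≈ 𝐡 k j ⊗ s (shape (row i))
      same (L , uq , (to , back) , e) (L′ , uq′ , (to′ , back′) , e′) = ≈-trans e (≈-trans
        (Σ⊕-↭ (↭-map⁺ s (unique-↭ uq uq′ ((λ p → back′ (Grown-sym (to p))) , λ p → back (Grown-sym (to′ p)))))) (≈-sym e′))

    s-comm : ∀ {λ′ μ} → KBounded k λ′ → KBounded k μ → s λ′ ⊗ s μ ≈ s μ ⊗ s λ′
    s-comm {λ′} {μ} bλ bμ = from (proj₁ (proj₂ isK) λ′ bλ) (proj₁ (proj₂ isK) μ bμ)
      where
      from : InHSubalgebra k (s λ′) → InHSubalgebra k (s μ) → s λ′ ⊗ s μ ≈ s μ ⊗ s λ′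
      from (e , p) (f , q) = ≈-trans (⊗-cong (≈-sym p) (≈-sym q)) (≈-trans
        (eval-commute (λ g g′ → 𝐡-comm (ℕ.s≤s ℕ.z≤n) (toℕ<n g) (ℕ.s≤s ℕ.z≤n) (toℕ<n g′)) e f) (⊗-cong q p))

    rot-s : ∀ c {λ′} → KBounded k λ′ → rot c (s λ′) ≈ s λ′
    rot-s c {λ′} b = from (proj₁ (proj₂ isK) λ′ b)
      where
      from : InHSubalgebra k (s λ′) → rot c (s λ′) ≈ s λ′
      from (e , p) = ≈-trans (rot-cong c (≈-sym p)) (≈-trans (rot-eval c (λ g → rot-𝐡 c (toℕ<n g)) e) p)

  import Algebra.Properties.Group (Ring.+-group 𝔸-ring) as 𝔸ₚ
  import Algebra.Properties.CommutativeMonoid.Sum +-0-commutativeMonoid as Sum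

  -- The rectangle

  ΣF-permute : ∀ {m} (f : Fin m → ℤ) (to from : Fin m → Fin m) → (∀ x → to (from x) ≡ x) → (∀ x → from (to x) ≡ x) → ΣF (λ x → f (to x)) ≡ ΣF f
  ΣF-permute f to from p q = trans (ΣF≡sum (λ x → f (to x))) (trans (sym (Sum.sum-permute f
      (permutation to from p q))) (sym (ΣF≡sum f)))
    where
    ΣF≡sum : ∀ {m} (f : Fin m → ℤ) → ΣF f ≡ Sum.sum f
    ΣF≡sum {zero} f = refl
    ΣF≡sum {suc m} f = cong (f fz +_) (ΣF≡sum (λ x → f (Fin.suc x)))

  ΣF-split : ∀ c r p q → ΣF {c ℕ.+ r} (λ x → if does (toℕ x ℕ.<? c) then p else q) ≡ pos c * p + pos r * q
  ΣF-split zero zero p q = refl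
  ΣF-split zero (suc r) p q = trans (cong (q +_) (ΣF-split zero r p q)) (e (pos r) p q)
    where
    e : ∀ r p q → q + (0ℤ * p + r * q) ≡ 0ℤ * p + (1ℤ + r) * q
    e = solve-∀
  ΣF-split (suc c) r p q = trans (cong (p +_) (ΣF-split c r p q)) (e (pos c) (pos r) p q)
    where
    e : ∀ c r p q → p + (c * p + r * q) ≡ (1ℤ + c) * p + r * q
    e = solve-∀

  -- The beads of `r` rows of length `c` from row `t` on: `r` consecutive positions, and all
  -- positions of the empty rows after them.
  Block : ℕ → ℕ → ℕ → ℤ → Set
  Block t r c y = (pos c + N - pos t - pos r + 1ℤ ≤ y × y ≤ pos c + N - pos t) ⊎ y ≤ N - pos t - pos r

  bead⇒block : ∀ t r c {y} → Bead t (replicate r c) y → Block t r c y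
  bead⇒block t zero c {y} b = inj₂ (≤-trans b (≤-reflexive (e N (pos t))))
    where
    e : ∀ N t → 0ℤ + N - t ≡ N - t - 0ℤ
    e = solve-∀
  bead⇒block t (suc r) c {y} (inj₁ refl) = inj₁ (lin₁ 0 (+≤+ {0} {r} ℕ.z≤n) (e (pos c) N (pos t) (pos r)) , ≤-refl)
    where
    e : ∀ c N t r → c + N - t - (c + N - t - (1ℤ + r) + 1ℤ) ≡ (r - 0ℤ) + pos 0
    e = solve-∀
  bead⇒block t (suc r) c {y} (inj₂ b) with bead⇒block (suc t) r c b
  ... | inj₁ (l , h) = inj₁ (≤-trans (≤-reflexive (e (pos c) N (pos t) (pos r))) l , lin₁ 1 h (e₂ (pos c) N (pos t) y))
    where
    e : ∀ c N t r → c + N - t - (1ℤ + r) + 1ℤ ≡ c + N - (1ℤ + t) - r + 1ℤ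
    e = solve-∀
    e₂ : ∀ c N t y → c + N - t - y ≡ (c + N - (1ℤ + t) - y) + pos 1
    e₂ = solve-∀
  ... | inj₂ l = inj₂ (≤-trans l (≤-reflexive (e N (pos t) (pos r))))
    where
    e : ∀ N t r → N - (1ℤ + t) - r ≡ N - t - (1ℤ + r)
    e = solve-∀

  block⇒bead : ∀ t r c {y} → Block t r c y → Bead t (replicate r c) y
  block⇒bead t zero c {y} (inj₁ (l , h)) = ⊥-elim (1+≤⇒≰ {y} {pos c + N - pos t} (≤-trans (≤-reflexive (e (pos c) N (pos t))) l) h)
    where
    e : ∀ c N t → c + N - t + 1ℤ ≡ c + N - t - 0ℤ + 1ℤ
    e = solve-∀
  block⇒bead t zero c {y} (inj₂ l) = ≤-trans l (≤-reflexive (e N (pos t)))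
    where
    e : ∀ N t → N - t - 0ℤ ≡ 0ℤ + N - t
    e = solve-∀
  block⇒bead t (suc r) c {y} (inj₁ (l , h)) with y Data.Integer.≟ bead t c
  ... | yes q = inj₁ q
  ... | no q = inj₂ (block⇒bead (suc t) r c (inj₁ (≤-trans (≤-reflexive (e (pos c) N (pos t) (pos r))) l
      , lin₁ 0 (≤-trans (≤-reflexive (+-comm y 1ℤ)) (i<j⇒suc[i]≤j (≤∧≢⇒< h q))) (e₂ (pos c) N (pos t) y))))
    where
    e : ∀ c N t r → c + N - (1ℤ + t) - r + 1ℤ ≡ c + N - t - (1ℤ + r) + 1ℤ
    e = solve-∀
    e₂ : ∀ c N t y → c + N - (1ℤ + t) - y ≡ (c + N - t - (y + 1ℤ)) + pos 0
    e₂ = solve-∀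
  block⇒bead t (suc r) c {y} (inj₂ l) = inj₂ (block⇒bead (suc t) r c (inj₂ (≤-trans l (≤-reflexive (e N (pos t) (pos r))))))
    where
    e : ∀ N t r → N - t - (1ℤ + r) ≡ N - (1ℤ + t) - r
    e = solve-∀

  module Rectangle (c r : ℕ) (1≤c : 1 ℕ.≤ c) (1≤r : 1 ℕ.≤ r) (c+r : c ℕ.+ r ≡ suc k) where

    N≡ : N ≡ pos c + pos r
    N≡ = trans (cong pos (sym c+r)) (pos-+ c r)

    rectValue : ℕ → ℤ
    rectValue t = pos t + (if does (t ℕ.<? c) then - pos r else pos c)

    rectValue-< : ∀ {t} → t ℕ.< c → rectValue t ≡ pos t - pos r
    rectValue-< {t} p = cong (λ z → pos t + (if z then - pos r else pos c)) (does-true (t ℕ.<? c) p)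

    rectValue-≮ : ∀ {t} → ¬ t ℕ.< c → rectValue t ≡ pos t + pos c
    rectValue-≮ {t} p = cong (λ z → pos t + (if z then - pos r else pos c)) (does-false (t ℕ.<? c) p)

    rectValue-suc : ∀ t → rectValue t + 1ℤ ≤ rectValue (suc t)
    rectValue-suc t = by (t ℕ.<? c) (suc t ℕ.<? c)
      where
      by : Dec (t ℕ.< c) → Dec (suc t ℕ.< c) → rectValue t + 1ℤ ≤ rectValue (suc t)
      by (yes p) (yes q) = ≤-reflexive (trans (cong (_+ 1ℤ) (rectValue-< p)) (trans (e (pos t) (pos r)) (sym (rectValue-< q))))
        where
        e : ∀ t r → t - r + 1ℤ ≡ 1ℤ + t - r
        e = solve-∀
      by (no p) (no q) = ≤-reflexive (trans (cong (_+ 1ℤ) (rectValue-≮ p)) (trans (e (pos t) (pos c)) (sym (rectValue-≮ q))))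
        where
        e : ∀ t r → t + r + 1ℤ ≡ 1ℤ + t + r
        e = solve-∀
      by (yes p) (no q) = subst₂ (λ a b → a + 1ℤ ≤ b) (sym (rectValue-< p)) (sym (rectValue-≮ q)) (lin₂ 0 (+≤+ {0} {r} ℕ.z≤n) (+≤+ {0} {c} ℕ.z≤n) (e (pos t) (pos r) (pos c)))
        where
        e : ∀ t r c → 1ℤ + t + c - (t - r + 1ℤ) ≡ (r - 0ℤ) + (c - 0ℤ) + pos 0
        e = solve-∀
      by (no p) (yes q) = ⊥-elim (p (ℕₚ.<⇒≤ q))

    -- The core of the rectangle: rotated back by c, its first c runners are lowered by r and the others raised by c.
    rect : State
    rect = fromFun (λ x → rectValue (toℕ (x +ₘ (c ℕ.* k))))

    rect-! : ∀ z → rect ! (z +ₘ c) ≡ rectValue (toℕ z)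
    rect-! z = trans (fromFun-! _ (z +ₘ c)) (cong (λ x → rectValue (toℕ x)) (+ₘ-undo z c))

    rect-residue : ∀ z → rectValue (toℕ z) ≡ₙ posF (z +ₘ c)
    rect-residue z = ≡ₙ-trans (by (toℕ z ℕ.<? c)) (≡ₙ-sym (posF-+ₘ z c))
      where
      by : Dec (toℕ z ℕ.< c) → rectValue (toℕ z) ≡ₙ posF z + pos c
      by (yes p) = ≡ₙ-trans (≡ₙ-reflexive (rectValue-< p)) (modulo (- 1ℤ) (trans (e (posF z) (pos c) (pos r)) (cong (λ n → posF z + pos c + - 1ℤ * n) (sym N≡))))
        where
        e : ∀ z c r → z - r ≡ z + c + - 1ℤ * (c + r)
        e = solve-∀
      by (no p) = ≡ₙ-reflexive (rectValue-≮ p)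

    rect-IsCore : IsCore rect
    rect-IsCore x = subst (λ y → rect ! y ≡ₙ posF y) (unrot c x) (≡ₙ-trans (≡ₙ-reflexive (rect-! z)) (rect-residue z))
      where
      z = x +ₘ (c ℕ.* k)

    -- Up to rotation, `c` runners fall by `r` and `r` runners rise by `c`.
    rect-sum : sumState rect ≡ sumState coreStart
    rect-sum = begin
      ΣF (rect !_) ≡⟨ ΣF-permute (rect !_) (_+ₘ c) (_+ₘ (c ℕ.* k)) (unrot c) (λ x → +ₘ-undo x c) ⟨
      ΣF (λ z → rect ! (z +ₘ c)) ≡⟨ ΣF-cong rect-! ⟩
      ΣF (λ z → posF z + (if does (toℕ z ℕ.<? c) then - pos r else pos c)) ≡⟨ ΣF-+ {suc k} posF (λ z → if does (toℕ z ℕ.<? c) then - pos r else pos c) ⟩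
      ΣF posF + ΣF {suc k} (λ z → if does (toℕ z ℕ.<? c) then - pos r else pos c) ≡⟨ cong (ΣF posF +_) (balanced (suc k) c+r) ⟩
      ΣF posF + 0ℤ ≡⟨ +-identityʳ _ ⟩
      ΣF posF ≡⟨ ΣF-cong (fromFun-! posF) ⟨
      ΣF (coreStart !_) ∎
      where
      open ≡-Reasoning
      balanced : ∀ m → c ℕ.+ r ≡ m → ΣF {m} (λ z → if does (toℕ z ℕ.<? c) then - pos r else pos c) ≡ 0ℤ
      balanced m refl = trans (ΣF-split c r (- pos r) (pos c)) (e (pos c) (pos r))
        where
        e : ∀ c r → c * - r + r * c ≡ 0ℤ
        e = solve-∀

    -- The rectangle has the beads from `2c` to `c + k` and all those up to `c - 1`. On runner
    -- `t + c` the position `t + c` belongs to the upper block exactly when `t ≥ c`; otherwise the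
    -- last bead is one turn lower, at `t - r`.
    rect-represents : Represents (replicate r c) rect
    rect-represents x y e = (λ g → subst (λ v → y ≤ rect ! v) (unrot c x) (≤-trans (to (toℕ z ℕ.<? c) (bead⇒block 1 r c g)) (≤-reflexive (sym (rect-! z)))))
      , λ p → block⇒bead 1 r c (from (toℕ z ℕ.<? c) (≤-trans (subst (λ v → y ≤ rect ! v) (sym (unrot c x)) p) (≤-reflexive (rect-! z))))
      where
      z = x +ₘ (c ℕ.* k)
      t = toℕ z
      y≡ : y ≡ₙ pos t + pos c
      y≡ = ≡ₙ-trans e (≡ₙ-trans (≡ₙ-reflexive (cong posF (sym (unrot c x)))) (posF-+ₘ z c))
      below : ∀ {b} → b + 1ℤ ≤ pos t + pos c + N → y ≤ b → y ≤ pos t + pos c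
      below {b} le y≤b = by (y ≤? pos t + pos c)
        where
        by : Dec (y ≤ pos t + pos c) → y ≤ pos t + pos c
        by (yes p) = p
        by (no ¬p) = ⊥-elim (1+≤⇒≰ {y} {b} (≤-trans le (≡ₙ-gap (≡ₙ-sym y≡) (≰⇒1+≤ ¬p))) y≤b)
      drop : y + 1ℤ ≤ pos t + pos c → y + N ≤ pos t + pos c
      drop = ≡ₙ-gap y≡
      to : Dec (t ℕ.< c) → Block 1 r c y → y ≤ rectValue t
      to (yes p) (inj₁ (l , h)) = ⊥-elim (1+≤⇒≰ {y} {pos t + pos c} (lin₂ 0 l (+≤+ p) (trans (e₁ (pos t) (pos c) (pos r) y)
            (cong (λ n → (y - (pos c + n - 1ℤ - pos r + 1ℤ)) + (pos c - (1ℤ + pos t)) + 0ℤ) (sym N≡))))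
          (below (lin₁ 0 (+≤+ {0} {t} ℕ.z≤n) (e₂ (pos t) (pos c) N)) h))
        where
        e₁ : ∀ t c r y → y - (t + c + 1ℤ) ≡ (y - (c + (c + r) - 1ℤ - r + 1ℤ)) + (c - (1ℤ + t)) + 0ℤ
        e₁ = solve-∀
        e₂ : ∀ t c N → t + c + N - (c + N - 1ℤ + 1ℤ) ≡ (t - 0ℤ) + 0ℤ
        e₂ = solve-∀
      to (yes p) (inj₂ l) = ≤-trans (lin₁ 0 (drop (lin₂ 0 l (+≤+ {0} {t} ℕ.z≤n) (trans (e₁ (pos t) (pos c) (pos r) y)
            (cong (λ n → (n - 1ℤ - pos r - y) + (pos t - 0ℤ) + 0ℤ) (sym N≡))))) (trans (e₂ (pos t) (pos c) (pos r) y) (cong (λ n → (pos t + pos c - (y + n)) + 0ℤ) (sym N≡))))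
          (≤-reflexive (sym (rectValue-< p)))
        where
        e₁ : ∀ t c r y → t + c - (y + 1ℤ) ≡ (c + r - 1ℤ - r - y) + (t - 0ℤ) + 0ℤ
        e₁ = solve-∀
        e₂ : ∀ t c r y → t - r - y ≡ (t + c - (y + (c + r))) + 0ℤ
        e₂ = solve-∀
      to (no p) b = ≤-trans (below (lin₁ 0 (+≤+ {0} {t} ℕ.z≤n) (e₂ (pos t) (pos c) N)) (upper b)) (≤-reflexive (sym (rectValue-≮ p)))
        where
        e₂ : ∀ t c N → t + c + N - (c + N - 1ℤ + 1ℤ) ≡ (t - 0ℤ) + 0ℤ
        e₂ = solve-∀
        e₃ : ∀ r c N y → c + N - 1ℤ - y ≡ (N - 1ℤ - r - y) + (c - 0ℤ) + (r - 0ℤ) + 0ℤ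
        e₃ = solve-∀
        upper : Block 1 r c y → y ≤ pos c + N - 1ℤ
        upper (inj₁ (l , h)) = h
        upper (inj₂ l) = lin₃ 0 l (+≤+ {0} {c} ℕ.z≤n) (+≤+ {0} {r} ℕ.z≤n) (e₃ (pos r) (pos c) N y)
      from : Dec (t ℕ.< c) → y ≤ rectValue t → Block 1 r c y
      from (yes p) q = inj₂ (lin₃ 0 (≤-trans q (≤-reflexive (rectValue-< p))) (+≤+ p) (+≤+ {0} {r} ℕ.z≤n)
          (trans (cong (λ n → n - 1ℤ - pos r - y) N≡) (e₁ (pos t) (pos c) (pos r) y)))
        where
        e₁ : ∀ t c r y → c + r - 1ℤ - r - y ≡ (t - r - y) + (c - (1ℤ + t)) + (r - 0ℤ) + 0ℤ
        e₁ = solve-∀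
      from (no p) q = by (pos c + N - pos 1 - pos r + 1ℤ ≤? y)
        where
        y≤ : y ≤ pos t + pos c
        y≤ = ≤-trans q (≤-reflexive (rectValue-≮ p))
        e₁ : ∀ t c N y → c + N - 1ℤ - y ≡ (t + c - y) + (N - (t + 1ℤ)) + 0ℤ
        e₁ = solve-∀
        e₂ : ∀ t c r y → t + c - (y + 1ℤ) ≡ (c + (c + r) - 1ℤ - r + 1ℤ - (y + 1ℤ)) + (t - c) + 0ℤ
        e₂ = solve-∀
        e₃ : ∀ t c r y → c + r - 1ℤ - r - y ≡ (t + c - (y + (c + r))) + (c + r - (t + 1ℤ)) + 0ℤ
        e₃ = solve-∀
        by : Dec (pos c + N - pos 1 - pos r + 1ℤ ≤ y) → Block 1 r c y
        by (yes l) = inj₁ (l , lin₂ 0 y≤ (posF-+1≤N z) (e₁ (pos t) (pos c) N y))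
        by (no ¬l) = inj₂ (lin₂ 0 (drop (lin₂ 0 (≰⇒1+≤ ¬l) (+≤+ (ℕₚ.≮⇒≥ p)) (trans (e₂ (pos t) (pos c) (pos r) y)
              (cong (λ n → (pos c + n - 1ℤ - pos r + 1ℤ - (y + 1ℤ)) + (pos t - pos c) + 0ℤ) (sym N≡)))))
            (posF-+1≤N z) (subst (λ n → n - 1ℤ - pos r - y ≡ (pos t + pos c - (y + n)) + (n - (pos t + 1ℤ)) + 0ℤ) (sym N≡) (e₃ (pos t) (pos c) (pos r) y)))

    -- Read from runner `c` on, the values of `rect` increase strictly, so only the letter `c`,
    -- where the cycle closes, can ascend. That letter is the rotation of 0, the only letter that
    -- does not fix ∅.
    killed : ∀ l → Neut l coreStart → ¬ Asc (l +ₘ c) rect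
    killed l n a = 1+≤⇒≰ {rectValue (toℕ l)} {rectValue (toℕ (prv l))} (≤-trans (rectValue-suc (toℕ (prv l))) (≤-reflexive (cong rectValue (sym next))))
        (subst₂ _≤_ (rect-! l) (trans (cong (rect !_) (sym (+ₘ-comm l k c))) (rect-! (prv l))) a)
      where
      next : toℕ l ≡ suc (toℕ (prv l))
      next = +-injective (trans (sym (fromFun-! posF l)) (trans n (trans (cong (_+ 1ℤ) (fromFun-! posF (prv l))) (+-comm (posF (prv l)) 1ℤ))))

    module Commuting (s : List ℕ → 𝔸 k) (isK : IsKSchur k s) where
      open KSchur s isK
      open Commutativity s isK

      s-rect : 𝔸 k
      s-rect = s (replicate r c)

      private
        word : Reachable rect
        word = reachable rect rect-IsCore rect-sum

      shape-rect : shape (proj₁ word) ≡ replicate r c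
      shape-rect = trans (shape-of {proj₁ word} {replicate r c} (proj₁ (proj₂ word)) (replicate-part nothing r c 1≤c tt)
        (subst (Represents (replicate r c)) (sym (proj₂ (proj₂ word))) rect-represents)) (shape-replicate r c 1≤c (ℕₚ.≤-reflexive c+r))

      rect-KBounded : KBounded k (replicate r c)
      rect-KBounded = subst (KBounded k) shape-rect (shape-KBounded (proj₁ (proj₂ word)))

      s-rect-acts : ∀ φ → ⟦ s-rect ⟧ φ coreStart ≡ φ rect
      s-rect-acts φ = trans (cong (λ μ → ⟦ s μ ⟧ φ coreStart) (sym shape-rect)) (trans (acts (proj₁ word) (proj₁ (proj₂ word)) φ) (cong φ (proj₂ (proj₂ word))))

      -- s_x := s (shape x) commutes with s_R and is invariant under rotation, and s_x and u(x) agree on the empty core.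
      s-rect-translates : ∀ x → Valid x coreStart → ∀ ψ → ⟦ s-rect ⟧ ψ (run x coreStart) ≡ ⟦ rot c (uw x) ⟧ ψ rect
      s-rect-translates x v ψ = begin
        ⟦ s-rect ⟧ ψ (run x coreStart)       ≡⟨ acts x v (⟦ s-rect ⟧ ψ) ⟨
        ⟦ s-rect ⊗ sₓ ⟧ ψ coreStart          ≡⟨ ⟦⟧-sound (s-comm rect-KBounded (shape-KBounded v)) ψ coreStart ⟩
        ⟦ s-rect ⟧ (⟦ sₓ ⟧ ψ) coreStart      ≡⟨ s-rect-acts (⟦ sₓ ⟧ ψ) ⟩
        ⟦ sₓ ⟧ ψ rect                        ≡⟨ ⟦⟧-sound (rot-s c (shape-KBounded v)) ψ rect ⟨
        ⟦ rot c sₓ ⟧ ψ rect                  ≡⟨ i-j≡0⇒i≡j _ _ (transfer c rect killed (sₓ ⊕ ⊖ uw x) vanish ψ) ⟩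
        ⟦ rot c (uw x) ⟧ ψ rect              ∎
        where
        open ≡-Reasoning
        sₓ : 𝔸 k
        sₓ = s (shape x)
        vanish : ∀ φ → ⟦ sₓ ⊕ ⊖ uw x ⟧ φ coreStart ≡ 0ℤ
        vanish φ = i≡j⇒i-j≡0 (trans (acts x v φ) (sym (⟦uw⟧-valid x φ v)))

      rect-generator : ∀ i → s-rect ⊗ u i ≈ u (i +ₘ c) ⊗ s-rect
      rect-generator i = 𝔸ₚ.x∙y⁻¹≈ε⇒x≈y _ _ (faithful (s-rect ⊗ u i ⊕ ⊖ (u (i +ₘ c) ⊗ s-rect)) λ x v φ → i≡j⇒i-j≡0 (same x v φ (Asc? i (run x coreStart))))
        where
        same : ∀ x → Valid x coreStart → ∀ φ → Dec (Asc i (run x coreStart)) → ⟦ s-rect ⊗ u i ⟧ φ (run x coreStart) ≡ ⟦ u (i +ₘ c) ⊗ s-rect ⟧ φ (run x coreStart)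
        same x v φ (yes a) = begin
          ⟦ u i ⟧ (⟦ s-rect ⟧ φ) (run x coreStart)          ≡⟨ ⟦gen⟧-asc (⟦ s-rect ⟧ φ) a ⟩
          ⟦ s-rect ⟧ φ (run (i ∷ x) coreStart)              ≡⟨ s-rect-translates (i ∷ x) (a , v) φ ⟩
          ⟦ rot c (uw x) ⟧ (⟦ u (i +ₘ c) ⟧ φ) rect          ≡⟨ s-rect-translates x v (⟦ u (i +ₘ c) ⟧ φ) ⟨
          ⟦ s-rect ⟧ (⟦ u (i +ₘ c) ⟧ φ) (run x coreStart)   ∎
          where open ≡-Reasoning
        -- `u i` kills `x∅`, so the word `i ∷ x` kills ∅, and by `transfer` its rotation kills
        -- `rect`.
        same x v φ (no ¬a) = begin
          ⟦ u i ⟧ (⟦ s-rect ⟧ φ) (run x coreStart)          ≡⟨ ⟦gen⟧-¬asc (⟦ s-rect ⟧ φ) ¬a ⟩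
          0ℤ                                                ≡⟨ transfer c rect killed (uw (i ∷ x)) (λ ψ → ⟦uw⟧-¬valid (i ∷ x) ψ (λ v′ → ¬a (proj₁ v′))) φ ⟨
          ⟦ rot c (uw x) ⟧ (⟦ u (i +ₘ c) ⟧ φ) rect          ≡⟨ s-rect-translates x v (⟦ u (i +ₘ c) ⟧ φ) ⟨
          ⟦ s-rect ⟧ (⟦ u (i +ₘ c) ⟧ φ) (run x coreStart)   ∎
          where open ≡-Reasoning

open import Data.Nat using (_+_; _≤_)
open import Data.Nat.Properties using (+-comm)
open import Data.Fin using (Fin)
open import Data.List using (List; replicate)
open import Relation.Binary.PropositionalEquality using (_≡_; trans)

theorem5p1 : (k c r : ℕ) → 1 ≤ k → 1 ≤ c → 1 ≤ r → c + r ≡ k + 1 →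
    (s : List ℕ → 𝔸 k) → IsKSchur k s →
    (i : Fin (suc k)) →
      s (replicate r c) ⊗ u i ≈ u (i +ₘ c) ⊗ s (replicate r c)
theorem5p1 k c r 1≤k 1≤c 1≤r c+r s isK i =
  NilCoxeter.Rectangle.Commuting.rect-generator k 1≤k c r 1≤c 1≤r (trans c+r (+-comm k 1)) s isK i
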